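{- Let $\mathbb{F}$ be a field of characteristic zero, and fix a constant depth parameter $\Gamma \in \mathbb{N}$ (i.e. $\Gamma = \mathcal{O}(1)$). Then, for every growing parameter $N \in \mathbb{N}$, there exist a multilinear polynomial $f_\Gamma \in \mathbb{F}[x_1,\ldots,x_N]$ that is unsatisfiable over $\{0,1\}^N$ (i.e. there is no $\mathbf{a}\in\{0,1\}^N$ with $f_\Gamma(\mathbf{a})=0$) and a size parameter $s$ (growing with $N$) such that: (1) there exists an $\mathsf{IPS}$ refutation of $f_\Gamma$ of depth $\Gamma$ and size $\mathcal{O}(s^5)$; (2) every $\mathsf{IPS}$ refutation of $f_\Gamma$ of depth at most $\Gamma/10$ has size $s^{\omega(1)}$.
   Context: An algebraic circuit is a directed acyclic graph whose internal nodes are addition gates (computing linear combinations of their inputs) or multiplication gates, and whose leaves are variables or field constants; its size is the number of wires (edges) and its depth is the length of the longest path from a leaf to the output. An algebraic formula is a circuit whose underlying graph is a tree. Ideal Proof System ($\mathsf{IPS}$): given polynomials $f_1,\ldots,f_m\in\mathbb{F}[x_1,\ldots,x_n]$ with no common zero in $\{0,1\}^n$, an $\mathsf{IPS}$ refutation is an algebraic circuit $C(x_1,\ldots,x_n,y_1,\ldots,y_m,z_1,\ldots,z_n)$ such that $C(\mathbf{x},\mathbf{0},\mathbf{0})=0$ and $C(\mathbf{x},f_1,\ldots,f_m,x_1^2-x_1,\ldots,x_n^2-x_n)=1$ as polynomials. Its size and depth are those of $C$. Here the system consists of the single polynomial $f_\Gamma$ (together with the Boolean axioms $x_i^2-x_i$).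 The notation $s^{\omega(1)}$ means a quantity that grows superpolynomially in $s$ as $N\to\infty$. -}

module Defs where

open import Level using (Level; _⊔_) renaming (suc to lsuc)
open import Algebra.Bundles using (CommutativeRing)
open import Data.Nat using (ℕ; zero; suc; _∸_; _≤_) renaming (_+_ to _+ℕ_; _⊔_ to _⊔ℕ_)
open import Data.Fin using (Fin; zero; suc)
open import Data.Vec using (Vec; []; _∷_; lookup; replicate; zipWith; head)
open import Data.Vec.Properties using (≡-dec)
open import Data.List using (List; []; _∷_; map; foldr; concatMap; upTo; length)
open import Data.Product using (Σ; _×_; _,_)
open import Data.Sum using (_⊎_; inj₁; inj₂)
open import Data.Unit using (⊤)
open import Data.Bool using (Bool; true; false; if_then_else_)
open import Relation.Nullary using (¬_; yes; no)
open import Relation.Binary.PropositionalEquality using (_≡_)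
import Data.Nat as ℕ

record Field (c ℓ : Level) : Set (lsuc (c ⊔ ℓ)) where
  field
    commutativeRing : CommutativeRing c ℓ
  open CommutativeRing commutativeRing public
  field
    nontrivial : ¬ (1# ≈ 0#)
    inverse    : ∀ x → ¬ (x ≈ 0#) → Σ Carrier λ y → (x * y) ≈ 1#

-- Variables of an IPS refutation of f_1..f_m in x_1..x_n :
-- x_i (inj₁), y_j (inj₂ ∘ inj₁), z_i (inj₂ ∘ inj₂).
IPSVar : ℕ → ℕ → Set
IPSVar n m = Fin n ⊎ (Fin m ⊎ Fin n)

module _ {c ℓ : Level} (F : Field c ℓ) where
  open Field F

  natF : ℕ → Carrier
  natF zero    = 0#
  natF (suc n) = 1# + natF n

  CharZero : Set ℓ
  CharZero = ∀ n → ¬ (natF (suc n) ≈ 0#)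

  -- Polynomials in F[x_1,…,x_n], given by their coefficient function on
  -- exponent vectors (monomials x^e, e ∈ ℕ^n).  Two polynomials are equal
  -- iff all coefficients agree.

  Exp : ℕ → Set
  Exp n = Vec ℕ n

  Poly : ℕ → Set c
  Poly n = Exp n → Carrier

  _≈P_ : ∀ {n} → Poly n → Poly n → Set ℓ
  p ≈P q = ∀ e → p e ≈ q e

  unitExp : ∀ {n} → Fin n → Exp n
  unitExp {suc n} zero    = 1 ∷ replicate n 0
  unitExp {suc n} (suc i) = 0 ∷ unitExp i

  constP : ∀ {n} → Carrier → Poly n
  constP {n} a e with ≡-dec ℕ._≟_ e (replicate n 0)
  ... | yes _ = a
  ... | no  _ = 0#

  varP : ∀ {n} → Fin n → Poly n
  varP i e with ≡-dec ℕ._≟_ e (unitExp i)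
  ... | yes _ = 1#
  ... | no  _ = 0#

  0P 1P : ∀ {n} → Poly n
  0P = constP 0#
  1P = constP 1#

  _+P_ : ∀ {n} → Poly n → Poly n → Poly n
  (p +P q) e = p e + q e

  _·P_ : ∀ {n} → Carrier → Poly n → Poly n
  (a ·P p) e = a * p e

  _-P_ : ∀ {n} → Poly n → Poly n → Poly n
  (p -P q) e = p e + (- q e)

  sumF : List Carrier → Carrier
  sumF = foldr _+_ 0#

  below : ∀ {n} → Exp n → List (Exp n)
  below []      = [] ∷ []
  below (k ∷ e) = concatMap (λ j → map (j ∷_) (below e)) (upTo (suc k))

  _*P_ : ∀ {n} → Poly n → Poly n → Poly n
  (p *P q) e = sumF (map (λ d → p d * q (zipWith _∸_ e d)) (below e))

  Multilinear : ∀ {n} → Poly n → Set ℓ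
  Multilinear {n} f = ∀ (e : Exp n) (i : Fin n) → 2 ≤ lookup e i → f e ≈ 0#

  pow : Carrier → ℕ → Carrier
  pow x zero    = 1#
  pow x (suc k) = x * pow x k

  monVal : ∀ {n} → Exp n → Vec Carrier n → Carrier
  monVal []      []      = 1#
  monVal (k ∷ e) (a ∷ v) = pow a k * monVal e v

  boolExps : ∀ n → List (Exp n)
  boolExps zero    = [] ∷ []
  boolExps (suc n) = concatMap (λ j → map (j ∷_) (boolExps n)) (0 ∷ 1 ∷ [])

  evalML : ∀ {n} → Poly n → Vec Carrier n → Carrier
  evalML {n} f v = sumF (map (λ e → f e * monVal e v) (boolExps n))

  boolToF : Bool → Carrier
  boolToF b = if b then 1# else 0#

  boolPt : ∀ {n} → Vec Bool n → Vec Carrier n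
  boolPt []      = []
  boolPt (b ∷ v) = boolToF b ∷ boolPt v

  UnsatBool : ∀ {n} → Poly n → Set ℓ
  UnsatBool {n} f = ∀ (a : Vec Bool n) → ¬ (evalML f (boolPt a) ≈ 0#)

  -- Algebraic circuits over F with input variables from a type V, given as
  -- straight-line programs (a topologically ordered DAG).  A node is a leaf
  -- (variable or field constant), an addition gate computing a linear
  -- combination of earlier nodes, or a multiplication gate of earlier
  -- nodes.  References Fin i point to the i earlier nodes, 0 = most recent.
  -- The output is the last node.

  data Gate (V : Set) (i : ℕ) : Set c where
    input : V → Gate V i
    const : Carrier → Gate V i
    plus  : List (Carrier × Fin i) → Gate V i
    times : List (Fin i) → Gate V i

  data SLP (V : Set) : ℕ → Set c where
    []  : SLP V 0
    _▷_ : ∀ {i} → SLP V i → Gate V i → SLP V (suc i)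

  record Circuit (V : Set) : Set c where
    constructor circuit
    field
      nodes : ℕ
      prog  : SLP V (suc nodes)

  fanIn : ∀ {V i} → Gate V i → ℕ
  fanIn (input _) = 0
  fanIn (const _) = 0
  fanIn (plus ws) = length ws
  fanIn (times ws) = length ws

  wiresSLP : ∀ {V i} → SLP V i → ℕ
  wiresSLP []      = 0
  wiresSLP (p ▷ g) = wiresSLP p +ℕ fanIn g

  size : ∀ {V} → Circuit V → ℕ
  size (circuit _ p) = wiresSLP p

  maxList : List ℕ → ℕ
  maxList = foldr _⊔ℕ_ 0

  gateDepth : ∀ {V i} → Vec ℕ i → Gate V i → ℕ
  gateDepth ds (input _)  = 0
  gateDepth ds (const _)  = 0
  gateDepth ds (plus ws)  = suc (maxList (map (λ w → lookup ds (Data.Product.proj₂ w)) ws))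
  gateDepth ds (times ws) = suc (maxList (map (lookup ds) ws))

  depthsSLP : ∀ {V i} → SLP V i → Vec ℕ i
  depthsSLP []      = []
  depthsSLP (p ▷ g) = gateDepth (depthsSLP p) g ∷ depthsSLP p

  depth : ∀ {V} → Circuit V → ℕ
  depth (circuit _ p) = head (depthsSLP p)

  gateVal : ∀ {V n i} → (V → Poly n) → Vec (Poly n) i → Gate V i → Poly n
  gateVal σ vs (input v)  = σ v
  gateVal σ vs (const a)  = constP a
  gateVal σ vs (plus ws)  = foldr (λ w acc → (Data.Product.proj₁ w ·P lookup vs (Data.Product.proj₂ w)) +P acc) 0P ws
  gateVal σ vs (times ws) = foldr (λ j acc → lookup vs j *P acc) 1P ws

  valsSLP : ∀ {V n i} → (V → Poly n) → SLP V i → Vec (Poly n) i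
  valsSLP σ []      = []
  valsSLP σ (p ▷ g) = gateVal σ (valsSLP σ p) g ∷ valsSLP σ p

  evalC : ∀ {V n} → (V → Poly n) → Circuit V → Poly n
  evalC σ (circuit _ p) = head (valsSLP σ p)

  σ₀ : ∀ {n m} → IPSVar n m → Poly n
  σ₀ (inj₁ i)        = varP i
  σ₀ (inj₂ (inj₁ j)) = 0P
  σ₀ (inj₂ (inj₂ i)) = 0P

  σ₁ : ∀ {n m} → (Fin m → Poly n) → IPSVar n m → Poly n
  σ₁ fs (inj₁ i)        = varP i
  σ₁ fs (inj₂ (inj₁ j)) = fs j
  σ₁ fs (inj₂ (inj₂ i)) = (varP i *P varP i) -P varP i

  IsIPSRefutation : ∀ {n m} → (Fin m → Poly n) → Circuit (IPSVar n m) → Set ℓ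
  IsIPSRefutation fs C = (evalC σ₀ C ≈P 0P) × (evalC (σ₁ fs) C ≈P 1P)

  IPSRef₁ : ∀ {n} → Poly n → Circuit (IPSVar n 1) → Set ℓ
  IPSRef₁ f = IsIPSRefutation (λ _ → f)

{-# OPTIONS --safe #-}
-- The hard polynomial is 1 + w + h, where h ∈ {0, 1} on Boolean points is an iterated sum of products of leaf variables, of
-- product depth about Γ/5, in which 0/1 selector variables choose the leaf variables. If w and h are Boolean then 1 + w + h has the
-- inverse (6 - 3w - 3h + 2wh)/6, and since h² is again computed by such a network this identity becomes a refutation of depth Γ.
--
-- Lower bound, after Limaye, Srinivasan and Tavenas. Put the polynomial 1 - C(x, 0, x² - x) of a small refutation C at the root
-- w = -1 - h: it vanishes there, and it is not identically zero. Its values at points x⁰ + Σ ε_l (unit vector of the string of l),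
-- with one ε_l of square zero for each leaf l, are tensors over the strings at the leaves. The leaves are rows or columns, of
-- incommensurable lengths, so that a tensor on few leaves is an unbalanced matrix and has small relative rank. Sums preserve
-- bounds of the form "the components at many ε's have small relative rank"; products do after passing to logarithms of units,
-- which turns them into sums, and the two steps for log and exp cost two levels of the thresholds for "many". Newton's iteration
-- extracts the simple root of a suitable Taylor coefficient, so h inherits the bound, but its top component is a nonsingular
-- diagonal matrix up to permutation. Equality of field elements is used up to double negation, as it is not decidable.
module Submission where

open import Level using (Level; _⊔_)
open import Algebra.Bundles using (CommutativeRing)
open import Data.Nat as ℕ using (ℕ; zero; suc; _≤_; _<_; z≤n; s≤s; _^_)
import Data.Nat.Properties as ℕP
import Data.Integer as ℤ
open import Data.Bool as Bool using (Bool; true; false; not)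
open import Data.Unit using (⊤; tt)
open import Data.Empty using (⊥; ⊥-elim)
open import Data.Maybe using (Maybe; just; nothing)
open import Data.Fin as Fin using (Fin; zero; suc)
import Data.Fin.Properties as FP
open import Data.Vec as Vec using (Vec; []; _∷_; lookup)
import Data.Vec.Properties as VP
open import Data.List as List using (List; []; _∷_; map; _++_; length)
import Data.List.Properties as LP
open import Data.List.Membership.Propositional using (_∈_)
open import Data.Product using (Σ; ∃; _×_; _,_; proj₁; proj₂)
open import Data.Sum using (_⊎_; inj₁; inj₂)
open import Relation.Nullary using (¬_; Dec; yes; no)
open import Relation.Binary using (DecidableEquality)
open import Relation.Binary.PropositionalEquality as ≡ using (_≡_)
open import Function using (_∘_)

module CommutativeAlgebra where
  open import Algebra.Solver.Ring.AlmostCommutativeRing using (AlmostCommutativeRing; fromCommutativeRing; _-Raw-AlmostCommutative⟶_)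
  open import Data.Integer using (ℤ; +_; -[1+_]; _⊖_)
  import Data.Integer.Properties as ℤP
  open import Data.List using (foldr; concatMap)
  open import Relation.Binary.Structures using (IsEquivalence)

  module RS {c ℓ} (R : CommutativeRing c ℓ) where
    open CommutativeRing R using (+-assoc; +-comm; +-cong; +-congʳ; +-congˡ; +-identityʳ; +-identityˡ; -‿cong; -‿inverseʳ; Carrier; refl; reflexive; ring; semiring; setoid; sym; trans; zero; _+_; _*_; -_; _-_; _≈_; 0#; 1#)
    open import Algebra.Properties.Ring ring
    open import Algebra.Properties.Semiring.Mult.TCOptimised semiring using (×-homo-+; ×1-homo-*; 1+×) renaming (_×_ to _×ₙ_)
    open import Relation.Binary.Reasoning.Setoid setoid
    ACR : AlmostCommutativeRing c ℓ
    ACR = fromCommutativeRing R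
    ⟦_⟧ℤ : ℤ → Carrier
    ⟦ + n ⟧ℤ = n ×ₙ 1#
    ⟦ -[1+ n ] ⟧ℤ = - (suc n ×ₙ 1#)

    ⊖-homo : ∀ m n → ⟦ m ⊖ n ⟧ℤ ≈ (m ×ₙ 1#) - (n ×ₙ 1#)
    ⊖-homo m zero = sym (trans (+-congˡ -0#≈0#) (+-identityʳ _))
    ⊖-homo zero (suc n) = sym (+-identityˡ _)
    ⊖-homo (suc m) (suc n) = begin
      ⟦ suc m ⊖ suc n ⟧ℤ ≡⟨ ≡.cong ⟦_⟧ℤ (ℤP.[1+m]⊖[1+n]≡m⊖n m n) ⟩
      ⟦ m ⊖ n ⟧ℤ ≈⟨ ⊖-homo m n ⟩
      (m ×ₙ 1#) - (n ×ₙ 1#) ≈⟨ +-congʳ (sym (+-identityˡ _)) ⟩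
      (0# + (m ×ₙ 1#)) - (n ×ₙ 1#) ≈⟨ +-congʳ (+-congʳ (sym (-‿inverseʳ 1#))) ⟩
      ((1# - 1#) + (m ×ₙ 1#)) - (n ×ₙ 1#) ≈⟨ +-congʳ (+-assoc _ _ _) ⟩
      (1# + (- 1# + (m ×ₙ 1#))) - (n ×ₙ 1#) ≈⟨ +-congʳ (+-congˡ (+-comm _ _)) ⟩
      (1# + ((m ×ₙ 1#) - 1#)) - (n ×ₙ 1#) ≈⟨ +-congʳ (sym (+-assoc _ _ _)) ⟩
      ((1# + (m ×ₙ 1#)) - 1#) - (n ×ₙ 1#) ≈⟨ +-assoc _ _ _ ⟩
      (1# + (m ×ₙ 1#)) + (- 1# - (n ×ₙ 1#)) ≈⟨ +-congˡ (-‿+-comm 1# (n ×ₙ 1#)) ⟩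
      (1# + (m ×ₙ 1#)) - (1# + (n ×ₙ 1#)) ≈⟨ +-cong (1+× m 1#) (-‿cong (1+× n 1#)) ⟨
      (suc m ×ₙ 1#) - (suc n ×ₙ 1#) ∎

    +-homoℤ : ∀ x y → ⟦ x ℤ.+ y ⟧ℤ ≈ ⟦ x ⟧ℤ + ⟦ y ⟧ℤ
    +-homoℤ (+ m) (+ n) = ×-homo-+ 1# m n
    +-homoℤ (+ m) -[1+ n ] = ⊖-homo m (suc n)
    +-homoℤ -[1+ m ] (+ n) = trans (⊖-homo n (suc m)) (+-comm _ _)
    +-homoℤ -[1+ m ] -[1+ n ] = trans (-‿cong (trans (reflexive (≡.cong (_×ₙ 1#) (≡.cong suc (≡.sym (ℕP.+-suc m n))))) (×-homo-+ 1# (suc m) (suc n)))) (sym (-‿+-comm _ _))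

    neg-homo : ∀ x → ⟦ ℤ.- x ⟧ℤ ≈ - ⟦ x ⟧ℤ
    neg-homo (+ zero) = sym -0#≈0#
    neg-homo (+ suc n) = refl
    neg-homo -[1+ n ] = sym (-‿involutive _)

    *-homo⁺ : ∀ m n → ⟦ + m ℤ.* + n ⟧ℤ ≈ (m ×ₙ 1#) * (n ×ₙ 1#)
    *-homo⁺ m n = trans (reflexive (≡.cong ⟦_⟧ℤ (≡.sym (ℤP.pos-* m n)))) (×1-homo-* m n)

    *-homoℤ : ∀ x y → ⟦ x ℤ.* y ⟧ℤ ≈ ⟦ x ⟧ℤ * ⟦ y ⟧ℤ
    *-homoℤ (+ m) (+ n) = *-homo⁺ m n
    *-homoℤ (+ m) -[1+ n ] = trans (reflexive (≡.cong ⟦_⟧ℤ (≡.sym (ℤP.neg-distribʳ-* (+ m) (+ suc n))))) (trans (neg-homo (+ m ℤ.* + suc n)) (trans (-‿cong (*-homo⁺ m (suc n))) (-‿distribʳ-* _ _)))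
    *-homoℤ -[1+ m ] (+ n) = trans (reflexive (≡.cong ⟦_⟧ℤ (≡.sym (ℤP.neg-distribˡ-* (+ suc m) (+ n))))) (trans (neg-homo (+ suc m ℤ.* + n)) (trans (-‿cong (*-homo⁺ (suc m) n)) (-‿distribˡ-* _ _)))
    *-homoℤ -[1+ m ] -[1+ n ] = trans (*-homo⁺ (suc m) (suc n)) (sym (trans (sym (-‿distribˡ-* _ _)) (trans (-‿cong (sym (-‿distribʳ-* _ _))) (-‿involutive _))))

    morph : ℤ.+-*-rawRing -Raw-AlmostCommutative⟶ ACR
    morph = record { ⟦_⟧ = ⟦_⟧ℤ ; +-homo = +-homoℤ ; *-homo = *-homoℤ ; -‿homo = neg-homo ; 0-homo = refl ; 1-homo = refl }
    weq : ∀ x y → Maybe (⟦ x ⟧ℤ ≈ ⟦ y ⟧ℤ)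
    weq x y with x ℤ.≟ y
    ... | yes p = just (reflexive (≡.cong ⟦_⟧ℤ p))
    ... | no _ = nothing
    open import Algebra.Solver.Ring ℤ.+-*-rawRing ACR morph weq public renaming (solve to rsolve; _:=_ to _⊜_)

  mkCommutativeRing : ∀ {c ℓ} {A : Set c} (_≈_ : A → A → Set ℓ) (_+_ _*_ : A → A → A) (-_ : A → A) (0# 1# : A) →
    IsEquivalence _≈_ →
    (∀ {x x' y y'} → x ≈ x' → y ≈ y' → (x + y) ≈ (x' + y')) →
    (∀ {x x' y y'} → x ≈ x' → y ≈ y' → (x * y) ≈ (x' * y')) →
    (∀ {x y} → x ≈ y → (- x) ≈ (- y)) →
    (∀ x y z → ((x + y) + z) ≈ (x + (y + z))) →
    (∀ x y → (x + y) ≈ (y + x)) →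
    (∀ x → (0# + x) ≈ x) →
    (∀ x → ((- x) + x) ≈ 0#) →
    (∀ x y z → ((x * y) * z) ≈ (x * (y * z))) →
    (∀ x y → (x * y) ≈ (y * x)) →
    (∀ x → (1# * x) ≈ x) →
    (∀ x y z → (x * (y + z)) ≈ ((x * y) + (x * z))) →
    CommutativeRing c ℓ
  mkCommutativeRing _≈_ _+_ _*_ -_ 0# 1# eq +-cong *-cong neg-cong +-assoc +-comm +-idˡ -invˡ *-assoc *-comm *-idˡ distˡ = record
    { _≈_ = _≈_ ; _+_ = _+_ ; _*_ = _*_ ; -_ = -_ ; 0# = 0# ; 1# = 1#
    ; isCommutativeRing = record
      { isRing = record
        { +-isAbelianGroup = record
          { isGroup = record
            { isMonoid = record
              { isSemigroup = record
                { isMagma = record { isEquivalence = eq ; ∙-cong = +-cong }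
                ; assoc = +-assoc }
              ; identity = +-idˡ , λ x → trans (+-comm x 0#) (+-idˡ x) }
            ; inverse = -invˡ , λ x → trans (+-comm x (- x)) (-invˡ x)
            ; ⁻¹-cong = neg-cong }
          ; comm = +-comm }
        ; *-cong = *-cong
        ; *-assoc = *-assoc
        ; *-identity = *-idˡ , λ x → trans (*-comm x 1#) (*-idˡ x)
        ; distrib = distˡ , λ x y z → trans (*-comm (y + z) x) (trans (distˡ x y z) (+-cong (*-comm x y) (*-comm x z))) }
      ; *-comm = *-comm } }
    where open IsEquivalence eq

  module Sums {c ℓ} (R : CommutativeRing c ℓ) where
    open CommutativeRing R using (*-assoc; *-comm; *-cong; *-congˡ; *-identityˡ; +-assoc; +-cong; +-congˡ; +-identityˡ; Carrier; distribˡ; refl; sym; trans; zeroʳ; _+_; _*_; _≈_; 0#; 1#)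
    open RS R using (rsolve; _:+_; _:*_; _⊜_)

    private variable
      a b : Level
      X Y : Set a

    ∑ ∏ : List X → (X → Carrier) → Carrier
    ∑ xs f = foldr (λ x acc → f x + acc) 0# xs
    ∏ xs f = foldr (λ x acc → f x * acc) 1# xs

    ∑-cong : (xs : List X) {f g : X → Carrier} → (∀ x → f x ≈ g x) → ∑ xs f ≈ ∑ xs g
    ∑-cong [] e = refl
    ∑-cong (x ∷ xs) e = +-cong (e x) (∑-cong xs e)

    ∏-cong : (xs : List X) {f g : X → Carrier} → (∀ x → f x ≈ g x) → ∏ xs f ≈ ∏ xs g
    ∏-cong [] e = refl
    ∏-cong (x ∷ xs) e = *-cong (e x) (∏-cong xs e)

    ∑-++ : (xs ys : List X) (f : X → Carrier) → ∑ (xs ++ ys) f ≈ ∑ xs f + ∑ ys f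
    ∑-++ [] ys f = sym (+-identityˡ _)
    ∑-++ (x ∷ xs) ys f = trans (+-congˡ (∑-++ xs ys f)) (sym (+-assoc _ _ _))

    ∏-++ : (xs ys : List X) (f : X → Carrier) → ∏ (xs ++ ys) f ≈ ∏ xs f * ∏ ys f
    ∏-++ [] ys f = sym (*-identityˡ _)
    ∏-++ (x ∷ xs) ys f = trans (*-congˡ (∏-++ xs ys f)) (sym (*-assoc _ _ _))

    ∑-map : (h : X → Y) (xs : List X) (f : Y → Carrier) → ∑ (map h xs) f ≈ ∑ xs (λ x → f (h x))
    ∑-map h [] f = refl
    ∑-map h (x ∷ xs) f = +-congˡ (∑-map h xs f)

    ∏-map : (h : X → Y) (xs : List X) (f : Y → Carrier) → ∏ (map h xs) f ≈ ∏ xs (λ x → f (h x))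
    ∏-map h [] f = refl
    ∏-map h (x ∷ xs) f = *-congˡ (∏-map h xs f)

    ∑-concatMap : (h : X → List Y) (xs : List X) (f : Y → Carrier) → ∑ (concatMap h xs) f ≈ ∑ xs (λ x → ∑ (h x) f)
    ∑-concatMap h [] f = refl
    ∑-concatMap h (x ∷ xs) f = trans (∑-++ (h x) _ f) (+-congˡ (∑-concatMap h xs f))

    ∏-concatMap : (h : X → List Y) (xs : List X) (f : Y → Carrier) → ∏ (concatMap h xs) f ≈ ∏ xs (λ x → ∏ (h x) f)
    ∏-concatMap h [] f = refl
    ∏-concatMap h (x ∷ xs) f = trans (∏-++ (h x) _ f) (*-congˡ (∏-concatMap h xs f))

    ∑-+ : (xs : List X) (f g : X → Carrier) → ∑ xs (λ x → f x + g x) ≈ ∑ xs f + ∑ xs g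
    ∑-+ [] f g = sym (+-identityˡ _)
    ∑-+ (x ∷ xs) f g = trans (+-congˡ (∑-+ xs f g))
      (rsolve 4 (λ p q r s → (p :+ q) :+ (r :+ s) ⊜ (p :+ r) :+ (q :+ s)) refl _ _ _ _)

    ∏-* : (xs : List X) (f g : X → Carrier) → ∏ xs (λ x → f x * g x) ≈ ∏ xs f * ∏ xs g
    ∏-* [] f g = sym (*-identityˡ _)
    ∏-* (x ∷ xs) f g = trans (*-congˡ (∏-* xs f g))
      (rsolve 4 (λ p q r s → (p :* q) :* (r :* s) ⊜ (p :* r) :* (q :* s)) refl _ _ _ _)

    ∑-0 : (xs : List X) {f : X → Carrier} → (∀ x → f x ≈ 0#) → ∑ xs f ≈ 0#
    ∑-0 [] e = refl
    ∑-0 (x ∷ xs) e = trans (+-cong (e x) (∑-0 xs e)) (+-identityˡ _)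

    *-∑ : (c : Carrier) (xs : List X) (f : X → Carrier) → c * ∑ xs f ≈ ∑ xs (λ x → c * f x)
    *-∑ c [] f = zeroʳ c
    *-∑ c (x ∷ xs) f = trans (distribˡ _ _ _) (+-congˡ (*-∑ c xs f))

    ∑-* : (xs : List X) (f : X → Carrier) (c : Carrier) → ∑ xs f * c ≈ ∑ xs (λ x → f x * c)
    ∑-* xs f c = trans (*-comm _ _) (trans (*-∑ c xs f) (∑-cong xs (λ x → *-comm _ _)))

    ∑-swap : (xs : List X) (ys : List Y) (f : X → Y → Carrier) →
      ∑ xs (λ x → ∑ ys (f x)) ≈ ∑ ys (λ y → ∑ xs (λ x → f x y))
    ∑-swap [] ys f = sym (∑-0 ys (λ _ → refl))
    ∑-swap (x ∷ xs) ys f = trans (+-congˡ (∑-swap xs ys f)) (sym (∑-+ ys (f x) _))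

  -- Formal power series; the Cauchy product is defined by recursion on the index through the tail of the left factor.
  module Series {c ℓ} (R : CommutativeRing c ℓ) where
    open CommutativeRing R using (*-assoc; *-comm; *-cong; *-congʳ; *-identityˡ; +-assoc; +-comm; +-cong; +-congˡ; +-identityʳ; +-identityˡ; -‿cong; -‿inverseˡ; Carrier; distribʳ; distribˡ; refl; sym; trans; zero; zeroˡ; _+_; _*_; -_; _-_; _≈_; 0#; 1#)
    open RS R using (rsolve; _:+_; _:*_; _⊜_)

    tail : (ℕ → Carrier) → ℕ → Carrier
    tail p n = p (suc n)

    conv : (ℕ → Carrier) → (ℕ → Carrier) → ℕ → Carrier
    conv p q zero = p 0 * q 0
    conv p q (suc n) = p 0 * q (suc n) + conv (tail p) q n

    scalar : Carrier → ℕ → Carrier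
    scalar a zero = a
    scalar a (suc _) = 0#

    indeterminate : ℕ → Carrier
    indeterminate zero = 0#
    indeterminate (suc n) = scalar 1# n

    conv-cong : ∀ {p p' q q'} → (∀ n → p n ≈ p' n) → (∀ n → q n ≈ q' n) → ∀ n → conv p q n ≈ conv p' q' n
    conv-cong e f zero = *-cong (e 0) (f 0)
    conv-cong e f (suc n) = +-cong (*-cong (e 0) (f (suc n))) (conv-cong (λ n → e (suc n)) f n)

    conv-sucʳ : ∀ p q n → conv p q (suc n) ≈ conv p (tail q) n + p (suc n) * q 0
    conv-sucʳ p q zero = refl
    conv-sucʳ p q (suc n) = trans (+-congˡ (conv-sucʳ (tail p) q n)) (sym (+-assoc _ _ _))

    conv-comm : ∀ p q n → conv p q n ≈ conv q p n
    conv-comm p q zero = *-comm _ _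
    conv-comm p q (suc n) = trans (conv-sucʳ p q n) (trans (+-comm _ _) (+-cong (*-comm _ _) (conv-comm p (tail q) n)))

    conv-distribʳ : ∀ p q r n → conv (λ i → p i + q i) r n ≈ conv p r n + conv q r n
    conv-distribʳ p q r zero = distribʳ _ _ _
    conv-distribʳ p q r (suc n) = trans (+-cong (distribʳ _ _ _) (conv-distribʳ (tail p) (tail q) r n))
      (rsolve 4 (λ p q r s → (p :+ q) :+ (r :+ s) ⊜ (p :+ r) :+ (q :+ s)) refl _ _ _ _)

    conv-distribˡ : ∀ p q r n → conv p (λ i → q i + r i) n ≈ conv p q n + conv p r n
    conv-distribˡ p q r n = trans (conv-comm p _ n) (trans (conv-distribʳ q r p n) (+-cong (conv-comm q p n) (conv-comm r p n)))

    conv-scale : ∀ a p q n → conv (λ i → a * p i) q n ≈ a * conv p q n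
    conv-scale a p q zero = *-assoc _ _ _
    conv-scale a p q (suc n) = trans (+-cong (*-assoc _ _ _) (conv-scale a (tail p) q n)) (sym (distribˡ _ _ _))

    conv-zeroˡ : ∀ {p} q → (∀ n → p n ≈ 0#) → ∀ n → conv p q n ≈ 0#
    conv-zeroˡ q e zero = trans (*-congʳ (e 0)) (zeroˡ _)
    conv-zeroˡ q e (suc n) = trans (+-cong (trans (*-congʳ (e 0)) (zeroˡ _)) (conv-zeroˡ q (λ n → e (suc n)) n)) (+-identityˡ _)

    conv-scalarˡ : ∀ a q n → conv (scalar a) q n ≈ a * q n
    conv-scalarˡ a q zero = refl
    conv-scalarˡ a q (suc n) = trans (+-congˡ (conv-zeroˡ q (λ _ → refl) n)) (+-identityʳ _)

    conv-assoc : ∀ p q r n → conv (conv p q) r n ≈ conv p (conv q r) n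
    conv-assoc p q r zero = *-assoc _ _ _
    conv-assoc p q r (suc n) =
      trans (+-congˡ (trans (conv-distribʳ (λ i → p 0 * q (suc i)) (conv (tail p) q) r n)
                            (+-cong (conv-scale (p 0) (tail q) r n) (conv-assoc (tail p) q r n))))
        (rsolve 6 (λ a b c d e f → (a :* b) :* c :+ (a :* d :+ e) ⊜ a :* (b :* c :+ d) :+ e) refl (p 0) (q 0) (r (suc n)) _ _ (p 0))

    seriesRing : CommutativeRing c ℓ
    seriesRing = mkCommutativeRing {A = ℕ → Carrier} (λ p q → ∀ n → p n ≈ q n)
      (λ p q n → p n + q n) conv (λ p n → - p n) (λ _ → 0#) (scalar 1#)
      (record { refl = λ n → refl ; sym = λ e n → sym (e n) ; trans = λ e f n → trans (e n) (f n) })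
      (λ e f n → +-cong (e n) (f n)) conv-cong (λ e n → -‿cong (e n))
      (λ p q r n → +-assoc _ _ _) (λ p q n → +-comm _ _) (λ p n → +-identityˡ _) (λ p n → -‿inverseˡ _)
      conv-assoc conv-comm (λ p n → trans (conv-scalarˡ 1# p n) (*-identityˡ _)) conv-distribˡ

  module Dual {c ℓ} (R : CommutativeRing c ℓ) where
    open CommutativeRing R using (*-assoc; *-comm; *-cong; *-identityˡ; +-assoc; +-comm; +-cong; +-identityʳ; +-identityˡ; -‿cong; -‿inverseˡ; Carrier; distribˡ; refl; sym; trans; zeroˡ; _+_; _*_; -_; _-_; _≈_; 0#; 1#)
    open RS R using (rsolve; _:+_; _:*_; _⊜_)

    dualRing : CommutativeRing c ℓ
    dualRing = mkCommutativeRing {A = Carrier × Carrier} (λ u v → (proj₁ u ≈ proj₁ v) × (proj₂ u ≈ proj₂ v))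
      (λ u v → proj₁ u + proj₁ v , proj₂ u + proj₂ v)
      (λ u v → proj₁ u * proj₁ v , proj₁ u * proj₂ v + proj₂ u * proj₁ v)
      (λ u → - proj₁ u , - proj₂ u) (0# , 0#) (1# , 0#)
      (record { refl = refl , refl ; sym = λ (e , f) → sym e , sym f ; trans = λ (e , f) (e' , f') → trans e e' , trans f f' })
      (λ (e , f) (e' , f') → +-cong e e' , +-cong f f')
      (λ (e , f) (e' , f') → *-cong e e' , +-cong (*-cong e f') (*-cong f e'))
      (λ (e , f) → -‿cong e , -‿cong f)
      (λ x y z → +-assoc _ _ _ , +-assoc _ _ _)
      (λ x y → +-comm _ _ , +-comm _ _)
      (λ x → +-identityˡ _ , +-identityˡ _)
      (λ x → -‿inverseˡ _ , -‿inverseˡ _)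
      (λ (a , b) (c , d) (e , f) → *-assoc _ _ _ ,
        rsolve 6 (λ a b c d e f → (a :* c) :* f :+ (a :* d :+ b :* c) :* e ⊜ a :* (c :* f :+ d :* e) :+ b :* (c :* e)) refl a b c d e f)
      (λ (a , b) (c , d) → *-comm _ _ , rsolve 4 (λ a b c d → a :* d :+ b :* c ⊜ c :* b :+ d :* a) refl a b c d)
      (λ (a , b) → *-identityˡ _ , trans (+-cong (*-identityˡ _) (zeroˡ _)) (+-identityʳ _))
      (λ (a , b) (c , d) (e , f) → distribˡ _ _ _ ,
        rsolve 6 (λ a b c d e f → a :* (d :+ f) :+ b :* (c :+ e) ⊜ (a :* d :+ b :* c) :+ (a :* f :+ b :* e)) refl a b c d e f)

  module Pointwise {c ℓ} (I : Set) (R : CommutativeRing c ℓ) where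
    open CommutativeRing R using (*-assoc; *-comm; *-cong; *-identityˡ; +-assoc; +-comm; +-cong; +-identityˡ; -‿cong; -‿inverseˡ; Carrier; distribˡ; refl; sym; trans; _+_; _*_; -_; _-_; _≈_; 0#; 1#)

    pointwiseRing : CommutativeRing c ℓ
    pointwiseRing = mkCommutativeRing {A = I → Carrier} (λ p q → ∀ n → p n ≈ q n)
      (λ p q n → p n + q n) (λ p q n → p n * q n) (λ p n → - p n) (λ _ → 0#) (λ _ → 1#)
      (record { refl = λ n → refl ; sym = λ e n → sym (e n) ; trans = λ e f n → trans (e n) (f n) })
      (λ e f n → +-cong (e n) (f n)) (λ e f n → *-cong (e n) (f n)) (λ e n → -‿cong (e n))
      (λ p q r n → +-assoc _ _ _) (λ p q n → +-comm _ _) (λ p n → +-identityˡ _) (λ p n → -‿inverseˡ _)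
      (λ p q r n → *-assoc _ _ _) (λ p q n → *-comm _ _) (λ p n → *-identityˡ _) (λ p q r n → distribˡ _ _ _)

  -- Equality up to double negation, which makes equality of the ring stable.
  module Stabilised {c ℓ} (R : CommutativeRing c ℓ) where
    open CommutativeRing R using (*-assoc; *-comm; *-cong; *-identityˡ; +-assoc; +-comm; +-cong; +-identityˡ; -‿cong; -‿inverseˡ; Carrier; distribˡ; refl; sym; trans; _+_; _*_; -_; _≈_; 0#; 1#)

    _≈ₛ_ : Carrier → Carrier → Set ℓ
    x ≈ₛ y = ¬ ¬ (x ≈ y)

    private
      lift₁ : ∀ {x y x' y'} → (x ≈ y → x' ≈ y') → x ≈ₛ y → x' ≈ₛ y'
      lift₁ f p k = p (λ e → k (f e))

      lift₂ : ∀ {x y x' y' x″ y″} → (x ≈ y → x' ≈ y' → x″ ≈ y″) → x ≈ₛ y → x' ≈ₛ y' → x″ ≈ₛ y″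
      lift₂ f p q k = p (λ e → q (λ e' → k (f e e')))

      now : ∀ {x y} → x ≈ y → x ≈ₛ y
      now e k = k e

    stableRing : CommutativeRing c ℓ
    stableRing = mkCommutativeRing _≈ₛ_ _+_ _*_ -_ 0# 1#
      (record { refl = now refl ; sym = lift₁ sym ; trans = lift₂ trans })
      (lift₂ +-cong) (lift₂ *-cong) (lift₁ -‿cong)
      (λ _ _ _ → now (+-assoc _ _ _)) (λ _ _ → now (+-comm _ _)) (λ _ → now (+-identityˡ _)) (λ _ → now (-‿inverseˡ _))
      (λ _ _ _ → now (*-assoc _ _ _)) (λ _ _ → now (*-comm _ _)) (λ _ → now (*-identityˡ _)) (λ _ _ _ → now (distribˡ _ _ _))

module FormulaSemantics where
  open CommutativeAlgebra
  open import Defs using (Field)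
  open import Level using () renaming (suc to lsuc)
  open import Data.Nat using () renaming (_⊔_ to _⊔ℕ_)

  -- Horner evaluation of the coefficients of index at most n.
  module Horner {c ℓ} (R : CommutativeRing c ℓ) where
    open CommutativeRing R using (*-cong; *-congˡ; +-cong; +-congʳ; +-congˡ; +-identityʳ; +-identityˡ; Carrier; distribʳ; refl; sym; trans; zero; zeroʳ; _+_; _*_; _≈_; 0#)
    open RS R using (rsolve; _:+_; _:*_; :-_; _⊜_)
    open Series R using (tail; conv; conv-zeroˡ; scalar)

    ev : ℕ → (ℕ → Carrier) → Carrier → Carrier
    ev zero q τ = q 0
    ev (suc n) q τ = q 0 + τ * ev n (tail q) τ

    ev-cong : ∀ n {q q' τ τ'} → (∀ j → q j ≈ q' j) → τ ≈ τ' → ev n q τ ≈ ev n q' τ'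
    ev-cong zero e f = e 0
    ev-cong (suc n) e f = +-cong (e 0) (*-cong f (ev-cong n (e ∘ suc) f))

    ev-+ : ∀ n q q' τ → ev n (λ j → q j + q' j) τ ≈ ev n q τ + ev n q' τ
    ev-+ zero q q' τ = refl
    ev-+ (suc n) q q' τ = trans (+-congˡ (*-congˡ (ev-+ n (tail q) (tail q') τ)))
      (rsolve 5 (λ a b t x y → (a :+ b) :+ t :* (x :+ y) ⊜ (a :+ t :* x) :+ (b :+ t :* y)) refl (q 0) (q' 0) τ _ _)

    ev-scale : ∀ n a q τ → ev n (λ j → a * q j) τ ≈ a * ev n q τ
    ev-scale zero a q τ = refl
    ev-scale (suc n) a q τ = trans (+-congˡ (*-congˡ (ev-scale n a (tail q) τ)))
      (rsolve 4 (λ a b t x → a :* b :+ t :* (a :* x) ⊜ a :* (b :+ t :* x)) refl a (q 0) τ _)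

    ev-zero : ∀ n {q} τ → (∀ j → q j ≈ 0#) → ev n q τ ≈ 0#
    ev-zero zero τ e = e 0
    ev-zero (suc n) τ e = trans (+-cong (e 0) (trans (*-congˡ (ev-zero n τ (e ∘ suc))) (zeroʳ τ))) (+-identityˡ 0#)

    ev-extend : ∀ {k n} q τ → k ≤ n → (∀ j → k < j → q j ≈ 0#) → ev n q τ ≈ ev k q τ
    ev-extend {zero} {zero} q τ le z = refl
    ev-extend {zero} {suc n} q τ le z = trans (+-congˡ (trans (*-congˡ (ev-zero n τ (λ j → z (suc j) (s≤s z≤n)))) (zeroʳ τ))) (+-identityʳ _)
    ev-extend {suc k} {suc n} q τ (s≤s le) z = +-congˡ (*-congˡ (ev-extend (tail q) τ le (λ j lt → z (suc j) (s≤s lt))))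

    conv-scalarTailˡ : ∀ p q n → (∀ j → 0 < j → p j ≈ 0#) → conv p q n ≈ p 0 * q n
    conv-scalarTailˡ p q zero z = refl
    conv-scalarTailˡ p q (suc n) z = trans (+-congˡ (conv-zeroˡ q (λ j → z (suc j) (s≤s z≤n)) n)) (+-identityʳ _)

    conv-vanish : ∀ k l p q → (∀ j → k < j → p j ≈ 0#) → (∀ j → l < j → q j ≈ 0#) → ∀ j → k ℕ.+ l < j → conv p q j ≈ 0#
    conv-vanish zero l p q zp zq j lt = trans (conv-scalarTailˡ p q j zp) (trans (*-congˡ (zq j lt)) (zeroʳ _))
    conv-vanish (suc k) l p q zp zq (suc j) (s≤s lt) =
      trans (+-cong (trans (*-congˡ (zq (suc j) (ℕP.≤-trans (s≤s (ℕP.m≤n+m l k)) (ℕP.m≤n⇒m≤1+n lt)))) (zeroʳ _))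
                    (conv-vanish k l (tail p) q (λ i h → zp (suc i) (s≤s h)) zq j lt)) (+-identityʳ _)

    ev-conv : ∀ k l p q τ → (∀ j → k < j → p j ≈ 0#) → (∀ j → l < j → q j ≈ 0#) →
      ev (k ℕ.+ l) (conv p q) τ ≈ ev k p τ * ev l q τ
    ev-conv zero l p q τ zp zq = trans (ev-cong l (λ j → conv-scalarTailˡ p q j zp) refl) (ev-scale l (p 0) q τ)
    ev-conv (suc k) l p q τ zp zq =
      trans (+-congˡ (*-congˡ (trans (ev-+ (k ℕ.+ l) (λ n → p 0 * q (suc n)) (conv (tail p) q) τ)
        (+-cong (ev-scale (k ℕ.+ l) (p 0) (tail q) τ) (ev-conv k l (tail p) q τ (λ i h → zp (suc i) (s≤s h)) zq)))))
      (trans (rsolve 6 (λ a b t x y z → a :* b :+ t :* (a :* x :+ y :* z) ⊜ a :* (b :+ t :* x) :+ (t :* y) :* z) refl (p 0) (q 0) τ _ _ _)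
      (trans (+-congʳ (*-congˡ (ev-extend q τ (ℕP.m≤n+m l (suc k)) zq)))
      (sym (distribʳ _ _ _))))

    ev-scalar : ∀ n a τ → ev n (scalar a) τ ≈ a
    ev-scalar zero a τ = refl
    ev-scalar (suc n) a τ = trans (+-congˡ (trans (*-congˡ (ev-zero n τ (λ _ → refl))) (zeroʳ τ))) (+-identityʳ a)

  module _ {c ℓ : Level} (F : Field c ℓ) where
    private module F = Field F using (-‿inverseˡ; Carrier; refl; _+_; _*_; -_; _-_; _≈_; 0#; 1#; commutativeRing)

    record Alg : Set (lsuc (c ⊔ ℓ)) where
      field
        cring : CommutativeRing c ℓ
      open CommutativeRing cring public using (*-assoc; *-comm; *-cong; *-congʳ; *-congˡ; *-identity; *-identityʳ; *-identityˡ; +-assoc; +-comm; +-commutativeMonoid; +-cong; +-congʳ; +-congˡ; +-group; +-identityʳ; +-identityˡ; +-isAbelianGroup; -‿cong; -‿inverseʳ; -‿inverseˡ; Carrier; distrib; distribʳ; distribˡ; isCommutativeRing; isEquivalence; isRing; refl; reflexive; ring; semiring; setoid; sym; trans; zero; zeroʳ; zeroˡ; _+_; _*_; -_; _-_; _≈_; 0#; 1#)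
      field
        ι      : F.Carrier → Carrier
        ι-cong : ∀ {a b} → a F.≈ b → ι a ≈ ι b
        ι-+    : ∀ a b → ι (a F.+ b) ≈ ι a + ι b
        ι-*    : ∀ a b → ι (a F.* b) ≈ ι a * ι b
        ι-0    : ι F.0# ≈ 0#
        ι-1    : ι F.1# ≈ 1#

      ι-neg : ∀ a → ι (F.- a) ≈ - ι a
      ι-neg a = trans (sym (+-identityʳ _)) (trans (+-congˡ (sym (-‿inverseʳ (ι a)))) (trans (sym (+-assoc _ _ _))
        (trans (+-congʳ (trans (sym (ι-+ _ _)) (trans (ι-cong (F.-‿inverseˡ a)) ι-0))) (+-identityˡ _))))

    baseAlg : Alg
    baseAlg = record { cring = F.commutativeRing ; ι = λ a → a ; ι-cong = λ e → e ; ι-+ = λ _ _ → F.refl ; ι-* = λ _ _ → F.refl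
                     ; ι-0 = F.refl ; ι-1 = F.refl }

    seriesAlg : Alg → Alg
    seriesAlg A = record
      { cring = Series.seriesRing cring ; ι = λ a → scalar (ι a)
      ; ι-cong = λ { e zero → ι-cong e ; e (suc n) → refl }
      ; ι-+ = λ { a b zero → ι-+ a b ; a b (suc n) → sym (+-identityˡ _) }
      ; ι-* = λ { a b zero → ι-* a b ; a b (suc n) → sym (trans (conv-scalarˡ (ι a) (scalar (ι b)) (suc n)) (zeroʳ _)) }
      ; ι-0 = λ { zero → ι-0 ; (suc n) → refl }
      ; ι-1 = λ { zero → ι-1 ; (suc n) → refl } }
      where
      open Alg A using (+-identityˡ; refl; sym; trans; zero; zeroʳ; cring; ι; ι-cong; ι-+; ι-*; ι-0; ι-1)
      open Series cring using (scalar; conv-scalarˡ)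

    dualAlg : Alg → Alg
    dualAlg A = record
      { cring = Dual.dualRing cring ; ι = λ a → ι a , 0#
      ; ι-cong = λ e → ι-cong e , refl
      ; ι-+ = λ a b → ι-+ a b , sym (+-identityˡ _)
      ; ι-* = λ a b → ι-* a b , sym (trans (+-cong (zeroʳ _) (zeroˡ _)) (+-identityˡ _))
      ; ι-0 = ι-0 , refl
      ; ι-1 = ι-1 , refl }
      where open Alg A using (+-cong; +-identityˡ; refl; sym; trans; zeroʳ; zeroˡ; 0#; cring; ι; ι-cong; ι-+; ι-*; ι-0; ι-1)

    pointwiseAlg : Set → Alg → Alg
    pointwiseAlg I A = record
      { cring = Pointwise.pointwiseRing I cring ; ι = λ a _ → ι a
      ; ι-cong = λ e _ → ι-cong e ; ι-+ = λ a b _ → ι-+ a b ; ι-* = λ a b _ → ι-* a b ; ι-0 = λ _ → ι-0 ; ι-1 = λ _ → ι-1 }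
      where open Alg A using (cring; ι; ι-cong; ι-+; ι-*; ι-0; ι-1)

    stableAlg : Alg
    stableAlg = record
      { cring = Stabilised.stableRing F.commutativeRing ; ι = λ a → a
      ; ι-cong = λ e k → k e ; ι-+ = λ _ _ k → k F.refl ; ι-* = λ _ _ k → k F.refl ; ι-0 = λ k → k F.refl ; ι-1 = λ k → k F.refl }

    data Form (V : Set) : Set c where
      inp  : V → Form V
      con  : F.Carrier → Form V
      sum  : List (F.Carrier × Form V) → Form V
      prod : List (Form V) → Form V

    module _ (A : Alg) {V : Set} where
      open Alg A using (Carrier; _+_; _*_; 0#; 1#; ι)

      ⟦_⟧ : Form V → (V → Carrier) → Carrier
      ⟦_⟧Σ : List (F.Carrier × Form V) → (V → Carrier) → Carrier
      ⟦_⟧Π : List (Form V) → (V → Carrier) → Carrier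
      ⟦ inp v ⟧ x = x v
      ⟦ con a ⟧ x = ι a
      ⟦ sum ws ⟧ x = ⟦ ws ⟧Σ x
      ⟦ prod fs ⟧ x = ⟦ fs ⟧Π x
      ⟦ [] ⟧Σ x = 0#
      ⟦ (a , f) ∷ ws ⟧Σ x = ι a * ⟦ f ⟧ x + ⟦ ws ⟧Σ x
      ⟦ [] ⟧Π x = 1#
      ⟦ f ∷ fs ⟧Π x = ⟦ f ⟧ x * ⟦ fs ⟧Π x

    module _ {V : Set} (δ : V → ℕ) where
      deg : Form V → ℕ
      degΣ : List (F.Carrier × Form V) → ℕ
      degΠ : List (Form V) → ℕ
      deg (inp v) = δ v
      deg (con a) = 0
      deg (sum ws) = degΣ ws
      deg (prod fs) = degΠ fs
      degΣ [] = 0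
      degΣ ((a , f) ∷ ws) = deg f ⊔ℕ degΣ ws
      degΠ [] = 0
      degΠ (f ∷ fs) = deg f ℕ.+ degΠ fs

    module _ {V U : Set} (σ : V → Form U) where
      bind : Form V → Form U
      bindΣ : List (F.Carrier × Form V) → List (F.Carrier × Form U)
      bindΠ : List (Form V) → List (Form U)
      bind (inp v) = σ v
      bind (con a) = con a
      bind (sum ws) = sum (bindΣ ws)
      bind (prod fs) = prod (bindΠ fs)
      bindΣ [] = []
      bindΣ ((a , f) ∷ ws) = (a , bind f) ∷ bindΣ ws
      bindΠ [] = []
      bindΠ (f ∷ fs) = bind f ∷ bindΠ fs

      module _ (A : Alg) where
        open Alg A using (*-cong; *-congˡ; +-cong; refl; _≈_)
        bind-⟦⟧ : ∀ f x → ⟦_⟧ A (bind f) x ≈ ⟦_⟧ A f (λ v → ⟦_⟧ A (σ v) x)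
        bind-Σ : ∀ f x → ⟦_⟧Σ A (bindΣ f) x ≈ ⟦_⟧Σ A f (λ v → ⟦_⟧ A (σ v) x)
        bind-Π : ∀ f x → ⟦_⟧Π A (bindΠ f) x ≈ ⟦_⟧Π A f (λ v → ⟦_⟧ A (σ v) x)
        bind-⟦⟧ (inp v) x = refl
        bind-⟦⟧ (con a) x = refl
        bind-⟦⟧ (sum ws) x = bind-Σ ws x
        bind-⟦⟧ (prod fs) x = bind-Π fs x
        bind-Σ [] x = refl
        bind-Σ ((a , f) ∷ ws) x = +-cong (*-congˡ (bind-⟦⟧ f x)) (bind-Σ ws x)
        bind-Π [] x = refl
        bind-Π (f ∷ fs) x = *-cong (bind-⟦⟧ f x) (bind-Π fs x)

    record GradedRel (A B : Alg) (r : Level) : Set (lsuc r ⊔ c ⊔ ℓ) where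
      private
        module A = Alg A using (+-cong; +-identityˡ; Carrier; refl; sym; trans; _+_; _*_; _≈_; 0#; cring; ι; ι-0; ι-1)
        module B = Alg B using (*-cong; *-identityʳ; +-cong; +-identityˡ; Carrier; refl; sym; trans; _+_; _*_; _≈_; 0#; cring; ι; ι-0; ι-1)
      field
        Rel      : ℕ → A.Carrier → B.Carrier → Set r
        rel-con  : ∀ a → Rel 0 (A.ι a) (B.ι a)
        rel-resp : ∀ {k a a' b b'} → a A.≈ a' → b B.≈ b' → Rel k a b → Rel k a' b'
        rel-≤    : ∀ {k l a b} → k ≤ l → Rel k a b → Rel l a b
        rel-+    : ∀ {k a b a' b'} → Rel k a b → Rel k a' b' → Rel k (a A.+ a') (b B.+ b')
        rel-*    : ∀ {k l a b a' b'} → Rel k a b → Rel l a' b' → Rel (k ℕ.+ l) (a A.* a') (b B.* b')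

      module _ {V : Set} (δ : V → ℕ) {x : V → A.Carrier} {y : V → B.Carrier} (rel-x : ∀ v → Rel (δ v) (x v) (y v)) where
        rel-⟦⟧ : ∀ f → Rel (deg δ f) (⟦_⟧ A f x) (⟦_⟧ B f y)
        rel-Σ : ∀ ws → Rel (degΣ δ ws) (⟦_⟧Σ A ws x) (⟦_⟧Σ B ws y)
        rel-Π : ∀ fs → Rel (degΠ δ fs) (⟦_⟧Π A fs x) (⟦_⟧Π B fs y)
        rel-⟦⟧ (inp v) = rel-x v
        rel-⟦⟧ (con a) = rel-con a
        rel-⟦⟧ (sum ws) = rel-Σ ws
        rel-⟦⟧ (prod fs) = rel-Π fs
        rel-Σ [] = rel-resp A.ι-0 B.ι-0 (rel-con F.0#)
        rel-Σ ((a , f) ∷ ws) = rel-+ (rel-≤ (ℕP.m≤m⊔n _ _) (rel-* (rel-con a) (rel-⟦⟧ f))) (rel-≤ (ℕP.m≤n⊔m (deg δ f) _) (rel-Σ ws))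
        rel-Π [] = rel-resp A.ι-1 B.ι-1 (rel-con F.1#)
        rel-Π (f ∷ fs) = rel-* (rel-⟦⟧ f) (rel-Π fs)

    record AlgHom (A B : Alg) : Set (c ⊔ ℓ) where
      private
        module A = Alg A using (+-cong; +-identityˡ; Carrier; refl; sym; trans; _+_; _*_; _≈_; 0#; cring; ι; ι-0; ι-1)
        module B = Alg B using (*-cong; *-identityʳ; +-cong; +-identityˡ; Carrier; refl; sym; trans; _+_; _*_; _≈_; 0#; cring; ι; ι-0; ι-1)
      field
        fun      : A.Carrier → B.Carrier
        fun-cong : ∀ {a b} → a A.≈ b → fun a B.≈ fun b
        fun-ι    : ∀ a → fun (A.ι a) B.≈ B.ι a
        fun-+    : ∀ a b → fun (a A.+ b) B.≈ fun a B.+ fun b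
        fun-*    : ∀ a b → fun (a A.* b) B.≈ fun a B.* fun b

      graph : GradedRel A B ℓ
      graph = record
        { Rel = λ _ a b → fun a B.≈ b ; rel-con = fun-ι
        ; rel-resp = λ e f h → B.trans (B.trans (fun-cong (A.sym e)) h) f
        ; rel-≤ = λ _ h → h
        ; rel-+ = λ h h' → B.trans (fun-+ _ _) (B.+-cong h h')
        ; rel-* = λ h h' → B.trans (fun-* _ _) (B.*-cong h h') }

      fun-⟦⟧ : ∀ {V : Set} (f : Form V) (x : V → A.Carrier) → fun (⟦_⟧ A f x) B.≈ ⟦_⟧ B f (λ v → fun (x v))
      fun-⟦⟧ f x = GradedRel.rel-⟦⟧ graph (λ _ → 0) {x} (λ v → B.refl) f

    idHom : ∀ A → AlgHom A A
    idHom A = record { fun = λ u → u ; fun-cong = λ e → e ; fun-ι = λ _ → refl ; fun-+ = λ _ _ → refl ; fun-* = λ _ _ → refl }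
      where open Alg A using (refl)

    ⟦⟧-cong : ∀ A {V : Set} (f : Form V) {x y : V → Alg.Carrier A} → (∀ v → Alg._≈_ A (x v) (y v)) → Alg._≈_ A (⟦_⟧ A f x) (⟦_⟧ A f y)
    ⟦⟧-cong A f {x} {y} e = GradedRel.rel-⟦⟧ (AlgHom.graph (idHom A)) (λ _ → 0) {x} {y} e f

    -- A graded relation between A and B, and a point θ of B, relate a polynomial over A to its value at θ over B.
    module EvalRel {A B : Alg} {r} (ρ : GradedRel A B r) (θ : Alg.Carrier B) where
      private
        module A = Alg A using (+-cong; +-identityˡ; Carrier; refl; sym; trans; _+_; _*_; _≈_; 0#; cring; ι; ι-0; ι-1)
        module B = Alg B using (*-cong; *-identityʳ; +-cong; +-identityˡ; Carrier; refl; sym; trans; _+_; _*_; _≈_; 0#; cring; ι; ι-0; ι-1)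
        module S = Series A.cring using (conv; indeterminate; scalar)
        module T = Series B.cring using (conv; indeterminate; scalar)
        module HA = Horner A.cring using (conv-vanish)
      open Horner B.cring using (conv-vanish; ev; ev-+; ev-conv; ev-extend; ev-scalar)
      open GradedRel ρ using (Rel; rel-*; rel-+; rel-con; rel-resp; rel-≤)

      EvRel : ℕ → (ℕ → A.Carrier) → B.Carrier → Set (c ⊔ ℓ ⊔ r)
      EvRel k p b = Σ (ℕ → B.Carrier) λ q → (∀ j → Rel k (p j) (q j)) × (∀ j → k < j → p j A.≈ A.0#) ×
                    (∀ j → k < j → q j B.≈ B.0#) × (b B.≈ ev k q θ)

      private
        rel-0 : ∀ k → Rel k A.0# B.0#
        rel-0 k = rel-≤ z≤n (rel-resp A.ι-0 B.ι-0 (rel-con F.0#))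

        rel-conv : ∀ {k l p p' q q'} → (∀ j → Rel k (p j) (q j)) → (∀ j → Rel l (p' j) (q' j)) →
          ∀ n → Rel (k ℕ.+ l) (S.conv p p' n) (T.conv q q' n)
        rel-conv h h' zero = rel-* (h 0) (h' 0)
        rel-conv h h' (suc n) = rel-+ (rel-* (h 0) (h' (suc n))) (rel-conv (h ∘ suc) h' n)

      evRel : GradedRel (seriesAlg A) B (c ⊔ ℓ ⊔ r)
      evRel = record
        { Rel = EvRel
        ; rel-con = λ a → T.scalar (B.ι a) , (λ { zero → rel-con a ; (suc j) → rel-0 0 }) , (λ { zero () ; (suc j) _ → A.refl })
                        , (λ { zero () ; (suc j) _ → B.refl }) , B.refl
        ; rel-resp = λ e f (q , h , z , z' , v) → q , (λ j → rel-resp (e j) B.refl (h j)) , (λ j lt → A.trans (A.sym (e j)) (z j lt)) , z' ,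
                       B.trans (B.sym f) v
        ; rel-≤ = λ le (q , h , z , z' , v) → q , (λ j → rel-≤ le (h j)) , (λ j lt → z j (ℕP.≤-<-trans le lt)) , (λ j lt → z' j (ℕP.≤-<-trans le lt)) ,
                       B.trans v (B.sym (ev-extend q θ le z'))
        ; rel-+ = λ {k} (q , h , z , z' , v) (q₁ , h₁ , z₁ , z₁' , v₁) → (λ j → q j B.+ q₁ j) , (λ j → rel-+ (h j) (h₁ j)) ,
                       (λ j lt → A.trans (A.+-cong (z j lt) (z₁ j lt)) (A.+-identityˡ _)) ,
                       (λ j lt → B.trans (B.+-cong (z' j lt) (z₁' j lt)) (B.+-identityˡ _)) ,
                       B.trans (B.+-cong v v₁) (B.sym (ev-+ k q q₁ θ))
        ; rel-* = λ {k} {l} (q , h , z , z' , v) (q₁ , h₁ , z₁ , z₁' , v₁) → T.conv q q₁ , rel-conv h h₁ ,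
                       HA.conv-vanish k l _ _ z z₁ , conv-vanish k l q q₁ z' z₁' ,
                       B.trans (B.*-cong v v₁) (B.sym (ev-conv k l q q₁ θ z' z₁')) }

      ev-indeterminate : EvRel 1 S.indeterminate θ
      ev-indeterminate = T.indeterminate ,
        (λ { zero → rel-0 1 ; (suc zero) → rel-≤ z≤n (rel-resp A.ι-1 B.ι-1 (rel-con F.1#)) ; (suc (suc j)) → rel-0 1 }) ,
        (λ { zero () ; (suc zero) (s≤s ()) ; (suc (suc j)) _ → A.refl }) ,
        (λ { zero () ; (suc zero) (s≤s ()) ; (suc (suc j)) _ → B.refl }) ,
        B.sym (B.trans (B.+-identityˡ _) (B.*-identityʳ θ))

      ev-const : ∀ {k a b} → Rel k a b → EvRel k (S.scalar a) b
      ev-const {k} {a} {b} h = T.scalar b , (λ { zero → h ; (suc j) → rel-0 k }) ,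
        (λ { zero () ; (suc j) _ → A.refl }) , (λ { zero () ; (suc j) _ → B.refl }) , B.sym (ev-scalar k b θ)

module CircuitSemantics where
  open CommutativeAlgebra
  open FormulaSemantics
  open import Defs
  open import Level using (Lift; lift)
  open import Data.Nat using (_∸_)
  open import Data.Vec using (replicate; zipWith; head)
  open import Data.Vec.Properties using (≡-dec; ∷-injectiveˡ; ∷-injectiveʳ)
  open import Data.List using (upTo; applyUpTo)

  module PolySemantics {c ℓ : Level} (F : Field c ℓ) where
    private module F = Field F using (*-congʳ; *-congˡ; *-identityʳ; *-identityˡ; +-cong; +-congˡ; +-identityʳ; Carrier; refl; sym; trans; _*_; -_; _-_; _≈_; 0#; 1#; commutativeRing)

    IPAlg : ℕ → Alg F
    IPAlg zero = baseAlg F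
    IPAlg (suc n) = seriesAlg F (IPAlg n)

    module IP n = Alg (IPAlg n) using (*-cong; *-congˡ; +-cong; +-congˡ; +-identityˡ; Carrier; refl; sym; trans; _+_; _*_; -_; _≈_; 0#; cring; ι; ι-0; ι-1)

    var : ∀ {n} → Fin n → IP.Carrier n
    var {suc n} zero = Series.indeterminate (IP.cring n)
    var {suc n} (suc i) = Series.scalar (IP.cring n) (var i)

    curryP : ∀ n → Poly F n → IP.Carrier n
    curryP zero p = p []
    curryP (suc n) p k = curryP n (λ e → p (k ∷ e))

    uncurryP : ∀ n → IP.Carrier n → Poly F n
    uncurryP zero p [] = p
    uncurryP (suc n) p (k ∷ e) = uncurryP n (p k) e

    curry-uncurry : ∀ n p → IP._≈_ n (curryP n (uncurryP n p)) p
    curry-uncurry zero p = F.refl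
    curry-uncurry (suc n) p k = curry-uncurry n (p k)

    curry-cong : ∀ n {p q : Poly F n} → _≈P_ F p q → IP._≈_ n (curryP n p) (curryP n q)
    curry-cong zero e = e []
    curry-cong (suc n) e k = curry-cong n (λ d → e (k ∷ d))

    curry-injective : ∀ n {p q : Poly F n} → IP._≈_ n (curryP n p) (curryP n q) → _≈P_ F p q
    curry-injective zero e [] = e
    curry-injective (suc n) e (k ∷ d) = curry-injective n (e k) d

    curry-+ : ∀ n (p q : Poly F n) → IP._≈_ n (curryP n (_+P_ F p q)) (IP._+_ n (curryP n p) (curryP n q))
    curry-+ zero p q = F.refl
    curry-+ (suc n) p q k = curry-+ n (λ e → p (k ∷ e)) (λ e → q (k ∷ e))

    curry-neg : ∀ n (p : Poly F n) → IP._≈_ n (curryP n (λ e → F.- p e)) (IP.-_ n (curryP n p))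
    curry-neg zero p = F.refl
    curry-neg (suc n) p k = curry-neg n (λ e → p (k ∷ e))

    curry-zero : ∀ n {p : Poly F n} → (∀ e → p e F.≈ F.0#) → IP._≈_ n (curryP n p) (IP.0# n)
    curry-zero zero e = e []
    curry-zero (suc n) e k = curry-zero n (λ d → e (k ∷ d))

    curry-∑ : ∀ n (js : List ℕ) (G : ℕ → Poly F n) →
      IP._≈_ n (curryP n (λ e → Sums.∑ F.commutativeRing js (λ j → G j e))) (Sums.∑ (IP.cring n) js (λ j → curryP n (G j)))
    curry-∑ n [] G = curry-zero n (λ _ → F.refl)
    curry-∑ n (j ∷ js) G = IP.trans n (curry-+ n (G j) _) (IP.+-congˡ n (curry-∑ n js G))

    private
      sumF-map : ∀ {a} {X : Set a} (xs : List X) (f : X → F.Carrier) → sumF F (map f xs) F.≈ Sums.∑ F.commutativeRing xs f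
      sumF-map [] f = F.refl
      sumF-map (x ∷ xs) f = F.+-congˡ (sumF-map xs f)

      ∑-conv : ∀ {a b} (R : CommutativeRing a b) (A B : ℕ → CommutativeRing.Carrier R) (H : ℕ → CommutativeRing.Carrier R) k (g : ℕ → ℕ) →
        (∀ i → CommutativeRing._≈_ R (H (g i)) (CommutativeRing._*_ R (A i) (B (k ∸ i)))) →
        CommutativeRing._≈_ R (Sums.∑ R (applyUpTo g (suc k)) H) (Series.conv R A B k)
      ∑-conv R A B H zero g e = R.trans (R.+-identityʳ _) (e 0)
        where module R = CommutativeRing R using (+-cong; +-identityʳ; trans)
      ∑-conv R A B H (suc k) g e = R.+-cong (e 0) (∑-conv R (A ∘ suc) B H k (g ∘ suc) (e ∘ suc))
        where module R = CommutativeRing R using (+-cong; +-identityʳ; trans)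

    curry-* : ∀ n (p q : Poly F n) → IP._≈_ n (curryP n (_*P_ F p q)) (IP._*_ n (curryP n p) (curryP n q))
    curry-* zero p q = F.+-identityʳ _
    curry-* (suc n) p q k = IP.trans n (curry-cong n expand)
      (IP.trans n (curry-∑ n (upTo (suc k)) (λ j → _*P_ F (λ e → p (j ∷ e)) (λ e → q ((k ∸ j) ∷ e))))
        (∑-conv (IP.cring n) (curryP n ∘ λ j e → p (j ∷ e)) (curryP n ∘ λ j e → q (j ∷ e)) _ k (λ j → j) (λ j → curry-* n (λ e → p (j ∷ e)) (λ e → q ((k ∸ j) ∷ e)))))
      where
      open Sums F.commutativeRing using (∑; ∑-concatMap; ∑-cong; ∑-map)
      expand : ∀ e → _*P_ F p q (k ∷ e) F.≈ ∑ (upTo (suc k)) (λ j → _*P_ F (λ e → p (j ∷ e)) (λ e → q ((k ∸ j) ∷ e)) e)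
      expand e = F.trans (sumF-map (below F (k ∷ e)) term) (F.trans (∑-concatMap (λ j → map (j ∷_) (below F e)) (upTo (suc k)) term)
        (∑-cong (upTo (suc k)) (λ j → F.trans (∑-map (j ∷_) (below F e) term) (F.sym (sumF-map (below F e) (λ d → term (j ∷ d)))))))
        where
        term : Vec ℕ (suc n) → F.Carrier
        term d = p d F.* q (zipWith _∸_ (k ∷ e) d)

    constP-here : ∀ {n} a (e : Vec ℕ n) → e ≡ replicate n 0 → constP F a e F.≈ a
    constP-here {n} a e eq with ≡-dec ℕ._≟_ e (replicate n 0)
    ... | yes _ = F.refl
    ... | no ne = ⊥-elim (ne eq)

    constP-there : ∀ {n} a (e : Vec ℕ n) → ¬ e ≡ replicate n 0 → constP F a e F.≈ F.0#
    constP-there {n} a e ne with ≡-dec ℕ._≟_ e (replicate n 0)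
    ... | yes eq = ⊥-elim (ne eq)
    ... | no _ = F.refl

    constP-cons : ∀ {n} a (e : Vec ℕ n) → constP F a (0 ∷ e) F.≈ constP F a e
    constP-cons {n} a e = cases (≡-dec ℕ._≟_ e (replicate n 0))
      where
      cases : Dec (e ≡ replicate n 0) → constP F a (0 ∷ e) F.≈ constP F a e
      cases (yes eq) = F.trans (constP-here a (0 ∷ e) (≡.cong (0 ∷_) eq)) (F.sym (constP-here a e eq))
      cases (no ne) = F.trans (constP-there a (0 ∷ e) (ne ∘ ∷-injectiveʳ)) (F.sym (constP-there a e ne))

    varP-here : ∀ {n} i (e : Vec ℕ n) → e ≡ unitExp F i → varP F i e F.≈ F.1#
    varP-here i e eq with ≡-dec ℕ._≟_ e (unitExp F i)
    ... | yes _ = F.refl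
    ... | no ne = ⊥-elim (ne eq)

    varP-there : ∀ {n} i (e : Vec ℕ n) → ¬ e ≡ unitExp F i → varP F i e F.≈ F.0#
    varP-there i e ne with ≡-dec ℕ._≟_ e (unitExp F i)
    ... | yes eq = ⊥-elim (ne eq)
    ... | no _ = F.refl

    varP-cons : ∀ {n} (i : Fin n) (e : Vec ℕ n) → varP F (suc i) (0 ∷ e) F.≈ varP F i e
    varP-cons i e = cases (≡-dec ℕ._≟_ e (unitExp F i))
      where
      cases : Dec (e ≡ unitExp F i) → varP F (suc i) (0 ∷ e) F.≈ varP F i e
      cases (yes eq) = F.trans (varP-here (suc i) (0 ∷ e) (≡.cong (0 ∷_) eq)) (F.sym (varP-here i e eq))
      cases (no ne) = F.trans (varP-there (suc i) (0 ∷ e) (ne ∘ ∷-injectiveʳ)) (F.sym (varP-there i e ne))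

    varP-one : ∀ {n} (e : Vec ℕ n) → varP F zero (1 ∷ e) F.≈ constP F F.1# e
    varP-one {n} e = cases (≡-dec ℕ._≟_ e (replicate n 0))
      where
      cases : Dec (e ≡ replicate n 0) → varP F zero (1 ∷ e) F.≈ constP F F.1# e
      cases (yes eq) = F.trans (varP-here zero (1 ∷ e) (≡.cong (1 ∷_) eq)) (F.sym (constP-here F.1# e eq))
      cases (no ne) = F.trans (varP-there zero (1 ∷ e) (ne ∘ ∷-injectiveʳ)) (F.sym (constP-there F.1# e ne))

    curry-const : ∀ n a → IP._≈_ n (curryP n (constP F a)) (IP.ι n a)
    curry-const zero a = constP-here {0} a [] ≡.refl
    curry-const (suc n) a zero = IP.trans n (curry-cong n (constP-cons a)) (curry-const n a)
    curry-const (suc n) a (suc k) = curry-zero n (λ e → constP-there a (suc k ∷ e) (λ ()))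

    curry-var : ∀ n (i : Fin n) → IP._≈_ n (curryP n (varP F i)) (var i)
    curry-var (suc n) zero zero = curry-zero n (λ e → varP-there zero (0 ∷ e) (λ ()))
    curry-var (suc n) zero (suc zero) = IP.trans n (curry-cong n varP-one) (IP.trans n (curry-const n F.1#) (IP.ι-1 n))
    curry-var (suc n) zero (suc (suc k)) = curry-zero n (λ e → varP-there zero (suc (suc k) ∷ e) (λ eq → ℕP.1+n≢0 (ℕP.suc-injective (∷-injectiveˡ eq))))
    curry-var (suc n) (suc i) zero = IP.trans n (curry-cong n (varP-cons i)) (curry-var n i)
    curry-var (suc n) (suc i) (suc k) = curry-zero n (λ e → varP-there (suc i) (suc k ∷ e) (λ ()))

    curry-scale : ∀ n a (p : Poly F n) → IP._≈_ n (curryP n (_·P_ F a p)) (IP._*_ n (IP.ι n a) (curryP n p))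
    curry-scale zero a p = F.refl
    curry-scale (suc n) a p k = IP.trans n (curry-scale n a (λ e → p (k ∷ e))) (IP.sym n (Series.conv-scalarˡ (IP.cring n) (IP.ι n a) (curryP (suc n) p) k))

    -- The formulas computed at the nodes of a straight-line program, shared subcomputations being duplicated.
    gateForm : ∀ {V i} → Vec (Form F V) i → Gate F V i → Form F V
    gateForm fs (input v) = inp v
    gateForm fs (const a) = con a
    gateForm fs (plus ws) = sum (map (λ w → proj₁ w , lookup fs (proj₂ w)) ws)
    gateForm fs (times js) = prod (map (lookup fs) js)

    nodeForms : ∀ {V i} → SLP F V i → Vec (Form F V) i
    nodeForms [] = []
    nodeForms (p ▷ g) = gateForm (nodeForms p) g ∷ nodeForms p

    circuitForm : ∀ {V} → Circuit F V → Form F V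
    circuitForm (circuit _ p) = head (nodeForms p)

    module _ {V : Set} {n : ℕ} (σ : V → Poly F n) where
      private
        ⟦_⟧P : Form F V → IP.Carrier n
        ⟦ f ⟧P = ⟦_⟧ F (IPAlg n) f (λ v → curryP n (σ v))

      curry-plus : ∀ {i} (vs : Vec (Poly F n) i) (fs : Vec (Form F V) i) → (∀ j → IP._≈_ n (curryP n (lookup vs j)) ⟦ lookup fs j ⟧P) →
        ∀ ws → IP._≈_ n (curryP n (gateVal F σ vs (plus ws))) ⟦ gateForm fs (plus ws) ⟧P
      curry-plus vs fs h [] = IP.trans n (curry-const n F.0#) (IP.ι-0 n)
      curry-plus vs fs h ((a , j) ∷ ws) = IP.trans n (curry-+ n _ _)
        (IP.+-cong n (IP.trans n (curry-scale n a (lookup vs j)) (IP.*-congˡ n (h j))) (curry-plus vs fs h ws))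

      curry-times : ∀ {i} (vs : Vec (Poly F n) i) (fs : Vec (Form F V) i) → (∀ j → IP._≈_ n (curryP n (lookup vs j)) ⟦ lookup fs j ⟧P) →
        ∀ js → IP._≈_ n (curryP n (gateVal F σ vs (times js))) ⟦ gateForm fs (times js) ⟧P
      curry-times vs fs h [] = IP.trans n (curry-const n F.1#) (IP.ι-1 n)
      curry-times vs fs h (j ∷ js) = IP.trans n (curry-* n _ _) (IP.*-cong n (h j) (curry-times vs fs h js))

      curry-nodes : ∀ {i} (p : SLP F V i) j → IP._≈_ n (curryP n (lookup (valsSLP F σ p) j)) ⟦ lookup (nodeForms p) j ⟧P
      curry-nodes (p ▷ input v) zero = IP.refl n
      curry-nodes (p ▷ const a) zero = curry-const n a
      curry-nodes (p ▷ plus ws) zero = curry-plus (valsSLP F σ p) (nodeForms p) (curry-nodes p) ws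
      curry-nodes (p ▷ times js) zero = curry-times (valsSLP F σ p) (nodeForms p) (curry-nodes p) js
      curry-nodes (p ▷ g) (suc j) = curry-nodes p j

      curry-evalC : (C : Circuit F V) → IP._≈_ n (curryP n (evalC F σ C)) ⟦ circuitForm C ⟧P
      curry-evalC (circuit m p) with valsSLP F σ p | nodeForms p | curry-nodes p
      ... | _ ∷ _ | _ ∷ _ | h = h zero

    module _ (B : Alg F) where
      private module B = Alg B using (*-cong; +-assoc; +-cong; +-congʳ; +-congˡ; +-identityʳ; +-identityˡ; -‿inverseˡ; Carrier; refl; sym; trans; _+_; -_; _-_; _≈_; 0#; cring; ι; ι-cong; ι-+; ι-*; ι-0)

      baseRel : GradedRel F (baseAlg F) B (c ⊔ ℓ)
      baseRel = record
        { Rel = λ _ a b → Lift (c ⊔ ℓ) (B.ι a B.≈ b) ; rel-con = λ _ → lift B.refl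
        ; rel-resp = λ e f (lift h) → lift (B.trans (B.sym (B.ι-cong e)) (B.trans h f)) ; rel-≤ = λ _ h → h
        ; rel-+ = λ (lift h) (lift h') → lift (B.trans (B.ι-+ _ _) (B.+-cong h h'))
        ; rel-* = λ (lift h) (lift h') → lift (B.trans (B.ι-* _ _) (B.*-cong h h')) }

      polyRel : ∀ n → (Fin n → B.Carrier) → GradedRel F (IPAlg n) B (c ⊔ ℓ)
      polyRel zero x = baseRel
      polyRel (suc n) x = EvalRel.evRel F (polyRel n (x ∘ suc)) (x zero)

      polyRel-var : ∀ n x i → GradedRel.Rel (polyRel n x) 1 (var i) (x i)
      polyRel-var (suc n) x zero = EvalRel.ev-indeterminate F (polyRel n (x ∘ suc)) (x zero)
      polyRel-var (suc n) x (suc i) = EvalRel.ev-const F (polyRel n (x ∘ suc)) (x zero) (polyRel-var n (x ∘ suc) i)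

      polyRel-zero : ∀ n x {k p b} → GradedRel.Rel (polyRel n x) k p b → IP._≈_ n p (IP.0# n) → b B.≈ B.0#
      polyRel-zero zero x (lift h) e = B.trans (B.sym h) (B.trans (B.ι-cong e) B.ι-0)
      polyRel-zero (suc n) x {k} (q , h , _ , _ , v) e = B.trans v (Horner.ev-zero B.cring k (x zero) (λ j → polyRel-zero n (x ∘ suc) (h j) (e j)))

      polyRel-functional : ∀ n x {k l p p' b b'} → GradedRel.Rel (polyRel n x) k p b → GradedRel.Rel (polyRel n x) l p' b' →
        IP._≈_ n p p' → b B.≈ b'
      polyRel-functional n x {k} {l} {p} {p'} {b} {b'} h h' e = B.trans (B.sym (B.+-identityʳ b))
        (B.trans (B.+-congˡ (B.sym (B.-‿inverseˡ b'))) (B.trans (B.sym (B.+-assoc _ _ _)) (B.trans (B.+-congʳ zero-diff) (B.+-identityˡ b'))))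
        where
        open GradedRel (polyRel n x) using (rel-*; rel-+; rel-con; rel-≤)
        module I = Alg (IPAlg n) using (+-cong; -‿inverseʳ; trans)
        minus : ∀ (A : Alg F) b → Alg._≈_ A (Alg._*_ A (Alg.ι A (F.- F.1#)) b) (Alg.-_ A b)
        minus A b = A.trans (A.*-congʳ (A.trans (A.ι-neg _) (A.-‿cong A.ι-1))) (-1*x≈-x b)
          where
          module A = Alg A using (*-congʳ; -‿cong; ring; trans; ι-1; ι-neg)
          open import Algebra.Properties.Ring A.ring using (-1*x≈-x)
        zero-diff : b B.+ B.- b' B.≈ B.0#
        zero-diff = B.trans (B.+-congˡ (B.sym (minus B b')))
          (polyRel-zero n x (rel-+ (rel-≤ (ℕP.m≤m+n k l) h) (rel-≤ (ℕP.m≤n+m l k) (rel-* (rel-con (F.- F.1#)) h')))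
            (I.trans (I.+-cong e (minus (IPAlg n) p')) (I.-‿inverseʳ p')))

      polyRel-⟦⟧ : ∀ {V : Set} n (x : Fin n → B.Carrier) (δ : V → ℕ) (p : V → IP.Carrier n) (b : V → B.Carrier) →
        (∀ v → GradedRel.Rel (polyRel n x) (δ v) (p v) (b v)) → ∀ f a →
        IP._≈_ n (⟦_⟧ F (IPAlg n) f p) (IP.ι n a) → ⟦_⟧ F B f b B.≈ B.ι a
      polyRel-⟦⟧ n x δ p b h f a e = polyRel-functional n x (rel-⟦⟧ δ h f) (rel-con a) e
        where open GradedRel (polyRel n x) using (rel-con; rel-⟦⟧)

    DegIn : ∀ {n} → Fin n → ℕ → IP.Carrier n → Set ℓ
    DegIn {suc n} zero k p = ∀ j → k < j → IP._≈_ n (p j) (IP.0# n)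
    DegIn {suc n} (suc i) k p = ∀ j → DegIn i k (p j)

    private
      degIn-resp : ∀ {n} (i : Fin n) {k p p'} → IP._≈_ n p p' → DegIn i k p → DegIn i k p'
      degIn-resp {suc n} zero e d j lt = IP.trans n (IP.sym n (e j)) (d j lt)
      degIn-resp (suc i) e d j = degIn-resp i (e j) (d j)

      degIn-0 : ∀ {n} (i : Fin n) {k} → DegIn i k (IP.0# n)
      degIn-0 {suc n} zero j lt = IP.refl n
      degIn-0 (suc i) j = degIn-0 i

      degIn-+ : ∀ {n} (i : Fin n) {k p p'} → DegIn i k p → DegIn i k p' → DegIn i k (IP._+_ n p p')
      degIn-+ {suc n} zero d d' j lt = IP.trans n (IP.+-cong n (d j lt) (d' j lt)) (IP.+-identityˡ n _)
      degIn-+ (suc i) d d' j = degIn-+ i (d j) (d' j)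

      degIn-con : ∀ {n} (i : Fin n) a → DegIn i 0 (IP.ι n a)
      degIn-con {suc n} zero a (suc j) lt = IP.refl n
      degIn-con (suc i) a zero = degIn-con i a
      degIn-con (suc i) a (suc j) = degIn-0 i

      degIn-≤ : ∀ {n} (i : Fin n) {k l p} → k ≤ l → DegIn i k p → DegIn i l p
      degIn-≤ zero le d j lt = d j (ℕP.≤-<-trans le lt)
      degIn-≤ (suc i) le d j = degIn-≤ i le (d j)

      degIn-* : ∀ {n} (i : Fin n) {k l p p'} → DegIn i k p → DegIn i l p' → DegIn i (k ℕ.+ l) (IP._*_ n p p')
      degIn-* {suc n} zero {k} {l} d d' = Horner.conv-vanish (IP.cring n) k l _ _ d d'
      degIn-* {suc n} (suc i) {k} {l} {p} {p'} d d' j = degIn-conv p d j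
        where
        degIn-conv : ∀ p → DegIn (suc i) k p → ∀ j → DegIn i (k ℕ.+ l) (Series.conv (IP.cring n) p p' j)
        degIn-conv p d zero = degIn-* i (d 0) (d' 0)
        degIn-conv p d (suc j) = degIn-+ i (degIn-* i (d 0) (d' (suc j))) (degIn-conv (p ∘ suc) (d ∘ suc) j)

    degRel : ∀ {n} → Fin n → GradedRel F (IPAlg n) (IPAlg n) ℓ
    degRel i = record
      { Rel = λ k p _ → DegIn i k p ; rel-con = degIn-con i ; rel-resp = λ e _ → degIn-resp i e ; rel-≤ = degIn-≤ i
      ; rel-+ = degIn-+ i ; rel-* = degIn-* i }

    degIn-var-other : ∀ {n} (i j : Fin n) → ¬ i ≡ j → DegIn i 0 (var j)
    degIn-var-other zero zero ne = ⊥-elim (ne ≡.refl)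
    degIn-var-other {suc n} zero (suc j) ne (suc k) lt = IP.refl n
    degIn-var-other {suc n} (suc i) zero ne zero = degIn-0 i
    degIn-var-other {suc n} (suc i) zero ne (suc zero) = degIn-resp i (IP.ι-1 n) (degIn-con i F.1#)
    degIn-var-other {suc n} (suc i) zero ne (suc (suc k)) = degIn-0 i
    degIn-var-other (suc i) (suc j) ne zero = degIn-var-other i j (ne ∘ ≡.cong suc)
    degIn-var-other (suc i) (suc j) ne (suc k) = degIn-0 i

    degIn-var-self : ∀ {n} (i : Fin n) → DegIn i 1 (var i)
    degIn-var-self {suc n} zero (suc (suc k)) lt = IP.refl n
    degIn-var-self {suc n} zero (suc zero) (s≤s ())
    degIn-var-self (suc i) zero = degIn-var-self i
    degIn-var-self (suc i) (suc k) = degIn-0 i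

    multilinear-uncurry : ∀ {n} (p : IP.Carrier n) → (∀ (i : Fin n) → DegIn i 1 p) → Multilinear F (uncurryP n p)
    multilinear-uncurry p d e i le = go p e i (d i) le
      where
      go0 : ∀ {n} (p : IP.Carrier n) (e : Vec ℕ n) → IP._≈_ n p (IP.0# n) → uncurryP n p e F.≈ F.0#
      go0 {zero} p [] z = z
      go0 {suc n} p (k ∷ e) z = go0 {n} (p k) e (z k)
      go : ∀ {n} (p : IP.Carrier n) (e : Vec ℕ n) i → DegIn i 1 p → 2 ≤ lookup e i → uncurryP n p e F.≈ F.0#
      go {suc n} p (k ∷ e) zero d le = go0 {n} (p k) e (d k le)
      go {suc n} p (k ∷ e) (suc i) d le = go {n} (p k) e i (d k) le

    evalML-polyRel : ∀ {n} (p : IP.Carrier n) (v : Vec F.Carrier n) {k b} → (∀ (i : Fin n) → DegIn i 1 p) →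
      GradedRel.Rel (polyRel (baseAlg F) n (lookup v)) k p b → evalML F (uncurryP n p) v F.≈ b
    evalML-polyRel {zero} p [] d (lift h) = F.trans (F.+-identityʳ _) (F.trans (F.*-identityʳ p) h)
    evalML-polyRel {suc n} p (a ∷ v) {k} d (q , h , _ , z , e) =
      F.trans (sumF-map (boolExps F (suc n)) term) (F.trans (∑-++ (map (0 ∷_) (boolExps F n)) (map (1 ∷_) (boolExps F n) ++ []) term)
       (F.trans (F.+-cong first (F.trans (∑-++ (map (1 ∷_) (boolExps F n)) [] term) (F.trans (F.+-identityʳ _) second)))
       (F.trans (F.sym (ev-extend {1} {k ℕ.+ 1} q a (ℕP.m≤n+m 1 k) (λ j lt → polyRel-zero (baseAlg F) n (lookup v) (h j) (d zero j lt))))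
         (F.trans (ev-extend {k} {k ℕ.+ 1} q a (ℕP.m≤m+n k 1) z) (F.sym e)))))
      where
      open Sums F.commutativeRing using (*-∑; ∑; ∑-++; ∑-cong; ∑-map)
      open Horner F.commutativeRing using (ev-extend)
      open RS F.commutativeRing using (rsolve; _:*_; _⊜_)
      term : Vec ℕ (suc n) → F.Carrier
      term e = uncurryP (suc n) p e F.* monVal F e (a ∷ v)
      IH : ∀ j → ∑ (boolExps F n) (λ e → uncurryP n (p j) e F.* monVal F e v) F.≈ q j
      IH j = F.trans (F.sym (sumF-map (boolExps F n) _)) (evalML-polyRel {n} (p j) v (λ i → d (suc i) j) (h j))
      first : ∑ (map (0 ∷_) (boolExps F n)) term F.≈ q 0
      first = F.trans (∑-map (0 ∷_) (boolExps F n) term) (F.trans (∑-cong (boolExps F n) (λ e → F.*-congˡ (F.*-identityˡ _))) (IH 0))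
      second : ∑ (map (1 ∷_) (boolExps F n)) term F.≈ a F.* q 1
      second = F.trans (∑-map (1 ∷_) (boolExps F n) term) (F.trans (∑-cong (boolExps F n)
        (λ e → F.trans (F.*-congˡ (F.*-congʳ (F.*-identityʳ a))) (rsolve 3 (λ x y z → x :* (y :* z) ⊜ y :* (x :* z)) F.refl _ _ _)))
        (F.trans (F.sym (*-∑ a (boolExps F n) (λ e → uncurryP n (p 1) e F.* monVal F e v))) (F.*-congˡ (IH 1))))

module PolynomialInterpolation where
  open CommutativeAlgebra
  open FormulaSemantics
  open import Defs

  module SumTo {c ℓ} (R : CommutativeRing c ℓ) where
    open CommutativeRing R using (+-cong; +-congˡ; +-identityˡ; Carrier; distribˡ; refl; sym; trans; zero; _+_; _*_; _≈_; 0#)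
    open RS R using (rsolve; _:+_; _:*_; :-_; _:-_; _⊜_)

    sumTo : ℕ → (ℕ → Carrier) → Carrier
    sumTo zero g = g 0
    sumTo (suc n) g = g 0 + sumTo n (g ∘ suc)

    sumTo-cong : ∀ n {f g} → (∀ l → l ≤ n → f l ≈ g l) → sumTo n f ≈ sumTo n g
    sumTo-cong zero e = e 0 z≤n
    sumTo-cong (suc n) e = +-cong (e 0 z≤n) (sumTo-cong n (λ l le → e (suc l) (s≤s le)))

    sumTo-+ : ∀ n f g → sumTo n (λ l → f l + g l) ≈ sumTo n f + sumTo n g
    sumTo-+ zero f g = refl
    sumTo-+ (suc n) f g = trans (+-congˡ (sumTo-+ n (f ∘ suc) (g ∘ suc)))
      (rsolve 4 (λ p q r s → (p :+ q) :+ (r :+ s) ⊜ (p :+ r) :+ (q :+ s)) refl _ _ _ _)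

    sumTo-scale : ∀ n a f → sumTo n (λ l → a * f l) ≈ a * sumTo n f
    sumTo-scale zero a f = refl
    sumTo-scale (suc n) a f = trans (+-congˡ (sumTo-scale n a (f ∘ suc))) (sym (distribˡ _ _ _))

    sumTo-zero : ∀ n {f} → (∀ l → l ≤ n → f l ≈ 0#) → sumTo n f ≈ 0#
    sumTo-zero zero e = e 0 z≤n
    sumTo-zero (suc n) e = trans (+-cong (e 0 z≤n) (sumTo-zero n (λ l le → e (suc l) (s≤s le)))) (+-identityˡ _)

  module Synthetic {c ℓ} (R : CommutativeRing c ℓ) (θ : CommutativeRing.Carrier R) where
    open CommutativeRing R using (*-congˡ; +-congʳ; +-congˡ; +-identityʳ; -‿cong; -‿inverseʳ; Carrier; refl; sym; trans; zero; zeroʳ; _+_; _*_; -_; _-_; _≈_; 0#)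
    open RS R using (rsolve; _:+_; _:*_; :-_; _:-_; _⊜_)
    open Horner R using (ev)
    open Series R using (tail)

    quot : ℕ → (ℕ → Carrier) → ℕ → Carrier
    quot zero q j = 0#
    quot (suc n) q zero = ev n (tail q) θ
    quot (suc n) q (suc j) = quot n (tail q) j

    quot-vanish : ∀ n q j → n ≤ j → quot n q j ≈ 0#
    quot-vanish zero q j le = refl
    quot-vanish (suc n) q (suc j) (s≤s le) = quot-vanish n (tail q) j le

    ev-quot₀ : ∀ n q → ev n q θ ≈ q 0 + θ * quot n q 0
    ev-quot₀ zero q = sym (trans (+-congˡ (zeroʳ θ)) (+-identityʳ _))
    ev-quot₀ (suc n) q = refl

    coeff-suc : ∀ n q j → (∀ i → n < i → q i ≈ 0#) → q (suc j) ≈ quot n q j - θ * quot n q (suc j)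
    coeff-suc zero q j z = trans (z (suc j) (s≤s z≤n)) (sym (trans (+-congˡ (-‿cong (zeroʳ θ))) (-‿inverseʳ 0#)))
    coeff-suc (suc n) q zero z = trans (rsolve 3 (λ a t g → a ⊜ (a :+ t :* g) :- t :* g) refl (q 1) θ (quot n (tail q) 0))
      (+-congʳ (sym (ev-quot₀ n (tail q))))
    coeff-suc (suc n) q (suc j) z = coeff-suc n (tail q) j (λ i lt → z (suc i) (s≤s lt))

    ev-quot : ∀ n q τ → ev (suc n) q τ ≈ ev (suc n) q θ + (τ - θ) * ev n (quot (suc n) q) τ
    ev-quot zero q τ = rsolve 4 (λ a b t s → a :+ t :* b ⊜ (a :+ s :* b) :+ (t :- s) :* b) refl (q 0) (q 1) τ θ
    ev-quot (suc n) q τ = trans (+-congˡ (*-congˡ (ev-quot n (tail q) τ)))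
      (rsolve 5 (λ a t s e g → a :+ t :* (e :+ (t :- s) :* g) ⊜ (a :+ s :* e) :+ (t :- s) :* (e :+ t :* g)) refl (q 0) τ θ _ _)

  module Interpolation {c ℓ : Level} (F : Field c ℓ) where
    private
      module F = Field F using (*-comm; *-congʳ; +-assoc; +-congʳ; +-congˡ; +-identityˡ; Carrier; refl; reflexive; sym; trans; _+_; _*_; -_; _-_; _≈_; 0#; 1#; commutativeRing; inverse)
      module SF = SumTo F.commutativeRing using (sumTo)

    Separated : (ℕ → F.Carrier) → Set (c ⊔ ℓ)
    Separated θ = ∀ i j → i < j → Σ F.Carrier λ y → (y F.* (θ j F.- θ i)) F.≈ F.1#

    module _ (A : Alg F) where
      open Alg A using (+-congˡ; refl; trans; zero; _≈_; cring; ι; ι-+)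
      open SumTo cring using (sumTo; sumTo-+; sumTo-cong; sumTo-scale; sumTo-zero) public
      open Horner cring using (conv-scalarTailˡ; conv-vanish; ev; ev-+; ev-cong; ev-conv; ev-extend; ev-scalar; ev-scale; ev-zero) public
      ι-sumTo : ∀ n g → ι (SF.sumTo n g) ≈ sumTo n (ι ∘ g)
      ι-sumTo zero g = refl
      ι-sumTo (suc n) g = trans (ι-+ _ _) (+-congˡ (ι-sumTo n (g ∘ suc)))

    weights : (θ : ℕ → F.Carrier) → Separated θ → ℕ → ℕ → ℕ → F.Carrier
    weights θ sep zero zero zero = F.1#
    weights θ sep zero zero (suc l) = F.0#
    weights θ sep zero (suc j) l = F.0#
    weights θ sep (suc n) j l = row j l
      where
      λ' : ℕ → ℕ → F.Carrier
      λ' = weights (θ ∘ suc) (λ i j lt → sep (suc i) (suc j) (s≤s lt)) n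
      κ : ℕ → ℕ → F.Carrier
      κ zero l = F.- (θ 0 F.* λ' 0 l) F.* proj₁ (sep 0 (suc l) (s≤s z≤n))
      κ (suc j) l = (λ' j l F.- θ 0 F.* λ' (suc j) l) F.* proj₁ (sep 0 (suc l) (s≤s z≤n))
      row : ℕ → ℕ → F.Carrier
      row zero zero = F.1# F.- SF.sumTo n (κ 0)
      row (suc j) zero = F.- SF.sumTo n (κ (suc j))
      row j (suc l) = κ j l

    interpolate : ∀ (A : Alg F) θ (sep : Separated θ) n q → (∀ j → n < j → Alg._≈_ A (q j) (Alg.0# A)) →
      ∀ j → Alg._≈_ A (q j) (sumTo A n (λ l → Alg._*_ A (Alg.ι A (weights θ sep n j l)) (ev A n q (Alg.ι A (θ l)))))
    interpolate A θ sep zero q z zero = A.sym (A.trans (A.*-congʳ A.ι-1) (A.*-identityˡ _))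
      where module A = Alg A using (*-congʳ; *-congˡ; *-identityˡ; sym; trans; zeroʳ; zeroˡ; ι-0; ι-1)
    interpolate A θ sep zero q z (suc j) = A.trans (z (suc j) (s≤s z≤n)) (A.sym (A.trans (A.*-congʳ A.ι-0) (A.zeroˡ _)))
      where module A = Alg A using (*-congʳ; *-congˡ; *-identityˡ; sym; trans; zeroʳ; zeroˡ; ι-0; ι-1)
    interpolate A θ sep (suc n) q z = result
      where
      open Alg A using (*-congʳ; *-congˡ; *-identityˡ; +-assoc; +-cong; +-congʳ; +-congˡ; -‿cong; Carrier; distribʳ; refl; setoid; sym; trans; zero; _+_; _*_; -_; _-_; _≈_; 1#; cring; ι; ι-cong; ι-+; ι-*; ι-1; ι-neg)
      open RS cring using (rsolve; _:+_; _:*_; :-_; _:-_; _⊜_)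
      open Synthetic cring (ι (θ 0)) using (coeff-suc; ev-quot; quot; quot-vanish)
      open import Relation.Binary.Reasoning.Setoid setoid
      θ' = θ ∘ suc
      sep' : Separated θ'
      sep' i j lt = sep (suc i) (suc j) (s≤s lt)
      λ' = weights θ' sep' n
      iv : ℕ → F.Carrier
      iv l = proj₁ (sep 0 (suc l) (s≤s z≤n))
      g v : ℕ → Carrier
      g = quot (suc n) q
      v l = ev A (suc n) q (ι (θ l))
      ivʳ : ∀ l → ι (iv l) * (ι (θ (suc l)) - ι (θ 0)) ≈ 1#
      ivʳ l = trans (*-congˡ (trans (+-congˡ (sym (ι-neg (θ 0)))) (sym (ι-+ _ _))))
        (trans (sym (ι-* _ _)) (trans (ι-cong (proj₂ (sep 0 (suc l) (s≤s z≤n)))) ι-1))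
      value : ∀ l → ev A n g (ι (θ' l)) ≈ ι (iv l) * (v (suc l) - v 0)
      value l = sym (trans (*-congˡ (+-congʳ (ev-quot n q (ι (θ' l)))))
        (trans (rsolve 4 (λ i b d e → i :* ((b :+ d :* e) :- b) ⊜ (i :* d) :* e) refl (ι (iv l)) (v 0) (ι (θ' l) - ι (θ 0)) _)
        (trans (*-congʳ (ivʳ l)) (*-identityˡ _))))
      gj : ∀ j → g j ≈ sumTo A n (λ l → ι (λ' j l) * (ι (iv l) * (v (suc l) - v 0)))
      gj j = trans (interpolate A θ' sep' n g (quot-vanish (suc n) q) j) (sumTo-cong A n (λ l _ → *-congˡ (value l)))
      functional : ∀ κ → sumTo A n (λ l → ι (κ l) * (v (suc l) - v 0)) ≈
        ι (F.- SF.sumTo n κ) * v 0 + sumTo A n (λ l → ι (κ l) * v (suc l))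
      functional κ = begin
        sumTo A n (λ l → ι (κ l) * (v (suc l) - v 0))
          ≈⟨ sumTo-cong A n (λ l _ → rsolve 3 (λ k a b → k :* (a :- b) ⊜ (:- b) :* k :+ k :* a) refl (ι (κ l)) (v (suc l)) (v 0)) ⟩
        sumTo A n (λ l → - v 0 * ι (κ l) + ι (κ l) * v (suc l))
          ≈⟨ sumTo-+ A n _ _ ⟩
        sumTo A n (λ l → - v 0 * ι (κ l)) + sumTo A n (λ l → ι (κ l) * v (suc l))
          ≈⟨ +-congʳ (trans (sumTo-scale A n (- v 0) (ι ∘ κ)) (*-congˡ (sym (ι-sumTo A n κ)))) ⟩
        - v 0 * ι (SF.sumTo n κ) + sumTo A n (λ l → ι (κ l) * v (suc l))
          ≈⟨ +-congʳ (trans (rsolve 2 (λ a b → (:- a) :* b ⊜ (:- b) :* a) refl (v 0) (ι (SF.sumTo n κ))) (*-congʳ (sym (ι-neg _)))) ⟩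
        ι (F.- SF.sumTo n κ) * v 0 + sumTo A n (λ l → ι (κ l) * v (suc l)) ∎
      result : ∀ j → q j ≈ sumTo A (suc n) (λ l → ι (weights θ sep (suc n) j l) * v l)
      result zero = begin
        q 0 ≈⟨ rsolve 3 (λ a t e → a ⊜ (a :+ t :* e) :+ (:- t) :* e) refl (q 0) (ι (θ 0)) (g 0) ⟩
        v 0 + (- ι (θ 0)) * g 0 ≈⟨ +-congˡ (*-congˡ (gj 0)) ⟩
        v 0 + (- ι (θ 0)) * sumTo A n (λ l → ι (λ' 0 l) * (ι (iv l) * (v (suc l) - v 0)))
          ≈⟨ +-congˡ (trans (sym (sumTo-scale A n _ _)) (trans (sumTo-cong A n (λ l _ → trans
               (rsolve 4 (λ t k i d → (:- t) :* (k :* (i :* d)) ⊜ ((:- (t :* k)) :* i) :* d) refl (ι (θ 0)) (ι (λ' 0 l)) (ι (iv l)) _)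
               (*-congʳ (sym (trans (ι-* _ _) (*-congʳ (trans (ι-neg _) (-‿cong (ι-* _ _)))))))))
               (functional κ₀))) ⟩
        v 0 + (ι (F.- SF.sumTo n κ₀) * v 0 + sumTo A n (λ l → ι (κ₀ l) * v (suc l)))
          ≈⟨ sym (+-assoc _ _ _) ⟩
        (v 0 + ι (F.- SF.sumTo n κ₀) * v 0) + sumTo A n (λ l → ι (κ₀ l) * v (suc l))
          ≈⟨ +-congʳ (sym (trans (*-congʳ (trans (ι-+ _ _) (+-congʳ ι-1))) (trans (distribʳ _ _ _) (+-congʳ (*-identityˡ _))))) ⟩
        ι (F.1# F.- SF.sumTo n κ₀) * v 0 + sumTo A n (λ l → ι (κ₀ l) * v (suc l)) ∎
        where
        κ₀ : ℕ → F.Carrier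
        κ₀ l = F.- (θ 0 F.* λ' 0 l) F.* iv l
      result (suc j) = begin
        q (suc j) ≈⟨ coeff-suc (suc n) q j z ⟩
        g j - ι (θ 0) * g (suc j) ≈⟨ +-cong (gj j) (-‿cong (*-congˡ (gj (suc j)))) ⟩
        S j - ι (θ 0) * S (suc j)
          ≈⟨ +-congˡ (rsolve 2 (λ a b → :- (a :* b) ⊜ (:- a) :* b) refl (ι (θ 0)) (S (suc j))) ⟩
        S j + (- ι (θ 0)) * S (suc j)
          ≈⟨ trans (+-congˡ (sym (sumTo-scale A n _ _))) (sym (sumTo-+ A n _ _)) ⟩
        sumTo A n (λ l → ι (λ' j l) * (ι (iv l) * (v (suc l) - v 0)) + (- ι (θ 0)) * (ι (λ' (suc j) l) * (ι (iv l) * (v (suc l) - v 0))))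
          ≈⟨ sumTo-cong A n (λ l _ → trans
               (rsolve 5 (λ t k k' i d → k :* (i :* d) :+ (:- t) :* (k' :* (i :* d)) ⊜ ((k :- t :* k') :* i) :* d) refl (ι (θ 0)) (ι (λ' j l)) (ι (λ' (suc j) l)) (ι (iv l)) _)
               (*-congʳ (sym (trans (ι-* _ _) (*-congʳ (trans (ι-+ _ _) (+-congˡ (trans (ι-neg _) (-‿cong (ι-* _ _)))))))))) ⟩
        sumTo A n (λ l → ι (κ₁ l) * (v (suc l) - v 0))
          ≈⟨ functional κ₁ ⟩
        ι (F.- SF.sumTo n κ₁) * v 0 + sumTo A n (λ l → ι (κ₁ l) * v (suc l)) ∎
        where
        S : ℕ → Carrier
        S i = sumTo A n (λ l → ι (λ' i l) * (ι (iv l) * (v (suc l) - v 0)))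
        κ₁ : ℕ → F.Carrier
        κ₁ l = (λ' j l F.- θ 0 F.* λ' (suc j) l) F.* iv l

    coefficients-vanish : ∀ (A : Alg F) θ → Separated θ → ∀ n q → (∀ j → n < j → Alg._≈_ A (q j) (Alg.0# A)) →
      (∀ l → l ≤ n → Alg._≈_ A (ev A n q (Alg.ι A (θ l))) (Alg.0# A)) → ∀ j → Alg._≈_ A (q j) (Alg.0# A)
    coefficients-vanish A θ sep n q z e j = A.trans (interpolate A θ sep n q z j)
      (sumTo-zero A n (λ l le → A.trans (A.*-congˡ (e l le)) (A.zeroʳ _)))
      where module A = Alg A using (*-congʳ; *-congˡ; *-identityˡ; sym; trans; zeroʳ; zeroˡ; ι-0; ι-1)

    natF-+ : ∀ m n → natF F (m ℕ.+ n) F.≈ natF F m F.+ natF F n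
    natF-+ zero n = F.sym (F.+-identityˡ _)
    natF-+ (suc m) n = F.trans (F.+-congˡ (natF-+ m n)) (F.sym (F.+-assoc _ _ _))

    module _ (char0 : CharZero F) where
      natF-separated : ∀ k → Separated (λ i → natF F (k ℕ.+ i))
      natF-separated k i j lt with ℕP.m≤n⇒∃[o]m+o≡n lt
      ... | o , ≡.refl = proj₁ inv , F.trans (F.*-comm _ _) (F.trans (F.*-congʳ difference) (proj₂ inv))
        where
        inv = F.inverse (natF F (suc o)) (char0 o)
        open RS F.commutativeRing using (rsolve; _:+_; _:*_; :-_; _:-_; _⊜_)
        difference : natF F (k ℕ.+ (suc i ℕ.+ o)) F.- natF F (k ℕ.+ i) F.≈ natF F (suc o)
        difference = F.trans (F.+-congʳ (F.trans (F.reflexive (≡.cong (natF F) (≡.trans (≡.cong (k ℕ.+_) (≡.sym (ℕP.+-suc i o))) (≡.sym (ℕP.+-assoc k i (suc o))))))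
          (natF-+ (k ℕ.+ i) (suc o)))) (rsolve 2 (λ a b → (a :+ b) :- a ⊜ b) F.refl (natF F (k ℕ.+ i)) (natF F (suc o)))

module TensorRank where
  open CommutativeAlgebra
  open import Data.List using (concatMap)
  open import Data.List.Relation.Unary.Any using (here; there)

  vecs : ∀ {a} {X : Set a} → List X → ∀ n → List (Vec X n)
  vecs xs zero = [] ∷ []
  vecs xs (suc n) = concatMap (λ x → map (x ∷_) (vecs xs n)) xs

  bools : List Bool
  bools = true ∷ false ∷ []

  strings : ∀ n → List (Vec Bool n)
  strings = vecs bools

  length-concatMap : ∀ {a b} {X : Set a} {Y : Set b} (h : X → List Y) xs k → (∀ x → length (h x) ≡ k) → length (concatMap h xs) ≡ length xs ℕ.* k
  length-concatMap h [] k e = ≡.refl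
  length-concatMap h (x ∷ xs) k e = ≡.trans (LP.length-++ (h x)) (≡.cong₂ ℕ._+_ (e x) (length-concatMap h xs k e))

  length-vecs : ∀ {a} {X : Set a} (xs : List X) n → length (vecs xs n) ≡ length xs ^ n
  length-vecs xs zero = ≡.refl
  length-vecs xs (suc n) = length-concatMap _ xs (length xs ^ n) (λ x → ≡.trans (LP.length-map _ (vecs xs n)) (length-vecs xs n))

  module Kronecker {c ℓ} (R : CommutativeRing c ℓ) where
    open CommutativeRing R using (*-assoc; *-cong; *-congʳ; *-congˡ; *-identityˡ; +-cong; +-congʳ; +-identityʳ; +-identityˡ; Carrier; refl; sym; trans; zeroʳ; zeroˡ; _*_; _≈_; 0#; 1#)
    open Sums R using (*-∑; ∑; ∑-concatMap; ∑-cong; ∑-map)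

    ∑-vecs : ∀ {a} {X : Set a} (xs : List X) n (g : Vec X (suc n) → Carrier) →
      ∑ (vecs xs (suc n)) g ≈ ∑ xs (λ x → ∑ (vecs xs n) (λ v → g (x ∷ v)))
    ∑-vecs xs n g = trans (∑-concatMap _ xs g) (∑-cong xs (λ x → ∑-map (x ∷_) (vecs xs n) g))

    δ : Bool → Bool → Carrier
    δ true true = 1#
    δ false false = 1#
    δ _ _ = 0#

    δᵥ : ∀ {n} → Vec Bool n → Vec Bool n → Carrier
    δᵥ [] [] = 1#
    δᵥ (a ∷ u) (b ∷ v) = δ a b * δᵥ u v

    δ-refl : ∀ b → δ b b ≈ 1#
    δ-refl true = refl
    δ-refl false = refl

    δ-≢ : ∀ {a b} → ¬ a ≡ b → δ a b ≈ 0#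
    δ-≢ {true} {true} ne = ⊥-elim (ne ≡.refl)
    δ-≢ {true} {false} ne = refl
    δ-≢ {false} {true} ne = refl
    δ-≢ {false} {false} ne = ⊥-elim (ne ≡.refl)

    δᵥ-refl : ∀ {n} (v : Vec Bool n) → δᵥ v v ≈ 1#
    δᵥ-refl [] = refl
    δᵥ-refl (b ∷ v) = trans (*-cong (δ-refl b) (δᵥ-refl v)) (*-identityˡ _)

    δᵥ-≢ : ∀ {n} (u v : Vec Bool n) → ¬ u ≡ v → δᵥ u v ≈ 0#
    δᵥ-≢ [] [] ne = ⊥-elim (ne ≡.refl)
    δᵥ-≢ (a ∷ u) (b ∷ v) ne = cases (a Bool.≟ b)
      where
      cases : Dec (a ≡ b) → δ a b * δᵥ u v ≈ 0#
      cases (yes ≡.refl) = trans (*-congˡ (δᵥ-≢ u v (λ e → ne (≡.cong (a ∷_) e)))) (zeroʳ _)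
      cases (no n) = trans (*-congʳ (δ-≢ n)) (zeroˡ _)

    ∑-δ : ∀ a (g : Bool → Carrier) → ∑ bools (λ b → δ a b * g b) ≈ g a
    ∑-δ true g = trans (+-cong (*-identityˡ _) (trans (+-congʳ (zeroˡ _)) (+-identityˡ _))) (+-identityʳ _)
    ∑-δ false g = trans (+-cong (zeroˡ _) (trans (+-congʳ (*-identityˡ _)) (+-identityʳ _))) (+-identityˡ _)

    ∑-δᵥ : ∀ {n} (u : Vec Bool n) (g : Vec Bool n → Carrier) → ∑ (strings n) (λ v → δᵥ u v * g v) ≈ g u
    ∑-δᵥ [] g = trans (+-identityʳ _) (*-identityˡ _)
    ∑-δᵥ {suc n} (a ∷ u) g = trans (∑-vecs bools n _)
      (trans (∑-cong bools (λ b → trans (∑-cong (strings n) (λ v → *-assoc (δ a b) (δᵥ u v) (g (b ∷ v)))) (sym (*-∑ (δ a b) (strings n) _))))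
      (trans (∑-δ a (λ b → ∑ (strings n) (λ v → δᵥ u v * g (b ∷ v)))) (∑-δᵥ u (λ v → g (a ∷ v)))))

  -- Functions of an assignment of strings to leaves, seen as matrices: the rows are indexed by the strings
  -- at the leaves of side true, the columns by those at the leaves of side false.
  module Tensor {c ℓ} (R : CommutativeRing c ℓ) (Leaf : Set) (_≟ℓ_ : DecidableEquality Leaf) (len : Leaf → ℕ) where
    open CommutativeRing R using (*-comm; *-cong; *-identityʳ; *-identityˡ; +-cong; +-identityʳ; Carrier; refl; reflexive; sym; trans; _+_; _*_; _≈_; 0#; 1#)
    open Sums R using (*-∑; ∑; ∑-*; ∑-++; ∑-concatMap; ∑-cong; ∑-map)
    open Kronecker R using (δᵥ; ∑-δᵥ)
    open RS R using (rsolve; _:+_; _:*_; _⊜_)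

    Idx : Set
    Idx = ∀ l → Vec Bool (len l)

    Tens : Set c
    Tens = Idx → Carrier

    Agree : (Leaf → Set) → Idx → Idx → Set
    Agree P a a' = ∀ l → P l → a l ≡ a' l

    DependsOn : (Leaf → Set) → Tens → Set ℓ
    DependsOn P t = ∀ a a' → Agree P a a' → t a ≈ t a'

    set : Idx → ∀ l → Vec Bool (len l) → Idx
    set a l j l' with l ≟ℓ l'
    ... | yes ≡.refl = j
    ... | no _ = a l'

    set-agree : ∀ a a' l j l' → (¬ l ≡ l' → a l' ≡ a' l') → set a l j l' ≡ set a' l j l'
    set-agree a a' l j l' e with l ≟ℓ l'
    ... | yes ≡.refl = ≡.refl
    ... | no ne = e ne

    set-id : ∀ a l l' → set a l (a l) l' ≡ a l'
    set-id a l l' with l ≟ℓ l'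
    ... | yes ≡.refl = ≡.refl
    ... | no ne = ≡.refl

    module Rank (side : Leaf → Bool) where
      RowDep ColDep : Tens → Set ℓ
      RowDep = DependsOn (λ l → side l ≡ true)
      ColDep = DependsOn (λ l → side l ≡ false)

      Rank1 : Set (c ⊔ ℓ)
      Rank1 = Σ Tens λ u → Σ Tens λ v → RowDep u × ColDep v

      entry : Idx → Rank1 → Carrier
      entry a (u , v , _) = u a * v a

      Rk : ℕ → Tens → Set (c ⊔ ℓ)
      Rk n t = Σ (List Rank1) λ ts → (length ts ≤ n) × (∀ a → t a ≈ ∑ ts (entry a))

      Rk-resp : ∀ {n t t'} → (∀ a → t a ≈ t' a) → Rk n t → Rk n t'
      Rk-resp e (ts , le , h) = ts , le , λ a → trans (sym (e a)) (h a)

      Rk-≤ : ∀ {m n t} → m ≤ n → Rk m t → Rk n t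
      Rk-≤ le (ts , le' , h) = ts , ℕP.≤-trans le' le , h

      Rk-0 : ∀ {t} → (∀ a → t a ≈ 0#) → Rk 0 t
      Rk-0 e = [] , z≤n , e

      Rk-1 : ∀ u v → RowDep u → ColDep v → Rk 1 (λ a → u a * v a)
      Rk-1 u v ru cv = ((u , v , ru , cv) ∷ []) , s≤s z≤n , λ a → sym (+-identityʳ _)

      Rk-+ : ∀ {m n t t'} → Rk m t → Rk n t' → Rk (m ℕ.+ n) (λ a → t a + t' a)
      Rk-+ (ts , le , h) (ts' , le' , h') = ts ++ ts' , ℕP.≤-trans (ℕP.≤-reflexive (LP.length-++ ts)) (ℕP.+-mono-≤ le le') ,
        λ a → trans (+-cong (h a) (h' a)) (sym (∑-++ ts ts' (entry a)))

      private
        mul : Rank1 → Rank1 → Rank1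
        mul (u , v , ru , cv) (u' , v' , ru' , cv') = (λ a → u a * u' a) , (λ a → v a * v' a) ,
          (λ a a' e → *-cong (ru a a' e) (ru' a a' e)) , (λ a a' e → *-cong (cv a a' e) (cv' a a' e))

      Rk-* : ∀ {m n t t'} → Rk m t → Rk n t' → Rk (m ℕ.* n) (λ a → t a * t' a)
      Rk-* (ts , le , h) (ts' , le' , h') = concatMap (λ s → map (mul s) ts') ts ,
        ℕP.≤-trans (ℕP.≤-reflexive (length-concatMap _ ts (length ts') (λ s → LP.length-map (mul s) ts'))) (ℕP.*-mono-≤ le le') ,
        λ a → trans (*-cong (h a) (h' a)) (trans (∑-* ts (entry a) _) (trans (∑-cong ts (λ s → trans (*-∑ (entry a s) ts' (entry a))
          (trans (∑-cong ts' (λ s' → rsolve 4 (λ p q r s → (p :* q) :* (r :* s) ⊜ (p :* r) :* (q :* s)) refl (proj₁ s a) (proj₁ (proj₂ s) a) (proj₁ s' a) (proj₁ (proj₂ s') a)))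
          (sym (∑-map (mul s) ts' (entry a)))))) (sym (∑-concatMap _ ts (entry a)))))

      Rk-∑ : ∀ {b} {X : Set b} {n} (xs : List X) {g : X → Tens} → (∀ x → Rk n (g x)) → Rk (length xs ℕ.* n) (λ a → ∑ xs (λ x → g x a))
      Rk-∑ [] h = Rk-0 (λ a → refl)
      Rk-∑ (x ∷ xs) h = Rk-+ (h x) (Rk-∑ xs h)

      rowBits : List Leaf → ℕ
      rowBits [] = 0
      rowBits (l ∷ ls) with side l
      ... | true = len l ℕ.+ rowBits ls
      ... | false = rowBits ls

      Rk-rows : ∀ ls {t} → DependsOn (λ l → (side l ≡ true → l ∈ ls)) t → Rk (2 ^ rowBits ls) t
      Rk-rows [] {t} d = Rk-resp (λ a → *-identityˡ _) (Rk-1 (λ _ → 1#) t (λ _ _ _ → refl) (λ a a' e → d a a' (λ l h → e l (col l h))))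
        where
        col : ∀ l → (side l ≡ true → l ∈ []) → side l ≡ false
        col l h with side l
        ... | false = ≡.refl
        ... | true with h ≡.refl
        ... | ()
      Rk-rows (l ∷ ls) {t} d with side l in eq
      ... | false = Rk-rows ls (λ a a' e → d a a' (λ l' h → e l' (λ s → tail l' s (h s))))
        where
        tail : ∀ l' → side l' ≡ true → l' ∈ l ∷ ls → l' ∈ ls
        tail l' s (here ≡.refl) with () ← ≡.trans (≡.sym s) eq
        tail l' s (there h) = h
      ... | true = Rk-≤ (ℕP.≤-reflexive (≡.trans (≡.cong₂ ℕ._*_ (length-vecs bools (len l)) (ℕP.*-identityˡ _)) (≡.sym (ℕP.^-distribˡ-+-* 2 (len l) (rowBits ls)))))
          (Rk-resp (λ a → trans (∑-δᵥ (a l) (λ j → t (set a l j))) (d _ _ (λ l' _ → set-id a l l')))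
            (Rk-∑ (strings (len l)) (λ j → Rk-* (Rk-resp (λ a → *-identityʳ _) (Rk-1 (λ a → δᵥ (a l) j) (λ _ → 1#) (λ a a' e → reflexive (≡.cong (λ z → δᵥ z j) (e l eq))) (λ _ _ _ → refl)))
              (Rk-rows ls {λ a → t (set a l j)} (λ a a' e → d _ _ (λ l' h → set-agree a a' l j l' (λ ne → e l' (λ s → tail ne (h s)))))))))
        where
        tail : ∀ {l'} → ¬ l ≡ l' → l' ∈ l ∷ ls → l' ∈ ls
        tail ne (here ≡.refl) = ⊥-elim (ne ≡.refl)
        tail ne (there h) = h

    module _ (side : Leaf → Bool) where
      private
        module P = Rank side using (Rank1; Rk; entry)
        module Q = Rank (not ∘ side) using (Rank1; Rk)

        not-true : ∀ {b} → not b ≡ true → b ≡ false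
        not-true {false} _ = ≡.refl

        not-false : ∀ {b} → not b ≡ false → b ≡ true
        not-false {true} _ = ≡.refl

        swap : Q.Rank1 → P.Rank1
        swap (u , v , ru , cv) = v , u , (λ a a' e → cv a a' (λ l s → e l (not-false s))) , (λ a a' e → ru a a' (λ l s → e l (not-true s)))

      Rk-flip : ∀ {n t} → Q.Rk n t → P.Rk n t
      Rk-flip (ts , le , h) = map swap ts , ℕP.≤-trans (ℕP.≤-reflexive (LP.length-map swap ts)) le ,
        λ a → trans (h a) (trans (∑-cong ts (λ s → *-comm _ _)) (sym (∑-map swap ts (P.entry a))))

module DualNumberTower where
  open CommutativeAlgebra
  open FormulaSemantics
  open import Defs using (Field; module Field)
  open import Data.List.Relation.Unary.All using (All; []; _∷_)

  -- The algebra 𝒯[ε_x : x ∈ es]/(ε_x²), as iterated dual numbers.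
  module Tower {c ℓ : Level} (F : Field c ℓ) (𝒯 : Alg F) {X : Set} where
    private module T = Alg 𝒯 using (*-cong; *-congʳ; *-identityʳ; *-identityˡ; +-cong; +-congˡ; +-identityʳ; +-identityˡ; Carrier; refl; reflexive; sym; trans; zeroˡ; _+_; _*_; _≈_; 0#; 1#; cring; ι; ι-*)

    EAlg : List X → Alg F
    EAlg [] = 𝒯
    EAlg (_ ∷ es) = dualAlg F (EAlg es)

    module E es = Alg (EAlg es) using (*-comm; *-cong; *-congʳ; +-cong; +-congˡ; +-identityʳ; +-identityˡ; Carrier; distribʳ; refl; reflexive; sym; trans; zeroʳ; zeroˡ; _+_; _*_; -_; _≈_; 0#; 1#; cring; ι; ι-+; ι-*; ι-1; ι-neg)

    base : ∀ es → E.Carrier es → T.Carrier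
    base [] u = u
    base (_ ∷ es) u = base es (proj₁ u)

    top : ∀ es → E.Carrier es → T.Carrier
    top [] u = u
    top (_ ∷ es) u = top es (proj₂ u)

    const : ∀ es → T.Carrier → E.Carrier es
    const [] t = t
    const (_ ∷ es) t = const es t , E.0# es

    baseHom : ∀ es → AlgHom F (EAlg es) 𝒯
    baseHom [] = record { fun = λ u → u ; fun-cong = λ e → e ; fun-ι = λ _ → T.refl ; fun-+ = λ _ _ → T.refl ; fun-* = λ _ _ → T.refl }
    baseHom (_ ∷ es) = record { fun = λ u → fun (proj₁ u) ; fun-cong = λ e → fun-cong (proj₁ e) ; fun-ι = fun-ι
      ; fun-+ = λ a b → fun-+ _ _ ; fun-* = λ a b → fun-* _ _ }
      where open AlgHom (baseHom es) using (fun; fun-*; fun-+; fun-cong; fun-ι)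

    fun≡base : ∀ es u → AlgHom.fun (baseHom es) u ≡ base es u
    fun≡base [] u = ≡.refl
    fun≡base (_ ∷ es) u = fun≡base es (proj₁ u)

    base-cong : ∀ es {u v} → E._≈_ es u v → base es u T.≈ base es v
    base-cong [] e = e
    base-cong (_ ∷ es) e = base-cong es (proj₁ e)

    base-* : ∀ es u v → base es (E._*_ es u v) T.≈ base es u T.* base es v
    base-* [] u v = T.refl
    base-* (_ ∷ es) u v = base-* es _ _

    base-+ : ∀ es u v → base es (E._+_ es u v) T.≈ base es u T.+ base es v
    base-+ [] u v = T.refl
    base-+ (_ ∷ es) u v = base-+ es _ _

    base-1 : ∀ es → base es (E.1# es) T.≈ T.1#
    base-1 [] = T.refl
    base-1 (_ ∷ es) = base-1 es

    base-0 : ∀ es → base es (E.0# es) T.≈ T.0#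
    base-0 [] = T.refl
    base-0 (_ ∷ es) = base-0 es

    top-cong : ∀ es {u v} → E._≈_ es u v → top es u T.≈ top es v
    top-cong [] e = e
    top-cong (_ ∷ es) e = top-cong es (proj₂ e)

    top-+ : ∀ es u v → top es (E._+_ es u v) T.≈ top es u T.+ top es v
    top-+ [] u v = T.refl
    top-+ (_ ∷ es) u v = top-+ es _ _

    top-0 : ∀ es → top es (E.0# es) T.≈ T.0#
    top-0 [] = T.refl
    top-0 (_ ∷ es) = top-0 es

    const-* : ∀ es t t' → E._≈_ es (const es (t T.* t')) (E._*_ es (const es t) (const es t'))
    const-* [] t t' = T.refl
    const-* (_ ∷ es) t t' = const-* es t t' , E.sym es (E.trans es (E.+-cong es (E.zeroʳ es _) (E.zeroˡ es _)) (E.+-identityˡ es _))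

    const-ι : ∀ es a → E._≈_ es (E.ι es a) (const es (T.ι a))
    const-ι [] a = T.refl
    const-ι (_ ∷ es) a = const-ι es a , E.refl es

    top-const-* : ∀ es t u → top es (E._*_ es (const es t) u) T.≈ t T.* top es u
    top-const-* [] t u = T.refl
    top-const-* (_ ∷ es) t u = T.trans (top-cong es (E.trans es (E.+-congˡ es (E.zeroˡ es _)) (E.+-identityʳ es _))) (top-const-* es t (proj₂ u))

    inv : ∀ es → E.Carrier es → T.Carrier → E.Carrier es
    inv [] u i = i
    inv (_ ∷ es) u i = v , E.-_ es (E._*_ es (proj₂ u) (E._*_ es v v))
      where v = inv es (proj₁ u) i

    inv-correct : ∀ es u i → base es u T.* i T.≈ T.1# → E._≈_ es (E._*_ es u (inv es u i)) (E.1# es)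
    inv-correct [] u i h = h
    inv-correct (_ ∷ es) (u₀ , u₁) i h = IH ,
      trans (+-congʳ (rsolve 3 (λ a b v → a :* (:- (b :* (v :* v))) ⊜ (:- (a :* v)) :* (b :* v)) refl u₀ u₁ v))
      (trans (+-congʳ (*-congʳ (-‿cong IH))) (trans (+-congʳ (-1*x≈-x _)) (-‿inverseˡ _)))
      where
      open Alg (EAlg es) using (*-congʳ; +-congʳ; -‿cong; -‿inverseˡ; refl; ring; trans; _*_; _≈_; 1#; cring)
      open RS cring using (rsolve; _:+_; _:*_; :-_; _:-_; _⊜_)
      open import Algebra.Properties.Ring ring using (-1*x≈-x)
      v = inv es u₀ i
      IH : u₀ * v ≈ 1#
      IH = inv-correct es u₀ i h

    log : ∀ es → E.Carrier es → T.Carrier → E.Carrier es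
    log [] u i = T.0#
    log (_ ∷ es) u i = log es (proj₁ u) i , E._*_ es (proj₂ u) (inv es (proj₁ u) i)

    exp : ∀ es → E.Carrier es → T.Carrier → E.Carrier es
    exp [] h c = c
    exp (_ ∷ es) h c = exp es (proj₁ h) c , E._*_ es (proj₂ h) (exp es (proj₁ h) c)

    exp-cong : ∀ es {h h' c c'} → E._≈_ es h h' → c T.≈ c' → E._≈_ es (exp es h c) (exp es h' c')
    exp-cong [] e f = f
    exp-cong (_ ∷ es) (e , e') f = exp-cong es e f , E.*-cong es e' (exp-cong es e f)

    exp-log : ∀ es u i → base es u T.* i T.≈ T.1# → E._≈_ es (exp es (log es u i) (base es u)) u
    exp-log [] u i h = T.refl
    exp-log (_ ∷ es) (u₀ , u₁) i h = exp-log es u₀ i h ,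
      trans (*-congˡ (exp-log es u₀ i h)) (trans (*-assoc _ _ _) (trans (*-congˡ (trans (*-comm _ _) (inv-correct es u₀ i h))) (*-identityʳ _)))
      where open Alg (EAlg es) using (*-assoc; *-comm; *-congˡ; *-identityʳ; trans)

    private
      inverse-unique : ∀ es {u v w} → E._≈_ es (E._*_ es u v) (E.1# es) → E._≈_ es (E._*_ es u w) (E.1# es) → E._≈_ es v w
      inverse-unique es {u} {v} {w} e f = trans (sym (*-identityʳ v)) (trans (*-congˡ (sym f)) (trans (sym (*-assoc _ _ _))
        (trans (*-congʳ (trans (*-comm _ _) e)) (*-identityˡ w))))
        where open Alg (EAlg es) using (*-assoc; *-comm; *-congʳ; *-congˡ; *-identityʳ; *-identityˡ; sym; trans)

      base-unit : ∀ es {u v i j} → base es u T.* i T.≈ T.1# → base es v T.* j T.≈ T.1# → base es (E._*_ es u v) T.* (i T.* j) T.≈ T.1#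
      base-unit es {u} {v} {i} {j} h h' = T.trans (T.*-congʳ (base-* es u v))
        (T.trans (rsolve 4 (λ a b c d → (a :* b) :* (c :* d) ⊜ (a :* c) :* (b :* d)) T.refl (base es u) (base es v) i j)
        (T.trans (T.*-cong h h') (T.*-identityˡ _)))
        where open RS T.cring using (rsolve; _:*_; _⊜_)

    log-* : ∀ es u v i j → base es u T.* i T.≈ T.1# → base es v T.* j T.≈ T.1# →
      E._≈_ es (log es (E._*_ es u v) (i T.* j)) (E._+_ es (log es u i) (log es v j))
    log-* [] u v i j h h' = T.sym (T.+-identityˡ _)
    log-* (_ ∷ es) (u₀ , u₁) (v₀ , v₁) i j h h' = log-* es u₀ v₀ i j h h' ,
      trans (*-congˡ inv-mul)
      (trans (rsolve 6 (λ a b c d p q → (a :* d :+ b :* c) :* (p :* q) ⊜ (b :* p) :* (c :* q) :+ (d :* q) :* (a :* p)) refl u₀ u₁ v₀ v₁ (inv es u₀ i) (inv es v₀ j))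
        (+-cong (trans (*-congˡ (inv-correct es v₀ j h')) (*-identityʳ _)) (trans (*-congˡ (inv-correct es u₀ i h)) (*-identityʳ _))))
      where
      open Alg (EAlg es) using (*-cong; *-congˡ; *-identityʳ; *-identityˡ; +-cong; refl; trans; _*_; _≈_; cring)
      open RS cring using (rsolve; _:+_; _:*_; :-_; _:-_; _⊜_)
      inv-mul : inv es (u₀ * v₀) (i T.* j) ≈ inv es u₀ i * inv es v₀ j
      inv-mul = inverse-unique es (inv-correct es (u₀ * v₀) (i T.* j) (base-unit es h h'))
        (trans (rsolve 4 (λ a b c d → (a :* b) :* (c :* d) ⊜ (a :* c) :* (b :* d)) refl u₀ v₀ _ _)
          (trans (*-cong (inv-correct es u₀ i h) (inv-correct es v₀ j h')) (*-identityˡ _)))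

    log-1 : ∀ es {i} → E._≈_ es (log es (E.1# es) i) (E.0# es)
    log-1 [] = T.refl
    log-1 (_ ∷ es) = log-1 es , E.zeroˡ es _

    Unit : ∀ es → Set _
    Unit es = Σ (E.Carrier es) λ u → Σ T.Carrier λ i → base es u T.* i T.≈ T.1#

    module _ (es : List X) where
      open Alg (EAlg es) using (*-identityʳ; +-congˡ; Carrier; refl; sym; trans; _*_; _≈_; 1#; cring)
      open Sums cring using (∏; ∑)

      ∏-units : List (Unit es) → Carrier
      ∏-units us = ∏ us proj₁

      ∑-logs : List (Unit es) → Carrier
      ∑-logs us = ∑ us (λ (u , i , _) → log es u i)

      private
        inverses : List (Unit es) → T.Carrier
        inverses us = Sums.∏ T.cring us (λ (_ , i , _) → i)

        base-∏ : ∀ us → base es (∏-units us) T.* inverses us T.≈ T.1#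
        base-∏ [] = T.trans (T.*-identityʳ _) (base-1 es)
        base-∏ ((u , i , h) ∷ us) = base-unit es h (base-∏ us)

        log-∏ : ∀ us → log es (∏-units us) (inverses us) ≈ ∑-logs us
        log-∏ [] = log-1 es
        log-∏ ((u , i , h) ∷ us) = trans (log-* es u (∏-units us) i (inverses us) h (base-∏ us)) (+-congˡ (log-∏ us))

      ∏-units≈exp : ∀ us → ∏-units us ≈ exp es (∑-logs us) (base es (∏-units us))
      ∏-units≈exp us = trans (sym (exp-log es (∏-units us) (inverses us) (base-∏ us))) (exp-cong es (log-∏ us) T.refl)

    Nil : ∀ es → E.Carrier es → Set _
    Nil es z = base es z T.≈ T.0#

    ∏E : ∀ es → List (E.Carrier es) → E.Carrier es
    ∏E es zs = Sums.∏ (E.cring es) zs (λ z → z)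

    nilpotent : ∀ es zs → All (Nil es) zs → length es < length zs → E._≈_ es (∏E es zs) (E.0# es)
    nilpotent [] (z ∷ zs) (h ∷ _) lt = T.trans (T.*-congʳ h) (T.zeroˡ _)
    nilpotent (x ∷ es) zs hs lt = first , trans (sym (*-identityˡ _)) (second [] zs [] hs lt)
      where
      open Alg (EAlg es) using (*-congˡ; *-identityˡ; +-cong; +-identityˡ; Carrier; refl; sym; trans; zeroʳ; _+_; _*_; _≈_; 0#; cring)
      open RS cring using (rsolve; _:+_; _:*_; :-_; _:-_; _⊜_)
      proj-∏ : ∀ zs → proj₁ (∏E (x ∷ es) zs) ≈ ∏E es (map proj₁ zs)
      proj-∏ [] = refl
      proj-∏ (z ∷ zs) = *-congˡ (proj-∏ zs)
      firsts : ∀ {zs} → All (Nil (x ∷ es)) zs → All (Nil es) (map proj₁ zs)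
      firsts [] = []
      firsts (h ∷ hs) = h ∷ firsts hs
      length-firsts : ∀ (zs : List (E.Carrier (x ∷ es))) → length (map proj₁ zs) ≡ length zs
      length-firsts [] = ≡.refl
      length-firsts (z ∷ zs) = ≡.cong suc (length-firsts zs)
      first : proj₁ (∏E (x ∷ es) zs) ≈ 0#
      first = trans (proj-∏ zs) (nilpotent es (map proj₁ zs) (firsts hs) (ℕP.≤-trans (ℕP.n≤1+n _) (ℕP.≤-trans lt (ℕP.≤-reflexive (≡.sym (length-firsts zs))))))
      second : ∀ xs zs → All (Nil es) xs → All (Nil (x ∷ es)) zs → suc (length es) < length xs ℕ.+ length zs →
        ∏E es xs * proj₂ (∏E (x ∷ es) zs) ≈ 0#
      second xs [] hx hz lt = zeroʳ _
      second xs (z ∷ zs) hx (h ∷ hz) lt =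
        trans (rsolve 5 (λ p z s q t → p :* (z :* s :+ q :* t) ⊜ (z :* p) :* s :+ q :* (p :* t)) refl (∏E es xs) (proj₁ z) _ (proj₂ z) _)
        (trans (+-cong (second (proj₁ z ∷ xs) zs (h ∷ hx) hz (ℕP.≤-trans lt (ℕP.≤-reflexive (ℕP.+-suc _ _))))
           (trans (*-congˡ (trans (*-congˡ (proj-∏ zs)) (trans (sym (Sums.∏-++ cring xs (map proj₁ zs) (λ z → z)))
              (nilpotent es (xs ++ map proj₁ zs) (all-++ hx (firsts hz))
                (ℕP.≤-trans (ℕP.≤-pred (ℕP.≤-trans lt (ℕP.≤-reflexive (ℕP.+-suc _ _)))) (ℕP.≤-reflexive (≡.sym (≡.trans (length-++ xs _) (≡.cong (length xs ℕ.+_) (length-firsts zs))))))))))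
              (zeroʳ _))) (+-identityˡ _))
        where
        all-++ : ∀ {xs ys} → All (Nil es) xs → All (Nil es) ys → All (Nil es) (xs ++ ys)
        all-++ [] b = b
        all-++ (a ∷ as) b = a ∷ all-++ as b
        length-++ : ∀ (xs ys : List Carrier) → length (xs ++ ys) ≡ length xs ℕ.+ length ys
        length-++ [] ys = ≡.refl
        length-++ (_ ∷ xs) ys = ≡.cong suc (length-++ xs ys)

    module _ (es : List X) where
      open Alg (EAlg es) using (*-congʳ; *-identityˡ; +-congˡ; +-identityʳ; refl; sym; trans; zero; zeroˡ; _+_; _*_; _≈_; cring)
      open Horner cring using (ev)
      open RS cring using (rsolve; _:+_; _:*_; :-_; _:-_; _⊜_)

      private
        truncate : ∀ xs k n r ν → All (Nil es) xs → Nil es ν → length es ≤ length xs ℕ.+ k → ∏E es xs * ev (k ℕ.+ n) r ν ≈ ∏E es xs * ev k r ν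
        truncate xs zero zero r ν hx h le = refl
        truncate xs zero (suc n) r ν hx h le = trans (rsolve 4 (λ p a v e → p :* (a :+ v :* e) ⊜ p :* a :+ (v :* p) :* e) refl (∏E es xs) (r 0) ν _)
          (trans (+-congˡ (trans (*-congʳ (nilpotent es (ν ∷ xs) (h ∷ hx) (s≤s (ℕP.≤-trans le (ℕP.≤-reflexive (ℕP.+-identityʳ _)))))) (zeroˡ _))) (+-identityʳ _))
        truncate xs (suc k) n r ν hx h le = trans (rsolve 4 (λ p a v e → p :* (a :+ v :* e) ⊜ p :* a :+ (v :* p) :* e) refl (∏E es xs) (r 0) ν _)
          (trans (+-congˡ (truncate (ν ∷ xs) k n (r ∘ suc) ν (h ∷ hx) h (ℕP.≤-trans le (ℕP.≤-reflexive (ℕP.+-suc _ k)))))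
          (rsolve 4 (λ p a v e → p :* a :+ (v :* p) :* e ⊜ p :* (a :+ v :* e)) refl (∏E es xs) (r 0) ν _))

      ev-nilpotent : ∀ k n r ν → Nil es ν → length es ≤ k → k ≤ n → ev n r ν ≈ ev k r ν
      ev-nilpotent k n r ν h le le' with ℕP.m≤n⇒∃[o]m+o≡n le'
      ... | o , ≡.refl = trans (sym (*-identityˡ _)) (trans (truncate [] k o r ν [] h le) (*-identityˡ _))

  module Derivative {c ℓ} (R : CommutativeRing c ℓ) where
    open CommutativeRing R using (*-congˡ; +-cong; +-congˡ; +-identityʳ; Carrier; refl; sym; trans; zero; zeroʳ; zeroˡ; _+_; _*_; _≈_; 0#)
    open RS R using (rsolve; _:+_; _:*_; :-_; _:-_; _⊜_)
    open Horner R using (ev; ev-+)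
    private module HD = Horner (Dual.dualRing R) using (ev)

    dv : ℕ → (ℕ → Carrier) → Carrier → Carrier
    dv zero q τ = 0#
    dv (suc n) q τ = ev n (q ∘ suc) τ + τ * dv n (q ∘ suc) τ

    ev-dual : ∀ n (q : ℕ → Carrier × Carrier) τ →
      (proj₁ (HD.ev n q τ) ≈ ev n (proj₁ ∘ q) (proj₁ τ)) ×
      (proj₂ (HD.ev n q τ) ≈ ev n (proj₂ ∘ q) (proj₁ τ) + dv n (proj₁ ∘ q) (proj₁ τ) * proj₂ τ)
    ev-dual zero q τ = refl , sym (trans (+-congˡ (zeroˡ _)) (+-identityʳ _))
    ev-dual (suc n) q (τ₀ , τ₁) = +-congˡ (*-congˡ (proj₁ IH)) ,
      trans (+-congˡ (+-cong (*-congˡ (proj₂ IH)) (*-congˡ (proj₁ IH))))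
        (rsolve 6 (λ a t s e d f → a :+ (t :* (e :+ d :* s) :+ s :* f) ⊜ (a :+ t :* e) :+ (f :+ t :* d) :* s) refl (proj₂ (q 0)) τ₀ τ₁ _ _ _)
      where IH = ev-dual n (q ∘ suc) (τ₀ , τ₁)

    times : ℕ → Carrier → Carrier
    times zero a = 0#
    times (suc k) a = a + times k a

    dv-coefficients : ∀ n q τ → dv (suc n) q τ ≈ ev n (λ j → times (suc j) (q (suc j))) τ
    dv-coefficients zero q τ = +-congˡ (zeroʳ τ)
    dv-coefficients (suc n) q τ = trans (+-congˡ (*-congˡ (dv-coefficients n (q ∘ suc) τ)))
      (trans (rsolve 4 (λ a t e d → (a :+ t :* e) :+ t :* d ⊜ a :+ t :* (e :+ d)) refl (q 1) τ _ _)
      (+-cong (sym (+-identityʳ _)) (*-congˡ (sym (ev-+ n (λ j → q (suc (suc j))) (λ j → times (suc j) (q (suc (suc j)))) τ)))))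

module LowRankDecomposition where
  open CommutativeAlgebra
  open FormulaSemantics
  open PolynomialInterpolation using (module SumTo)
  open TensorRank
  open DualNumberTower
  open import Defs using (Field; module Field)
  open import Data.Nat using (_+_; _*_; _∸_; ∣_-_∣)
  open import Data.Nat.Properties using (module ≤-Reasoning)
  open import Data.Nat.Solver using (module +-*-Solver)
  open import Data.Bool using (if_then_else_)
  open import Data.List using (concatMap)
  open import Data.List.Relation.Unary.Any using (here; there)
  open import Data.List.Relation.Unary.All using ([]; _∷_)

  private
    *-interchange : ∀ a b x y → (a * b) * (x * y) ≡ (a * x) * (b * y)
    *-interchange = solve 4 (λ a b x y → (a :* b) :* (x :* y) := (a :* x) :* (b :* y)) ≡.refl
      where open +-*-Solver

  module LowRank {c ℓ : Level} (F : Field c ℓ) (Leaf : Set) (_≟ℓ_ : DecidableEquality Leaf) (len : Leaf → ℕ)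
    (side : Leaf → Bool) (hv : Leaf → ℕ) (len≡ : ∀ l → len l ≡ 2 * hv l) (Λ : ℕ) where

    private module F = Field F using (commutativeRing)

    K : CommutativeRing c ℓ
    K = Stabilised.stableRing F.commutativeRing

    private module K = CommutativeRing K using (*-comm; *-cong; *-congʳ; *-congˡ; *-identityʳ; *-identityˡ; +-assoc; +-comm; +-commutativeMonoid; +-cong; +-congʳ; +-congˡ; +-identityʳ; +-identityˡ; -‿cong; -‿inverseʳ; -‿inverseˡ; distribʳ; distribˡ; refl; reflexive; ring; semiring; sym; trans; zeroʳ; zeroˡ; _+_; _*_; -_; _-_; _≈_; 0#; 1#)

    open Tensor K Leaf _≟ℓ_ len using (Agree; DependsOn; Idx; Rk-flip; Tens; set; set-agree; set-id; module Rank) public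
    open Rank side using (ColDep; Rank1; Rk; Rk-*; Rk-+; Rk-0; Rk-1; Rk-resp; Rk-rows; Rk-∑; Rk-≤; RowDep; entry; rowBits) public
    open Sums K using (*-∑; ∑; ∑-*; ∑-++; ∑-concatMap; ∑-cong; ∑-map)

    𝒯 : Alg F
    𝒯 = pointwiseAlg F Idx (stableAlg F)

    module T = Alg 𝒯 using (*-cong; *-congʳ; *-identityʳ; *-identityˡ; +-cong; +-congˡ; +-identityʳ; +-identityˡ; Carrier; refl; reflexive; sym; trans; zeroˡ; _+_; _*_; _≈_; 0#; 1#; cring; ι; ι-*)

    open Tower F 𝒯 {Leaf} using (EAlg; Nil; Unit; base; base-*; base-+; base-0; base-1; base-cong; baseHom; const; const-*; const-ι; ev-nilpotent; exp; exp-cong; exp-log; fun≡base; inv; inv-correct; log; log-*; log-1; nilpotent; top; top-+; top-0; top-cong; top-const-*; ∏-units; ∏-units≈exp; ∏E; ∑-logs; module E) public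

    hvs rowH colH : List Leaf → ℕ
    hvs [] = 0
    hvs (l ∷ ls) = hv l + hvs ls
    rowH [] = 0
    rowH (l ∷ ls) = (if side l then hv l else 0) + rowH ls
    colH [] = 0
    colH (l ∷ ls) = (if side l then 0 else hv l) + colH ls

    private
      rowBits≡ : ∀ A → rowBits A ≡ 2 * rowH A
      rowBits≡ [] = ≡.refl
      rowBits≡ (l ∷ A) with side l
      ... | true = ≡.trans (≡.cong₂ _+_ (len≡ l) (rowBits≡ A)) (≡.sym (ℕP.*-distribˡ-+ 2 (hv l) (rowH A)))
      ... | false = rowBits≡ A

      colBits≡ : ∀ A → Rank.rowBits (not ∘ side) A ≡ 2 * colH A
      colBits≡ [] = ≡.refl
      colBits≡ (l ∷ A) with side l
      ... | false = ≡.trans (≡.cong₂ _+_ (len≡ l) (colBits≡ A)) (≡.sym (ℕP.*-distribˡ-+ 2 (hv l) (colH A)))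
      ... | true = colBits≡ A

      hvs≡ : ∀ A → rowH A + colH A ≡ hvs A
      hvs≡ [] = ≡.refl
      hvs≡ (l ∷ A) with side l
      ... | true = ≡.trans (ℕP.+-assoc (hv l) _ _) (≡.cong (hv l +_) (hvs≡ A))
      ... | false = ≡.trans (≡.trans (≡.sym (ℕP.+-assoc (rowH A) (hv l) _)) (≡.trans (≡.cong (_+ colH A) (ℕP.+-comm (rowH A) (hv l))) (ℕP.+-assoc (hv l) _ _))) (≡.cong (hv l +_) (hvs≡ A))

    trivialRank : ∀ A {t} → DependsOn (_∈ A) t → Σ ℕ λ R → Rk R t × (R * 2 ^ ∣ rowH A - colH A ∣ ≤ 2 ^ hvs A)
    trivialRank A {t} d with ℕP.≤-total (rowH A) (colH A)
    ... | inj₁ le = 2 ^ rowBits A , Rk-rows A (λ a a' e → d a a' (λ l m → e l (λ _ → m))) , ℕP.≤-reflexive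
        (≡.trans (≡.sym (ℕP.^-distribˡ-+-* 2 (rowBits A) _)) (≡.cong (2 ^_) (≡.trans (≡.cong₂ _+_ (rowBits≡ A) (ℕP.m≤n⇒∣m-n∣≡n∸m le))
          (≡.trans (≡.cong (_+ (colH A ∸ rowH A)) (≡.cong (rowH A +_) (ℕP.+-identityʳ _))) (≡.trans (ℕP.+-assoc (rowH A) _ _) (≡.trans (≡.cong (rowH A +_) (ℕP.m+[n∸m]≡n le)) (hvs≡ A)))))))
    ... | inj₂ le = 2 ^ Rank.rowBits (not ∘ side) A , Rk-flip side (Rank.Rk-rows (not ∘ side) A (λ a a' e → d a a' (λ l m → e l (λ _ → m)))) , ℕP.≤-reflexive
        (≡.trans (≡.sym (ℕP.^-distribˡ-+-* 2 (Rank.rowBits (not ∘ side) A) _)) (≡.cong (2 ^_) (≡.trans (≡.cong₂ _+_ (colBits≡ A) (ℕP.m≤n⇒∣n-m∣≡n∸m le))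
          (≡.trans (≡.cong (_+ (rowH A ∸ colH A)) (≡.cong (colH A +_) (ℕP.+-identityʳ _))) (≡.trans (ℕP.+-assoc (colH A) _ _) (≡.trans (≡.cong (colH A +_) (ℕP.m+[n∸m]≡n le)) (≡.trans (ℕP.+-comm (colH A) _) (hvs≡ A))))))))

    Rk-scale : ∀ {n t} c → Rk n t → Rk n (λ a → c K.* t a)
    Rk-scale {n} c h = Rk-≤ (ℕP.≤-reflexive (ℕP.*-identityˡ n)) (Rk-* (Rk-resp (λ a → K.*-identityʳ _) (Rk-1 (λ _ → c) (λ _ → K.1#) (λ _ _ _ → K.refl) (λ _ _ _ → K.refl))) h)

    -- The component of u at a set S of leaves only depends on the strings at S and at A.
    DepE : List Leaf → ∀ es → E.Carrier es → Set ℓ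
    DepE A [] t = DependsOn (_∈ A) t
    DepE A (l ∷ es) (u₀ , u₁) = DepE A es u₀ × DepE (l ∷ A) es u₁

    DepE-⊆ : ∀ {A B} es {u} → (∀ {l} → l ∈ A → l ∈ B) → DepE A es u → DepE B es u
    DepE-⊆ [] sub d a a' e = d a a' (λ l m → e l (sub m))
    DepE-⊆ (l ∷ es) sub (d , d') = DepE-⊆ es sub d , DepE-⊆ es (λ { (here p) → here p ; (there m) → there (sub m) }) d'

    DepE-resp : ∀ {A} es {u v} → E._≈_ es u v → DepE A es u → DepE A es v
    DepE-resp [] e d a a' g = K.trans (K.sym (e a)) (K.trans (d a a' g) (e a'))
    DepE-resp (l ∷ es) (e , e') (d , d') = DepE-resp es e d , DepE-resp es e' d'

    DepE-const : ∀ {A} es {t} → DependsOn (_∈ A) t → DepE A es (const es t)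
    DepE-0 : ∀ {A} es → DepE A es (E.0# es)
    DepE-const [] d = d
    DepE-const (l ∷ es) d = DepE-const es d , DepE-0 es
    DepE-0 [] a a' e = K.refl
    DepE-0 (l ∷ es) = DepE-0 es , DepE-0 es

    DepE-+ : ∀ {A} es {u v} → DepE A es u → DepE A es v → DepE A es (E._+_ es u v)
    DepE-+ [] d d' a a' e = K.+-cong (d a a' e) (d' a a' e)
    DepE-+ (l ∷ es) (d , e) (d' , e') = DepE-+ es d d' , DepE-+ es e e'

    DepE-neg : ∀ {A} es {u} → DepE A es u → DepE A es (E.-_ es u)
    DepE-neg [] d a a' e = K.-‿cong (d a a' e)
    DepE-neg (l ∷ es) (d , e) = DepE-neg es d , DepE-neg es e

    DepE-* : ∀ {A} es {u v} → DepE A es u → DepE A es v → DepE A es (E._*_ es u v)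
    DepE-* [] d d' a a' e = K.*-cong (d a a' e) (d' a a' e)
    DepE-* (l ∷ es) (d , e) (d' , e') = DepE-* es d d' , DepE-+ es (DepE-* es (DepE-⊆ es there d) e') (DepE-* es e (DepE-⊆ es there d'))

    DepE-ι : ∀ {A} es a → DepE A es (E.ι es a)
    DepE-ι es a = DepE-resp es (E.sym es (const-ι es a)) (DepE-const es (λ _ _ _ → K.refl))

    depRel : ∀ es → GradedRel F (EAlg es) (EAlg es) ℓ
    depRel es = record { Rel = λ _ u _ → DepE [] es u ; rel-con = DepE-ι es ; rel-resp = λ e _ → DepE-resp es e ; rel-≤ = λ _ d → d
      ; rel-+ = DepE-+ es ; rel-* = DepE-* es }

    DepE-inv : ∀ {A} es {u i} → DepE A es u → DependsOn (_∈ A) i → DepE A es (inv es u i)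
    DepE-inv [] d di = di
    DepE-inv (l ∷ es) (d , e) di = dv , DepE-neg es (DepE-* es e (DepE-* es (DepE-⊆ es there dv) (DepE-⊆ es there dv)))
      where dv = DepE-inv es d di

    DepE-log : ∀ {A} es {u i} → DepE A es u → DependsOn (_∈ A) i → DepE A es (log es u i)
    DepE-log [] d di = λ _ _ _ → K.refl
    DepE-log (l ∷ es) (d , e) di = DepE-log es d di , DepE-* es e (DepE-⊆ es there (DepE-inv es d di))

    DepE-∑ : ∀ {A b} es {X : Set b} (xs : List X) (g : X → E.Carrier es) → (∀ x → DepE A es (g x)) → DepE A es (Sums.∑ (E.cring es) xs g)
    DepE-∑ es [] g h = DepE-0 es
    DepE-∑ es (x ∷ xs) g h = DepE-+ es (h x) (DepE-∑ es xs g h)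

    -- The components at sets of more than θ leaves have relative rank at most M / 2^Λ.
    BigE : ℕ → ℕ → List Leaf → ∀ es → E.Carrier es → Set (c ⊔ ℓ)
    BigE θ M A [] t = θ < length A → Σ ℕ λ R → Rk R t × (R * 2 ^ Λ ≤ M * 2 ^ hvs A)
    BigE θ M A (l ∷ es) (u₀ , u₁) = BigE θ M A es u₀ × BigE θ M (l ∷ A) es u₁

    BigE-≤ : ∀ {θ θ' M M' A} es {u} → θ ≤ θ' → M ≤ M' → BigE θ M A es u → BigE θ' M' A es u
    BigE-≤ {A = A} [] le le' h lt with h (ℕP.≤-<-trans le lt)
    ... | R , rk , b = R , rk , ℕP.≤-trans b (ℕP.*-monoˡ-≤ (2 ^ hvs A) le')
    BigE-≤ (l ∷ es) le le' (h , h') = BigE-≤ es le le' h , BigE-≤ es le le' h'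

    BigE-resp : ∀ {θ M A} es {u v} → E._≈_ es u v → BigE θ M A es u → BigE θ M A es v
    BigE-resp [] e h lt with h lt
    ... | R , rk , b = R , Rk-resp e rk , b
    BigE-resp (l ∷ es) (e , e') (h , h') = BigE-resp es e h , BigE-resp es e' h'

    BigE-0 : ∀ {θ A} es → BigE θ 0 A es (E.0# es)
    BigE-0 [] lt = 0 , Rk-0 (λ _ → K.refl) , z≤n
    BigE-0 (l ∷ es) = BigE-0 es , BigE-0 es

    BigE-+ : ∀ {θ M M' A} es {u v} → BigE θ M A es u → BigE θ M' A es v → BigE θ (M + M') A es (E._+_ es u v)
    BigE-+ {M = M} {M'} {A} [] h h' lt with h lt | h' lt
    ... | R , rk , b | R' , rk' , b' = R + R' , Rk-+ rk rk' , ℕP.≤-trans (ℕP.≤-reflexive (ℕP.*-distribʳ-+ (2 ^ Λ) R R'))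
      (ℕP.≤-trans (ℕP.+-mono-≤ b b') (ℕP.≤-reflexive (≡.sym (ℕP.*-distribʳ-+ (2 ^ hvs A) M M'))))
    BigE-+ (l ∷ es) (h , e) (h' , e') = BigE-+ es h h' , BigE-+ es e e'

    BigE-scale : ∀ {θ M A} es a {u} → BigE θ M A es u → BigE θ M A es (E._*_ es (E.ι es a) u)
    BigE-scale [] a h lt with h lt
    ... | R , rk , b = R , Rk-scale a rk , b
    BigE-scale (l ∷ es) a (h , e) = BigE-scale es a h ,
      BigE-resp es (E.trans es (E.sym es (E.+-identityʳ es _)) (E.+-congˡ es (E.sym es (E.zeroˡ es _)))) (BigE-scale es a e)

    BigE-∑ : ∀ {θ M A b} es {X : Set b} (xs : List X) (g : X → E.Carrier es) → (∀ x → BigE θ M A es (g x)) → BigE θ (length xs * M) A es (Sums.∑ (E.cring es) xs g)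
    BigE-∑ es [] g h = BigE-0 es
    BigE-∑ es (x ∷ xs) g h = BigE-+ es (h x) (BigE-∑ es xs g h)

    BigE-sumTo : ∀ {θ M A} es n (g : ℕ → E.Carrier es) → (∀ l → l ≤ n → BigE θ M A es (g l)) → BigE θ (suc n * M) A es (SumTo.sumTo (E.cring es) n g)
    BigE-sumTo {M = M} es zero g h = BigE-≤ es ℕP.≤-refl (ℕP.≤-reflexive (≡.sym (ℕP.*-identityˡ M))) (h 0 z≤n)
    BigE-sumTo es (suc n) g h = BigE-+ es (h 0 z≤n) (BigE-sumTo es n (g ∘ suc) (λ l le → h (suc l) (s≤s le)))

    record Lvl : Set where
      field
        θ w θ' : ℕ
        θ≤θ'   : θ ≤ θ'
        small  : ∀ A → 1 ≤ length A → length A ≤ θ → w ≤ ∣ rowH A - colH A ∣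
        step   : ∀ n k → θ' < n → n ≤ k * θ → Λ ≤ k * w

    module Gen (lv : Lvl) (M : ℕ) (M≥1 : 1 ≤ M) where
      open Lvl lv using (small; step; w; θ; θ')

      -- Tensors of shape (V, n), i.e. on n leaves of total half-length V, of small rank because they are products
      -- of many imbalanced factors or because they have a factor that is already known to have small rank.
      data Nice (V n : ℕ) (t : Tens) : Set (c ⊔ ℓ) where
        thin  : (Σ ℕ λ R → Rk R t × Σ ℕ λ k → (n ≤ k * θ) × (R * 2 ^ (k * w) ≤ 2 ^ V)) → Nice V n t
        thick : (Σ ℕ λ R → Rk R t × (R ≤ 2 ^ V)) × (Σ ℕ λ R → Rk R t × (R * 2 ^ Λ ≤ M * 2 ^ V)) → Nice V n t

      nice-trivial : ∀ {V n t} → Nice V n t → Σ ℕ λ R → Rk R t × (R ≤ 2 ^ V)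
      nice-trivial (thin (R , rk , k , _ , b)) = R , rk , ℕP.≤-trans (ℕP.m≤m*n R (2 ^ (k * w)) {{ℕP.m^n≢0 2 (k * w)}}) b
      nice-trivial (thick (h , _)) = h

      private
        mul-≤ : ∀ {a b x y p q} → a * x ≤ p → b * y ≤ q → (a * b) * (x * y) ≤ p * q
        mul-≤ {a} {b} {x} {y} h h' = ℕP.≤-trans (ℕP.≤-reflexive (*-interchange a b x y)) (ℕP.*-mono-≤ h h')

        pow-+ : ∀ a b → 2 ^ a * 2 ^ b ≡ 2 ^ (a + b)
        pow-+ a b = ≡.sym (ℕP.^-distribˡ-+-* 2 a b)

      nice-* : ∀ {V V' n n' t t'} → Nice V n t → Nice V' n' t' → Nice (V + V') (n + n') (λ a → t a K.* t' a)
      nice-* {V} {V'} {n} {n'} (thin (R , rk , k , h , b)) (thin (R' , rk' , k' , h' , b')) =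
        thin (R * R' , Rk-* rk rk' , k + k' , ℕP.≤-trans (ℕP.+-mono-≤ h h') (ℕP.≤-reflexive (≡.sym (ℕP.*-distribʳ-+ θ k k'))) ,
          (begin R * R' * 2 ^ ((k + k') * w) ≡⟨ ≡.cong (λ z → R * R' * 2 ^ z) (ℕP.*-distribʳ-+ w k k') ⟩
                 R * R' * 2 ^ (k * w + k' * w) ≡⟨ ≡.cong (R * R' *_) (≡.sym (pow-+ (k * w) (k' * w))) ⟩
                 R * R' * (2 ^ (k * w) * 2 ^ (k' * w)) ≤⟨ mul-≤ {R} {R'} b b' ⟩
                 2 ^ V * 2 ^ V' ≡⟨ pow-+ V V' ⟩
                 2 ^ (V + V') ∎))
        where open ≤-Reasoning
      nice-* {V} {V'} {t = t} {t'} p@(thin _) q@(thick (_ , R₂ , rk₂ , b₂)) with nice-trivial p | nice-trivial q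
      ... | R , rk , b | R' , rk' , b' = thick ((R * R' , Rk-* rk rk' , ℕP.≤-trans (ℕP.*-mono-≤ b b') (ℕP.≤-reflexive (pow-+ V V'))) ,
          (R * R₂ , Rk-* rk rk₂ , (begin
             R * R₂ * 2 ^ Λ ≡⟨ ℕP.*-assoc R R₂ _ ⟩
             R * (R₂ * 2 ^ Λ) ≤⟨ ℕP.*-mono-≤ b b₂ ⟩
             2 ^ V * (M * 2 ^ V') ≡⟨ ≡.trans (≡.sym (ℕP.*-assoc (2 ^ V) M _)) (≡.trans (≡.cong (_* 2 ^ V') (ℕP.*-comm (2 ^ V) M)) (ℕP.*-assoc M _ _)) ⟩
             M * (2 ^ V * 2 ^ V') ≡⟨ ≡.cong (M *_) (pow-+ V V') ⟩
             M * 2 ^ (V + V') ∎)))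
        where open ≤-Reasoning
      nice-* {V} {V'} p@(thick (_ , R₂ , rk₂ , b₂)) q with nice-trivial p | nice-trivial q
      ... | R , rk , b | R' , rk' , b' = thick ((R * R' , Rk-* rk rk' , ℕP.≤-trans (ℕP.*-mono-≤ b b') (ℕP.≤-reflexive (pow-+ V V'))) ,
          (R₂ * R' , Rk-* rk₂ rk' , (begin
             R₂ * R' * 2 ^ Λ ≡⟨ ≡.trans (ℕP.*-assoc R₂ R' _) (≡.trans (≡.cong (R₂ *_) (ℕP.*-comm R' _)) (≡.sym (ℕP.*-assoc R₂ _ R'))) ⟩
             R₂ * 2 ^ Λ * R' ≤⟨ ℕP.*-mono-≤ b₂ b' ⟩
             M * 2 ^ V * 2 ^ V' ≡⟨ ≡.trans (ℕP.*-assoc M _ _) (≡.cong (M *_) (pow-+ V V')) ⟩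
             M * 2 ^ (V + V') ∎)))
        where open ≤-Reasoning

      nice-scale : ∀ {V n t} c → Nice V n t → Nice V n (λ a → c K.* t a)
      nice-scale c (thin (R , rk , h)) = thin (R , Rk-scale c rk , h)
      nice-scale c (thick ((R , rk , h) , (R' , rk' , h'))) = thick ((R , Rk-scale c rk , h) , (R' , Rk-scale c rk' , h'))

      nice-big : ∀ {V n t} → Nice V n t → θ' < n → Σ ℕ λ R → Rk R t × (R * 2 ^ Λ ≤ M * 2 ^ V)
      nice-big {V} {n} (thin (R , rk , k , h , b)) lt = R , rk , ℕP.≤-trans (ℕP.*-monoʳ-≤ R (ℕP.^-monoʳ-≤ 2 (step n k lt h)))
        (ℕP.≤-trans b (ℕP.≤-trans (ℕP.≤-reflexive (≡.sym (ℕP.*-identityˡ _))) (ℕP.*-monoˡ-≤ (2 ^ V) M≥1)))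
      nice-big (thick (_ , h)) lt = h

      GenT : ℕ → ℕ → ℕ → Tens → Set (c ⊔ ℓ)
      GenT N V n t = Σ (List (Σ Tens (Nice V n))) λ ts → (length ts ≤ N) × (∀ a → t a K.≈ ∑ ts (λ s → proj₁ s a))

      private
        shape : ∀ {V V' n n' N t} → V ≡ V' → n ≡ n' → GenT N V n t → GenT N V' n' t
        shape ≡.refl ≡.refl h = h

      GenE : ℕ → ℕ → ℕ → ∀ es → E.Carrier es → Set (c ⊔ ℓ)
      GenE N V n [] t = GenT N V n t
      GenE N V n (l ∷ es) (u₀ , u₁) = GenE N V n es u₀ × GenE N (hv l + V) (suc n) es u₁

      GenE-shape : ∀ {V V' n n' N} es {u} → V ≡ V' → n ≡ n' → GenE N V n es u → GenE N V' n' es u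
      GenE-shape es ≡.refl ≡.refl h = h

      GenE-resp : ∀ {N V n} es {u v} → E._≈_ es u v → GenE N V n es u → GenE N V n es v
      GenE-resp [] e (ts , le , h) = ts , le , λ a → K.trans (K.sym (e a)) (h a)
      GenE-resp (l ∷ es) (e , e') (g , g') = GenE-resp es e g , GenE-resp es e' g'

      GenE-≤ : ∀ {N N' V n} es {u} → N ≤ N' → GenE N V n es u → GenE N' V n es u
      GenE-≤ [] le (ts , le' , h) = ts , ℕP.≤-trans le' le , h
      GenE-≤ (l ∷ es) le (g , g') = GenE-≤ es le g , GenE-≤ es le g'

      GenE-0 : ∀ {V n} es → GenE 0 V n es (E.0# es)
      GenE-0 [] = [] , z≤n , λ a → K.refl
      GenE-0 (l ∷ es) = GenE-0 es , GenE-0 es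

      GenE-const : ∀ es {t} → DependsOn (_∈ []) t → GenE 1 0 0 es (const es t)
      GenE-const [] {t} d = ((t , thin (1 , Rk-rows [] (λ a a' e → d a a' (λ _ ())) , 0 , z≤n , ℕP.≤-refl)) ∷ []) , s≤s z≤n , λ a → K.sym (K.+-identityʳ _)
      GenE-const (l ∷ es) d = GenE-const es d , GenE-≤ es z≤n (GenE-0 es)

      GenE-+ : ∀ {N N' V n} es {u v} → GenE N V n es u → GenE N' V n es v → GenE (N + N') V n es (E._+_ es u v)
      GenE-+ [] (ts , le , h) (ts' , le' , h') = ts ++ ts' , ℕP.≤-trans (ℕP.≤-reflexive (LP.length-++ ts)) (ℕP.+-mono-≤ le le') ,
        λ a → K.trans (K.+-cong (h a) (h' a)) (K.sym (∑-++ ts ts' _))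
      GenE-+ (l ∷ es) (g , e) (g' , e') = GenE-+ es g g' , GenE-+ es e e'

      private
        GenT-* : ∀ {N N' V V' n n' t t'} → GenT N V n t → GenT N' V' n' t' → GenT (N * N') (V + V') (n + n') (λ a → t a K.* t' a)
        GenT-* {N} {N'} {V} {V'} {n} {n'} (ts , le , h) (ts' , le' , h') = concatMap (λ s → map (mul s) ts') ts ,
          ℕP.≤-trans (ℕP.≤-reflexive (length-concatMap _ ts (length ts') (λ s → LP.length-map (mul s) ts'))) (ℕP.*-mono-≤ le le') ,
          λ a → K.trans (K.*-cong (h a) (h' a)) (K.trans (∑-* ts (λ s → proj₁ s a) _) (K.trans (∑-cong ts (λ s → K.trans (*-∑ (proj₁ s a) ts' (λ s → proj₁ s a))
            (K.sym (∑-map (mul s) ts' (λ s → proj₁ s a))))) (K.sym (∑-concatMap _ ts (λ s → proj₁ s a)))))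
          where
          mul : Σ Tens (Nice V n) → Σ Tens (Nice V' n') → Σ Tens (Nice (V + V') (n + n'))
          mul (t , p) (t' , p') = (λ a → t a K.* t' a) , nice-* p p'

        *-commute : ∀ k N N' → 2 * (2 ^ k * (N * N')) ≡ 2 ^ k * (N * N') + 2 ^ k * (N * N')
        *-commute k N N' = ≡.cong (2 ^ k * (N * N') +_) (ℕP.+-identityʳ _)

      GenE-* : ∀ {N N' V V' n n'} es {u v} → GenE N V n es u → GenE N' V' n' es v → GenE (2 ^ length es * (N * N')) (V + V') (n + n') es (E._*_ es u v)
      GenE-* {N} {N'} [] g g' = GenE-≤ [] (ℕP.≤-reflexive (≡.sym (ℕP.*-identityˡ (N * N')))) (GenT-* g g')
      GenE-* {N} {N'} {V} {V'} {n} {n'} (l ∷ es) (g , e) (g' , e') =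
        GenE-≤ es (ℕP.*-monoˡ-≤ (N * N') (ℕP.^-monoʳ-≤ 2 (ℕP.n≤1+n (length es)))) (GenE-* es g g') ,
        GenE-≤ es (ℕP.≤-reflexive (≡.trans (≡.sym (*-commute (length es) N N')) (≡.sym (ℕP.*-assoc 2 (2 ^ length es) _))))
          (GenE-+ es (GenE-shape es (≡.trans (≡.sym (ℕP.+-assoc V (hv l) V')) (≡.trans (≡.cong (_+ V') (ℕP.+-comm V (hv l))) (ℕP.+-assoc (hv l) V V'))) (ℕP.+-suc n n') (GenE-* es g e'))
                     (GenE-shape es (ℕP.+-assoc (hv l) V V') ≡.refl (GenE-* es e g')))

      GenE-neg : ∀ {N V n} es {u} → GenE N V n es u → GenE N V n es (E.-_ es u)
      GenE-neg {N} {V} {n} [] {u} (ts , le , h) = map neg ts , ℕP.≤-trans (ℕP.≤-reflexive (LP.length-map neg ts)) le ,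
        λ a → K.trans (K.sym (-1*x≈-x (u a))) (K.trans (K.*-congˡ (h a)) (K.trans (*-∑ (K.- K.1#) ts (λ s → proj₁ s a)) (K.sym (∑-map neg ts (λ s → proj₁ s a)))))
        where
        open import Algebra.Properties.Ring K.ring using (-1*x≈-x)
        neg : Σ Tens (Nice V n) → Σ Tens (Nice V n)
        neg (t , p) = (λ a → K.- K.1# K.* t a) , nice-scale (K.- K.1#) p
      GenE-neg (l ∷ es) (g , e) = GenE-neg es g , GenE-neg es e

      GenE-top : ∀ {N V n} es {u} → GenE N V n es u → GenT N (hvs es + V) (length es + n) (top es u)
      GenE-top [] g = g
      GenE-top {V = V} {n} (l ∷ es) (_ , g) = shape (≡.trans (≡.sym (ℕP.+-assoc (hvs es) (hv l) V)) (≡.cong (_+ V) (ℕP.+-comm (hvs es) (hv l)))) (ℕP.+-suc (length es) n) (GenE-top es g)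

      GenT⇒big : ∀ {N V n t} → GenT N V n t → θ' < n → Σ ℕ λ R → Rk R t × (R * 2 ^ Λ ≤ (N * M) * 2 ^ V)
      GenT⇒big {N} {V} (ts , le , h) lt with go ts
        where
        go : ∀ ts → Σ ℕ λ R → Rk R (λ a → ∑ ts (λ s → proj₁ s a)) × (R * 2 ^ Λ ≤ (length ts * M) * 2 ^ V)
        go [] = 0 , Rk-0 (λ _ → K.refl) , z≤n
        go ((t , p) ∷ ts) with nice-big p lt | go ts
        ... | R , rk , b | R' , rk' , b' = R + R' , Rk-+ rk rk' , ℕP.≤-trans (ℕP.≤-reflexive (ℕP.*-distribʳ-+ (2 ^ Λ) R R'))
          (ℕP.≤-trans (ℕP.+-mono-≤ b b') (ℕP.≤-reflexive (≡.sym (ℕP.*-distribʳ-+ (2 ^ V) M (length ts * M)))))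
      ... | R , rk , b = R , Rk-resp (λ a → K.sym (h a)) rk , ℕP.≤-trans b (ℕP.*-monoˡ-≤ (2 ^ V) (ℕP.*-monoˡ-≤ M le))

      GenE⇒BigE : ∀ {N A} es {u} → GenE N (hvs A) (length A) es u → BigE θ' (N * M) A es u
      GenE⇒BigE [] g lt = GenT⇒big g lt
      GenE⇒BigE (l ∷ es) (g , e) = GenE⇒BigE es g , GenE⇒BigE es e

      good⇒GenE : ∀ {A} es {u} → DepE A es u → BigE θ M A es u → GenE 1 (hvs A) (length A) es u
      good⇒GenE {A} [] {u} d h = ((u , nice (ℕP.<-cmp (length A) (suc θ))) ∷ []) , s≤s z≤n , λ a → K.sym (K.+-identityʳ _)
        where
        open import Relation.Binary.Definitions using (Tri; tri<; tri≈; tri>)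
        isBig : θ < length A → Nice (hvs A) (length A) u
        isBig lt with trivialRank A d
        ... | R , rk , b = thick ((R , rk , ℕP.≤-trans (ℕP.m≤m*n R (2 ^ ∣ rowH A - colH A ∣) {{ℕP.m^n≢0 2 ∣ rowH A - colH A ∣}}) b) , h lt)
        isSmall : length A ≤ θ → 1 ≤ length A → Nice (hvs A) (length A) u
        isSmall le pos with trivialRank A d
        ... | R , rk , b = thin (R , rk , 1 , ℕP.≤-trans le (ℕP.≤-reflexive (≡.sym (ℕP.*-identityˡ θ))) ,
          ℕP.≤-trans (ℕP.*-monoʳ-≤ R (ℕP.^-monoʳ-≤ 2 (ℕP.≤-trans (ℕP.≤-reflexive (ℕP.*-identityˡ w)) (small A pos le)))) b)
        isScalar : length A ≡ 0 → Nice (hvs A) (length A) u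
        isScalar z with trivialRank A d
        ... | R , rk , b = thin (R , rk , 0 , ℕP.≤-reflexive z , ℕP.≤-trans (ℕP.*-monoʳ-≤ R (ℕP.^-monoʳ-≤ 2 (z≤n {∣ rowH A - colH A ∣}))) b)
        nice : Tri (length A < suc θ) (length A ≡ suc θ) (length A ℕ.> suc θ) → Nice (hvs A) (length A) u
        nice (tri≈ _ e _) = isBig (ℕP.≤-reflexive (≡.sym e))
        nice (tri> _ _ gt) = isBig (ℕP.<-trans (ℕP.n<1+n θ) gt)
        nice (tri< lt _ _) with length A ℕ.≟ 0
        ... | yes z = isScalar z
        ... | no nz = isSmall (ℕP.≤-pred lt) (ℕP.n≢0⇒n>0 nz)
      good⇒GenE (l ∷ es) (d , d') (h , h') = good⇒GenE es d h , good⇒GenE es d' h'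

module GateBounds where
  open CommutativeAlgebra
  open FormulaSemantics
  open DualNumberTower
  open LowRankDecomposition
  open import Defs using (Field; module Field)
  open import Data.List.Relation.Unary.All using (All; []; _∷_)

  -- Bounds for the numbers of products in the expansions; d is the number of leaves.
  invCount : ℕ → ℕ → ℕ
  invCount N zero = 1
  invCount N (suc d) = invCount N d ℕ.+ 2 ^ d ℕ.* (N ℕ.* (2 ^ d ℕ.* (invCount N d ℕ.* invCount N d)))

  logCount expCount : ℕ → ℕ
  logCount zero = 1
  logCount (suc d) = logCount d ℕ.+ 2 ^ d ℕ.* (1 ℕ.* invCount 1 d)
  expCount zero = 1
  expCount (suc d) = expCount d ℕ.+ 2 ^ d ℕ.* (1 ℕ.* expCount d)

  powCount : ℕ → ℕ → ℕ
  powCount d zero = 1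
  powCount d (suc k) = 2 ^ d ℕ.* (1 ℕ.* powCount d k)

  timesCount : ℕ → ℕ
  timesCount d = 2 ^ d ℕ.* (powCount d d ℕ.* expCount d)

  evCount dvCount : ℕ → ℕ → ℕ → ℕ
  evCount d c zero = 1
  evCount d c (suc n) = 1 ℕ.+ 2 ^ d ℕ.* (c ℕ.* evCount d c n)
  dvCount d c zero = 0
  dvCount d c (suc n) = evCount d c n ℕ.+ 2 ^ d ℕ.* (c ℕ.* dvCount d c n)

  rootCount : ℕ → ℕ → ℕ
  rootCount n zero = 0
  rootCount n (suc d) = c ℕ.+ 2 ^ d ℕ.* (evCount d c n ℕ.* invCount (dvCount d c n) d)
    where c = rootCount n d

  logCount≥1 : ∀ d → 1 ≤ logCount d
  logCount≥1 zero = s≤s z≤n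
  logCount≥1 (suc d) = ℕP.≤-trans (logCount≥1 d) (ℕP.m≤m+n _ _)

  powCount-mono : ∀ d {k m} → k ≤ m → powCount d k ≤ powCount d m
  powCount-mono d {zero} {zero} le = ℕP.≤-refl
  powCount-mono d {zero} {suc m} le = ℕP.≤-trans (powCount-mono d {zero} {m} z≤n) (ℕP.≤-trans (ℕP.≤-reflexive (≡.sym (ℕP.*-identityˡ _))) (ℕP.m≤n*m (1 ℕ.* powCount d m) (2 ^ d) {{ℕP.m^n≢0 2 d}}))
  powCount-mono d {suc k} {suc m} (s≤s le) = ℕP.*-monoʳ-≤ (2 ^ d) (ℕP.*-monoʳ-≤ 1 (powCount-mono d le))

  module Gates {c ℓ : Level} (F : Field c ℓ) (Leaf : Set) (_≟ℓ_ : DecidableEquality Leaf) (len : Leaf → ℕ)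
    (side : Leaf → Bool) (hv : Leaf → ℕ) (len≡ : ∀ l → len l ≡ 2 ℕ.* hv l) (Λ : ℕ) where

    open LowRank F Leaf _≟ℓ_ len side hv len≡ Λ using (Agree; BigE; BigE-+; BigE-0; BigE-resp; BigE-scale; BigE-sumTo; BigE-∑; BigE-≤; ColDep; DepE; DepE-*; DepE-+; DepE-0; DepE-const; DepE-inv; DepE-log; DepE-neg; DepE-resp; DepE-ι; DepE-∑; DepE-⊆; DependsOn; EAlg; Idx; K; Lvl; Nil; Rank1; Rk; Rk-*; Rk-+; Rk-0; Rk-1; Rk-flip; Rk-resp; Rk-rows; Rk-scale; Rk-∑; Rk-≤; RowDep; Tens; Unit; base; base-*; base-+; base-0; base-1; base-cong; baseHom; colH; const; const-*; const-ι; depRel; entry; ev-nilpotent; exp; exp-cong; exp-log; fun≡base; hvs; inv; inv-correct; log; log-*; log-1; nilpotent; rowBits; rowH; set; set-agree; set-id; top; top-+; top-0; top-cong; top-const-*; trivialRank; ∏-units; ∏-units≈exp; ∏E; ∑-logs; 𝒯; module E; module Gen; module Lvl; module Rank; module T) public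
    private module K = CommutativeRing K using (*-comm; *-cong; *-congʳ; *-congˡ; *-identityʳ; *-identityˡ; +-assoc; +-comm; +-commutativeMonoid; +-cong; +-congʳ; +-congˡ; +-identityʳ; +-identityˡ; -‿cong; -‿inverseʳ; -‿inverseˡ; distribʳ; distribˡ; refl; reflexive; ring; semiring; sym; trans; zeroʳ; zeroˡ; _+_; _*_; -_; _-_; _≈_; 0#; 1#)

    module Expansions (lv : Lvl) (M : ℕ) (M≥1 : 1 ≤ M) where
      open Gen lv M M≥1 using (GenE; GenE-*; GenE-+; GenE-0; GenE-const; GenE-neg; GenE-resp; GenE-shape; GenE-top; GenE-≤; GenE⇒BigE; GenT; GenT⇒big; Nice; good⇒GenE; nice-*; nice-big; nice-scale; nice-trivial; thick; thin; module Nice) public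

      GenE-inv : ∀ {N} es {u i} → GenE N 0 0 es u → DependsOn (_∈ []) i → GenE (invCount N (length es)) 0 0 es (inv es u i)
      GenE-inv [] g d = GenE-const [] d
      GenE-inv (l ∷ es) (g , e) d = GenE-≤ es (ℕP.m≤m+n _ _) v , GenE-≤ es (ℕP.m≤n+m _ _)
        (GenE-neg es (GenE-shape es (ℕP.+-identityʳ _) ≡.refl (GenE-* es e (GenE-* es v v))))
        where v = GenE-inv es g d

      GenE-log : ∀ es {u i} → GenE 1 0 0 es u → DependsOn (_∈ []) i → GenE (logCount (length es)) 0 0 es (log es u i)
      GenE-log [] g d = GenE-≤ [] z≤n (GenE-0 [])
      GenE-log (l ∷ es) (g , e) d = GenE-≤ es (ℕP.m≤m+n _ _) (GenE-log es g d) , GenE-≤ es (ℕP.m≤n+m _ _)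
        (GenE-shape es (ℕP.+-identityʳ _) ≡.refl (GenE-* es e (GenE-inv es g d)))

      GenE-exp : ∀ es {h k} → GenE 1 0 0 es h → DependsOn (_∈ []) k → GenE (expCount (length es)) 0 0 es (exp es h k)
      GenE-exp [] g d = GenE-const [] d
      GenE-exp (l ∷ es) (g , e) d = GenE-≤ es (ℕP.m≤m+n _ _) IH , GenE-≤ es (ℕP.m≤n+m _ _)
        (GenE-shape es (ℕP.+-identityʳ _) ≡.refl (GenE-* es e IH))
        where IH = GenE-exp es g d

      GenE-1 : ∀ es → GenE 1 0 0 es (E.1# es)
      GenE-1 es = GenE-resp es (E.trans es (E.sym es (const-ι es (Field.1# F))) (E.ι-1 es)) (GenE-const es (λ _ _ _ → K.refl))

      module _ (es : List Leaf) where
        open Alg (EAlg es) using (*-congʳ; +-cong; +-congˡ; +-identityʳ; refl; trans; zero; zeroˡ; _≈_; cring)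
        open Horner cring using (ev)
        open Derivative cring using (dv)

        GenE-ev : ∀ {V n k} m r ν → (∀ j → GenE 1 V n es (r j)) → GenE k 0 0 es ν → GenE (evCount (length es) k m) V n es (ev m r ν)
        GenE-ev zero r ν h g = h 0
        GenE-ev (suc m) r ν h g = GenE-+ es (h 0) (GenE-* es g (GenE-ev m (r ∘ suc) ν (h ∘ suc) g))

        GenE-dv : ∀ {V n k} m r ν → (∀ j → GenE 1 V n es (r j)) → GenE k 0 0 es ν → GenE (dvCount (length es) k m) V n es (dv m r ν)
        GenE-dv zero r ν h g = GenE-0 es
        GenE-dv (suc m) r ν h g = GenE-+ es (GenE-ev m (r ∘ suc) ν (h ∘ suc) g) (GenE-* es g (GenE-dv m (r ∘ suc) ν (h ∘ suc) g))

        base-ev : ∀ m r ν → Nil es ν → base es (ev m r ν) T.≈ base es (r 0)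
        base-ev zero r ν h = T.refl
        base-ev (suc m) r ν h = T.trans (base-+ es _ _) (T.trans (T.+-congˡ {base es (r 0)} (T.trans (base-* es ν _) (T.trans (T.*-congʳ {_} {base es ν} h) (T.zeroˡ (base es (ev m (r ∘ suc) ν)))))) (T.+-identityʳ (base es (r 0))))

        base-dv : ∀ m r ν → Nil es ν → base es (dv (suc m) r ν) T.≈ base es (r 1)
        base-dv m r ν h = T.trans (base-+ es _ _) (T.trans (T.+-cong {base es (ev m (r ∘ suc) ν)} (base-ev m (r ∘ suc) ν h) (T.trans (base-* es ν _) (T.trans (T.*-congʳ {_} {base es ν} h) (T.zeroˡ (base es (dv m (r ∘ suc) ν)))))) (T.+-identityʳ (base es (r 1))))

      -- A simple root ν of a polynomial r is computed one ε at a time: the coefficient of ε in r(ν) = 0 is linear in that of ν.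
      GenE-root : ∀ m es r ν i → (∀ j → GenE 1 0 0 es (r j)) → Nil es ν → base es (r 1) T.* i T.≈ T.1# → DependsOn (_∈ []) i →
        E._≈_ es (Horner.ev (E.cring es) (suc m) r ν) (E.0# es) → GenE (rootCount (suc m) (length es)) 0 0 es ν
      GenE-root m [] r ν i h nil unit di root = GenE-resp [] (T.sym {ν} nil) (GenE-0 [])
      GenE-root m (l ∷ es) r (ν₀ , ν₁) i h nil unit di (root₀ , root₁) = GenE-≤ es (ℕP.m≤m+n _ _) IH , GenE-resp es (sym solve) (GenE-≤ es (ℕP.m≤n+m _ _)
          (GenE-neg es (GenE-shape es (ℕP.+-identityʳ _) ≡.refl (GenE-* es (GenE-ev es (suc m) (proj₂ ∘ r) ν₀ (proj₂ ∘ h) IH)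
            (GenE-inv es (GenE-dv es (suc m) (proj₁ ∘ r) ν₀ (proj₁ ∘ h) IH) di)))))
        where
        open Alg (EAlg es) using (*-congʳ; *-identityˡ; +-congʳ; +-identityʳ; +-identityˡ; refl; sym; trans; zeroˡ; _*_; -_; _-_; _≈_; 1#; cring)
        open Horner cring using (ev)
        open Derivative cring using (dv; ev-dual)
        open RS cring using (rsolve; _:+_; _:*_; :-_; _:-_; _⊜_)
        expand = ev-dual (suc m) r (ν₀ , ν₁)
        IH = GenE-root m es (proj₁ ∘ r) ν₀ i (proj₁ ∘ h) nil unit di (trans (sym (proj₁ expand)) root₀)
        e = ev (suc m) (proj₂ ∘ r) ν₀
        d = dv (suc m) (proj₁ ∘ r) ν₀
        v = inv es d i
        dv≈1 : d * v ≈ 1#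
        dv≈1 = inv-correct es d i (T.trans (T.*-congʳ {i} {base es d} (base-dv es m (proj₁ ∘ r) ν₀ nil)) unit)
        solve : ν₁ ≈ - (e * v)
        solve = trans (sym (*-identityˡ ν₁)) (trans (*-congʳ (sym dv≈1)) (trans
          (rsolve 4 (λ d v n e → (d :* v) :* n ⊜ (e :+ d :* n) :* v :- e :* v) refl d v ν₁ e)
          (trans (+-congʳ (trans (*-congʳ (trans (sym (proj₂ expand)) root₁)) (zeroˡ v))) (+-identityˡ _))))

    module TimesGate (lv lv' : Lvl) (chain : Lvl.θ' lv ≡ Lvl.θ lv') (M : ℕ) (M≥1 : 1 ≤ M) (es : List Leaf) where
      open Alg (EAlg es) using (*-assoc; *-congʳ; *-congˡ; *-identityˡ; Carrier; refl; sym; trans; zeroˡ; _*_; _≈_; 0#; 1#; cring; ι-1)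
      private
        d = length es
        module S₁ = Expansions lv M M≥1 using (GenE-log; GenE⇒BigE; good⇒GenE)
        θ = Lvl.θ lv

      UnitAt NilOrUnit : Carrier → Set (c ⊔ ℓ)
      UnitAt g = Σ T.Carrier λ i → (base es g T.* i T.≈ T.1#) × DependsOn (_∈ []) i
      NilOrUnit g = Nil es g ⊎ UnitAt g

      Factor : Set (c ⊔ ℓ)
      Factor = Σ Carrier λ g → DepE [] es g × BigE θ M [] es g × NilOrUnit g

      private
        UnitF NilF : Set (c ⊔ ℓ)
        UnitF = Σ Carrier λ g → DepE [] es g × BigE θ M [] es g × UnitAt g
        NilF = Σ Carrier λ g → DepE [] es g × BigE θ M [] es g × Nil es g

        open Sums cring using (∏; ∏-map; ∑; ∑-map)
        open RS cring using (rsolve; _:*_; _⊜_)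

        split : (gs : List Factor) → Σ (List NilF) λ zs → Σ (List UnitF) λ us → (∏ gs proj₁ ≈ ∏ zs proj₁ * ∏ us proj₁) × length us ≤ length gs
        split [] = [] , [] , sym (*-identityˡ _) , z≤n
        split ((g , dp , bg , inj₁ z) ∷ gs) with split gs
        ... | zs , us , e , le = (g , dp , bg , z) ∷ zs , us , trans (*-congˡ e) (sym (*-assoc _ _ _)) , ℕP.m≤n⇒m≤1+n le
        split ((g , dp , bg , inj₂ u) ∷ gs) with split gs
        ... | zs , us , e , le = zs , (g , dp , bg , u) ∷ us , trans (*-congˡ e) (rsolve 3 (λ a b c → a :* (b :* c) ⊜ b :* (a :* c)) refl _ _ _) , s≤s le

        toUnit : UnitF → Unit es
        toUnit (g , _ , _ , i , e , _) = g , i , e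

      times-big : ∀ t (gs : List Factor) → length gs ≤ t → BigE (Lvl.θ' lv') (timesCount d ℕ.* (suc t ℕ.* (logCount d ℕ.* M))) [] es (∏ gs proj₁)
      times-big t gs le = cases (split gs)
        where
        M' = suc t ℕ.* (logCount d ℕ.* M)
        M≤M' : M ≤ M'
        M≤M' = ℕP.≤-trans (ℕP.≤-trans (ℕP.≤-reflexive (≡.sym (ℕP.*-identityˡ M))) (ℕP.*-monoˡ-≤ M (logCount≥1 d))) (ℕP.m≤m+n _ _)
        module S₂ = Expansions lv' M' (ℕP.≤-trans M≥1 M≤M') using (GenE; GenE-*; GenE-1; GenE-exp; GenE-resp; GenE-≤; GenE⇒BigE; good⇒GenE)
        cases : (Σ (List NilF) λ zs → Σ (List UnitF) λ us → (∏ gs proj₁ ≈ ∏ zs proj₁ * ∏ us proj₁) × length us ≤ length gs) → _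
        cases (zs , us , e , us≤) = BigE-resp es (sym e) (result (length zs ℕP.≤? d))
          where
          logs = ∑-logs es (map toUnit us)
          logs≈ : logs ≈ ∑ us (λ (g , _ , _ , i , _) → log es g i)
          logs≈ = ∑-map toUnit us _
          logs-dep : DepE [] es logs
          logs-dep = DepE-resp es (sym logs≈) (DepE-∑ es us _ (λ (g , dp , bg , i , _ , di) → DepE-log es dp di))
          logs-big : BigE (Lvl.θ lv') M' [] es logs
          logs-big = BigE-resp es (sym logs≈) (BigE-≤ es (ℕP.≤-reflexive chain) (ℕP.*-monoˡ-≤ (logCount d ℕ.* M) (ℕP.≤-trans us≤ (ℕP.≤-trans le (ℕP.n≤1+n t))))
            (BigE-∑ es us _ (λ (g , dp , bg , i , _ , di) → S₁.GenE⇒BigE es (S₁.GenE-log es (S₁.good⇒GenE es dp bg) di))))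
          base-dep : DependsOn (_∈ []) (base es (∏-units es (map toUnit us)))
          base-dep = base-DepE es (DepE-resp es (sym (∏-map toUnit us proj₁)) (∏-dep us))
            where
            base-DepE : ∀ es {u} → DepE [] es u → DependsOn (_∈ []) (base es u)
            base-DepE [] h = h
            base-DepE (_ ∷ es) (h , _) = base-DepE es h
            ∏-dep : ∀ us → DepE [] es (∏ us proj₁)
            ∏-dep [] = DepE-resp es (E.ι-1 es) (DepE-ι es (Field.1# F))
            ∏-dep ((g , dp , _) ∷ us) = DepE-* es dp (∏-dep us)
          units : S₂.GenE (expCount d) 0 0 es (∏ us proj₁)
          units = S₂.GenE-resp es (trans (sym (∏-units≈exp es (map toUnit us))) (∏-map toUnit us proj₁)) (S₂.GenE-exp es (S₂.good⇒GenE es logs-dep logs-big) base-dep)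
          nils : S₂.GenE (powCount d (length zs)) 0 0 es (∏ zs proj₁)
          nils = go zs
            where
            go : ∀ zs → S₂.GenE (powCount d (length zs)) 0 0 es (∏ zs proj₁)
            go [] = S₂.GenE-1 es
            go ((z , dp , bg , _) ∷ zs) = S₂.GenE-* es (S₂.good⇒GenE es dp (BigE-≤ es (ℕP.≤-trans (Lvl.θ≤θ' lv) (ℕP.≤-reflexive chain)) M≤M' bg)) (go zs)
          result : Dec (length zs ≤ d) → BigE (Lvl.θ' lv') (timesCount d ℕ.* M') [] es (∏ zs proj₁ * ∏ us proj₁)
          result (yes le) = S₂.GenE⇒BigE es (S₂.GenE-* es (S₂.GenE-≤ es (powCount-mono d le) nils) units)
          result (no nle) = BigE-≤ es z≤n z≤n (BigE-resp es (sym (trans (*-congʳ vanish) (zeroˡ _))) (BigE-0 {0} es))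
            where
            allNil : ∀ zs → All (Nil es) (map (proj₁ {B = λ g → DepE [] es g × BigE θ M [] es g × Nil es g}) zs)
            allNil [] = []
            allNil ((_ , _ , _ , z) ∷ zs) = z ∷ allNil zs
            vanish : ∏ zs proj₁ ≈ 0#
            vanish = trans (sym (∏-map proj₁ zs (λ z → z))) (nilpotent es (map proj₁ zs) (allNil zs)
              (ℕP.≤-trans (ℕP.≰⇒> nle) (ℕP.≤-reflexive (≡.sym (LP.length-map proj₁ zs)))))

module CircuitBounds where
  open CommutativeAlgebra
  open FormulaSemantics
  open CircuitSemantics
  open DualNumberTower
  open LowRankDecomposition
  open GateBounds
  open import Defs

  circuitCount : ℕ → ℕ → ℕ → ℕ
  circuitCount d t zero = 1
  circuitCount d t (suc δ) = timesCount d ℕ.* (suc t ℕ.* (logCount d ℕ.* circuitCount d t δ))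

  expCount≥1 : ∀ d → 1 ≤ expCount d
  expCount≥1 zero = s≤s z≤n
  expCount≥1 (suc d) = ℕP.≤-trans (expCount≥1 d) (ℕP.m≤m+n _ _)

  timesCount≥1 : ∀ d → 1 ≤ timesCount d
  timesCount≥1 d = ℕP.*-mono-≤ {1} {_} {1} (ℕP.m^n>0 2 d) (ℕP.*-mono-≤ {1} {_} {1} (powCount-mono d {0} {d} z≤n) (expCount≥1 d))

  circuitCount-step : ∀ d t δ → suc t ℕ.* circuitCount d t δ ≤ circuitCount d t (suc δ)
  circuitCount-step d t δ = ℕP.≤-trans (ℕP.*-monoʳ-≤ (suc t) (ℕP.≤-trans (ℕP.≤-reflexive (≡.sym (ℕP.*-identityˡ _))) (ℕP.*-monoˡ-≤ (circuitCount d t δ) (logCount≥1 d))))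
    (ℕP.≤-trans (ℕP.≤-reflexive (≡.sym (ℕP.*-identityˡ _))) (ℕP.*-monoˡ-≤ _ (timesCount≥1 d)))

  circuitCount-suc : ∀ d t δ → circuitCount d t δ ≤ circuitCount d t (suc δ)
  circuitCount-suc d t δ = ℕP.≤-trans (ℕP.m≤m+n _ _) (circuitCount-step d t δ)

  circuitCount-mono : ∀ d t {δ δ'} → δ ≤ δ' → circuitCount d t δ ≤ circuitCount d t δ'
  circuitCount-mono d t {δ} le with ℕP.m≤n⇒∃[o]m+o≡n le
  ... | o , ≡.refl = go o
    where
    go : ∀ o → circuitCount d t δ ≤ circuitCount d t (δ ℕ.+ o)
    go zero = ℕP.≤-reflexive (≡.cong (circuitCount d t) (≡.sym (ℕP.+-identityʳ δ)))
    go (suc o) = ℕP.≤-trans (go o) (ℕP.≤-trans (circuitCount-suc d t (δ ℕ.+ o)) (ℕP.≤-reflexive (≡.cong (circuitCount d t) (≡.sym (ℕP.+-suc δ o)))))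

  circuitCount≥1 : ∀ d t δ → 1 ≤ circuitCount d t δ
  circuitCount≥1 d t δ = circuitCount-mono d t {0} {δ} z≤n

  module CircuitBound {c ℓ : Level} (F : Field c ℓ) (Leaf : Set) (_≟ℓ_ : DecidableEquality Leaf) (len : Leaf → ℕ)
    (side : Leaf → Bool) (hv : Leaf → ℕ) (len≡ : ∀ l → len l ≡ 2 ℕ.* hv l) (Λ : ℕ) where

    open Gates F Leaf _≟ℓ_ len side hv len≡ Λ using (Agree; BigE; BigE-+; BigE-0; BigE-resp; BigE-scale; BigE-sumTo; BigE-∑; BigE-≤; ColDep; DepE; DepE-*; DepE-+; DepE-0; DepE-const; DepE-inv; DepE-log; DepE-neg; DepE-resp; DepE-ι; DepE-∑; DepE-⊆; DependsOn; EAlg; Idx; K; Lvl; Nil; Rank1; Rk; Rk-*; Rk-+; Rk-0; Rk-1; Rk-flip; Rk-resp; Rk-rows; Rk-scale; Rk-∑; Rk-≤; RowDep; Tens; Unit; base; base-*; base-+; base-0; base-1; base-cong; baseHom; colH; const; const-*; const-ι; depRel; entry; ev-nilpotent; exp; exp-cong; exp-log; fun≡base; hvs; inv; inv-correct; log; log-*; log-1; nilpotent; rowBits; rowH; set; set-agree; set-id; top; top-+; top-0; top-cong; top-const-*; trivialRank; ∏-units; ∏-units≈exp; ∏E; ∑-logs; 𝒯; module E; module Expansions; module Gen; module Lvl; module Rank; module T; module TimesGate) public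
    open PolySemantics F using (circuitForm; gateForm; nodeForms)

    -- Thresholds thr 0 ≤ thr 1 ≤ ...; one level separates consecutive ones.
    record Levels (P : ℕ) : Set where
      field
        thr      : ℕ → ℕ
        thr-suc  : ∀ p → thr p ≤ thr (suc p)
        level    : ∀ p → p < P → Lvl
        level-θ  : ∀ p lt → Lvl.θ (level p lt) ≡ thr p
        level-θ' : ∀ p lt → Lvl.θ' (level p lt) ≡ thr (suc p)

      thr-mono : ∀ {p q} → p ≤ q → thr p ≤ thr q
      thr-mono {p} le with ℕP.m≤n⇒∃[o]m+o≡n le
      ... | o , ≡.refl = go o
        where
        go : ∀ o → thr p ≤ thr (p ℕ.+ o)
        go zero = ℕP.≤-reflexive (≡.cong thr (≡.sym (ℕP.+-identityʳ p)))
        go (suc o) = ℕP.≤-trans (go o) (ℕP.≤-trans (thr-suc (p ℕ.+ o)) (ℕP.≤-reflexive (≡.cong thr (≡.sym (ℕP.+-suc p o)))))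

    module _ {P : ℕ} (lvs : Levels P) (Δ : ℕ) (2Δ≤P : 2 ℕ.* Δ ≤ P) (es : List Leaf) {V : Set} (x : V → E.Carrier es)
      (x-dep : ∀ v → DepE [] es (x v)) (x-big : ∀ v → BigE (Levels.thr lvs 0) 1 [] es (x v)) (t : ℕ) where
      open Levels lvs using (level; level-θ; level-θ'; thr; thr-mono)
      open Alg (EAlg es) using (*-congˡ; Carrier; refl; sym; trans; _*_; _≈_; 1#; cring)
      private
        d = length es

      value : Form F V → Carrier
      value f = ⟦_⟧ F (EAlg es) f x

      value-dep : ∀ f → DepE [] es (value f)
      value-dep f = GradedRel.rel-⟦⟧ (depRel es) (λ _ → 0) {x} {x} x-dep f

      Bounded : ℕ → Carrier → Set (c ⊔ ℓ)
      Bounded δ u = BigE (thr (2 ℕ.* δ)) (circuitCount d t δ) [] es u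

      NodeClass : Form F V → Set (c ⊔ ℓ)
      NodeClass f = Nil es (value f) ⊎ (Σ T.Carrier λ i → (base es (value f) T.* i T.≈ T.1#) × DependsOn (_∈ []) i)

      private
        bounded-mono : ∀ {δ δ' u} → δ ≤ δ' → Bounded δ u → Bounded δ' u
        bounded-mono le = BigE-≤ es (thr-mono (ℕP.*-monoʳ-≤ 2 le)) (circuitCount-mono d t le)

        module _ {i : ℕ} (fs : Vec (Form F V) i) (ds : Vec ℕ i) (δ : ℕ) (bound : ∀ j → lookup ds j ≤ δ → Bounded δ (value (lookup fs j))) where

          plus-bounded : ∀ ws → maxList F (map (λ w → lookup ds (proj₂ w)) ws) ≤ δ →
            BigE (thr (2 ℕ.* δ)) (length ws ℕ.* circuitCount d t δ) [] es (value (gateForm fs (plus ws)))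
          plus-bounded [] le = BigE-0 es
          plus-bounded ((a , j) ∷ ws) le = BigE-+ es (BigE-scale es a (bound j (ℕP.≤-trans (ℕP.m≤m⊔n _ _) le)))
            (plus-bounded ws (ℕP.≤-trans (ℕP.m≤n⊔m (lookup ds j) _) le))

          module _ (cls : ∀ j → NodeClass (lookup fs j)) (lt₁ : 2 ℕ.* δ < P) (lt₂ : suc (2 ℕ.* δ) < P) where
            private
              module TG = TimesGate (level (2 ℕ.* δ) lt₁) (level (suc (2 ℕ.* δ)) lt₂) (≡.trans (level-θ' _ lt₁) (≡.sym (level-θ _ lt₂)))
                (circuitCount d t δ) (circuitCount≥1 d t δ) es using (Factor; times-big)

            factors : ∀ js → maxList F (map (lookup ds) js) ≤ δ → Σ (List TG.Factor) λ gs → (length gs ≡ length js) ×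
              (Sums.∏ cring gs proj₁ ≈ value (gateForm fs (times js)))
            factors [] le = [] , ≡.refl , refl
            factors (j ∷ js) le with factors js (ℕP.≤-trans (ℕP.m≤n⊔m (lookup ds j) _) le)
            ... | gs , e , h = (value (lookup fs j) , value-dep (lookup fs j) ,
                BigE-≤ es (ℕP.≤-reflexive (≡.sym (level-θ _ lt₁))) ℕP.≤-refl (bound j (ℕP.≤-trans (ℕP.m≤m⊔n _ _) le)) , cls j) ∷ gs ,
                ≡.cong suc e , *-congˡ h

            times-bounded : ∀ js → maxList F (map (lookup ds) js) ≤ δ → length js ≤ t → Bounded (suc δ) (value (gateForm fs (times js)))
            times-bounded js le fan with factors js le
            ... | gs , e , h = BigE-≤ es (ℕP.≤-reflexive (≡.trans (level-θ' _ lt₂) (≡.cong thr (≡.sym (ℕP.*-suc 2 δ))))) ℕP.≤-refl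
              (BigE-resp es h (TG.times-big t gs (ℕP.≤-trans (ℕP.≤-reflexive e) fan)))

      nodes-bounded : ∀ {i} (p : SLP F V i) → wiresSLP F p ≤ t → (∀ j → NodeClass (lookup (nodeForms p) j)) →
        ∀ j → lookup (depthsSLP F p) j ≤ Δ → Bounded (lookup (depthsSLP F p) j) (value (lookup (nodeForms p) j))
      nodes-bounded (p ▷ g) w cls (suc j) le = nodes-bounded p (ℕP.≤-trans (ℕP.m≤m+n _ _) w) (cls ∘ suc) j le
      nodes-bounded (p ▷ input v) w cls zero le = x-big v
      nodes-bounded (p ▷ const a) w cls zero le = BigE-≤ es z≤n z≤n (BigE-resp es (sym (const-ι es a)) (const-big es))
        where
        const-big : ∀ es {s} → BigE 0 0 [] es (Tower.const F 𝒯 es s)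
        const-big [] ()
        const-big (l ∷ es) = const-big es , BigE-0 es
      nodes-bounded (p ▷ plus ws) w cls zero le = BigE-≤ es (thr-mono (ℕP.*-monoʳ-≤ 2 (ℕP.n≤1+n _)))
        (ℕP.≤-trans (ℕP.*-monoˡ-≤ (circuitCount d t δ) (ℕP.≤-trans (ℕP.m≤n+m (length ws) (wiresSLP F p)) (ℕP.≤-trans w (ℕP.n≤1+n t)))) (circuitCount-step d t δ))
        (plus-bounded (nodeForms p) (depthsSLP F p) δ
          (λ j h → bounded-mono h (nodes-bounded p (ℕP.≤-trans (ℕP.m≤m+n _ _) w) (cls ∘ suc) j (ℕP.≤-trans h (ℕP.≤-trans (ℕP.n≤1+n _) le)))) ws ℕP.≤-refl)
        where δ = maxList F (map (λ w → lookup (depthsSLP F p) (proj₂ w)) ws)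
      nodes-bounded (p ▷ times js) w cls zero le =
        times-bounded (nodeForms p) (depthsSLP F p) δ
          (λ j h → bounded-mono h (nodes-bounded p (ℕP.≤-trans (ℕP.m≤m+n _ _) w) (cls ∘ suc) j (ℕP.≤-trans h (ℕP.≤-trans (ℕP.n≤1+n _) le))))
          (cls ∘ suc) (ℕP.≤-trans (ℕP.n≤1+n _) lt₂) lt₂ js ℕP.≤-refl (ℕP.≤-trans (ℕP.m≤n+m _ _) w)
        where
        δ = maxList F (map (lookup (depthsSLP F p)) js)
        lt₂ : suc (2 ℕ.* δ) < P
        lt₂ = ℕP.≤-trans (ℕP.≤-reflexive (≡.sym (ℕP.*-suc 2 δ))) (ℕP.≤-trans (ℕP.*-monoʳ-≤ 2 le) 2Δ≤P)

      circuit-bounded : (C : Circuit F V) → size F C ≤ t → depth F C ≤ Δ →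
        (∀ j → NodeClass (lookup (nodeForms (Circuit.prog C)) j)) → Bounded Δ (value (circuitForm C))
      circuit-bounded (circuit m (p ▷ g)) w dep cls = bounded-mono dep (nodes-bounded (p ▷ g) w cls zero dep)

module RootExpansions where
  open CommutativeAlgebra
  open FormulaSemantics
  open PolynomialInterpolation
  open DualNumberTower using (module Derivative)
  open import Defs using (Field; module Field; natF; CharZero)

  ¬¬-dec : ∀ {a} (P : Set a) → ¬ ¬ Dec P
  ¬¬-dec P k = k (no (λ p → k (yes p)))

  ¬¬-bounded : ∀ {a} (P : ℕ → Set a) n → (∀ l → l ≤ n → ¬ ¬ P l) → ¬ ¬ (∀ l → l ≤ n → P l)
  ¬¬-bounded P zero h k = h 0 z≤n (λ p → k (λ { zero _ → p }))
  ¬¬-bounded P (suc n) h k = h 0 z≤n (λ p → ¬¬-bounded (P ∘ suc) n (λ l le → h (suc l) (s≤s le)) (λ q → k (λ { zero _ → p ; (suc l) (s≤s le) → q l le })))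

  ¬¬-fin : ∀ {a} n (P : Fin n → Set a) → (∀ i → ¬ ¬ P i) → ¬ ¬ (∀ i → P i)
  ¬¬-fin zero P h k = k (λ ())
  ¬¬-fin (suc n) P h k = h zero (λ p → ¬¬-fin n (P ∘ suc) (h ∘ suc) (λ q → k (λ { zero → p ; (suc i) → q i })))

  ¬¬-least : ∀ {a} (P : ℕ → Set a) n → (∃ λ j → j ≤ n × P j) → ¬ ¬ (∃ λ m → P m × m ≤ n × ∀ j → j < m → ¬ P j)
  ¬¬-least P zero (zero , le , p) k = k (0 , p , z≤n , λ j ())
  ¬¬-least P (suc n) (j , le , p) k = ¬¬-dec (∃ λ i → i ≤ n × P i) λ
    { (yes h) → ¬¬-least P n h (λ (m , pm , le , least) → k (m , pm , ℕP.m≤n⇒m≤1+n le , least))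
    ; (no none) → k (j , p , le , λ i lt pi → none (i , ℕP.≤-pred (ℕP.≤-trans lt le) , pi)) }

  module Shift {c ℓ} (R : CommutativeRing c ℓ) (θ : CommutativeRing.Carrier R) where
    open CommutativeRing R using (*-congˡ; +-cong; +-congˡ; +-identityˡ; Carrier; distribʳ; refl; sym; trans; zeroʳ; _+_; _*_; _≈_; 0#)
    open RS R using (rsolve; _:+_; _:*_; :-_; _:-_; _⊜_)
    open Horner R using (ev; ev-+; ev-extend; ev-scale)
    open Derivative R using (dv)

    -- The coefficients of q(τ + θ).
    shift : ℕ → (ℕ → Carrier) → ℕ → Carrier
    shift zero q zero = q 0
    shift zero q (suc j) = 0#
    shift (suc n) q zero = q 0 + θ * shift n (q ∘ suc) 0
    shift (suc n) q (suc j) = shift n (q ∘ suc) j + θ * shift n (q ∘ suc) (suc j)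

    shift-vanish : ∀ n q j → n < j → shift n q j ≈ 0#
    shift-vanish zero q (suc j) lt = refl
    shift-vanish (suc n) q (suc j) (s≤s lt) = trans (+-cong (shift-vanish n (q ∘ suc) j lt)
      (trans (*-congˡ (shift-vanish n (q ∘ suc) (suc j) (ℕP.m≤n⇒m≤1+n lt))) (zeroʳ θ))) (+-identityˡ _)

    ev-shift : ∀ n q τ → ev n (shift n q) τ ≈ ev n q (τ + θ)
    ev-shift zero q τ = refl
    ev-shift (suc n) q τ = trans (+-congˡ (*-congˡ (trans (ev-+ n (shift n (q ∘ suc)) (λ j → θ * shift n (q ∘ suc) (suc j)) τ)
        (+-congˡ (ev-scale n θ (shift n (q ∘ suc) ∘ suc) τ)))))
      (trans (rsolve 6 (λ a t s z e f → (a :+ s :* z) :+ t :* (e :+ s :* f) ⊜ a :+ (t :* e :+ s :* (z :+ t :* f))) refl (q 0) τ θ (shift n (q ∘ suc) 0) _ _)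
      (+-congˡ (trans (+-cong (*-congˡ (ev-shift n (q ∘ suc) τ)) (*-congˡ (trans tail-ev (ev-shift n (q ∘ suc) τ)))) (sym (distribʳ _ _ _)))))
      where
      s = shift n (q ∘ suc)
      tail-ev : s 0 + τ * ev n (s ∘ suc) τ ≈ ev n s τ
      tail-ev = ev-extend {n} {suc n} s τ (ℕP.n≤1+n n) (shift-vanish n (q ∘ suc))

    shift-0 : ∀ n q → shift n q 0 ≈ ev n q θ
    shift-0 zero q = refl
    shift-0 (suc n) q = +-congˡ (*-congˡ (shift-0 n (q ∘ suc)))

    shift-1 : ∀ n q → shift n q 1 ≈ dv n q θ
    shift-1 zero q = refl
    shift-1 (suc n) q = +-cong (shift-0 n (q ∘ suc)) (*-congˡ (shift-1 n (q ∘ suc)))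

  module RootExtraction {c ℓ : Level} (F : Field c ℓ) (char0 : CharZero F) where
    private module F = Field F using (*-assoc; *-congʳ; *-congˡ; *-identityʳ; Carrier; sym; trans; zeroˡ; -_; _-_; 1#; inverse)
    open Interpolation F using (Separated; weights; interpolate; coefficients-vanish; natF-separated; natF-+)

    cons : ∀ {a} {X : Set a} {n} → X → (Fin n → X) → Fin (suc n) → X
    cons w x zero = w
    cons w x (suc i) = x i

    lineDeg : ∀ {V : Set} → Form F V → ℕ
    lineDeg = deg F (λ _ → 1)

    module Line (A : Alg F) {V : Set} (f : Form F V) (x₀ x₁ : V → Alg.Carrier A) where
      open Alg A using (*-comm; +-congˡ; Carrier; refl; sym; trans; _+_; _*_; _≈_; 0#; cring)
      open Horner cring using (ev; ev-cong; ev-extend)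

      private
        point : V → ℕ → Carrier
        point v zero = x₀ v
        point v (suc zero) = x₁ v
        point v (suc (suc _)) = 0#

      coefficients : ℕ → Carrier
      coefficients = ⟦_⟧ F (seriesAlg F A) f point

      private
        related : ∀ τ → EvalRel.EvRel F (AlgHom.graph (idHom F A)) τ (lineDeg f) coefficients (⟦_⟧ F A f (λ v → x₀ v + x₁ v * τ))
        related τ = GradedRel.rel-⟦⟧ (EvalRel.evRel F (AlgHom.graph (idHom F A)) τ) (λ _ → 1) {point} {λ v → x₀ v + x₁ v * τ}
          (λ v → point v , (λ _ → refl) , (λ { zero () ; (suc zero) (s≤s ()) ; (suc (suc _)) _ → refl }) ,
            (λ { zero () ; (suc zero) (s≤s ()) ; (suc (suc _)) _ → refl }) , +-congˡ (*-comm _ _)) f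

      coefficients-vanish-above : ∀ j → lineDeg f < j → coefficients j ≈ 0#
      coefficients-vanish-above with related 0#
      ... | _ , _ , z , _ = z

      line-ev : ∀ τ → ⟦_⟧ F A f (λ v → x₀ v + x₁ v * τ) ≈ ev (lineDeg f) coefficients τ
      line-ev τ with related τ
      ... | q , h , _ , _ , v = trans v (ev-cong (lineDeg f) (λ j → sym (h j)) refl)

      line-dual : (⟦_⟧ F (dualAlg F A) f (λ v → x₀ v , x₁ v)) .proj₁ ≈ coefficients 0 × (⟦_⟧ F (dualAlg F A) f (λ v → x₀ v , x₁ v)) .proj₂ ≈ coefficients 1
      line-dual with AlgHom.fun-⟦⟧ truncate f point
        where
        truncate : AlgHom F (seriesAlg F A) (dualAlg F A)
        truncate = record { fun = λ p → p 0 , p 1 ; fun-cong = λ e → e 0 , e 1 ; fun-ι = λ a → refl , refl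
          ; fun-+ = λ _ _ → refl , refl ; fun-* = λ _ _ → refl , refl }
      ... | e₀ , e₁ = sym e₀ , sym e₁

    Vanishes : ∀ (A : Alg F) {V : Set} → Form F V → Set _
    Vanishes A {V} f = ∀ (x : V → Alg.Carrier A) → Alg._≈_ A (⟦_⟧ F A f x) (Alg.0# A)

    vanishes-dual : ∀ A {V : Set} (f : Form F V) → Vanishes A f → Vanishes (dualAlg F A) f
    vanishes-dual A f h x = A.trans (proj₁ line-dual) (zero-coeffs 0) , A.trans (proj₂ line-dual) (zero-coeffs 1)
      where
      module A = Alg A using (refl; sym; trans; _≈_; 0#)
      open Line A f (proj₁ ∘ x) (proj₂ ∘ x) using (coefficients; coefficients-vanish-above; line-dual; line-ev)
      zero-coeffs : ∀ j → coefficients j A.≈ A.0#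
      zero-coeffs = coefficients-vanish A (natF F) (natF-separated char0 0) (lineDeg f) coefficients coefficients-vanish-above
        (λ l _ → A.trans (A.sym (line-ev _)) (h _))

    vanishes-pointwise : ∀ (I : Set) A {V : Set} (f : Form F V) → Vanishes A f → Vanishes (pointwiseAlg F I A) f
    vanishes-pointwise I A f h x a = A.trans (AlgHom.fun-⟦⟧ at f x) (h _)
      where
      module A = Alg A using (refl; sym; trans; _≈_; 0#)
      at : AlgHom F (pointwiseAlg F I A) A
      at = record { fun = λ p → p a ; fun-cong = λ e → e a ; fun-ι = λ _ → A.refl ; fun-+ = λ _ _ → A.refl ; fun-* = λ _ _ → A.refl }

    K : Alg F
    K = stableAlg F

    module K = Alg K using (*-comm; *-cong; *-congʳ; *-congˡ; *-identityʳ; *-identityˡ; +-assoc; +-comm; +-commutativeMonoid; +-cong; +-congʳ; +-congˡ; +-identityʳ; +-identityˡ; -‿cong; -‿inverseʳ; -‿inverseˡ; distribʳ; distribˡ; refl; reflexive; ring; semiring; sym; trans; zeroʳ; zeroˡ; _+_; _*_; -_; _-_; _≈_; 0#; 1#; cring)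

    θ : ℕ → F.Carrier
    θ = natF F

    θ-sep : Separated θ
    θ-sep = natF-separated char0 0

    -- p is a polynomial in w and x; its expansion around the root w = -1 - h(x) is considered up to the degree D.
    module _ {n : ℕ} (p : Form F (Fin (suc n))) (h : Form F (Fin n)) (D : ℕ) (deg≤D : lineDeg p ≤ D) where

      wt : ℕ → ℕ → F.Carrier
      wt = weights θ θ-sep D

      root : F.Carrier → Form F (Fin n)
      root s = sum ((F.- F.1# , con F.1#) ∷ (F.- F.1# , h) ∷ (s , con F.1#) ∷ [])

      atRoot : F.Carrier → Form F (Fin n)
      atRoot s = bind F (cons (root s) inp) p

      sumForm : ℕ → (ℕ → F.Carrier) → (ℕ → Form F (Fin n)) → List (F.Carrier × Form F (Fin n))
      sumForm zero κ f = (κ 0 , f 0) ∷ []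
      sumForm (suc k) κ f = (κ 0 , f 0) ∷ sumForm k (κ ∘ suc) (f ∘ suc)

      -- The j-th Taylor coefficient at the root.
      taylor : ℕ → Form F (Fin n)
      taylor j = sum (sumForm D (wt j) (atRoot ∘ θ))

      module At (A : Alg F) (x : Fin n → Alg.Carrier A) where
        open Alg A using (*-cong; *-congʳ; *-congˡ; *-identityʳ; *-identityˡ; +-assoc; +-cong; +-congʳ; +-congˡ; +-identityʳ; +-identityˡ; -‿cong; Carrier; refl; ring; sym; trans; zeroʳ; zeroˡ; _+_; _*_; -_; _-_; _≈_; 0#; 1#; cring; ι; ι-1; ι-neg)
        open Horner cring using (ev; ev-+; ev-cong; ev-extend; ev-scale)
        open SumTo cring using (sumTo; sumTo-cong; sumTo-zero)
        open Derivative cring using (times)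
        open RS cring using (rsolve; _:+_; _:*_; :-_; _:-_; _⊜_)

        ⟦p⟧ : Carrier → Carrier
        ⟦p⟧ w = ⟦_⟧ F A p (cons w x)

        ⟦p⟧-cong : ∀ {w w'} → w ≈ w' → ⟦p⟧ w ≈ ⟦p⟧ w'
        ⟦p⟧-cong e = ⟦⟧-cong F A p (λ { zero → e ; (suc i) → refl })

        rootValue : Carrier
        rootValue = - 1# - ⟦_⟧ F A h x

        taylor-value : ∀ j → ⟦_⟧ F A (taylor j) x ≈ sumTo D (λ l → ι (wt j l) * ⟦p⟧ (rootValue + ι (θ l)))
        taylor-value j = go D (wt j) θ
          where
          go : ∀ k κ s → ⟦_⟧Σ F A (sumForm k κ (atRoot ∘ s)) x ≈ sumTo k (λ l → ι (κ l) * ⟦p⟧ (rootValue + ι (s l)))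
          one : ∀ s → ⟦_⟧ F A (atRoot s) x ≈ ⟦p⟧ (rootValue + ι s)
          one s = trans (bind-⟦⟧ F (cons (root s) inp) A p x) (⟦⟧-cong F A p (λ { zero → w ; (suc i) → refl }))
            where
            w : ⟦_⟧ F A (root s) x ≈ rootValue + ι s
            w = trans (+-cong (*-cong (trans (ι-neg _) (-‿cong ι-1)) ι-1) (+-cong (*-congʳ (trans (ι-neg _) (-‿cong ι-1))) (+-congʳ (*-congˡ ι-1))))
              (trans (+-cong (trans (*-identityʳ _) refl) (+-cong (-1*x≈-x _) (trans (+-identityʳ _) (*-identityʳ _)))) (sym (+-assoc _ _ _)))
              where open import Algebra.Properties.Ring ring using (-1*x≈-x)
          go zero κ s = trans (+-identityʳ _) (*-congˡ (one (s 0)))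
          go (suc k) κ s = +-cong (*-congˡ (one (s 0))) (go k (κ ∘ suc) (s ∘ suc))

        module Around (w₀ : Carrier) where
          open Line A p (cons w₀ x) (cons 1# (λ _ → 0#)) using (coefficients; coefficients-vanish-above; line-ev)

          q : ℕ → Carrier
          q = coefficients

          q-vanish : ∀ j → D < j → q j ≈ 0#
          q-vanish j lt = coefficients-vanish-above j (ℕP.≤-<-trans deg≤D lt)

          q-ev : ∀ τ → ⟦p⟧ (w₀ + τ) ≈ ev D q τ
          q-ev τ = trans (⟦⟧-cong F A p (λ { zero → +-congˡ (sym (*-identityˡ τ)) ; (suc i) → sym (trans (+-congˡ (zeroˡ τ)) (+-identityʳ _)) }))
            (trans (line-ev τ) (sym (ev-extend q τ deg≤D coefficients-vanish-above)))

          coefficient : ∀ j → q j ≈ sumTo D (λ l → ι (wt j l) * ⟦p⟧ (w₀ + ι (θ l)))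
          coefficient j = trans (interpolate A θ θ-sep D q q-vanish j) (sumTo-cong D (λ l _ → *-congˡ (sym (q-ev (ι (θ l))))))

          -- The functional extracting the k-th coefficient, applied to p(w₀ + τ + ·).
          R : ℕ → Carrier → Carrier
          R k τ = sumTo D (λ l → ι (wt k l) * ⟦p⟧ (w₀ + (τ + ι (θ l))))

          r : ℕ → ℕ → Carrier
          r k j = sumTo D (λ i → ι (wt j i) * R k (ι (θ i)))

          private
            module Sh l = Shift cring (ι (θ l)) using (ev-shift; shift; shift-1; shift-vanish)
            shifted : ℕ → ℕ → Carrier
            shifted k j = sumTo D (λ l → ι (wt k l) * Sh.shift l D q j)

            ev-shifted : ∀ k τ → R k τ ≈ ev D (shifted k) τ
            ev-shifted k τ = trans (sumTo-cong D (λ l _ → *-congˡ (trans (q-ev _) (sym (Sh.ev-shift l D q τ))))) (sym (ev-sumTo D (λ l → ι (wt k l)) (λ l → Sh.shift l D q)))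
              where
              ev-sumTo : ∀ m (κ : ℕ → Carrier) (s : ℕ → ℕ → Carrier) → ev D (λ j → sumTo m (λ l → κ l * s l j)) τ ≈ sumTo m (λ l → κ l * ev D (s l) τ)
              ev-sumTo zero κ s = ev-scale D (κ 0) (s 0) τ
              ev-sumTo (suc m) κ s = trans (ev-+ D _ _ τ) (+-cong (ev-scale D (κ 0) (s 0) τ) (ev-sumTo m (κ ∘ suc) (s ∘ suc)))

            r≈shifted : ∀ k j → r k j ≈ shifted k j
            r≈shifted k j = sym (trans (interpolate A θ θ-sep D (shifted k)
              (λ j lt → sumTo-zero D (λ l _ → trans (*-congˡ (Sh.shift-vanish l D q j lt)) (zeroʳ _))) j)
              (sumTo-cong D (λ i _ → *-congˡ (sym (ev-shifted k (ι (θ i)))))))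

          R-ev : ∀ k τ → R k τ ≈ ev D (r k) τ
          R-ev k τ = trans (ev-shifted k τ) (ev-cong D (λ j → sym (r≈shifted k j)) refl)

          r-1 : ∀ m → 1 ≤ D → r m 1 ≈ times (suc m) (q (suc m))
          r-1 m 1≤D = trans (r≈shifted m 1) (trans (sumTo-cong D (λ l _ → *-congˡ (trans (Sh.shift-1 l D q) (dv-D 1≤D (ι (θ l))))))
            (sym (interpolate A θ θ-sep D q' (λ j lt → times-0 (suc j) (q-vanish (suc j) (ℕP.m≤n⇒m≤1+n lt))) m)))
            where
            open Derivative cring using (dv; dv-coefficients)
            q' : ℕ → Carrier
            q' j = times (suc j) (q (suc j))
            times-0 : ∀ k {a} → a ≈ 0# → times k a ≈ 0#
            times-0 zero e = refl
            times-0 (suc k) e = trans (+-cong e (times-0 k e)) (+-identityˡ _)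
            dv-D : 1 ≤ D → ∀ τ → dv D q τ ≈ ev D q' τ
            dv-D 1≤D τ = go D (λ j lt → q-vanish j lt) 1≤D
              where
              go : ∀ D → (∀ j → D < j → q j ≈ 0#) → 1 ≤ D → dv D q τ ≈ ev D q' τ
              go (suc D) z _ = trans (dv-coefficients D q τ) (sym (ev-extend {D} {suc D} q' τ (ℕP.n≤1+n D) (λ j lt → times-0 (suc j) (z (suc j) (s≤s lt)))))

        taylor≈q : ∀ j → ⟦_⟧ F A (taylor j) x ≈ Around.q rootValue j
        taylor≈q j = trans (taylor-value j) (sym (Around.coefficient rootValue j))

        taylor-R : ∀ j w₀ ν → w₀ + ν ≈ rootValue → ⟦_⟧ F A (taylor j) x ≈ Around.R w₀ j ν
        taylor-R j w₀ ν e = trans (taylor-value j) (sumTo-cong D (λ l _ → *-congˡ (⟦p⟧-cong (trans (+-congʳ (sym e)) (+-assoc _ _ _)))))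

      module _ (kill : ∀ A x → Alg._≈_ A (At.⟦p⟧ A x (At.rootValue A x)) (Alg.0# A))
               (start : ¬ (⟦_⟧ F K p (λ _ → K.0#) K.≈ K.0#))
               (sel : Form F (Fin n)) (sel-nonzero : ∀ l → ¬ (⟦_⟧ F K sel (λ _ → natF F (2 ℕ.+ l)) K.≈ K.0#)) where

        Alive : ℕ → Set _
        Alive j = Σ (Fin n → F.Carrier) λ x → ¬ (⟦_⟧ F K (prod (taylor j ∷ sel ∷ [])) x K.≈ K.0#)

        K-domain : ∀ {a b} → a K.* b K.≈ K.0# → ¬ (b K.≈ K.0#) → a K.≈ K.0#
        K-domain {a} {b} e nb k with F.inverse b (λ z → nb (λ f → f z))
        ... | y , h = e (λ e → k (F.trans (F.sym (F.*-identityʳ a)) (F.trans (F.*-congˡ (F.sym h)) (F.trans (F.sym (F.*-assoc _ _ _)) (F.trans (F.*-congʳ e) (F.zeroˡ y))))))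

        some-alive : ¬ ¬ (∃ λ j → j ≤ D × Alive j)
        some-alive none = start (K.trans (K.sym (K.trans (⟦⟧-cong F K p (λ { zero → K.trans (K.+-congˡ (K.zeroˡ _)) (K.+-identityʳ _) ; (suc i) → K.trans (K.+-congˡ (K.zeroʳ _)) (K.+-identityʳ _) })) K.refl))
            (K.trans (line-ev K.0#) (Horner.ev-zero K.cring (lineDeg p) K.0# line-zero)))
          where
          open Line K p (λ _ → K.0#) (cons K.0# (λ _ → K.1#)) using (coefficients; coefficients-vanish-above; line-ev)
          module _ (l : ℕ) where
            τ = natF F (2 ℕ.+ l)
            open At K (λ _ → τ) using (rootValue; taylor≈q; ⟦p⟧; ⟦p⟧-cong; module Around)
            taylor-zero : ∀ j → j ≤ D → Around.q rootValue j K.≈ K.0#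
            taylor-zero j le k = taylor≈q j (λ e → K-domain (λ k' → none (j , le , (λ _ → τ) , λ z → z (λ z' → k' (F.trans (F.*-congˡ (F.sym (F.*-identityʳ _))) z')))) (sel-nonzero l) (λ z → k (F.trans (F.sym e) z)))
            all-zero : ∀ j → Around.q rootValue j K.≈ K.0#
            all-zero j with j ℕP.≤? D
            ... | yes le = taylor-zero j le
            ... | no nle = Around.q-vanish rootValue j (ℕP.≰⇒> nle)
            at-zero : ⟦p⟧ K.0# K.≈ K.0#
            at-zero = K.trans (⟦p⟧-cong (K.trans (K.sym (K.-‿inverseʳ rootValue)) K.refl))
              (K.trans (Around.q-ev rootValue (K.- rootValue)) (Horner.ev-zero K.cring D (K.- rootValue) all-zero))
          line-zero : ∀ j → coefficients j K.≈ K.0#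
          line-zero = coefficients-vanish K (λ l → natF F (2 ℕ.+ l)) (natF-separated char0 2) (lineDeg p) coefficients coefficients-vanish-above
            (λ l _ → K.trans (K.sym (line-ev _)) (K.trans (⟦⟧-cong F K p (λ { zero → K.trans (K.+-identityˡ _) (K.zeroˡ _) ; (suc i) → K.trans (K.+-identityˡ _) (K.*-identityˡ _) })) (at-zero l)))

        not-alive-0 : ¬ Alive 0
        not-alive-0 (x , nz) = nz (K.trans (K.*-congʳ (K.trans (taylor≈q 0) (K.trans q0 (kill K x)))) (K.zeroˡ _))
          where
          open At K x using (rootValue; taylor≈q; ⟦p⟧; ⟦p⟧-cong; module Around)
          q0 : Around.q rootValue 0 K.≈ ⟦p⟧ rootValue
          q0 = K.sym (K.trans (⟦p⟧-cong (K.sym (K.+-identityʳ rootValue))) (K.trans (Around.q-ev rootValue K.0#) (ev-at-0 D (Around.q rootValue))))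
            where
            ev-at-0 : ∀ k q → Horner.ev K.cring k q K.0# K.≈ q 0
            ev-at-0 zero q = K.refl
            ev-at-0 (suc k) q = K.trans (K.+-congˡ (K.zeroˡ _)) (K.+-identityʳ _)

        dead⇒vanishes : ∀ j → ¬ Alive j → Vanishes K (prod (taylor j ∷ sel ∷ []))
        dead⇒vanishes j dead x k = dead (x , λ z → z k)

        -- The order m + 1 of vanishing at the root, and a point where the leading Taylor coefficient does not vanish.
        multiplicity : ¬ ¬ (∃ λ m → Alive (suc m) × suc m ≤ D × Vanishes K (prod (taylor m ∷ sel ∷ [])))
        multiplicity k = some-alive (λ alive → ¬¬-least Alive D alive (λ
          { (zero , a , _ , _) → not-alive-0 a
          ; (suc m , a , le , least) → k (m , a , le , dead⇒vanishes m (least m (ℕP.n<1+n m))) }))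

module Refutations where
  open FormulaSemantics
  open import Defs using (Field; module Field; IPSVar)

  -- The values of the variables of a refutation: X for the x_i, y for the axiom and z for the Boolean axioms.
  module Assignments {c ℓ : Level} (F : Field c ℓ) {n : ℕ} where

    assign : ∀ (A : Alg F) → (Fin n → Alg.Carrier A) → Alg.Carrier A → (Fin n → Alg.Carrier A) → IPSVar n 1 → Alg.Carrier A
    assign A X y z (inj₁ i) = X i
    assign A X y z (inj₂ (inj₁ _)) = y
    assign A X y z (inj₂ (inj₂ i)) = z i

    square-minus : ∀ (A : Alg F) → (Fin n → Alg.Carrier A) → Fin n → Alg.Carrier A
    square-minus A X i = X i * X i - X i
      where open Alg A using (_*_; -_; _-_)

    record RefutesIn (f : ∀ (A : Alg F) → (Fin n → Alg.Carrier A) → Alg.Carrier A) (C : Form F (IPSVar n 1)) : Set (Level.suc (c ⊔ ℓ)) where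
      field
        zero-axioms : ∀ A X → Alg._≈_ A (⟦_⟧ F A C (assign A X (Alg.0# A) (λ _ → Alg.0# A))) (Alg.0# A)
        axioms      : ∀ A X → Alg._≈_ A (⟦_⟧ F A C (assign A X (f A X) (square-minus A X))) (Alg.1# A)

  module Refutation {c ℓ : Level} (F : Field c ℓ) {n : ℕ} (h : Form F (Fin n)) where
    open Assignments F {suc n} using (RefutesIn; assign; square-minus; module RefutesIn) public

    fValue : ∀ (A : Alg F) → (Fin (suc n) → Alg.Carrier A) → Alg.Carrier A
    fValue A X = 1# + (X zero + ⟦_⟧ F A h (X ∘ suc))
      where open Alg A using (_+_; 1#)

    Refutes : Form F (IPSVar (suc n) 1) → Set (Level.suc (c ⊔ ℓ))
    Refutes = RefutesIn fValue

module LowRankExtraction where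
  open CommutativeAlgebra
  open FormulaSemantics
  open CircuitSemantics
  open PolynomialInterpolation
  open DualNumberTower
  open LowRankDecomposition
  open GateBounds
  open CircuitBounds
  open RootExpansions
  open Refutations
  open import Defs using (Field; module Field; natF; CharZero; IPSVar; Circuit; module Circuit; size; depth)
  open import Data.Vec using (replicate)
  open import Data.List.Relation.Unary.Any using (here)

  totalCount : (d D t Δ : ℕ) → ℕ
  totalCount d D t Δ = rootCount (suc d) d ℕ.* (suc D ℕ.* (suc D ℕ.* circuitCount d t Δ))

  module Extraction {c ℓ : Level} (F : Field c ℓ) (char0 : CharZero F) (Leaf : Set) (_≟ℓ_ : DecidableEquality Leaf) (len : Leaf → ℕ)
    (side : Leaf → Bool) (hv : Leaf → ℕ) (len≡ : ∀ l → len l ≡ 2 ℕ.* hv l) (Λ : ℕ) where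

    private module F = Field F using (*-assoc; *-congˡ; *-identityʳ; Carrier; sym; trans; _+_; _*_; -_; _-_; _≈_; 0#; 1#; nontrivial; inverse)
    open CircuitBound F Leaf _≟ℓ_ len side hv len≡ Λ using (Agree; BigE; BigE-+; BigE-0; BigE-resp; BigE-scale; BigE-sumTo; BigE-∑; BigE-≤; Bounded; ColDep; DepE; DepE-*; DepE-+; DepE-0; DepE-const; DepE-inv; DepE-log; DepE-neg; DepE-resp; DepE-ι; DepE-∑; DepE-⊆; DependsOn; EAlg; Idx; K; Levels; Lvl; Nil; NodeClass; Rank1; Rk; Rk-*; Rk-+; Rk-0; Rk-1; Rk-flip; Rk-resp; Rk-rows; Rk-scale; Rk-∑; Rk-≤; RowDep; Tens; Unit; base; base-*; base-+; base-0; base-1; base-cong; baseHom; circuit-bounded; colH; const; const-*; const-ι; depRel; entry; ev-nilpotent; exp; exp-cong; exp-log; fun≡base; hvs; inv; inv-correct; log; log-*; log-1; nilpotent; nodes-bounded; rowBits; rowH; set; set-agree; set-id; top; top-+; top-0; top-cong; top-const-*; trivialRank; value; value-dep; ∏-units; ∏-units≈exp; ∏E; ∑-logs; 𝒯; module E; module Expansions; module Gen; module Levels; module Lvl; module Rank; module T; module TimesGate) public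
    open PolySemantics F using (nodeForms; circuitForm)
    open RootExtraction F char0 using (Vanishes; cons; lineDeg; multiplicity; taylor; vanishes-dual; vanishes-pointwise; wt; θ; module At)
    private module K = Alg (stableAlg F) using (*-comm; *-cong; *-congʳ; *-congˡ; *-identityʳ; *-identityˡ; +-assoc; +-comm; +-commutativeMonoid; +-cong; +-congʳ; +-congˡ; +-identityʳ; +-identityˡ; -‿cong; -‿inverseʳ; -‿inverseˡ; distribʳ; distribˡ; refl; reflexive; ring; semiring; sym; trans; zeroʳ; zeroˡ; _+_; _*_; -_; _-_; _≈_; 0#; 1#; cring)

    -- The element a + β ε_l.
    lin : ∀ es → F.Carrier → Leaf → Tens → E.Carrier es
    lin [] a l β = T.ι a
    lin (l' ∷ es) a l β with l' ≟ℓ l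
    ... | yes _ = E.ι es a , const es β
    ... | no _ = lin es a l β , E.0# es

    base-lin : ∀ es a l β → base es (lin es a l β) T.≈ T.ι a
    base-lin [] a l β = T.refl {T.ι a}
    base-lin (l' ∷ es) a l β with l' ≟ℓ l
    ... | yes _ = T.trans (T.reflexive (≡.sym (fun≡base es (E.ι es a)))) (AlgHom.fun-ι (baseHom es) a)
    ... | no _ = base-lin es a l β

    lin-square : ∀ es a l β → E._≈_ es (E._*_ es (lin es a l β) (lin es a l β)) (lin es (a F.* a) l (λ x → (a F.+ a) F.* β x))
    lin-square [] a l β = T.sym {T.ι (a F.* a)} (T.ι-* a a)
    lin-square (l' ∷ es) a l β with l' ≟ℓ l
    ... | yes _ = E.sym es (E.ι-* es a a) , E.trans es (E.trans es (E.+-congˡ es (E.*-comm es _ _)) (E.sym es (E.distribʳ es _ _ _)))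
        (E.trans es (E.*-congʳ es (E.trans es (E.sym es (E.ι-+ es a a)) (const-ι es (a F.+ a)))) (E.sym es (const-* es (T.ι (a F.+ a)) β)))
    ... | no _ = lin-square es a l β , E.trans es (E.+-cong es (E.zeroʳ es _) (E.zeroˡ es _)) (E.+-identityˡ es _)

    lin-dep : ∀ {A} es a l β → DependsOn (_≡ l) β → DepE A es (lin es a l β)
    lin-dep [] a l β d = DepE-ι [] a
    lin-dep (l' ∷ es) a l β d with l' ≟ℓ l
    ... | yes ≡.refl = DepE-ι es a , DepE-const es (λ x x' e → d x x' (λ { l ≡.refl → e l (here ≡.refl) }))
    ... | no _ = lin-dep es a l β d , DepE-0 es

    private
      const-big : ∀ {A} es {s} → length A ≤ 1 → BigE 1 0 A es (const es s)
      const-big [] le lt = ⊥-elim (ℕP.<⇒≱ lt le)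
      const-big (l ∷ es) le = const-big es le , BigE-0 es

      ι-big : ∀ {A} es a → length A ≤ 1 → BigE 1 0 A es (E.ι es a)
      ι-big es a le = BigE-resp es (E.sym es (const-ι es a)) (const-big es le)

    lin-big : ∀ es a l β → BigE 1 0 [] es (lin es a l β)
    lin-big [] a l β ()
    lin-big (l' ∷ es) a l β with l' ≟ℓ l
    ... | yes _ = ι-big es a z≤n , const-big es ℕP.≤-refl
    ... | no _ = lin-big es a l β , BigE-0 es

    module _ {n : ℕ} (dir : Fin n → Maybe (Σ Leaf λ l → Σ Tens λ β → DependsOn (_≡ l) β)) (es : List Leaf) where
      open Alg (EAlg es) using (*-assoc; *-cong; *-congʳ; *-congˡ; *-identityʳ; *-identityˡ; +-assoc; +-comm; +-cong; +-congʳ; +-congˡ; +-identityʳ; +-identityˡ; -‿cong; -‿inverseʳ; -‿inverseˡ; Carrier; distribʳ; refl; reflexive; ring; sym; trans; zeroʳ; zeroˡ; _+_; _*_; -_; _-_; _≈_; 0#; 1#; cring; ι; ι-+; ι-*; ι-0; ι-1; ι-neg)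

      point : (Fin n → F.Carrier) → Fin n → Carrier
      point x i with dir i
      ... | just (l , β , _) = lin es (x i) l β
      ... | nothing = ι (x i)

      private
        point-base : ∀ x i → base es (point x i) T.≈ T.ι (x i)
        point-base x i with dir i
        ... | just (l , β , _) = base-lin es (x i) l β
        ... | nothing = T.trans (T.reflexive (≡.sym (fun≡base es (ι (x i))))) (AlgHom.fun-ι (baseHom es) (x i))

        point-dep : ∀ x i → DepE [] es (point x i)
        point-dep x i with dir i
        ... | just (l , β , d) = lin-dep es (x i) l β d
        ... | nothing = DepE-ι es (x i)

        point-big : ∀ x i → BigE 1 0 [] es (point x i)
        point-big x i with dir i
        ... | just (l , β , d) = lin-big es (x i) l β
        ... | nothing = ι-big es (x i) z≤n

        square-big : ∀ x i → BigE 1 0 [] es (point x i * point x i)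
        square-big x i with dir i
        ... | just (l , β , d) = BigE-resp es (sym (lin-square es (x i) l β)) (lin-big es _ l _)
        ... | nothing = BigE-resp es (ι-* _ _) (ι-big es _ z≤n)

      base-⟦⟧ : ∀ (f : Form F (Fin n)) x a → base es (⟦_⟧ F (EAlg es) f (point x)) a K.≈ ⟦_⟧ F (stableAlg F) f x
      base-⟦⟧ f x a = K.trans (K.reflexive (≡.cong (λ t → t a) (≡.sym (fun≡base es (⟦_⟧ F (EAlg es) f (point x))))))
        (K.trans (AlgHom.fun-⟦⟧ (baseHom es) f (point x) a) (K.trans (⟦⟧-cong F 𝒯 f {y = λ v → T.ι (x v)}
          (λ v → T.trans {_} {base es (point x v)} (T.reflexive (fun≡base es (point x v))) (point-base x v)) a) (AlgHom.fun-⟦⟧ at f (λ v → T.ι (x v)))))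
        where
        at : AlgHom F 𝒯 (stableAlg F)
        at = record { fun = λ p → p a ; fun-cong = λ e → e a ; fun-ι = λ _ → K.refl ; fun-+ = λ _ _ → K.refl ; fun-* = λ _ _ → K.refl }

      module _ (Δ : ℕ) (lvs : Levels (suc (2 ℕ.* Δ))) (thr0 : 1 ≤ Levels.thr lvs 0) (many : Levels.thr lvs (suc (2 ℕ.* Δ)) < length es)
        (h sel : Form F (Fin n)) (sel-nonzero : ∀ l → ¬ (⟦_⟧ F (stableAlg F) sel (λ _ → natF F (2 ℕ.+ l)) K.≈ K.0#))
        (C : Circuit F (IPSVar (suc n) 1)) (depth≤ : depth F C ≤ Δ) (t : ℕ) (size≤ : size F C ≤ t)
        (D : ℕ) (deg≤ : deg F (λ _ → 2) (circuitForm C) ≤ D) (len≤ : suc (length es) ≤ D) where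

        open Refutation F h using (Refutes; RefutesIn; assign; fValue; square-minus; module RefutesIn)
        module _ (ref : Refutes (circuitForm C)) where
          open RefutesIn ref using (axioms; zero-axioms)
          open Levels lvs using (level; level-θ; level-θ'; thr; thr-mono)

          private
            d = length es
            f = circuitForm C

          axiomForm : IPSVar (suc n) 1 → Form F (Fin (suc n))
          axiomForm (inj₁ i) = inp i
          axiomForm (inj₂ (inj₁ _)) = con F.0#
          axiomForm (inj₂ (inj₂ i)) = sum ((F.1# , prod (inp i ∷ inp i ∷ [])) ∷ (F.- F.1# , inp i) ∷ [])

          pForm : Form F (Fin (suc n))
          pForm = sum ((F.1# , con F.1#) ∷ (F.- F.1# , bind F axiomForm f) ∷ [])

          p-value : ∀ A X → Alg._≈_ A (⟦_⟧ F A pForm X) (Alg._-_ A (Alg.1# A) (⟦_⟧ F A f (assign A X (Alg.0# A) (square-minus A X))))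
          p-value A X = A.+-cong (A.trans (A.*-cong A.ι-1 A.ι-1) (A.*-identityˡ _)) (A.trans (A.+-identityʳ _)
              (A.trans (A.*-congʳ (A.trans (A.ι-neg _) (A.-‿cong A.ι-1))) (A.trans (-1*x≈-x _) (A.-‿cong (A.trans (bind-⟦⟧ F axiomForm A f X) (⟦⟧-cong F A f same))))))
            where
            module A = Alg A using (*-cong; *-congʳ; *-congˡ; *-identityʳ; *-identityˡ; +-cong; +-congˡ; +-identityʳ; -‿cong; -‿inverseʳ; Carrier; refl; ring; sym; trans; _≈_; 0#; 1#; cring; ι-0; ι-1; ι-neg)
            open import Algebra.Properties.Ring A.ring using (-1*x≈-x)
            same : ∀ v → ⟦_⟧ F A (axiomForm v) X A.≈ assign A X A.0# (square-minus A X) v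
            same (inj₁ i) = A.refl
            same (inj₂ (inj₁ _)) = A.ι-0
            same (inj₂ (inj₂ i)) = A.+-cong (A.trans (A.*-congʳ A.ι-1) (A.trans (A.*-identityˡ _) (A.*-congˡ (A.*-identityʳ _))))
              (A.trans (A.+-identityʳ _) (A.trans (A.*-congʳ (A.trans (A.ι-neg _) (A.-‿cong A.ι-1))) (-1*x≈-x _)))

          p-degree : lineDeg pForm ≤ D
          p-degree = ℕP.⊔-lub z≤n (ℕP.⊔-lub (ℕP.≤-trans (deg-bind f) deg≤) z≤n)
            where
            deg-bind : ∀ f → lineDeg (bind F axiomForm f) ≤ deg F (λ _ → 2) f
            deg-Σ : ∀ ws → degΣ F (λ _ → 1) (bindΣ F axiomForm ws) ≤ degΣ F (λ _ → 2) ws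
            deg-Π : ∀ fs → degΠ F (λ _ → 1) (bindΠ F axiomForm fs) ≤ degΠ F (λ _ → 2) fs
            deg-bind (inp (inj₁ i)) = s≤s z≤n
            deg-bind (inp (inj₂ (inj₁ _))) = z≤n
            deg-bind (inp (inj₂ (inj₂ i))) = ℕP.≤-refl
            deg-bind (con a) = z≤n
            deg-bind (sum ws) = deg-Σ ws
            deg-bind (prod fs) = deg-Π fs
            deg-Σ [] = z≤n
            deg-Σ ((a , f) ∷ ws) = ℕP.⊔-mono-≤ (deg-bind f) (deg-Σ ws)
            deg-Π [] = z≤n
            deg-Π (f ∷ fs) = ℕP.+-mono-≤ (deg-bind f) (deg-Π fs)

          kill : ∀ A x → Alg._≈_ A (At.⟦p⟧ pForm h D p-degree A x (At.rootValue pForm h D p-degree A x)) (Alg.0# A)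
          kill A x = A.trans (p-value A X) (A.trans (A.+-congˡ (A.-‿cong (A.trans (⟦⟧-cong F A f same) (axioms A X)))) (A.-‿inverseʳ _))
            where
            module A = Alg A using (*-cong; *-congʳ; *-congˡ; *-identityʳ; *-identityˡ; +-cong; +-congˡ; +-identityʳ; -‿cong; -‿inverseʳ; Carrier; refl; ring; sym; trans; _≈_; 0#; 1#; cring; ι-0; ι-1; ι-neg)
            open RS A.cring using (rsolve; _:+_; _:*_; :-_; _:-_; _⊜_)
            X : Fin (suc n) → A.Carrier
            X = cons (At.rootValue pForm h D p-degree A x) x
            same : ∀ v → assign A X A.0# (square-minus A X) v A.≈ assign A X (fValue A X) (square-minus A X) v
            same (inj₁ i) = A.refl
            same (inj₂ (inj₁ _)) = A.sym (rsolve 2 (λ o h → o :+ (((:- o) :- h) :+ h) ⊜ o :- o) A.refl A.1# _ ∙ A.-‿inverseʳ A.1#)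
              where
              _∙_ : ∀ {a b c} → a A.≈ b → b A.≈ c → a A.≈ c
              _∙_ = A.trans
            same (inj₂ (inj₂ i)) = A.refl

          start : ¬ (⟦_⟧ F (stableAlg F) pForm (λ _ → K.0#) K.≈ K.0#)
          start e = e (λ e → value-1 (λ v → F.nontrivial (F.trans (F.sym v) e)))
            where
            value-1 : ⟦_⟧ F (stableAlg F) pForm (λ _ → K.0#) K.≈ K.1#
            value-1 = K.trans (p-value (stableAlg F) (λ _ → K.0#)) (K.trans (K.+-congˡ (K.-‿cong (K.trans (⟦⟧-cong F (stableAlg F) f same) (zero-axioms (stableAlg F) (λ _ → K.0#)))))
              (K.trans (K.+-congˡ -0#≈0#) (K.+-identityʳ _)))
              where
              open import Algebra.Properties.Ring K.ring using (-0#≈0#)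
              same : ∀ v → assign (stableAlg F) (λ _ → K.0#) K.0# (square-minus (stableAlg F) (λ _ → K.0#)) v K.≈ assign (stableAlg F) (λ _ → K.0#) K.0# (λ _ → K.0#) v
              same (inj₁ i) = K.refl
              same (inj₂ (inj₁ _)) = K.refl
              same (inj₂ (inj₂ i)) = K.trans (K.+-congʳ (K.zeroˡ _)) (K.-‿inverseʳ K.0#)

          LowRankTop : Set _
          LowRankTop = Σ (Fin n → F.Carrier) λ x → ¬ (⟦_⟧ F (stableAlg F) sel x K.≈ K.0#) ×
            Σ ℕ λ R → Rk R (top es (⟦_⟧ F (EAlg es) h (point x))) × (R ℕ.* 2 ^ Λ ≤ totalCount d D t Δ ℕ.* 2 ^ hvs es)

          private
            a₀ : Idx
            a₀ l = replicate (len l) false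

            constantBase : ∀ es {u} → DepE [] es u → DependsOn (_∈ []) (base es u)
            constantBase [] dp = dp
            constantBase (_ ∷ es) (dp , _) = constantBase es dp

            classify : ∀ {u} → DepE [] es u → ¬ ¬ (Nil es u ⊎ (Σ T.Carrier λ i → (base es u T.* i T.≈ T.1#) × DependsOn (_∈ []) i))
            classify {u} dp k = ¬¬-dec (base es u a₀ F.≈ F.0#) λ
              { (yes z) → k (inj₁ (λ a → K.trans (constantBase es dp a a₀ (λ _ ())) (λ k → k z)))
              ; (no nz) → let (y , e) = F.inverse _ nz in
                  k (inj₂ ((λ _ → y) , (λ a → K.trans (K.*-congʳ (constantBase es dp a a₀ (λ _ ()))) (λ k → k e)) , λ _ _ _ → K.refl)) }

            nonzero-* : ∀ {a b} → ¬ (a K.≈ K.0#) → ¬ (b K.≈ K.0#) → ¬ (a K.* b K.≈ K.0#)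
            nonzero-* {a} {b} na nb e with F.inverse b (λ z → nb (λ k → k z))
            ... | y , h = na (K.trans (λ k → k (F.trans (F.sym (F.*-identityʳ a)) (F.trans (F.*-congˡ (F.sym h)) (F.sym (F.*-assoc _ _ _))))) (K.trans (K.*-congʳ e) (K.zeroˡ y)))

            times-base : ∀ es k {u} a → base es (Derivative.times (E.cring es) k u) a K.≈ natF F k K.* base es u a
            times-base es zero {u} a = K.trans (base-0 es a) (K.sym (K.zeroˡ _))
            times-base es (suc k) {u} a = K.trans (base-+ es _ _ a) (K.trans (K.+-cong (K.sym (K.*-identityˡ _)) (times-base es k a)) (K.sym (K.distribʳ _ _ _)))

            top-ι : ∀ es a → 1 ≤ length es → top es (E.ι es a) T.≈ T.0#
            top-ι (_ ∷ es) a _ = top-0 es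

            module Point (x : Fin n → F.Carrier) (m : ℕ) (alive : ¬ (⟦_⟧ F (stableAlg F) (prod (taylor pForm h D p-degree (suc m) ∷ sel ∷ [])) x K.≈ K.0#))
              (flat : Vanishes (stableAlg F) (prod (taylor pForm h D p-degree m ∷ sel ∷ []))) where
              X = point x
              module AX = At pForm h D p-degree (EAlg es) X using (rootValue; taylor-R; ⟦p⟧; ⟦p⟧-cong; module Around)

              sel-x : ¬ (⟦_⟧ F (stableAlg F) sel x K.≈ K.0#)
              sel-x e = alive (K.trans (K.*-congˡ (K.trans (K.*-congʳ e) (K.zeroˡ _))) (K.zeroʳ _))

              taylor-x : ¬ (⟦_⟧ F (stableAlg F) (taylor pForm h D p-degree (suc m)) x K.≈ K.0#)
              taylor-x e = alive (K.trans (K.*-congʳ e) (K.zeroˡ _))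

              w₀ : F.Carrier
              w₀ = At.rootValue pForm h D p-degree (stableAlg F) x

              ν : Carrier
              ν = AX.rootValue - ι w₀

              module AR = AX.Around (ι w₀) using (R-ev; coefficient; q; r; r-1)

              flat-E : ∀ es → Vanishes (EAlg es) (prod (taylor pForm h D p-degree m ∷ sel ∷ []))
              flat-E [] = vanishes-pointwise Idx (stableAlg F) (prod (taylor pForm h D p-degree m ∷ sel ∷ [])) flat
              flat-E (_ ∷ es) = vanishes-dual (EAlg es) (prod (taylor pForm h D p-degree m ∷ sel ∷ [])) (flat-E es)

              sel-value : Carrier
              sel-value = ⟦_⟧ F (EAlg es) sel X

              sel-inverse : Σ Carrier λ v → sel-value * v ≈ 1#
              sel-inverse = inv es sel-value (λ _ → proj₁ y) , inv-correct es sel-value (λ _ → proj₁ y) (λ a → K.trans (K.*-congʳ (base-⟦⟧ sel x a)) (λ k → k (proj₂ y)))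
                where y = F.inverse (⟦_⟧ F (stableAlg F) sel x) (λ z → sel-x (λ k → k z))

              cancel : ∀ {u s v} → u * (s * 1#) ≈ 0# → s * v ≈ 1# → u ≈ 0#
              cancel {v = v} h e = trans (sym (*-identityʳ _)) (trans (*-congˡ (sym e)) (trans (sym (*-assoc _ _ _)) (trans (*-congʳ (trans (*-congˡ (sym (*-identityʳ _))) h)) (zeroˡ v))))

              flat-X : ⟦_⟧ F (EAlg es) (taylor pForm h D p-degree m) X ≈ 0#
              flat-X = cancel (flat-E es X) (proj₂ sel-inverse)

              base-minus : ∀ u v a → base es (u - v) a K.≈ base es u a K.- base es v a
              base-minus u v a = K.trans (base-+ es u (- v) a) (K.+-congˡ (K.trans (K.sym (K.+-identityʳ _)) (K.trans (K.+-congˡ (K.sym (K.-‿inverseʳ (base es v a))))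
                (K.trans (K.sym (K.+-assoc _ _ _)) (K.trans (K.+-congʳ (K.trans (K.sym (base-+ es (- v) v a)) (K.trans (base-cong es (-‿inverseˡ v) a) (base-0 es a)))) (K.+-identityˡ _))))))

              base-ι : ∀ b a → base es (ι b) a K.≈ b
              base-ι b a = K.trans (K.reflexive (≡.cong (λ t → t a) (≡.sym (fun≡base es (ι b))))) (AlgHom.fun-ι (baseHom es) b a)

              ν-nil : Nil es ν
              ν-nil a = K.trans (base-minus AX.rootValue (ι w₀) a) (K.trans (K.+-cong rootBase (K.-‿cong (base-ι w₀ a))) (K.-‿inverseʳ w₀))
                where
                rootBase : base es AX.rootValue a K.≈ w₀
                rootBase = K.trans (base-minus (- 1#) _ a) (K.+-cong (K.trans (base-cong es (trans (-‿cong (sym ι-1)) (sym (ι-neg F.1#))) a) (base-ι (F.- F.1#) a)) (K.-‿cong (base-⟦⟧ h x a)))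

              w₀+ν : ι w₀ + ν ≈ AX.rootValue
              w₀+ν = trans (+-comm _ _) (trans (+-assoc _ _ _) (trans (+-congˡ (-‿inverseˡ _)) (+-identityʳ _)))

              r : ℕ → Carrier
              r = AR.r m

              root-eq : Horner.ev cring (suc d) r ν ≈ 0#
              root-eq = trans (sym (ev-nilpotent es (suc d) D r ν ν-nil (ℕP.n≤1+n d) len≤)) (trans (sym (AR.R-ev m ν)) (trans (sym (AX.taylor-R m (ι w₀) ν w₀+ν)) flat-X))

              base-q : ∀ j a → base es (AR.q j) a K.≈ ⟦_⟧ F (stableAlg F) (taylor pForm h D p-degree j) x
              base-q j a = K.trans (base-cong es (AR.coefficient j) a) (K.trans (base-sumTo D (λ l → ι (wt pForm h D p-degree j l) * AX.⟦p⟧ (ι w₀ + ι (θ l))))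
                (K.trans (SumTo.sumTo-cong K.cring D (λ l _ → term l)) (K.sym (At.taylor-value pForm h D p-degree (stableAlg F) x j))))
                where
                base-sumTo : ∀ k g → base es (SumTo.sumTo cring k g) a K.≈ SumTo.sumTo K.cring k (λ l → base es (g l) a)
                base-sumTo zero g = K.refl
                base-sumTo (suc k) g = K.trans (base-+ es _ _ a) (K.+-congˡ (base-sumTo k (g ∘ suc)))
                at : AlgHom F (EAlg es) (stableAlg F)
                at = record { fun = λ u → AlgHom.fun (baseHom es) u a ; fun-cong = λ e → AlgHom.fun-cong (baseHom es) e a ; fun-ι = λ b → AlgHom.fun-ι (baseHom es) b a
                  ; fun-+ = λ u v → AlgHom.fun-+ (baseHom es) u v a ; fun-* = λ u v → AlgHom.fun-* (baseHom es) u v a }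
                fun-at : ∀ u → AlgHom.fun at u K.≈ base es u a
                fun-at u = K.reflexive (≡.cong (λ t → t a) (fun≡base es u))
                term : ∀ l → base es (ι (wt pForm h D p-degree j l) * AX.⟦p⟧ (ι w₀ + ι (θ l))) a K.≈
                  wt pForm h D p-degree j l K.* At.⟦p⟧ pForm h D p-degree (stableAlg F) x (w₀ K.+ θ l)
                term l = K.trans (base-* es _ _ a) (K.*-cong (base-ι _ a) (K.trans (K.sym (fun-at _)) (K.trans (AlgHom.fun-⟦⟧ at pForm (cons (ι w₀ + ι (θ l)) X))
                  (⟦⟧-cong F (stableAlg F) pForm (λ { zero → K.trans (fun-at _) (K.trans (base-+ es _ _ a) (K.+-cong (base-ι _ a) (base-ι _ a)))
                                                 ; (suc i) → K.trans (fun-at _) (point-base x i a) })))))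

              r-1-unit : Σ T.Carrier λ i → (base es (r 1) T.* i T.≈ T.1#) × DependsOn (_∈ []) i
              r-1-unit = (λ _ → proj₁ y) , (λ a → K.trans (K.*-congʳ (K.trans (base-cong es (AR.r-1 m (ℕP.≤-trans (s≤s z≤n) len≤)) a)
                  (K.trans (times-base es (suc m) a) (K.*-congˡ (base-q (suc m) a))))) (λ k → k (proj₂ y))) , λ _ _ _ → K.refl
                where
                y = F.inverse (natF F (suc m) F.* ⟦_⟧ F (stableAlg F) (taylor pForm h D p-degree (suc m)) x)
                              (λ z → nonzero-* (λ e → e (char0 m)) taylor-x (λ k → k z))

              ips : Carrier → IPSVar (suc n) 1 → Carrier
              ips w = assign (EAlg es) (cons w X) 0# (square-minus (EAlg es) (cons w X))

              private
                cons-dep : ∀ s v → DepE [] es (cons (ι s) X v)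
                cons-dep s zero = DepE-ι es s
                cons-dep s (suc i) = point-dep x i

                cons-big : ∀ s v → BigE 1 0 [] es (cons (ι s) X v)
                cons-big s zero = ι-big es s z≤n
                cons-big s (suc i) = point-big x i

                cons-square-big : ∀ s v → BigE 1 0 [] es (cons (ι s) X v * cons (ι s) X v)
                cons-square-big s zero = BigE-resp es (ι-* s s) (ι-big es (s F.* s) z≤n)
                cons-square-big s (suc i) = square-big x i

                neg-big : ∀ {u} → BigE 1 0 [] es u → BigE 1 0 [] es (- u)
                neg-big b = BigE-resp es (trans (*-congʳ (trans (ι-neg _) (-‿cong ι-1))) (-1*x≈-x _)) (BigE-scale es (F.- F.1#) b)
                  where open import Algebra.Properties.Ring ring using (-1*x≈-x)

              ips-dep : ∀ s v → DepE [] es (ips (ι s) v)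
              ips-dep s (inj₁ v) = cons-dep s v
              ips-dep s (inj₂ (inj₁ _)) = DepE-0 es
              ips-dep s (inj₂ (inj₂ v)) = DepE-+ es (DepE-* es (cons-dep s v) (cons-dep s v)) (DepE-neg es (cons-dep s v))

              ips-big : ∀ s v → BigE (thr 0) 1 [] es (ips (ι s) v)
              ips-big s (inj₁ v) = BigE-≤ es thr0 z≤n (cons-big s v)
              ips-big s (inj₂ (inj₁ _)) = BigE-≤ es z≤n z≤n (BigE-0 {0} es)
              ips-big s (inj₂ (inj₂ v)) = BigE-≤ es thr0 z≤n (BigE-+ es (cons-square-big s v) (neg-big (cons-big s v)))

              NodesAt : F.Carrier → Set _
              NodesAt s = ∀ j → NodeClass lvs Δ (ℕP.n≤1+n _) es (ips (ι s)) (ips-dep s) (ips-big s) t (lookup (nodeForms (Circuit.prog C)) j)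

              nodes-at : ∀ s → ¬ ¬ NodesAt s
              nodes-at s = ¬¬-fin _ _ (λ j → classify (value-dep lvs Δ (ℕP.n≤1+n _) es (ips (ι s)) (ips-dep s) (ips-big s) t (lookup (nodeForms (Circuit.prog C)) j)))

              M = suc D ℕ.* (suc D ℕ.* circuitCount d t Δ)

              M≥1 : 1 ≤ M
              M≥1 = ℕP.*-mono-≤ {1} {suc D} {1} (s≤s z≤n) (ℕP.*-mono-≤ {1} {suc D} {1} (s≤s z≤n) (circuitCount≥1 d t Δ))

              s-of : ℕ → ℕ → F.Carrier
              s-of i l = w₀ F.+ (θ i F.+ θ l)

              ⟦p⟧-dep : ∀ s → DepE [] es (AX.⟦p⟧ (ι s))
              ⟦p⟧-dep s = GradedRel.rel-⟦⟧ (depRel es) (λ _ → 0) {cons (ι s) X} {cons (ι s) X} (cons-dep s) pForm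

              ⟦p⟧-big : ∀ s → NodesAt s → BigE (thr (2 ℕ.* Δ)) (circuitCount d t Δ) [] es (AX.⟦p⟧ (ι s))
              ⟦p⟧-big s cls = BigE-resp es (sym (p-value (EAlg es) (cons (ι s) X)))
                (BigE-+ {M = 0} es (BigE-≤ es (ℕP.≤-trans thr0 (thr-mono z≤n)) z≤n (BigE-resp es ι-1 (ι-big es F.1# z≤n)))
                  (BigE-resp es (trans (*-congʳ (trans (ι-neg _) (-‿cong ι-1))) (-1*x≈-x _)) (BigE-scale es (F.- F.1#)
                    (circuit-bounded lvs Δ (ℕP.n≤1+n _) es (ips (ι s)) (ips-dep s) (ips-big s) t C size≤ depth≤ cls))))
                where open import Algebra.Properties.Ring ring using (-1*x≈-x)

              w-of : ∀ i l → ι (s-of i l) ≈ ι w₀ + (ι (θ i) + ι (θ l))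
              w-of i l = trans (ι-+ _ _) (+-congˡ (ι-+ _ _))

              DepE-sumTo : ∀ k g → (∀ l → DepE [] es (g l)) → DepE [] es (SumTo.sumTo cring k g)
              DepE-sumTo zero g hg = hg 0
              DepE-sumTo (suc k) g hg = DepE-+ es (hg 0) (DepE-sumTo k (g ∘ suc) (hg ∘ suc))

              r-dep : ∀ j → DepE [] es (r j)
              r-dep j = DepE-sumTo D _ (λ i → DepE-* es (DepE-ι es _) (DepE-sumTo D _ (λ l → DepE-* es (DepE-ι es _) (DepE-resp es (AX.⟦p⟧-cong (w-of i l)) (⟦p⟧-dep (s-of i l))))))

              r-big : (∀ i → i ≤ D → ∀ l → l ≤ D → NodesAt (s-of i l)) → ∀ j → BigE (thr (2 ℕ.* Δ)) M [] es (r j)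
              r-big cls j = BigE-sumTo es D _ (λ i i≤ → BigE-scale es _ (BigE-sumTo es D _ (λ l l≤ → BigE-scale es _
                (BigE-resp es (AX.⟦p⟧-cong (w-of i l)) (⟦p⟧-big (s-of i l) (cls i i≤ l l≤))))))

              ν-top : 1 ≤ d → ∀ a → K.- K.1# K.* top es ν a K.≈ top es (⟦_⟧ F (EAlg es) h X) a
              ν-top pos a = K.trans (K.*-congˡ (K.trans (top-cong es split a) (K.trans (top-+ es _ _ a) (K.trans (K.+-congˡ (top-ι es _ pos a)) (K.+-identityʳ _)))))
                  (K.trans (K.sym (top-const-* es (T.ι (F.- F.1#)) _ a)) (top-cong es flip a))
                where
                open RS cring using (rsolve; _:+_; _:*_; :-_; _:-_; _⊜_)
                open import Algebra.Properties.Ring ring using (-1*x≈-x; -‿involutive)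
                H = ⟦_⟧ F (EAlg es) h X
                split : ν ≈ - H + ι (F.- F.1# F.- w₀)
                split = trans (rsolve 3 (λ o h w → ((:- o) :- h) :- w ⊜ (:- h) :+ ((:- o) :- w)) refl 1# H (ι w₀))
                  (+-congˡ (sym (trans (ι-+ _ _) (+-cong (trans (ι-neg _) (-‿cong ι-1)) (ι-neg _)))))
                flip : const es (T.ι (F.- F.1#)) * (- H) ≈ H
                flip = trans (*-congʳ (trans (sym (const-ι es _)) (trans (ι-neg _) (-‿cong ι-1)))) (trans (-1*x≈-x _) (-‿involutive H))

              module X = Expansions (level (2 ℕ.* Δ) ℕP.≤-refl) M M≥1 using (GenE; GenE-root; GenE-top; GenT⇒big; good⇒GenE)

              ν-gen : (∀ i → i ≤ D → ∀ l → l ≤ D → NodesAt (s-of i l)) → X.GenE (rootCount (suc d) d) 0 0 es ν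
              ν-gen cls = X.GenE-root d es r ν (proj₁ r-1-unit) (λ j → X.good⇒GenE es (r-dep j) (BigE-≤ es (ℕP.≤-reflexive (≡.sym (level-θ _ ℕP.≤-refl))) ℕP.≤-refl (r-big cls j)))
                ν-nil (proj₁ (proj₂ r-1-unit)) (proj₂ (proj₂ r-1-unit)) root-eq

              ν-big : (∀ i → i ≤ D → ∀ l → l ≤ D → NodesAt (s-of i l)) → Σ ℕ λ R → Rk R (top es ν) × (R ℕ.* 2 ^ Λ ≤ totalCount d D t Δ ℕ.* 2 ^ (hvs es ℕ.+ 0))
              ν-big cls = X.GenT⇒big (X.GenE-top es (ν-gen cls)) (ℕP.≤-trans (s≤s (ℕP.≤-reflexive (level-θ' _ ℕP.≤-refl))) (ℕP.≤-trans many (ℕP.≤-reflexive (≡.sym (ℕP.+-identityʳ d)))))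

              conclude : (Σ ℕ λ R → Rk R (top es ν) × (R ℕ.* 2 ^ Λ ≤ totalCount d D t Δ ℕ.* 2 ^ (hvs es ℕ.+ 0))) → LowRankTop
              conclude (R , rk , b) = x , sel-x , R , Rk-resp (ν-top (ℕP.≤-trans (s≤s z≤n) many)) (Rk-scale (F.- F.1#) rk) ,
                ℕP.≤-trans b (ℕP.≤-reflexive (≡.cong (λ z → totalCount d D t Δ ℕ.* 2 ^ z) (ℕP.+-identityʳ (hvs es))))

              low-rank : ¬ ¬ LowRankTop
              low-rank k = ¬¬-bounded (λ i → ∀ l → l ≤ D → NodesAt (s-of i l)) D (λ i _ → ¬¬-bounded (λ l → NodesAt (s-of i l)) D (λ l _ → nodes-at (s-of i l))) (λ cls → k (conclude (ν-big cls)))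

          low-rank-top : ¬ ¬ LowRankTop
          low-rank-top k = multiplicity pForm h D p-degree kill start sel sel-nonzero
            (λ (m , (x , alive) , _ , flat) → Point.low-rank x m alive flat k)

module NetworkStructure where
  open CommutativeAlgebra
  open FormulaSemantics
  open TensorRank
  open import Data.Nat.Solver using (module +-*-Solver)
  open import Data.Vec using (concat) renaming (_++_ to _++ᵥ_)
  open import Data.List using (concatMap; allFin; tabulate)
  import Data.Product.Properties as ΣP
  import Data.Sum.Properties as ⊎P

  -- A tower of blocks. A block of height r + 2 with top index t consists of a block of height r and of γ t copies of a block
  -- of height r + 1. W t is the number of free indices of a block with top index t, H t is half of it.
  module Network (γ : ℕ → ℕ) (Z : ℕ) where

    H W : ℕ → ℕ
    H zero = 0
    H (suc zero) = Z
    H (suc (suc t)) = γ t ℕ.* H (suc t) ℕ.+ H t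
    W zero = 0
    W (suc zero) = 2 ℕ.* Z
    W (suc (suc t)) = γ t ℕ.* W (suc t) ℕ.+ W t

    W≡2H : ∀ t → W t ≡ 2 ℕ.* H t
    W≡2H zero = ≡.refl
    W≡2H (suc zero) = ≡.refl
    W≡2H (suc (suc t)) = ≡.trans (≡.cong₂ (λ a b → γ t ℕ.* a ℕ.+ b) (W≡2H (suc t)) (W≡2H t))
      (solve 3 (λ g a b → g :* (con 2 :* a) :+ con 2 :* b := con 2 :* (g :* a :+ b)) ≡.refl (γ t) (H (suc t)) (H t))
      where open +-*-Solver

    Leaf : ℕ → ℕ → Set
    Leaf zero t = ⊤
    Leaf (suc zero) t = ⊤
    Leaf (suc (suc r)) t = Leaf r (suc (suc t)) ⊎ (Fin (γ t) × Leaf (suc r) (suc t))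

    leaf≟ : ∀ r t → DecidableEquality (Leaf r t)
    leaf≟ zero t tt tt = yes ≡.refl
    leaf≟ (suc zero) t tt tt = yes ≡.refl
    leaf≟ (suc (suc r)) t = ⊎P.≡-dec (leaf≟ r (suc (suc t))) (ΣP.≡-dec Fin._≟_ (leaf≟ (suc r) (suc t)))

    level : ∀ r t → Leaf r t → ℕ
    level zero t l = t
    level (suc zero) t l = t
    level (suc (suc r)) t (inj₁ l) = level r (suc (suc t)) l
    level (suc (suc r)) t (inj₂ (_ , l)) = level (suc r) (suc t) l

    len : ∀ r t → Leaf r t → ℕ
    len r t l = W (level r t l)

    isRow : ∀ r t → Leaf r t → Bool
    isRow zero t l = true
    isRow (suc zero) t l = false
    isRow (suc (suc r)) t (inj₁ l) = isRow r (suc (suc t)) l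
    isRow (suc (suc r)) t (inj₂ (_ , l)) = isRow (suc r) (suc t) l

    leaves : ∀ r t → List (Leaf r t)
    leaves zero t = tt ∷ []
    leaves (suc zero) t = tt ∷ []
    leaves (suc (suc r)) t = map inj₁ (leaves r (suc (suc t))) ++ concatMap (λ i → map (λ l → inj₂ (i , l)) (leaves (suc r) (suc t))) (allFin (γ t))

    -- The cut strings of a block: one string for each of the copies.
    cuts : ∀ {X : Set} → List X → ∀ t → List (Vec (Vec X (W (suc t))) (γ t))
    cuts xs t = vecs (vecs xs (W (suc t))) (γ t)

    module Contraction {c ℓ} (R : CommutativeRing c ℓ) {X : Set} (xs : List X) where
      open CommutativeRing R using (*-cong; Carrier; _*_; _≈_)
      open Sums R using (∏; ∏-cong; ∑; ∑-cong)

      net : ∀ r t → ((l : Leaf r t) → Vec X (len r t l) → Carrier) → Vec X (W t) → Carrier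
      net zero t lv m = lv tt m
      net (suc zero) t lv m = lv tt m
      net (suc (suc r)) t lv m = ∑ (cuts xs t) (λ M → net r (suc (suc t)) (λ l → lv (inj₁ l)) (concat M ++ᵥ m) *
        ∏ (allFin (γ t)) (λ i → net (suc r) (suc t) (λ l → lv (inj₂ (i , l))) (lookup M i)))

      net-cong : ∀ r t {lv lv'} m → (∀ l j → lv l j ≈ lv' l j) → net r t lv m ≈ net r t lv' m
      net-cong zero t m e = e tt m
      net-cong (suc zero) t m e = e tt m
      net-cong (suc (suc r)) t m e = ∑-cong (cuts xs t) (λ M → *-cong (net-cong r (suc (suc t)) _ (λ l → e (inj₁ l)))
        (∏-cong (allFin (γ t)) (λ i → net-cong (suc r) (suc t) _ (λ l → e (inj₂ (i , l))))))

    module Pairs {c ℓ} (R : CommutativeRing c ℓ) where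
      open CommutativeRing R using (*-assoc; *-cong; *-congʳ; *-congˡ; *-identityˡ; +-cong; +-congʳ; +-identityʳ; +-identityˡ; Carrier; refl; reflexive; sym; trans; zeroˡ; _+_; _*_; _≈_; 1#)
      open Sums R using (*-∑; ∏; ∏-*; ∏-cong; ∑; ∑-*; ∑-cong; ∑-swap)
      open Kronecker R using (δ; ∑-vecs)
      open RS R using (rsolve; Polynomial; con; _:+_; _:*_; :-_; _:-_; _⊜_)

      B² : Set
      B² = Bool × Bool

      pairs : List B²
      pairs = (true , true) ∷ (true , false) ∷ (false , true) ∷ (false , false) ∷ []

      module C₁ = Contraction R bools using (net)
      module C₂ = Contraction R pairs using (net)

      -- ps enumerates the pairs of elements of xs.
      IsProduct : ∀ {P X : Set} → List P → List X → (P → X) → (P → X) → Set (c ⊔ ℓ)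
      IsProduct {P} {X} ps xs π₁ π₂ = ∀ (g : X → X → Carrier) → ∑ ps (λ p → g (π₁ p) (π₂ p)) ≈ ∑ xs (λ x → ∑ xs (λ y → g x y))

      pairs-product : IsProduct pairs bools proj₁ proj₂
      pairs-product g = rsolve 4 (λ a b c d → a :+ (b :+ (c :+ (d :+ o))) ⊜ (a :+ (b :+ o)) :+ ((c :+ (d :+ o)) :+ o)) refl _ _ _ _
        where
        o : ∀ {n} → Polynomial n
        o = con (ℤ.+ 0)

      vecs-product : ∀ {P X : Set} (ps : List P) (xs : List X) π₁ π₂ → IsProduct ps xs π₁ π₂ → ∀ n → IsProduct (vecs ps n) (vecs xs n) (Vec.map π₁) (Vec.map π₂)
      vecs-product ps xs π₁ π₂ h zero g = sym (+-identityʳ _)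
      vecs-product ps xs π₁ π₂ h (suc n) g = trans (∑-vecs ps n _)
        (trans (∑-cong ps (λ p → vecs-product ps xs π₁ π₂ h n (λ u v → g (π₁ p ∷ u) (π₂ p ∷ v))))
        (trans (h (λ x y → ∑ (vecs xs n) (λ u → ∑ (vecs xs n) (λ v → g (x ∷ u) (y ∷ v)))))
        (trans (∑-cong xs (λ x → trans (∑-swap xs (vecs xs n) _) (∑-cong (vecs xs n) (λ u → sym (∑-vecs xs n (λ w → g (x ∷ u) w))))))
        (sym (∑-vecs xs n _)))))

      fsts snds : ∀ {n} → Vec B² n → Vec Bool n
      fsts = Vec.map proj₁
      snds = Vec.map proj₂

      private
        map-cut : ∀ {γ w v} (f : B² → Bool) (M : Vec (Vec B² w) γ) (m : Vec B² v) → Vec.map f (concat M ++ᵥ m) ≡ concat (Vec.map (Vec.map f) M) ++ᵥ Vec.map f m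
        map-cut f [] m = ≡.refl
        map-cut {v = v} f (x ∷ M) m = ≡.trans (VP.map-++ f (x ++ᵥ concat M) m)
          (≡.cong (_++ᵥ Vec.map f m) (≡.trans (VP.map-++ f x (concat M)) (≡.cong (Vec.map f x ++ᵥ_) (VP.map-concat f M))))

      net-square : ∀ r t {lv : (l : Leaf r t) → Vec Bool (len r t l) → Carrier} {lv₂ : (l : Leaf r t) → Vec B² (len r t l) → Carrier} →
        (∀ l j → lv₂ l j ≈ lv l (fsts j) * lv l (snds j)) → ∀ m → C₂.net r t lv₂ m ≈ C₁.net r t lv (fsts m) * C₁.net r t lv (snds m)
      net-square zero t h m = h tt m
      net-square (suc zero) t h m = h tt m
      net-square (suc (suc r)) t {lv} {lv₂} h m =
        trans (∑-cong (cuts pairs t) (λ M → trans (*-cong (trans (net-square r (suc (suc t)) (λ l → h (inj₁ l)) (concat M ++ᵥ m))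
                (*-cong (reflexive (≡.cong (C₁.net r (suc (suc t)) _) (map-cut proj₁ M m))) (reflexive (≡.cong (C₁.net r (suc (suc t)) _) (map-cut proj₂ M m)))))
              (trans (∏-cong (allFin (γ t)) (λ i → trans (net-square (suc r) (suc t) (λ l → h (inj₂ (i , l))) (lookup M i))
                (*-cong (reflexive (≡.cong (C₁.net (suc r) (suc t) _) (≡.sym (VP.lookup-map i fsts M)))) (reflexive (≡.cong (C₁.net (suc r) (suc t) _) (≡.sym (VP.lookup-map i snds M)))))))
                (∏-* (allFin (γ t)) _ _)))
            (rsolve 4 (λ a b c d → (a :* b) :* (c :* d) ⊜ (a :* c) :* (b :* d)) refl _ _ _ _)))
        (trans (vecs-product (vecs pairs w) (strings w) fsts snds (vecs-product pairs bools proj₁ proj₂ pairs-product w) (γ t) (λ M M' → term M (fsts m) * term M' (snds m)))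
        (trans (∑-cong (cuts bools t) (λ M → sym (*-∑ (term M (fsts m)) (cuts bools t) _))) (sym (∑-* (cuts bools t) _ _))))
        where
        w = W (suc t)
        term : Vec (Vec Bool w) (γ t) → Vec Bool (W t) → Carrier
        term M m = C₁.net r (suc (suc t)) (λ l → lv (inj₁ l)) (concat M ++ᵥ m) * ∏ (allFin (γ t)) (λ i → C₁.net (suc r) (suc t) (λ l → lv (inj₂ (i , l))) (lookup M i))

      δ² : B² → Carrier
      δ² p = δ (proj₁ p) (proj₂ p)

      δ²ᵥ : ∀ {n} → Vec B² n → Carrier
      δ²ᵥ [] = 1#
      δ²ᵥ (p ∷ v) = δ² p * δ²ᵥ v

      private
        Idem : Carrier → Set ℓ
        Idem a = a * a ≈ a

        δ-idem : ∀ p → Idem (δ² p)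
        δ-idem (true , true) = *-identityˡ _
        δ-idem (true , false) = zeroˡ _
        δ-idem (false , true) = zeroˡ _
        δ-idem (false , false) = *-identityˡ _

        idem-* : ∀ {a b} → Idem a → Idem b → Idem (a * b)
        idem-* {a} {b} h h' = trans (rsolve 2 (λ a b → (a :* b) :* (a :* b) ⊜ (a :* a) :* (b :* b)) refl a b) (*-cong h h')

        δᵥ-idem : ∀ {n} (v : Vec B² n) → Idem (δ²ᵥ v)
        δᵥ-idem [] = *-identityˡ _
        δᵥ-idem (p ∷ v) = idem-* (δ-idem p) (δᵥ-idem v)

        δ²-++ : ∀ {n k} (u : Vec B² n) (v : Vec B² k) → δ²ᵥ (u ++ᵥ v) ≈ δ²ᵥ u * δ²ᵥ v
        δ²-++ [] v = sym (*-identityˡ _)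
        δ²-++ (p ∷ u) v = trans (*-congˡ (δ²-++ u v)) (sym (*-assoc _ _ _))

        δ²-concat : ∀ {n k} (M : Vec (Vec B² n) k) → δ²ᵥ (concat M) ≈ ∏ (allFin k) (λ i → δ²ᵥ (lookup M i))
        δ²-concat [] = refl
        δ²-concat {k = suc k} (v ∷ M) = trans (δ²-++ v (concat M)) (*-congˡ (trans (δ²-concat M) (tabulate-suc k (λ i → i) M)))
          where
          tabulate-suc : ∀ k {n} (f : Fin k → Fin n) (M : Vec (Vec B² _) n) → ∏ (tabulate f) (λ i → δ²ᵥ (lookup M i)) ≈ ∏ (tabulate (suc ∘ f)) (λ i → δ²ᵥ (lookup (v ∷ M) i))
          tabulate-suc zero f M = refl
          tabulate-suc (suc k) f M = *-congˡ (tabulate-suc k (f ∘ suc) M)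

      IsDiagonal : ∀ {P X : Set} → List P → List X → (P → Carrier) → (P → X) → Set (c ⊔ ℓ)
      IsDiagonal {P} {X} ps xs d π = ∀ (g : X → Carrier) → ∑ ps (λ p → d p * g (π p)) ≈ ∑ xs g

      pairs-diagonal : IsDiagonal pairs bools δ² proj₁
      pairs-diagonal g = +-cong (*-identityˡ _) (trans (+-congʳ (zeroˡ _)) (trans (+-identityˡ _) (trans (+-congʳ (zeroˡ _)) (trans (+-identityˡ _) (+-congʳ (*-identityˡ _))))))

      ∏ᵥ : ∀ {P : Set} {n} → (P → Carrier) → Vec P n → Carrier
      ∏ᵥ d [] = 1#
      ∏ᵥ d (p ∷ v) = d p * ∏ᵥ d v

      vecs-diagonal : ∀ {P X : Set} (ps : List P) (xs : List X) d π → IsDiagonal ps xs d π → ∀ n → IsDiagonal (vecs ps n) (vecs xs n) (∏ᵥ d) (Vec.map π)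
      vecs-diagonal ps xs d π h zero g = +-congʳ (*-identityˡ _)
      vecs-diagonal ps xs d π h (suc n) g = trans (∑-vecs ps n _)
        (trans (∑-cong ps (λ p → trans (∑-cong (vecs ps n) (λ v → *-assoc (d p) (∏ᵥ d v) (g (π p ∷ Vec.map π v)))) (trans (sym (*-∑ (d p) (vecs ps n) _))
            (*-congˡ (vecs-diagonal ps xs d π h n (λ v → g (π p ∷ v)))))))
        (trans (h (λ x → ∑ (vecs xs n) (λ v → g (x ∷ v)))) (sym (∑-vecs xs n g))))

      private
        ∏ᵥ-δ² : ∀ {n} (v : Vec B² n) → ∏ᵥ δ² v ≈ δ²ᵥ v
        ∏ᵥ-δ² [] = refl
        ∏ᵥ-δ² (p ∷ v) = *-congˡ (∏ᵥ-δ² v)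

        ∏ᵥ-δ²ᵥ : ∀ {n k} (M : Vec (Vec B² n) k) → ∏ᵥ (∏ᵥ δ²) M ≈ δ²ᵥ (concat M)
        ∏ᵥ-δ²ᵥ [] = refl
        ∏ᵥ-δ²ᵥ (v ∷ M) = trans (*-cong (∏ᵥ-δ² v) (∏ᵥ-δ²ᵥ M)) (sym (δ²-++ v (concat M)))

      net-diagonal : ∀ r t {lv : (l : Leaf r t) → Vec Bool (len r t l) → Carrier} {lv₂ : (l : Leaf r t) → Vec B² (len r t l) → Carrier} →
        (∀ l j → lv₂ l j ≈ δ²ᵥ j * lv l (fsts j)) → ∀ m → C₂.net r t lv₂ m ≈ δ²ᵥ m * C₁.net r t lv (fsts m)
      net-diagonal zero t h m = h tt m
      net-diagonal (suc zero) t h m = h tt m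
      net-diagonal (suc (suc r)) t {lv} {lv₂} h m =
        trans (∑-cong (cuts pairs t) (λ M → trans (*-cong (trans (net-diagonal r (suc (suc t)) (λ l → h (inj₁ l)) (concat M ++ᵥ m))
                (*-cong (δ²-++ (concat M) m) (reflexive (≡.cong (C₁.net r (suc (suc t)) _) (map-cut proj₁ M m)))))
              (trans (∏-cong (allFin (γ t)) (λ i → trans (net-diagonal (suc r) (suc t) (λ l → h (inj₂ (i , l))) (lookup M i))
                (*-congˡ (reflexive (≡.cong (C₁.net (suc r) (suc t) _) (≡.sym (VP.lookup-map i fsts M)))))))
                (trans (∏-* (allFin (γ t)) _ _) (*-congʳ (sym (δ²-concat M))))))
            (trans (rsolve 4 (λ a b c d → ((a :* b) :* c) :* (a :* d) ⊜ (a :* a) :* (b :* (c :* d))) refl _ _ _ _)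
              (*-congʳ (trans (δᵥ-idem (concat M)) (sym (∏ᵥ-δ²ᵥ M)))))))
        (trans (vecs-diagonal (vecs pairs w) (strings w) (∏ᵥ δ²) fsts (vecs-diagonal pairs bools δ² proj₁ pairs-diagonal w) (γ t) (λ M → δ²ᵥ m * term M))
          (sym (*-∑ (δ²ᵥ m) (cuts bools t) term)))
        where
        w = W (suc t)
        term : Vec (Vec Bool w) (γ t) → Carrier
        term M = C₁.net r (suc (suc t)) (λ l → lv (inj₁ l)) (concat M ++ᵥ fsts m) * ∏ (allFin (γ t)) (λ i → C₁.net (suc r) (suc t) (λ l → lv (inj₂ (i , l))) (lookup M i))

module NetworkRank where
  open CommutativeAlgebra
  open TensorRank
  open NetworkStructure
  open RootExpansions using (¬¬-dec)
  open import Defs using (Field; module Field)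
  open import Data.Nat.Solver using (module +-*-Solver)
  open import Data.Bool using (if_then_else_)
  open import Data.Fin using (punchIn; combine; remQuot)
  open import Data.Vec using (concat) renaming (_++_ to _++ᵥ_)
  open import Data.Vec.Functional using (insertAt)
  import Data.Vec.Functional.Properties as VFP
  open import Data.List using (concatMap; allFin)
  open import Data.List.Relation.Unary.All as All using (All; []; _∷_)
  import Data.List.Relation.Unary.All.Properties as AllP
  open import Data.Product using (uncurry)

  module LinearDependence {c ℓ : Level} (F : Field c ℓ) where
    private
      module F = Field F using (*-assoc; *-congˡ; *-identityʳ; Carrier; sym; trans; _*_; _≈_; 1#; commutativeRing; nontrivial; inverse)
      module K = CommutativeRing (Stabilised.stableRing F.commutativeRing) using (*-comm; *-cong; *-congʳ; *-congˡ; *-identityʳ; *-identityˡ; +-assoc; +-comm; +-commutativeMonoid; +-cong; +-congʳ; +-congˡ; +-identityʳ; +-identityˡ; -‿cong; -‿inverseʳ; -‿inverseˡ; distribʳ; distribˡ; refl; reflexive; ring; semiring; sym; trans; zeroʳ; zeroˡ; _+_; _*_; -_; _-_; _≈_; 0#; 1#)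
    open import Algebra.Properties.CommutativeMonoid.Sum K.+-commutativeMonoid using (sum; sum-remove; ∑-distrib-+; sum-cong-≋; sum-replicate-zero) public
    open import Algebra.Properties.Semiring.Sum K.semiring using (*-distribˡ-sum)
    open RS (Stabilised.stableRing F.commutativeRing) using (rsolve; _:+_; _:*_; :-_; _:-_; _⊜_)

    sum-zero : ∀ {n} {t : Fin n → F.Carrier} → (∀ i → t i K.≈ K.0#) → sum t K.≈ K.0#
    sum-zero {n} e = K.trans (sum-cong-≋ e) (sum-replicate-zero n)

    sum-scale : ∀ {n} x (t : Fin n → F.Carrier) → sum (λ i → x K.* t i) K.≈ x K.* sum t
    sum-scale x t = K.sym (*-distribˡ-sum x t)

    dependent : ∀ R n (fs : List (Fin n → F.Carrier)) → length fs ≡ R → R < n →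
      ¬ ¬ (Σ (Fin n → F.Carrier) λ κ → (∃ λ i → ¬ (κ i K.≈ K.0#)) × All (λ f → sum (λ i → κ i K.* f i) K.≈ K.0#) fs)
    dependent _ (suc n) [] len lt k = k ((λ _ → F.1#) , (zero , λ e → e F.nontrivial) , [])
    dependent (suc R) (suc n) (f ∷ fs) len lt k = ¬¬-dec (∃ λ p → ¬ (f p K.≈ K.0#)) λ
      { (no none) → dependent R (suc n) fs (ℕP.suc-injective len) (ℕP.≤-trans (ℕP.n≤1+n _) lt) (λ (κ , nz , h) →
          k (κ , nz , sum-zero (λ i → K.trans (K.*-congˡ {κ i} (λ k → none (i , λ z → z k))) (K.zeroʳ _)) ∷ h))
      ; (yes (p , nz)) → pivot p (F.inverse (f p) (λ z → nz (λ k → k z))) }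
      where
      pivot : ∀ p → (Σ F.Carrier λ y → f p F.* y F.≈ F.1#) → ⊥
      pivot p (y , e) = dependent R n (map reduce fs) (≡.trans (LP.length-map reduce fs) (ℕP.suc-injective len)) (ℕP.≤-pred lt) solve
        where
        reduce : (Fin (suc n) → F.Carrier) → Fin n → F.Carrier
        reduce g j = g (punchIn p j) K.- (g p K.* y) K.* f (punchIn p j)
        solve : (Σ (Fin n → F.Carrier) λ κ → (∃ λ i → ¬ (κ i K.≈ K.0#)) × All (λ f → sum (λ i → κ i K.* f i) K.≈ K.0#) (map reduce fs)) → ⊥
        solve (κ , (i , κi) , h) = k (κ' , (punchIn p i , λ z → κi (K.trans (K.reflexive (≡.sym (VFP.insertAt-punchIn κ p v i))) z)) , first ∷ All.map (λ {g} → rest {g}) (AllP.map⁻ h))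
          where
          S v : F.Carrier
          S = sum (λ j → κ j K.* f (punchIn p j))
          v = K.- (y K.* S)
          κ' : Fin (suc n) → F.Carrier
          κ' = insertAt κ p v
          split : ∀ g → sum (λ i → κ' i K.* g i) K.≈ v K.* g p K.+ sum (λ j → κ j K.* g (punchIn p j))
          split g = K.trans (sum-remove {i = p} (λ i → κ' i K.* g i)) (K.+-cong (K.*-congʳ (K.reflexive (VFP.insertAt-lookup κ p v)))
            (sum-cong-≋ (λ j → K.*-congʳ (K.reflexive (VFP.insertAt-punchIn κ p v j)))))
          unit : f p K.* y K.≈ K.1#
          unit k = k e
          first : sum (λ i → κ' i K.* f i) K.≈ K.0#
          first = K.trans (split f) (K.trans (K.+-congʳ (rsolve 3 (λ y s f → (:- (y :* s)) :* f ⊜ :- ((f :* y) :* s)) K.refl y S (f p)))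
            (K.trans (K.+-congʳ (K.-‿cong (K.trans (K.*-congʳ unit) (K.*-identityˡ S)))) (K.-‿inverseˡ S)))
          rest : ∀ {g} → sum (λ j → κ j K.* reduce g j) K.≈ K.0# → sum (λ i → κ' i K.* g i) K.≈ K.0#
          rest {g} z = K.trans (split g) (K.trans (K.trans (K.+-comm _ _) (K.+-congˡ (K.trans (rsolve 3 (λ y s g → (:- (y :* s)) :* g ⊜ (:- (g :* y)) :* s) K.refl y S (g p)) (K.sym (sum-scale (K.- (g p K.* y)) (λ j → κ j K.* f (punchIn p j)))))))
            (K.trans (K.sym (∑-distrib-+ (λ j → κ j K.* g (punchIn p j)) (λ j → (K.- (g p K.* y)) K.* (κ j K.* f (punchIn p j)))))
              (K.trans (sum-cong-≋ (λ j → rsolve 4 (λ k g c f → k :* g :+ (:- c) :* (k :* f) ⊜ k :* (g :- c :* f)) K.refl (κ j) (g (punchIn p j)) (g p K.* y) (f (punchIn p j)))) z)))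

  module RankLower {c ℓ : Level} (F : Field c ℓ) (Leaf : Set) (_≟ℓ_ : DecidableEquality Leaf) (len : Leaf → ℕ) (side : Leaf → Bool) where
    private
      module F = Field F using (*-assoc; *-congˡ; *-identityʳ; Carrier; sym; trans; _*_; _≈_; 1#; commutativeRing; nontrivial; inverse)
      module K = CommutativeRing (Stabilised.stableRing F.commutativeRing) using (*-comm; *-cong; *-congʳ; *-congˡ; *-identityʳ; *-identityˡ; +-assoc; +-comm; +-commutativeMonoid; +-cong; +-congʳ; +-congˡ; +-identityʳ; +-identityˡ; -‿cong; -‿inverseʳ; -‿inverseˡ; distribʳ; distribˡ; refl; reflexive; ring; semiring; sym; trans; zeroʳ; zeroˡ; _+_; _*_; -_; _-_; _≈_; 0#; 1#)
    open Tensor (Stabilised.stableRing F.commutativeRing) Leaf _≟ℓ_ len using (Agree; Idx; module Rank)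
    open Rank side using (Rk)
    open LinearDependence F using (dependent; sum; sum-cong-≋; sum-remove; sum-scale; sum-zero; ∑-distrib-+)
    open Sums (Stabilised.stableRing F.commutativeRing) using (∑; ∑-cong)

    mix : Idx → Idx → Idx
    mix a b l = if side l then a l else b l

    diagonal-rank : ∀ {n R t} (a : Fin n → Idx) → (∀ i k → ¬ i ≡ k → t (mix (a i) (a k)) K.≈ K.0#) → (∀ i → ¬ (t (mix (a i) (a i)) K.≈ K.0#)) →
      Rk R t → n ≤ R
    diagonal-rank {n} {R} {t} a off diag (ts , le , h) with n ℕP.≤? R
    ... | yes p = p
    ... | no np = ⊥-elim (dependent _ n (map (λ s i → proj₁ s (a i)) ts) ≡.refl (ℕP.≤-trans (s≤s (ℕP.≤-trans (ℕP.≤-reflexive (LP.length-map _ ts)) le)) (ℕP.≰⇒> np))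
        (λ (κ , (i , nz) , zs) → contradiction κ i nz (AllP.map⁻ zs)))
      where
      open RS (Stabilised.stableRing F.commutativeRing) using (rsolve; _:+_; _:*_; :-_; _:-_; _⊜_)
      contradiction : ∀ (κ : Fin n → F.Carrier) i → ¬ (κ i K.≈ K.0#) → All (λ s → sum (λ i → κ i K.* proj₁ s (a i)) K.≈ K.0#) ts → ⊥
      contradiction κ k nz zs = K-domain (K.trans (K.sym single) (K.trans (sum-cong-≋ (λ i → K.*-congˡ {κ i} (expand i))) (total ts zs))) (diag k)
        where
        K-domain : κ k K.* t (mix (a k) (a k)) K.≈ K.0# → ¬ ¬ (t (mix (a k) (a k)) K.≈ K.0#)
        K-domain e nd with F.inverse _ (λ z → nd (λ k → k z))
        ... | y , u = nz (K.trans (λ k → k (F.trans (F.sym (F.*-identityʳ _)) (F.trans (F.*-congˡ (F.sym u)) (F.sym (F.*-assoc _ _ _))))) (K.trans (K.*-congʳ e) (K.zeroˡ y)))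
        single : sum (λ i → κ i K.* t (mix (a i) (a k))) K.≈ κ k K.* t (mix (a k) (a k))
        single = go n a κ k off
          where
          go : ∀ n (a : Fin n → Idx) (κ : Fin n → F.Carrier) k → (∀ i k → ¬ i ≡ k → t (mix (a i) (a k)) K.≈ K.0#) → sum (λ i → κ i K.* t (mix (a i) (a k))) K.≈ κ k K.* t (mix (a k) (a k))
          go (suc n) a κ k off = K.trans (sum-remove {i = k} (λ i → κ i K.* t (mix (a i) (a k)))) (K.trans (K.+-congˡ (sum-zero (λ j → K.trans (K.*-congˡ {κ (punchIn k j)} (off (punchIn k j) k (FP.punchInᵢ≢i k j))) (K.zeroʳ _)))) (K.+-identityʳ _))
        rowAgree : ∀ b b' → Agree (λ l → side l ≡ true) (mix b b') b
        rowAgree b b' l s with side l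
        rowAgree b b' l ≡.refl | .true = ≡.refl
        colAgree : ∀ b b' → Agree (λ l → side l ≡ false) (mix b b') b'
        colAgree b b' l s with side l
        colAgree b b' l ≡.refl | .false = ≡.refl
        expand : ∀ i → t (mix (a i) (a k)) K.≈ ∑ ts (λ s → proj₁ s (a i) K.* proj₁ (proj₂ s) (a k))
        expand i = K.trans (h _) (∑-cong ts (λ (u , v , ru , cv) → K.*-cong (ru _ _ (rowAgree (a i) (a k))) (cv _ _ (colAgree (a i) (a k)))))
        total : ∀ ts → All (λ s → sum (λ i → κ i K.* proj₁ s (a i)) K.≈ K.0#) ts → sum (λ i → κ i K.* ∑ ts (λ s → proj₁ s (a i) K.* proj₁ (proj₂ s) (a k))) K.≈ K.0#
        total [] [] = sum-zero {t = λ i → κ i K.* K.0#} (λ i → K.zeroʳ (κ i))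
        total ((u , v , _) ∷ ts) (z ∷ zs) = K.trans (sum-cong-≋ (λ i → K.trans (K.distribˡ (κ i) _ _) (K.+-congʳ (rsolve 3 (λ k u v → k :* (u :* v) ⊜ v :* (k :* u)) K.refl (κ i) (u (a i)) (v (a k))))))
          (K.trans (∑-distrib-+ (λ i → v (a k) K.* (κ i K.* u (a i))) _) (K.trans (K.+-cong (K.trans (sum-scale (v (a k)) (λ i → κ i K.* u (a i))) (K.trans (K.*-congˡ {v (a k)} z) (K.zeroʳ _))) (total ts zs)) (K.+-identityˡ _)))

  module Configurations (γ : ℕ → ℕ) (Z : ℕ) where
    open Network γ Z using (Leaf; W; cuts; isRow; leaves; len; module Contraction)

    Conf : ℕ → ℕ → Set
    Conf zero t = ⊤
    Conf (suc zero) t = ⊤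
    Conf (suc (suc r)) t = Vec (Vec Bool (W (suc t))) (γ t) × Conf r (suc (suc t)) × Vec (Conf (suc r) (suc t)) (γ t)

    decode : ∀ r t → Conf r t → Vec Bool (W t) → (l : Leaf r t) → Vec Bool (len r t l)
    decode zero t c m l = m
    decode (suc zero) t c m l = m
    decode (suc (suc r)) t (M , c , cs) m (inj₁ l) = decode r (suc (suc t)) c (concat M ++ᵥ m) l
    decode (suc (suc r)) t (M , c , cs) m (inj₂ (i , l)) = decode (suc r) (suc t) (lookup cs i) (lookup M i) l

    -- Whether the rows are the longer side of blocks of height r.
    rowDominant : ℕ → Bool
    rowDominant zero = true
    rowDominant (suc r) = not (rowDominant r)

    private
      concat-injective : ∀ {n k} (M M' : Vec (Vec Bool n) k) → concat M ≡ concat M' → M ≡ M'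
      concat-injective [] [] e = ≡.refl
      concat-injective (v ∷ M) (v' ∷ M') e with VP.++-injective v v' e
      ... | e₁ , e₂ = ≡.cong₂ _∷_ e₁ (concat-injective M M' e₂)

      lookup-ext : ∀ {A : Set} {n} (u v : Vec A n) → (∀ i → lookup u i ≡ lookup v i) → u ≡ v
      lookup-ext [] [] e = ≡.refl
      lookup-ext (x ∷ u) (y ∷ v) e = ≡.cong₂ _∷_ (e zero) (lookup-ext u v (e ∘ suc))

      conf-≡ : ∀ {r t} {M M' : Vec (Vec Bool (W (suc t))) (γ t)} {c c' : Conf r (suc (suc t))} {cs cs' : Vec (Conf (suc r) (suc t)) (γ t)} {m m' : Vec Bool (W t)} →
        (concat M ++ᵥ m ≡ concat M' ++ᵥ m') × (c ≡ c') → (M ≡ M' → ∀ i → lookup cs i ≡ lookup cs' i) → (m ≡ m') × ((M , c , cs) ≡ (M' , c' , cs'))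
      conf-≡ {M = M} {M'} {cs = cs} {cs'} (e , ≡.refl) h with VP.++-injective (concat M) (concat M') e
      ... | eM , ≡.refl with concat-injective M M' eM
      ... | ≡.refl = ≡.refl , ≡.cong (λ z → M , _ , z) (lookup-ext cs cs' (h ≡.refl))

      conf-≡′ : ∀ {r t} {M M' : Vec (Vec Bool (W (suc t))) (γ t)} {c c' : Conf r (suc (suc t))} {cs cs' : Vec (Conf (suc r) (suc t)) (γ t)} →
        (∀ i → (lookup M i ≡ lookup M' i) × (lookup cs i ≡ lookup cs' i)) → (M ≡ M' → c ≡ c') → (M , c , cs) ≡ (M' , c' , cs')
      conf-≡′ {M = M} {M'} {cs = cs} {cs'} h k with lookup-ext M M' (proj₁ ∘ h) | lookup-ext cs cs' (proj₂ ∘ h)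
      ... | ≡.refl | ≡.refl = ≡.cong (λ z → M , z , cs) (k ≡.refl)

      not-not : ∀ b → not (not b) ≡ b
      not-not true = ≡.refl
      not-not false = ≡.refl

    dominant-determines : ∀ r t c c' m m' → (∀ l → isRow r t l ≡ rowDominant r → decode r t c m l ≡ decode r t c' m' l) → m ≡ m' × c ≡ c'
    other-determines : ∀ r t c c' m → (∀ l → isRow r t l ≡ not (rowDominant r) → decode r t c m l ≡ decode r t c' m l) → c ≡ c'
    dominant-determines zero t tt tt m m' h = h tt ≡.refl , ≡.refl
    dominant-determines (suc zero) t tt tt m m' h = h tt ≡.refl , ≡.refl
    dominant-determines (suc (suc r)) t (M , c , cs) (M' , c' , cs') m m' h = conf-≡
      (dominant-determines r (suc (suc t)) c c' (concat M ++ᵥ m) (concat M' ++ᵥ m') (λ l s → h (inj₁ l) (≡.trans s (≡.sym (not-not _)))))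
      (λ eM i → other-determines (suc r) (suc t) (lookup cs i) (lookup cs' i) (lookup M i) (λ l s → ≡.trans (h (inj₂ (i , l)) s)
        (≡.cong (λ M → decode (suc r) (suc t) (lookup cs' i) (lookup M i) l) (≡.sym eM))))
    other-determines zero t tt tt m h = ≡.refl
    other-determines (suc zero) t tt tt m h = ≡.refl
    other-determines (suc (suc r)) t (M , c , cs) (M' , c' , cs') m h = conf-≡′
      (λ i → dominant-determines (suc r) (suc t) (lookup cs i) (lookup cs' i) (lookup M i) (lookup M' i) (λ l s → h (inj₂ (i , l)) (≡.trans s (≡.sym (not-not _)))))
      (λ eM → other-determines r (suc (suc t)) c c' (concat M ++ᵥ m) (λ l s → ≡.trans (h (inj₁ l) (≡.trans s (≡.cong not (≡.sym (not-not _)))))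
        (≡.cong (λ M → decode r (suc (suc t)) c' (concat M ++ᵥ m) l) (≡.sym eM))))

    rows-determine : ∀ r t c c' m → (∀ l → isRow r t l ≡ true → decode r t c m l ≡ decode r t c' m l) → c ≡ c'
    rows-determine r t c c' m h with rowDominant r in eq
    ... | true = proj₂ (dominant-determines r t c c' m m (λ l s → h l (≡.trans s eq)))
    ... | false = other-determines r t c c' m (λ l s → h l (≡.trans s (≡.cong not eq)))

    cols-determine : ∀ r t c c' m → (∀ l → isRow r t l ≡ false → decode r t c m l ≡ decode r t c' m l) → c ≡ c'
    cols-determine r t c c' m h with rowDominant r in eq
    ... | false = proj₂ (dominant-determines r t c c' m m (λ l s → h l (≡.trans s eq)))
    ... | true = other-determines r t c c' m (λ l s → h l (≡.trans s (≡.cong not eq)))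

    confs : ∀ r t → List (Conf r t)
    confs zero t = tt ∷ []
    confs (suc zero) t = tt ∷ []
    confs (suc (suc r)) t = concatMap (λ M → concatMap (λ c → map (λ cs → M , c , cs) (vecs (confs (suc r) (suc t)) (γ t))) (confs r (suc (suc t)))) (cuts bools t)

    bits : ℕ → ℕ → ℕ
    bits zero t = 0
    bits (suc zero) t = 0
    bits (suc (suc r)) t = W (suc t) ℕ.* γ t ℕ.+ (bits r (suc (suc t)) ℕ.+ bits (suc r) (suc t) ℕ.* γ t)

    record Injection (e : ℕ) (A : Set) : Set where
      field
        fun       : Fin (2 ^ e) → A
        injective : ∀ i j → fun i ≡ fun j → i ≡ j

    private
      inj-0 : ∀ {A} → A → Injection 0 A
      inj-0 a = record { fun = λ _ → a ; injective = λ { zero zero _ → ≡.refl } }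

      cast-injective : ∀ {m n} (eq : m ≡ n) {i j : Fin m} → Fin.cast eq i ≡ Fin.cast eq j → i ≡ j
      cast-injective eq {i} {j} h = FP.toℕ-injective (≡.trans (≡.sym (FP.toℕ-cast eq i)) (≡.trans (≡.cong Fin.toℕ h) (FP.toℕ-cast eq j)))

      cast : ∀ {e e' A} → e ≡ e' → Injection e A → Injection e' A
      cast ≡.refl h = h

      inj-× : ∀ {e e' A B} → Injection e A → Injection e' B → Injection (e ℕ.+ e') (A × B)
      inj-× {e} {e'} {A} {B} f g = record
        { fun = λ i → fun f (proj₁ (remQuot {2 ^ e} (2 ^ e') (split i))) , fun g (proj₂ (remQuot {2 ^ e} (2 ^ e') (split i)))
        ; injective = λ i j eq → cast-injective (ℕP.^-distribˡ-+-* 2 e e') (≡.trans (≡.sym (FP.combine-remQuot {2 ^ e} (2 ^ e') (split i))) (≡.trans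
            (≡.cong (uncurry combine) (≡.cong₂ _,_ (injective f _ _ (≡.cong proj₁ eq)) (injective g _ _ (≡.cong proj₂ eq)))) (FP.combine-remQuot {2 ^ e} (2 ^ e') (split j)))) }
        where
        open Injection using (fun; injective)
        split : Fin (2 ^ (e ℕ.+ e')) → Fin (2 ^ e ℕ.* 2 ^ e')
        split = Fin.cast (ℕP.^-distribˡ-+-* 2 e e')

      inj-map : ∀ {e A B} (h : A → B) → (∀ {a a'} → h a ≡ h a' → a ≡ a') → Injection e A → Injection e B
      inj-map h hi f = record { fun = h ∘ Injection.fun f ; injective = λ i j eq → Injection.injective f i j (hi eq) }

      inj-vec : ∀ {e A} → Injection e A → ∀ n → Injection (e ℕ.* n) (Vec A n)
      inj-vec {e} h zero = cast (≡.sym (ℕP.*-zeroʳ e)) (inj-0 [])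
      inj-vec {e} {A} h (suc n) = cast (≡.sym (ℕP.*-suc e n)) (inj-map {A = A × Vec A n} (λ p → proj₁ p ∷ proj₂ p) (λ eq → ≡.cong₂ _,_ (VP.∷-injectiveˡ eq) (VP.∷-injectiveʳ eq)) (inj-× h (inj-vec h n)))

      inj-bool : Injection 1 Bool
      inj-bool = record { fun = λ { zero → true ; (suc zero) → false } ; injective = λ { zero zero _ → ≡.refl ; (suc zero) (suc zero) _ → ≡.refl ; zero (suc zero) () ; (suc zero) zero () } }

    configurations : ∀ r t → Injection (bits r t) (Conf r t)
    configurations zero t = inj-0 tt
    configurations (suc zero) t = inj-0 tt
    configurations (suc (suc r)) t = inj-× (inj-vec (cast (ℕP.+-identityʳ _) (inj-vec inj-bool (W (suc t)))) (γ t)) (inj-× (configurations r (suc (suc t))) (inj-vec (configurations (suc r) (suc t)) (γ t)))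

    lens : ∀ r t → List (Leaf r t) → ℕ
    lens r t [] = 0
    lens r t (l ∷ ls) = len r t l ℕ.+ lens r t ls

    totalLen : ∀ r t → ℕ
    totalLen r t = lens r t (leaves r t)

    private
      lens-++ : ∀ r t xs ys → lens r t (xs ++ ys) ≡ lens r t xs ℕ.+ lens r t ys
      lens-++ r t [] ys = ≡.refl
      lens-++ r t (x ∷ xs) ys = ≡.trans (≡.cong (len r t x ℕ.+_) (lens-++ r t xs ys)) (≡.sym (ℕP.+-assoc (len r t x) _ _))

    totalLen-suc : ∀ r t → totalLen (suc (suc r)) t ≡ totalLen r (suc (suc t)) ℕ.+ γ t ℕ.* totalLen (suc r) (suc t)
    totalLen-suc r t = ≡.trans (lens-++ (suc (suc r)) t (map inj₁ (leaves r (suc (suc t)))) _) (≡.cong₂ ℕ._+_ (first (leaves r (suc (suc t))))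
        (≡.trans (copies (allFin (γ t))) (≡.cong (ℕ._* totalLen (suc r) (suc t)) (LP.length-tabulate {n = γ t} (λ i → i)))))
      where
      first : ∀ ls → lens (suc (suc r)) t (map inj₁ ls) ≡ lens r (suc (suc t)) ls
      first [] = ≡.refl
      first (l ∷ ls) = ≡.cong (len r (suc (suc t)) l ℕ.+_) (first ls)
      copy : ∀ i ls → lens (suc (suc r)) t (map (λ l → inj₂ (i , l)) ls) ≡ lens (suc r) (suc t) ls
      copy i [] = ≡.refl
      copy i (l ∷ ls) = ≡.cong (len (suc r) (suc t) l ℕ.+_) (copy i ls)
      copies : ∀ is → lens (suc (suc r)) t (concatMap (λ i → map (λ l → inj₂ (i , l)) (leaves (suc r) (suc t))) is) ≡ length is ℕ.* totalLen (suc r) (suc t)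
      copies [] = ≡.refl
      copies (i ∷ is) = ≡.trans (lens-++ (suc (suc r)) t (map (λ l → inj₂ (i , l)) (leaves (suc r) (suc t))) _) (≡.cong₂ ℕ._+_ (copy i (leaves (suc r) (suc t))) (copies is))

    totalLen≡ : ∀ r t → totalLen r t ≡ 2 ℕ.* bits r t ℕ.+ W t
    totalLen≡ zero t = ℕP.+-identityʳ _
    totalLen≡ (suc zero) t = ℕP.+-identityʳ _
    totalLen≡ (suc (suc r)) t = ≡.trans (totalLen-suc r t) (≡.trans (≡.cong₂ (λ a b → a ℕ.+ γ t ℕ.* b) (totalLen≡ r (suc (suc t))) (totalLen≡ (suc r) (suc t)))
      (solve 5 (λ b b' g w v → (con 2 :* b :+ (g :* w :+ v)) :+ g :* (con 2 :* b' :+ w) := con 2 :* (w :* g :+ (b :+ b' :* g)) :+ v) ≡.refl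
        (bits r (suc (suc t))) (bits (suc r) (suc t)) (γ t) (W (suc t)) (W t)))
      where open +-*-Solver

    module Expansion {c ℓ} (R : CommutativeRing c ℓ) where
      open CommutativeRing R using (*-cong; *-congˡ; *-identityʳ; +-cong; +-congˡ; +-identityʳ; +-identityˡ; Carrier; refl; sym; trans; _*_; _≈_; 0#)
      open Sums R using (*-∑; ∏; ∏-++; ∏-concatMap; ∏-cong; ∏-map; ∑; ∑-*; ∑-0; ∑-concatMap; ∑-cong; ∑-map)
      open Kronecker R using (∑-vecs)
      open Contraction R bools using (net)
      open RS R using (rsolve; _:+_; _:*_; _⊜_)

      private
        ∏-allFin-suc : ∀ n (g : Fin (suc n) → Carrier) → ∏ (allFin (suc n)) g ≈ g zero * ∏ (allFin n) (g ∘ suc)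
        ∏-allFin-suc n g = *-congˡ (go n (λ i → i))
          where
          go : ∀ k (f : Fin k → Fin n) → ∏ (List.tabulate (suc ∘ f)) g ≈ ∏ (List.tabulate f) (g ∘ suc)
          go zero f = refl
          go (suc k) f = *-congˡ (go k (f ∘ suc))

        ∏-∑ : ∀ {A : Set} (xs : List A) n (g : Fin n → A → Carrier) → ∏ (allFin n) (λ i → ∑ xs (g i)) ≈ ∑ (vecs xs n) (λ v → ∏ (allFin n) (λ i → g i (lookup v i)))
        ∏-∑ xs zero g = sym (+-identityʳ _)
        ∏-∑ xs (suc n) g = trans (∏-allFin-suc n _) (trans (*-congˡ (∏-∑ xs n (g ∘ suc))) (trans (∑-* xs (g zero) _)
          (trans (∑-cong xs (λ x → trans (*-∑ (g zero x) (vecs xs n) _) (∑-cong (vecs xs n) (λ v → sym (∏-allFin-suc n (λ i → g i (lookup (x ∷ v) i)))))))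
          (sym (∑-vecs xs n _)))))

      ∑-confs : ∀ r t (g : Conf (suc (suc r)) t → Carrier) → ∑ (confs (suc (suc r)) t) g ≈
        ∑ (cuts bools t) (λ M → ∑ (confs r (suc (suc t))) (λ c → ∑ (vecs (confs (suc r) (suc t)) (γ t)) (λ cs → g (M , c , cs))))
      ∑-confs r t g = trans (∑-concatMap inner (cuts bools t) g) (∑-cong (cuts bools t) (λ M → trans (∑-concatMap (inner₂ M) (confs r (suc (suc t))) g)
          (∑-cong (confs r (suc (suc t))) (λ c → ∑-map (λ cs → M , c , cs) css g))))
        where
        css = vecs (confs (suc r) (suc t)) (γ t)
        inner₂ : Vec (Vec Bool (W (suc t))) (γ t) → Conf r (suc (suc t)) → List (Conf (suc (suc r)) t)
        inner₂ M c = map (λ cs → M , c , cs) css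
        inner : Vec (Vec Bool (W (suc t))) (γ t) → List (Conf (suc (suc r)) t)
        inner M = concatMap (inner₂ M) (confs r (suc (suc t)))

      term : ∀ r t → ((l : Leaf r t) → Vec Bool (len r t l) → Carrier) → Vec Bool (W t) → Conf r t → Carrier
      term r t lv m c = ∏ (leaves r t) (λ l → lv l (decode r t c m l))

      net-expand : ∀ r t lv m → net r t lv m ≈ ∑ (confs r t) (term r t lv m)
      net-expand zero t lv m = sym (trans (+-identityʳ _) (*-identityʳ _))
      net-expand (suc zero) t lv m = sym (trans (+-identityʳ _) (*-identityʳ _))
      net-expand (suc (suc r)) t lv m = trans (∑-cong (cuts bools t) (λ M → trans (*-cong (net-expand r (suc (suc t)) (λ l → lv (inj₁ l)) (concat M ++ᵥ m))
          (trans (∏-cong (allFin (γ t)) (λ i → net-expand (suc r) (suc t) (λ l → lv (inj₂ (i , l))) (lookup M i)))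
                 (∏-∑ (confs (suc r) (suc t)) (γ t) (λ i → term (suc r) (suc t) (λ l → lv (inj₂ (i , l))) (lookup M i)))))
          (trans (∑-* (confs r (suc (suc t))) (term r (suc (suc t)) (λ l → lv (inj₁ l)) (concat M ++ᵥ m)) _) (∑-cong (confs r (suc (suc t))) (λ c → trans (*-∑ _ (vecs (confs (suc r) (suc t)) (γ t)) _)
            (∑-cong (vecs (confs (suc r) (suc t)) (γ t)) (λ cs → sym (split M c cs))))))))
        (sym (∑-confs r t (term (suc (suc r)) t lv m)))
        where
        split : ∀ M c cs → term (suc (suc r)) t lv m (M , c , cs) ≈ term r (suc (suc t)) (λ l → lv (inj₁ l)) (concat M ++ᵥ m) c *
          ∏ (allFin (γ t)) (λ i → term (suc r) (suc t) (λ l → lv (inj₂ (i , l))) (lookup M i) (lookup cs i))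
        split M c cs = trans (∏-++ (map inj₁ (leaves r (suc (suc t)))) _ _) (*-cong (∏-map inj₁ (leaves r (suc (suc t))) _)
          (trans (∏-concatMap _ (allFin (γ t)) _) (∏-cong (allFin (γ t)) (λ i → ∏-map _ (leaves (suc r) (suc t)) _))))

      -- xs enumerates A without repetitions.
      Enumerates : ∀ {A : Set} → List A → Set (c ⊔ ℓ)
      Enumerates {A} xs = ∀ x (g : A → Carrier) → (∀ y → ¬ y ≡ x → g y ≈ 0#) → ∑ xs g ≈ g x

      private
        bools-enumerate : Enumerates bools
        bools-enumerate true g z = trans (+-congˡ (trans (+-identityʳ _) (z false (λ ())))) (+-identityʳ _)
        bools-enumerate false g z = trans (+-cong (z true (λ ())) (+-identityʳ _)) (+-identityˡ _)

        tt-enumerate : Enumerates (tt ∷ [])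
        tt-enumerate tt g z = +-identityʳ _

        vecs-enumerate : ∀ {A : Set} {xs : List A} → Enumerates xs → ∀ n → Enumerates (vecs xs n)
        vecs-enumerate h zero [] g z = +-identityʳ _
        vecs-enumerate {xs = xs} h (suc n) (x ∷ v) g z = trans (∑-vecs xs n g) (trans (h x _ (λ y ne → ∑-0 (vecs xs n) (λ w → z _ (λ e → ne (VP.∷-injectiveˡ e)))))
          (vecs-enumerate h n v _ (λ w ne → z _ (λ e → ne (VP.∷-injectiveʳ e)))))

      confs-enumerate : ∀ r t → Enumerates (confs r t)
      confs-enumerate zero t = tt-enumerate
      confs-enumerate (suc zero) t = tt-enumerate
      confs-enumerate (suc (suc r)) t (M , c , cs) g z = trans (∑-confs r t g)
        (trans (vecs-enumerate (vecs-enumerate bools-enumerate (W (suc t))) (γ t) M _ (λ M' ne →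
          ∑-0 (confs r (suc (suc t))) (λ c' → ∑-0 (vecs (confs (suc r) (suc t)) (γ t)) (λ cs' → z _ (λ e → ne (≡.cong proj₁ e))))))
        (trans (confs-enumerate r (suc (suc t)) c _ (λ c' ne → ∑-0 (vecs (confs (suc r) (suc t)) (γ t)) (λ cs' → z _ (λ e → ne (≡.cong (proj₁ ∘ proj₂) e)))))
        (vecs-enumerate (confs-enumerate (suc r) (suc t)) (γ t) cs _ (λ cs' ne → z _ (λ e → ne (≡.cong (proj₂ ∘ proj₂) e))))))

module NetworkFormulas where
  open CommutativeAlgebra
  open FormulaSemantics
  open TensorRank
  open NetworkStructure
  open import Defs using (Field; module Field; IPSVar)
  open import Data.Fin using (combine; remQuot; splitAt; _↑ˡ_; _↑ʳ_)
  open import Data.Vec using (concat) renaming (_++_ to _++ᵥ_)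
  open import Data.List using (allFin)

  encodeBits : ∀ {n} → Vec Bool n → Fin (2 ^ n)
  encodeBits [] = zero
  encodeBits (true ∷ v) = combine (zero {1}) (encodeBits v)
  encodeBits (false ∷ v) = combine (suc (zero {0})) (encodeBits v)

  decodeBits : ∀ n → Fin (2 ^ n) → Vec Bool n
  consBit : ∀ n → Fin 2 × Fin (2 ^ n) → Vec Bool (suc n)
  decodeBits zero _ = []
  decodeBits (suc n) i = consBit n (remQuot {2} (2 ^ n) i)
  consBit n (zero , i) = true ∷ decodeBits n i
  consBit n (suc _ , i) = false ∷ decodeBits n i

  decode-encodeBits : ∀ {n} (v : Vec Bool n) → decodeBits n (encodeBits v) ≡ v
  decode-encodeBits [] = ≡.refl
  decode-encodeBits {suc n} (true ∷ v) = ≡.trans (≡.cong (consBit n) (FP.remQuot-combine {2} {2 ^ n} zero (encodeBits v))) (≡.cong (true ∷_) (decode-encodeBits v))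
  decode-encodeBits {suc n} (false ∷ v) = ≡.trans (≡.cong (consBit n) (FP.remQuot-combine {2} {2 ^ n} (suc zero) (encodeBits v))) (≡.cong (false ∷_) (decode-encodeBits v))

  module Variables (γ : ℕ → ℕ) (Z : ℕ) where
    open Network γ Z using (H; Leaf; W; W≡2H; cuts; isRow; leaf≟; leaves; len; level; module Contraction; module Pairs) public

    -- The variables of a leaf: one for each string, and one selector for each position.
    LocalVar : ℕ → Set
    LocalVar n = Vec Bool n ⊎ Fin n

    Var : ℕ → ℕ → Set
    Var r t = Σ (Leaf r t) (λ l → LocalVar (len r t l))

    varCount : ℕ → ℕ → ℕ
    varCount zero t = 2 ^ W t ℕ.+ W t
    varCount (suc zero) t = 2 ^ W t ℕ.+ W t
    varCount (suc (suc r)) t = varCount r (suc (suc t)) ℕ.+ γ t ℕ.* varCount (suc r) (suc t)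

    private
      encodeLocal : ∀ {n} → LocalVar n → Fin (2 ^ n ℕ.+ n)
      encodeLocal {n} (inj₁ j) = encodeBits j ↑ˡ n
      encodeLocal {n} (inj₂ k) = 2 ^ n ↑ʳ k

      localPart : ∀ n → Fin (2 ^ n) ⊎ Fin n → LocalVar n
      localPart n (inj₁ j) = inj₁ (decodeBits n j)
      localPart n (inj₂ k) = inj₂ k

      decodeLocal : ∀ n → Fin (2 ^ n ℕ.+ n) → LocalVar n
      decodeLocal n i = localPart n (splitAt (2 ^ n) i)

      decode-encodeLocal : ∀ {n} (v : LocalVar n) → decodeLocal n (encodeLocal v) ≡ v
      decode-encodeLocal {n} (inj₁ j) = ≡.trans (≡.cong (localPart n) (FP.splitAt-↑ˡ (2 ^ n) (encodeBits j) n)) (≡.cong inj₁ (decode-encodeBits j))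
      decode-encodeLocal {n} (inj₂ k) = ≡.cong (localPart n) (FP.splitAt-↑ʳ (2 ^ n) n k)

    encodeVar : ∀ r t → Var r t → Fin (varCount r t)
    encodeVar zero t (tt , v) = encodeLocal v
    encodeVar (suc zero) t (tt , v) = encodeLocal v
    encodeVar (suc (suc r)) t (inj₁ l , v) = encodeVar r (suc (suc t)) (l , v) ↑ˡ _
    encodeVar (suc (suc r)) t (inj₂ (i , l) , v) = varCount r (suc (suc t)) ↑ʳ combine i (encodeVar (suc r) (suc t) (l , v))

    private
      copy : ∀ r t → (Fin (varCount (suc r) (suc t)) → Var (suc r) (suc t)) → Fin (γ t) × Fin (varCount (suc r) (suc t)) → Var (suc (suc r)) t
      copy r t g (k , j) = inj₂ (k , proj₁ (g j)) , proj₂ (g j)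

      part : ∀ r t → (Fin (varCount r (suc (suc t))) → Var r (suc (suc t))) → (Fin (varCount (suc r) (suc t)) → Var (suc r) (suc t)) →
        Fin (varCount r (suc (suc t))) ⊎ Fin (γ t ℕ.* varCount (suc r) (suc t)) → Var (suc (suc r)) t
      part r t f g (inj₁ j) = inj₁ (proj₁ (f j)) , proj₂ (f j)
      part r t f g (inj₂ j) = copy r t g (remQuot {γ t} (varCount (suc r) (suc t)) j)

    decodeVar : ∀ r t → Fin (varCount r t) → Var r t
    decodeVar zero t i = tt , decodeLocal (W t) i
    decodeVar (suc zero) t i = tt , decodeLocal (W t) i
    decodeVar (suc (suc r)) t i = part r t (decodeVar r (suc (suc t))) (decodeVar (suc r) (suc t)) (splitAt (varCount r (suc (suc t))) i)

    decode-encodeVar : ∀ r t v → decodeVar r t (encodeVar r t v) ≡ v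
    decode-encodeVar zero t (tt , v) = ≡.cong (tt ,_) (decode-encodeLocal v)
    decode-encodeVar (suc zero) t (tt , v) = ≡.cong (tt ,_) (decode-encodeLocal v)
    decode-encodeVar (suc (suc r)) t (inj₁ l , v) =
      ≡.trans (≡.cong (part r t (decodeVar r (suc (suc t))) (decodeVar (suc r) (suc t))) (FP.splitAt-↑ˡ (varCount r (suc (suc t))) (encodeVar r (suc (suc t)) (l , v)) (γ t ℕ.* varCount (suc r) (suc t))))
        (≡.cong (λ u → inj₁ (proj₁ u) , proj₂ u) (decode-encodeVar r (suc (suc t)) (l , v)))
    decode-encodeVar (suc (suc r)) t (inj₂ (i , l) , v) =
      ≡.trans (≡.cong (part r t (decodeVar r (suc (suc t))) (decodeVar (suc r) (suc t))) (FP.splitAt-↑ʳ (varCount r (suc (suc t))) (γ t ℕ.* varCount (suc r) (suc t)) (combine i (encodeVar (suc r) (suc t) (l , v)))))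
      (≡.trans (≡.cong (copy r t (decodeVar (suc r) (suc t))) (FP.remQuot-combine {γ t} {varCount (suc r) (suc t)} i (encodeVar (suc r) (suc t) (l , v))))
        (≡.cong (λ u → inj₂ (i , proj₁ u) , proj₂ u) (decode-encodeVar (suc r) (suc t) (l , v))))

  module Formulas {c ℓ : Level} (F : Field c ℓ) (γ : ℕ → ℕ) (Z : ℕ) where
    private module F = Field F using (Carrier; -_; _-_; 1#; commutativeRing)
    open Variables γ Z using (H; Leaf; LocalVar; Var; W; W≡2H; cuts; decode-encodeVar; decodeVar; encodeVar; isRow; leaf≟; leaves; len; level; varCount; module Contraction; module Pairs) public

    module _ {V X : Set} (xs : List X) where

      private
        factors : ∀ t → (Vec X (W (suc (suc t))) → Form F V) → (Fin (γ t) → Vec X (W (suc t)) → Form F V) → Vec X (W t) → Vec (Vec X (W (suc t))) (γ t) → List (Form F V)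
        factors t f g m M = f (concat M ++ᵥ m) ∷ map (λ i → g i (lookup M i)) (allFin (γ t))

      netForm : ∀ r t → ((l : Leaf r t) → Vec X (len r t l) → Form F V) → Vec X (W t) → Form F V
      netForm zero t lf m = lf tt m
      netForm (suc zero) t lf m = lf tt m
      netForm (suc (suc r)) t lf m = sum (map (λ M → F.1# , prod (factors t (netForm r (suc (suc t)) (λ l → lf (inj₁ l))) (λ i → netForm (suc r) (suc t) (λ l → lf (inj₂ (i , l)))) m M)) (cuts xs t))

      children : ∀ r t → ((l : Leaf (suc (suc r)) t) → Vec X (len (suc (suc r)) t l) → Form F V) → Vec X (W t) → Vec (Vec X (W (suc t))) (γ t) → List (Form F V)
      children r t lf = factors t (netForm r (suc (suc t)) (λ l → lf (inj₁ l))) (λ i → netForm (suc r) (suc t) (λ l → lf (inj₂ (i , l))))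

      -- The summands of the network, with weight a and an additional factor e.
      weightedTerms : ∀ r t → F.Carrier → Form F V → ((l : Leaf (suc (suc r)) t) → Vec X (len (suc (suc r)) t l) → Form F V) → Vec X (W t) → List (F.Carrier × Form F V)
      weightedTerms r t a e lf m = map (λ M → a , prod (e ∷ children r t lf m M)) (cuts xs t)

      module NetSemantics (A : Alg F) (x : V → Alg.Carrier A) where
        open Alg A using (*-cong; *-congʳ; *-congˡ; *-identityˡ; +-assoc; +-congˡ; +-identityˡ; Carrier; distribˡ; refl; sym; trans; zeroʳ; _+_; _*_; _≈_; 1#; cring; ι; ι-1)
        open Sums cring using (*-∑; ∏; ∏-cong; ∑; ∑-cong)
        open Contraction cring xs using (net)
        open RS cring using (rsolve; _:+_; _:*_; _⊜_)

        ⟦map⟧Π : ∀ {b} {I : Set b} (f : I → Form F V) is → ⟦_⟧Π F A (map f is) x ≈ ∏ is (λ i → ⟦_⟧ F A (f i) x)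
        ⟦map⟧Π f [] = refl
        ⟦map⟧Π f (i ∷ is) = *-congˡ (⟦map⟧Π f is)

        ⟦map⟧Σ : ∀ {b} {I : Set b} a (f : I → Form F V) is → ⟦_⟧Σ F A (map (λ i → a , f i) is) x ≈ ι a * ∑ is (λ i → ⟦_⟧ F A (f i) x)
        ⟦map⟧Σ a f [] = sym (zeroʳ _)
        ⟦map⟧Σ a f (i ∷ is) = trans (+-congˡ (⟦map⟧Σ a f is)) (sym (distribˡ _ _ _))

        ⟦++⟧Σ : ∀ us vs → ⟦_⟧Σ F A (us ++ vs) x ≈ ⟦_⟧Σ F A us x + ⟦_⟧Σ F A vs x
        ⟦++⟧Σ [] vs = sym (+-identityˡ _)
        ⟦++⟧Σ ((a , f) ∷ us) vs = trans (+-congˡ (⟦++⟧Σ us vs)) (sym (+-assoc _ _ _))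

        private
          factors-value : ∀ t f g (f' : Vec X (W (suc (suc t))) → Carrier) (g' : Fin (γ t) → Vec X (W (suc t)) → Carrier) → (∀ v → ⟦_⟧ F A (f v) x ≈ f' v) → (∀ i v → ⟦_⟧ F A (g i v) x ≈ g' i v) → ∀ m M →
            ⟦_⟧Π F A (factors t f g m M) x ≈ f' (concat M ++ᵥ m) * ∏ (allFin (γ t)) (λ i → g' i (lookup M i))
          factors-value t f g f' g' hf hg m M = *-cong (hf _) (trans (⟦map⟧Π (λ i → g i (lookup M i)) (allFin (γ t))) (∏-cong (allFin (γ t)) (λ i → hg i (lookup M i))))

        netForm-value : ∀ r t lf m → ⟦_⟧ F A (netForm r t lf m) x ≈ net r t (λ l j → ⟦_⟧ F A (lf l j) x) m
        netForm-value zero t lf m = refl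
        netForm-value (suc zero) t lf m = refl
        netForm-value (suc (suc r)) t lf m = trans (⟦map⟧Σ F.1# (λ M → prod (children r t lf m M)) (cuts xs t))
          (trans (*-congʳ ι-1) (trans (*-identityˡ _) (∑-cong (cuts xs t) (factors-value t (netForm r (suc (suc t)) (λ l → lf (inj₁ l))) (λ i → netForm (suc r) (suc t) (λ l → lf (inj₂ (i , l))))
            (net r (suc (suc t)) (λ l j → ⟦_⟧ F A (lf (inj₁ l) j) x)) (λ i → net (suc r) (suc t) (λ l j → ⟦_⟧ F A (lf (inj₂ (i , l)) j) x))
            (netForm-value r (suc (suc t)) (λ l → lf (inj₁ l))) (λ i → netForm-value (suc r) (suc t) (λ l → lf (inj₂ (i , l)))) m))))

        children-value : ∀ r t lf m M → ⟦_⟧Π F A (children r t lf m M) x ≈ net r (suc (suc t)) (λ l j → ⟦_⟧ F A (lf (inj₁ l) j) x) (concat M ++ᵥ m) *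
          ∏ (allFin (γ t)) (λ i → net (suc r) (suc t) (λ l j → ⟦_⟧ F A (lf (inj₂ (i , l)) j) x) (lookup M i))
        children-value r t lf = factors-value t (netForm r (suc (suc t)) (λ l → lf (inj₁ l))) (λ i → netForm (suc r) (suc t) (λ l → lf (inj₂ (i , l))))
            (net r (suc (suc t)) (λ l j → ⟦_⟧ F A (lf (inj₁ l) j) x)) (λ i → net (suc r) (suc t) (λ l j → ⟦_⟧ F A (lf (inj₂ (i , l)) j) x))
            (netForm-value r (suc (suc t)) (λ l → lf (inj₁ l))) (λ i → netForm-value (suc r) (suc t) (λ l → lf (inj₂ (i , l))))

        weightedTerms-value : ∀ r t a e lf m → ⟦_⟧Σ F A (weightedTerms r t a e lf m) x ≈ ι a * (⟦_⟧ F A e x * net (suc (suc r)) t (λ l j → ⟦_⟧ F A (lf l j) x) m)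
        weightedTerms-value r t a e lf m = trans (⟦map⟧Σ a (λ M → prod (e ∷ children r t lf m M)) (cuts xs t))
          (*-congˡ (trans (sym (*-∑ (⟦_⟧ F A e x) (cuts xs t) (λ M → ⟦_⟧Π F A (children r t lf m M) x))) (*-congˡ (∑-cong (cuts xs t) (λ M → children-value r t lf m M)))))

    literal : ∀ {V} → V → Bool → Form F V
    literal s true = inp s
    literal s false = sum ((F.1# , con F.1#) ∷ (F.- F.1# , inp s) ∷ [])

    module _ (A : Alg F) where
      open Alg A using (*-cong; *-congʳ; *-identityˡ; +-cong; +-identityʳ; -‿cong; Carrier; refl; ring; sym; trans; zeroˡ; _+_; _*_; -_; _-_; _≈_; 0#; 1#; cring; ι; ι-1; ι-neg)
      open RS cring using (rsolve; con; _:+_; _:*_; :-_; _:-_; _⊜_)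
      open Kronecker cring using (δ)

      lit : Carrier → Bool → Carrier
      lit s true = s
      lit s false = 1# - s

      neg-ι : ∀ {a} → ι (F.- F.1#) * a ≈ - a
      neg-ι {a} = trans (*-congʳ (trans (ι-neg _) (-‿cong ι-1))) (-1*x≈-x a)
        where open import Algebra.Properties.Ring ring using (-1*x≈-x)

      literal-value : ∀ {V} (x : V → Carrier) s b → ⟦_⟧ F A (literal s b) x ≈ lit (x s) b
      literal-value x s true = refl
      literal-value x s false = +-cong (trans (*-cong ι-1 ι-1) (*-identityˡ _)) (trans (+-identityʳ _) neg-ι)

      -- The product of the literals of two bits of the same selector, with s² - s replaced by z.
      lit² : Carrier → Carrier → Bool × Bool → Carrier
      lit² s z (true , true) = s + z
      lit² s z (false , false) = (1# - s) + z
      lit² s z (true , false) = - z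
      lit² s z (false , true) = - z

      lit²-square : ∀ s p → lit² s (s * s - s) p ≈ lit s (proj₁ p) * lit s (proj₂ p)
      lit²-square s (true , true) = rsolve 1 (λ s → s :+ (s :* s :- s) ⊜ s :* s) refl s
      lit²-square s (false , false) = rsolve 1 (λ s → (con (ℤ.+ 1) :- s) :+ (s :* s :- s) ⊜ (con (ℤ.+ 1) :- s) :* (con (ℤ.+ 1) :- s)) refl s
      lit²-square s (true , false) = rsolve 1 (λ s → :- (s :* s :- s) ⊜ s :* (con (ℤ.+ 1) :- s)) refl s
      lit²-square s (false , true) = rsolve 1 (λ s → :- (s :* s :- s) ⊜ (con (ℤ.+ 1) :- s) :* s) refl s

      lit²-zero : ∀ s p → lit² s 0# p ≈ δ (proj₁ p) (proj₂ p) * lit s (proj₁ p)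
      lit²-zero s (true , true) = trans (+-identityʳ _) (sym (*-identityˡ _))
      lit²-zero s (false , false) = trans (+-identityʳ _) (sym (*-identityˡ _))
      lit²-zero s (true , false) = trans -0#≈0# (sym (zeroˡ _))
        where open import Algebra.Properties.Ring ring using (-0#≈0#)
      lit²-zero s (false , true) = trans -0#≈0# (sym (zeroˡ _))
        where open import Algebra.Properties.Ring ring using (-0#≈0#)

    module Construction (r pad : ℕ) where
      size : ℕ
      size = varCount (suc (suc r)) 0 ℕ.+ pad

      private
        R : ℕ
        R = suc (suc r)

      stringVar : (l : Leaf R 0) → Vec Bool (len R 0 l) → Fin size
      stringVar l j = encodeVar R 0 (l , inj₁ j) ↑ˡ pad

      selectorVar : (l : Leaf R 0) → Fin (len R 0 l) → Fin size
      selectorVar l k = encodeVar R 0 (l , inj₂ k) ↑ˡ pad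

      module _ {V : Set} (v : Fin size → V) where
        leafForm : (l : Leaf R 0) → Vec Bool (len R 0 l) → Form F V
        leafForm l j = prod (inp (v (stringVar l j)) ∷ map (λ k → literal (v (selectorVar l k)) (lookup j k)) (allFin (len R 0 l)))

      h : Form F (Fin size)
      h = netForm bools R 0 (leafForm (λ i → i)) []

      leafValue : (A : Alg F) (x : Fin size → Alg.Carrier A) (l : Leaf R 0) → Vec Bool (len R 0 l) → Alg.Carrier A
      leafValue A x l j = x (stringVar l j) * ∏ (allFin (len R 0 l)) (λ k → lit A (x (selectorVar l k)) (lookup j k))
        where
        open Alg A using (_*_; cring)
        open Sums cring using (∏)

      leafForm-value : ∀ {V} (v : Fin size → V) A x l j → Alg._≈_ A (⟦_⟧ F A (leafForm v l j) x) (leafValue A (x ∘ v) l j)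
      leafForm-value v A x l j = *-congˡ (trans (NetSemantics.⟦map⟧Π bools A x (λ k → literal (v (selectorVar l k)) (lookup j k)) (allFin (len R 0 l)))
        (∏-cong (allFin (len R 0 l)) (λ k → literal-value A x (v (selectorVar l k)) (lookup j k))))
        where
        open Alg A using (*-congˡ; trans; cring)
        open Sums cring using (∏-cong)

      h-value : ∀ A x → Alg._≈_ A (⟦_⟧ F A h x) (Contraction.net (Alg.cring A) bools R 0 (leafValue A x) [])
      h-value A x = trans (NetSemantics.netForm-value bools A x R 0 (leafForm (λ i → i)) []) (Contraction.net-cong cring bools R 0 [] (λ l j → leafForm-value (λ i → i) A x l j))
        where open Alg A using (trans; cring)

      private
        V B² : Set
        V = IPSVar (suc size) 1
        B² = Bool × Bool
        fsts snds : ∀ {n} → Vec B² n → Vec Bool n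
        fsts = Vec.map proj₁
        snds = Vec.map proj₂
        xV zV : Fin size → V
        xV i = inj₁ (suc i)
        zV i = inj₂ (inj₂ (suc i))

      pairs : List B²
      pairs = Network.Pairs.pairs γ Z F.commutativeRing

      literal² : V → V → B² → Form F V
      literal² s z (true , true) = sum ((F.1# , inp s) ∷ (F.1# , inp z) ∷ [])
      literal² s z (false , false) = sum ((F.1# , con F.1#) ∷ (F.- F.1# , inp s) ∷ (F.1# , inp z) ∷ [])
      literal² s z (true , false) = sum ((F.- F.1# , inp z) ∷ [])
      literal² s z (false , true) = sum ((F.- F.1# , inp z) ∷ [])

      string² : (l : Leaf R 0) (p : Vec B² (len R 0 l)) → Dec (fsts p ≡ snds p) → Form F V
      string² l p (yes _) = sum ((F.1# , inp (xV (stringVar l (fsts p)))) ∷ (F.1# , inp (zV (stringVar l (fsts p)))) ∷ [])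
      string² l p (no _) = prod (inp (xV (stringVar l (fsts p))) ∷ inp (xV (stringVar l (snds p))) ∷ [])

      leafForm² : (l : Leaf R 0) → Vec B² (len R 0 l) → Form F V
      leafForm² l p = prod (string² l p (VP.≡-dec Bool._≟_ (fsts p) (snds p)) ∷ map (λ k → literal² (xV (selectorVar l k)) (zV (selectorVar l k)) (lookup p k)) (allFin (len R 0 l)))

      module Squares (A : Alg F) (x z : Fin size → Alg.Carrier A) (u : V → Alg.Carrier A) (ux : ∀ i → u (xV i) ≡ x i) (uz : ∀ i → u (zV i) ≡ z i) where
        open Alg A using (*-cong; *-congʳ; *-congˡ; *-identityʳ; *-identityˡ; +-assoc; +-cong; +-congˡ; +-identityʳ; -‿cong; refl; reflexive; sym; trans; zeroʳ; zeroˡ; _*_; -_; _-_; _≈_; 0#; 1#; cring; ι; ι-1)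
        open Sums cring using (∏; ∏-*; ∏-cong)
        open Kronecker cring using (δ; δ-≢)
        module P = Network.Pairs γ Z cring using (net-diagonal; net-square; δ²ᵥ)
        open RS cring using (rsolve; con; _:+_; _:*_; :-_; _:-_; _⊜_)

        private
          one-ι : ∀ {a} → ι F.1# * a ≈ a
          one-ι = trans (*-congʳ ι-1) (*-identityˡ _)

          literal²-value : ∀ i p → ⟦_⟧ F A (literal² (xV i) (zV i) p) u ≈ lit² A (x i) (z i) p
          literal²-value i (true , true) = +-cong (trans one-ι (reflexive (ux i))) (trans (+-identityʳ _) (trans one-ι (reflexive (uz i))))
          literal²-value i (false , false) = trans (+-cong (trans one-ι ι-1) (+-cong (trans (neg-ι A) (-‿cong (reflexive (ux i)))) (trans (+-identityʳ _) (trans one-ι (reflexive (uz i)))))) (sym (+-assoc _ _ _))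
          literal²-value i (true , false) = trans (+-identityʳ _) (trans (neg-ι A) (-‿cong (reflexive (uz i))))
          literal²-value i (false , true) = trans (+-identityʳ _) (trans (neg-ι A) (-‿cong (reflexive (uz i))))

          leaf²-value : ∀ l p → ⟦_⟧ F A (leafForm² l p) u ≈ ⟦_⟧ F A (string² l p (VP.≡-dec Bool._≟_ (fsts p) (snds p))) u *
            ∏ (allFin (len R 0 l)) (λ k → lit² A (x (selectorVar l k)) (z (selectorVar l k)) (lookup p k))
          leaf²-value l p = *-congˡ (trans (NetSemantics.⟦map⟧Π pairs A u (λ k → literal² (xV (selectorVar l k)) (zV (selectorVar l k)) (lookup p k)) (allFin (len R 0 l)))
            (∏-cong (allFin (len R 0 l)) (λ k → literal²-value (selectorVar l k) (lookup p k))))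

          lookup-fsts : ∀ {n} (p : Vec B² n) k → lookup (fsts p) k ≡ proj₁ (lookup p k)
          lookup-fsts p k = VP.lookup-map k proj₁ p
          lookup-snds : ∀ {n} (p : Vec B² n) k → lookup (snds p) k ≡ proj₂ (lookup p k)
          lookup-snds p k = VP.lookup-map k proj₂ p

        -- With z = x² - x the value is the product of two leaves.
        leaf²-square : (∀ i → z i ≈ x i * x i - x i) → ∀ l p → ⟦_⟧ F A (leafForm² l p) u ≈ leafValue A x l (fsts p) * leafValue A x l (snds p)
        leaf²-square hz l p = trans (leaf²-value l p) (trans (*-cong (strings-square (VP.≡-dec Bool._≟_ (fsts p) (snds p)))
            (trans (∏-cong (allFin (len R 0 l)) (λ k → trans (lit²-cong (hz (selectorVar l k)) (lookup p k)) (trans (lit²-square A (x (selectorVar l k)) (lookup p k))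
              (*-cong (reflexive (≡.cong (lit A _) (≡.sym (lookup-fsts p k)))) (reflexive (≡.cong (lit A _) (≡.sym (lookup-snds p k)))))))) (∏-* (allFin (len R 0 l)) _ _)))
          (rsolve 4 (λ a b c d → (a :* b) :* (c :* d) ⊜ (a :* c) :* (b :* d)) refl _ _ _ _))
          where
          lit²-cong : ∀ {s z z'} → z ≈ z' → ∀ p → lit² A s z p ≈ lit² A s z' p
          lit²-cong e (true , true) = +-congˡ e
          lit²-cong e (false , false) = +-congˡ e
          lit²-cong e (true , false) = -‿cong e
          lit²-cong e (false , true) = -‿cong e
          strings-square : ∀ d → ⟦_⟧ F A (string² l p d) u ≈ x (stringVar l (fsts p)) * x (stringVar l (snds p))
          strings-square (yes e) = trans (+-cong (trans one-ι (reflexive (ux _))) (trans (+-identityʳ _) (trans one-ι (trans (reflexive (uz _)) (hz _)))))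
            (trans (rsolve 1 (λ s → s :+ (s :* s :- s) ⊜ s :* s) refl (x (stringVar l (fsts p)))) (*-congˡ (reflexive (≡.cong (λ j → x (stringVar l j)) e))))
          strings-square (no _) = *-cong (reflexive (ux _)) (trans (*-identityʳ _) (reflexive (ux _)))

        -- With z = 0 the value is a leaf on the diagonal and 0 elsewhere.
        leaf²-diagonal : (∀ i → z i ≈ 0#) → ∀ l p → ⟦_⟧ F A (leafForm² l p) u ≈ P.δ²ᵥ p * leafValue A x l (fsts p)
        leaf²-diagonal hz l p = trans (leaf²-value l p) (trans (*-congˡ (trans (∏-cong (allFin (len R 0 l)) (λ k → trans (lit²-cong (hz (selectorVar l k)) (lookup p k))
              (trans (lit²-zero A (x (selectorVar l k)) (lookup p k)) (*-congˡ (reflexive (≡.cong (lit A _) (≡.sym (lookup-fsts p k)))))))) (trans (∏-* (allFin (len R 0 l)) _ _) (*-congʳ (∏-δ² p)))))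
          (strings-diagonal (VP.≡-dec Bool._≟_ (fsts p) (snds p))))
          where
          lit²-cong : ∀ {s z z'} → z ≈ z' → ∀ p → lit² A s z p ≈ lit² A s z' p
          lit²-cong e (true , true) = +-congˡ e
          lit²-cong e (false , false) = +-congˡ e
          lit²-cong e (true , false) = -‿cong e
          lit²-cong e (false , true) = -‿cong e
          ∏-δ² : ∀ {n} (p : Vec B² n) → ∏ (allFin n) (λ k → δ (proj₁ (lookup p k)) (proj₂ (lookup p k))) ≈ P.δ²ᵥ p
          ∏-δ² [] = refl
          ∏-δ² {suc n} (q ∷ p) = *-congˡ (trans (shift n (λ k → k)) (∏-δ² p))
            where
            shift : ∀ m (f : Fin m → Fin n) → ∏ (List.tabulate (suc ∘ f)) (λ k → δ (proj₁ (lookup (q ∷ p) k)) (proj₂ (lookup (q ∷ p) k))) ≈ ∏ (List.tabulate f) (λ k → δ (proj₁ (lookup p k)) (proj₂ (lookup p k)))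
            shift zero f = refl
            shift (suc m) f = *-congˡ (shift m (f ∘ suc))
          off-diagonal : ∀ {n} (p : Vec B² n) → ¬ fsts p ≡ snds p → P.δ²ᵥ p ≈ 0#
          off-diagonal [] ne = ⊥-elim (ne ≡.refl)
          off-diagonal ((a , b) ∷ p) ne with a Bool.≟ b
          ... | yes ≡.refl = trans (*-congˡ (off-diagonal p (λ e → ne (≡.cong (a ∷_) e)))) (zeroʳ _)
          ... | no n = trans (*-congʳ (δ-≢ n)) (zeroˡ _)
          strings-diagonal : ∀ d {L} → ⟦_⟧ F A (string² l p d) u * (P.δ²ᵥ p * L) ≈ P.δ²ᵥ p * (x (stringVar l (fsts p)) * L)
          strings-diagonal (yes e) = trans (*-congʳ (trans (+-cong (trans one-ι (reflexive (ux _))) (trans (+-identityʳ _) (trans one-ι (trans (reflexive (uz _)) (hz _))))) (+-identityʳ _)))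
            (rsolve 3 (λ a b c → a :* (b :* c) ⊜ b :* (a :* c)) refl _ _ _)
          strings-diagonal (no ne) = trans (*-congˡ (trans (*-congʳ (off-diagonal p ne)) (zeroˡ _))) (trans (zeroʳ _) (sym (trans (*-congʳ (off-diagonal p ne)) (zeroˡ _))))

module HardRefutation where
  open CommutativeAlgebra
  open FormulaSemantics
  open TensorRank
  open Refutations
  open NetworkFormulas
  open import Defs using (Field; module Field; natF; CharZero; IPSVar)
  open import Data.Fin using (splitAt)
  open import Data.Maybe.Properties using (just-injective)
  open import Data.List using (allFin)

  module RefutationForm {c ℓ : Level} (F : Field c ℓ) (char0 : CharZero F) (γ : ℕ → ℕ) (Z : ℕ) (r pad : ℕ) where
    private module F = Field F using (Carrier; _*_; -_; _-_; _≈_; 1#; inverse)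
    open Formulas F γ Z using (H; Leaf; LocalVar; Var; W; W≡2H; children; cuts; decode-encodeVar; decodeVar; encodeVar; isRow; leaf≟; leaves; len; level; lit; literal; literal-value; lit²; lit²-square; lit²-zero; neg-ι; netForm; varCount; weightedTerms; module Construction; module Contraction; module NetSemantics; module Pairs) public
    open Construction r pad using (h; h-value; leafForm; leafForm-value; leafForm²; leafValue; literal²; pairs; selectorVar; size; stringVar; string²; module Squares) public
    open Refutation F h using (Refutes; RefutesIn; assign; fValue; square-minus; module RefutesIn) public

    private
      R : ℕ
      R = suc (suc r)
      V : Set
      V = IPSVar (suc size) 1
      w y z : Form F V
      w = inp (inj₁ zero)
      y = inp (inj₂ (inj₁ zero))
      z = inp (inj₂ (inj₂ zero))

      num : ℕ → F.Carrier
      num = natF F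

      sixth : Σ F.Carrier λ s → num 6 F.* s F.≈ F.1#
      sixth = F.inverse (num 6) (char0 5)

    i6 : F.Carrier
    i6 = proj₁ sixth

    -- For y = 1 + w + h the inverse of y on Boolean points is (6 - 3w - 3h + 2wh) / 6; multiplied out, with w² = w + z and
    -- with the network Q for h², this gives six times the refutation as
    -- (-3y + 2wy - 3 - 2z + 2w) h + (3 - 2w) Q + 6y - 3wy + 3z.
    hFactor QFactor : Form F V
    hFactor = sum ((F.- num 3 , y) ∷ (num 2 , prod (w ∷ y ∷ [])) ∷ (F.- num 3 , con F.1#) ∷ (F.- num 2 , z) ∷ (num 2 , w) ∷ [])
    QFactor = sum ((num 3 , con F.1#) ∷ (F.- num 2 , w) ∷ [])

    leafForm¹ : (l : Leaf R 0) → Vec Bool (len R 0 l) → Form F V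
    leafForm¹ = leafForm (λ i → inj₁ (suc i))

    refutationTerms : List (F.Carrier × Form F V)
    refutationTerms = weightedTerms bools r 0 i6 hFactor leafForm¹ [] ++ (weightedTerms pairs r 0 i6 QFactor leafForm² [] ++
      ((i6 , prod (con (num 6) ∷ y ∷ [])) ∷ (i6 , prod (con (F.- num 3) ∷ w ∷ y ∷ [])) ∷ (i6 , prod (con (num 3) ∷ z ∷ [])) ∷ []))

    refutation : Form F V
    refutation = sum refutationTerms

    module _ (A : Alg F) (u : V → Alg.Carrier A) where
      open Alg A using (*-comm; *-cong; *-congʳ; *-congˡ; *-identityʳ; +-cong; +-congʳ; +-congˡ; +-identityʳ; -‿cong; Carrier; refl; sym; trans; _+_; _*_; -_; _-_; _≈_; 0#; 1#; cring; ι; ι-cong; ι-+; ι-*; ι-0; ι-1; ι-neg)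
      open RS cring using (rsolve; con; Polynomial; _:+_; _:*_; :-_; _:-_; _⊜_)

      private
        n₂ n₃ n₆ : Carrier
        n₂ = 1# + (1# + 0#)
        n₃ = 1# + n₂
        n₆ = 1# + (1# + (1# + n₃))

        ι-num : ∀ n → ι (num (suc n)) ≈ 1# + ι (num n)
        ι-num n = trans (ι-+ _ _) (+-congʳ ι-1)

        ι₂ : ι (num 2) ≈ n₂
        ι₂ = trans (ι-num 1) (+-congˡ (trans (ι-num 0) (+-congˡ ι-0)))

        ι₃ : ι (num 3) ≈ n₃
        ι₃ = trans (ι-num 2) (+-congˡ ι₂)

        ι₆ : ι (num 6) ≈ n₆
        ι₆ = trans (ι-num 5) (+-congˡ (trans (ι-num 4) (+-congˡ (trans (ι-num 3) (+-congˡ ι₃)))))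

        wA yA zA hA QA : Carrier
        wA = u (inj₁ zero)
        yA = u (inj₂ (inj₁ zero))
        zA = u (inj₂ (inj₂ zero))
        hA = Contraction.net cring bools R 0 (λ l j → ⟦_⟧ F A (leafForm¹ l j) u) []
        QA = Contraction.net cring pairs R 0 (λ l j → ⟦_⟧ F A (leafForm² l j) u) []

        one two three six : ∀ {n} → Polynomial n
        one = con (ℤ.+ 1)
        two = con (ℤ.+ 1) :+ (con (ℤ.+ 1) :+ con (ℤ.+ 0))
        three = con (ℤ.+ 1) :+ two
        six = con (ℤ.+ 1) :+ (con (ℤ.+ 1) :+ (con (ℤ.+ 1) :+ three))

      combination : Carrier → Carrier → Carrier → Carrier → Carrier → Carrier
      combination w y z h Q = ((- n₃ * y + n₂ * (w * y) - n₃ - n₂ * z + n₂ * w) * h + (n₃ - n₂ * w) * Q) + (n₆ * y - n₃ * (w * y) + n₃ * z)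

      combination-axioms : ∀ w h → combination w (1# + (w + h)) (w * w - w) h (h * h) ≈ n₆
      combination-axioms = rsolve 2 (λ w h → let y = one :+ (w :+ h) ; z = w :* w :- w in
        (((:- three) :* y :+ two :* (w :* y) :- three :- two :* z :+ two :* w) :* h :+ (three :- two :* w) :* (h :* h)) :+ (six :* y :- three :* (w :* y) :+ three :* z) ⊜ six) refl

      combination-zero : ∀ w h → combination w 0# 0# h h ≈ 0#
      combination-zero = rsolve 2 (λ w h → let y = con (ℤ.+ 0) ; z = con (ℤ.+ 0) in
        (((:- three) :* y :+ two :* (w :* y) :- three :- two :* z :+ two :* w) :* h :+ (three :- two :* w) :* h) :+ (six :* y :- three :* (w :* y) :+ three :* z) ⊜ con (ℤ.+ 0)) refl

      combination-cong : ∀ {w y y' z z' h h' Q Q'} → y ≈ y' → z ≈ z' → h ≈ h' → Q ≈ Q' → combination w y z h Q ≈ combination w y' z' h' Q'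
      combination-cong ey ez eh eQ = +-cong (+-cong (*-cong (+-cong (+-cong (+-cong (+-cong (*-congˡ ey) (*-congˡ (*-congˡ ey))) refl) (-‿cong (*-congˡ ez))) refl) eh) (*-congˡ eQ))
        (+-cong (+-cong (*-congˡ ey) (-‿cong (*-congˡ (*-congˡ ey)))) (*-congˡ ez))

      refutation-value : ⟦_⟧ F A refutation u ≈ ι i6 * combination wA yA zA hA QA
      refutation-value = trans (NetSemantics.⟦++⟧Σ bools A u (weightedTerms bools r 0 i6 hFactor leafForm¹ []) _)
        (trans (+-cong (trans (NetSemantics.weightedTerms-value bools A u r 0 i6 hFactor leafForm¹ []) (*-congˡ (*-congʳ hFactor-value)))
          (trans (NetSemantics.⟦++⟧Σ bools A u (weightedTerms pairs r 0 i6 QFactor leafForm² []) _) (+-cong (trans (NetSemantics.weightedTerms-value pairs A u r 0 i6 QFactor leafForm² []) (*-congˡ (*-congʳ QFactor-value)))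
            (+-cong (*-congˡ (*-cong ι₆ (*-identityʳ _))) (+-cong (*-congˡ (*-cong (trans (ι-neg _) (-‿cong ι₃)) (*-congˡ (*-identityʳ _)))) (trans (+-identityʳ _) (*-congˡ (*-cong ι₃ (*-identityʳ _)))))))))
        (rsolve 9 (λ s e h f q y t w z → s :* (e :* h) :+ (s :* (f :* q) :+ (s :* (six :* y) :+ (s :* ((:- t) :* (w :* y)) :+ s :* (t :* z)))) ⊜
          s :* ((e :* h :+ f :* q) :+ (six :* y :- t :* (w :* y) :+ t :* z))) refl (ι i6) _ hA _ QA yA n₃ wA zA))
        where
        hFactor-value : ⟦_⟧ F A hFactor u ≈ - n₃ * yA + n₂ * (wA * yA) - n₃ - n₂ * zA + n₂ * wA
        hFactor-value = trans (+-cong (*-congʳ (trans (ι-neg _) (-‿cong ι₃))) (+-cong (*-cong ι₂ (*-congˡ (*-identityʳ _))) (+-cong (trans (*-cong (trans (ι-neg _) (-‿cong ι₃)) ι-1) (*-identityʳ _))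
            (+-cong (*-congʳ (trans (ι-neg _) (-‿cong ι₂))) (+-congʳ (*-congʳ ι₂))))))
          (rsolve 5 (λ t d y w z → (:- t) :* y :+ (d :* (w :* y) :+ ((:- t) :+ ((:- d) :* z :+ (d :* w :+ con (ℤ.+ 0))))) ⊜ (:- t) :* y :+ d :* (w :* y) :- t :- d :* z :+ d :* w) refl n₃ n₂ yA wA zA)
        QFactor-value : ⟦_⟧ F A QFactor u ≈ n₃ - n₂ * wA
        QFactor-value = trans (+-cong (trans (*-cong ι₃ ι-1) (*-identityʳ _)) (+-congʳ (*-congʳ (trans (ι-neg _) (-‿cong ι₂)))))
          (rsolve 3 (λ t d w → t :+ ((:- d) :* w :+ con (ℤ.+ 0)) ⊜ t :- d :* w) refl n₃ n₂ wA)

      i6-n₆ : ι i6 * n₆ ≈ 1#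
      i6-n₆ = trans (*-comm _ _) (trans (*-congʳ (sym ι₆)) (trans (sym (ι-* _ _)) (trans (ι-cong (proj₂ sixth)) ι-1)))

    refutes : Refutes refutation
    refutes = record { zero-axioms = zeroAxioms ; axioms = axiomsHold }
      where
      zeroAxioms : ∀ A X → Alg._≈_ A (⟦_⟧ F A refutation (assign A X (Alg.0# A) (λ _ → Alg.0# A))) (Alg.0# A)
      zeroAxioms A X = trans (refutation-value A u) (trans (*-congˡ (trans (combination-cong A u refl refl refl Q≈h) (combination-zero A u (X zero) _))) (zeroʳ _))
        where
        open Alg A using (*-congˡ; *-identityˡ; Carrier; refl; sym; trans; zeroʳ; _≈_; 0#; cring)
        u : V → Carrier
        u = assign A X 0# (λ _ → 0#)
        module S = Squares A (X ∘ suc) (λ _ → 0#) u (λ _ → ≡.refl) (λ _ → ≡.refl) using (leaf²-diagonal; leaf²-square; module P)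
        Q≈h : Contraction.net cring pairs R 0 (λ l j → ⟦_⟧ F A (leafForm² l j) u) [] ≈ Contraction.net cring bools R 0 (λ l j → ⟦_⟧ F A (leafForm¹ l j) u) []
        Q≈h = trans (S.P.net-diagonal R 0 {lv = leafValue A (X ∘ suc)} (S.leaf²-diagonal (λ _ → refl)) []) (trans (*-identityˡ _)
          (Contraction.net-cong cring bools R 0 [] (λ l j → sym (leafForm-value (λ i → inj₁ (suc i)) A u l j))))
      axiomsHold : ∀ A X → Alg._≈_ A (⟦_⟧ F A refutation (assign A X (fValue A X) (square-minus A X))) (Alg.1# A)
      axiomsHold A X = trans (refutation-value A u) (trans (*-congˡ (trans (combination-cong A u (+-congˡ (+-congˡ (sym h≈))) refl refl Q≈h²) (combination-axioms A u (X zero) _))) (i6-n₆ A u))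
        where
        open Alg A using (*-cong; *-congˡ; +-congˡ; Carrier; refl; sym; trans; _*_; _≈_; cring)
        u : V → Carrier
        u = assign A X (fValue A X) (square-minus A X)
        module S = Squares A (X ∘ suc) (square-minus A X ∘ suc) u (λ _ → ≡.refl) (λ _ → ≡.refl) using (leaf²-diagonal; leaf²-square; module P)
        leaf≈ : ∀ l j → ⟦_⟧ F A (leafForm¹ l j) u ≈ leafValue A (X ∘ suc) l j
        leaf≈ = leafForm-value (λ i → inj₁ (suc i)) A u
        h≈ : Contraction.net cring bools R 0 (λ l j → ⟦_⟧ F A (leafForm¹ l j) u) [] ≈ ⟦_⟧ F A h (X ∘ suc)
        h≈ = trans (Contraction.net-cong cring bools R 0 [] leaf≈) (sym (h-value A (X ∘ suc)))
        Q≈h² : Contraction.net cring pairs R 0 (λ l j → ⟦_⟧ F A (leafForm² l j) u) [] ≈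
          Contraction.net cring bools R 0 (λ l j → ⟦_⟧ F A (leafForm¹ l j) u) [] * Contraction.net cring bools R 0 (λ l j → ⟦_⟧ F A (leafForm¹ l j) u) []
        Q≈h² = trans (S.P.net-square R 0 {lv = leafValue A (X ∘ suc)} (S.leaf²-square (λ _ → refl)) [])
          (*-cong (Contraction.net-cong cring bools R 0 [] (λ l j → sym (leaf≈ l j))) (Contraction.net-cong cring bools R 0 [] (λ l j → sym (leaf≈ l j))))

    -- Every variable of h belongs to at most one leaf, so h is multilinear.
    variable? : Fin size → Maybe (Var R 0)
    variable? i with splitAt (varCount R 0) i
    ... | inj₁ j = just (decodeVar R 0 j)
    ... | inj₂ _ = nothing

    variable-string : ∀ l j → variable? (stringVar l j) ≡ just (l , inj₁ j)
    variable-string l j rewrite FP.splitAt-↑ˡ (varCount R 0) (encodeVar R 0 (l , inj₁ j)) pad = ≡.cong just (decode-encodeVar R 0 (l , inj₁ j))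

    variable-selector : ∀ l k → variable? (selectorVar l k) ≡ just (l , inj₂ k)
    variable-selector l k rewrite FP.splitAt-↑ˡ (varCount R 0) (encodeVar R 0 (l , inj₂ k)) pad = ≡.cong just (decode-encodeVar R 0 (l , inj₂ k))

    module _ (δ : Fin size → ℕ) (δ≤1 : ∀ i → δ i ≤ 1) (i₀ : Fin size) (δ-other : ∀ i → ¬ i ≡ i₀ → δ i ≡ 0) where
      private
        δ-not : ∀ {i v} → variable? i ≡ just v → ¬ variable? i₀ ≡ just v → δ i ≡ 0
        δ-not e ne = δ-other _ (λ { ≡.refl → ne e })

        degLit : ∀ i b → deg F δ (literal i b) ≡ δ i
        degLit i true = ≡.refl
        degLit i false = ℕP.⊔-identityʳ (δ i)

        degΠ-zero : ∀ {n} (g : Fin n → Form F (Fin size)) → (∀ k → deg F δ (g k) ≡ 0) → ∀ ks → degΠ F δ (map g ks) ≡ 0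
        degΠ-zero g e [] = ≡.refl
        degΠ-zero g e (k ∷ ks) = ≡.cong₂ ℕ._+_ (e k) (degΠ-zero g e ks)

        degΠ-one : ∀ {n} (g : Fin n → Form F (Fin size)) k₀ → (∀ k → ¬ k ≡ k₀ → deg F δ (g k) ≡ 0) → deg F δ (g k₀) ≤ 1 → degΠ F δ (map g (allFin n)) ≤ 1
        degΠ-one {n} g k₀ z o = go n (λ k → k) k₀ z o (λ k e → e)
          where
          go : ∀ m (f : Fin m → Fin n) (k₁ : Fin m) → (∀ k → ¬ k ≡ f k₁ → deg F δ (g k) ≡ 0) → deg F δ (g (f k₁)) ≤ 1 → (∀ k → f k ≡ f k₁ → k ≡ k₁) → degΠ F δ (map g (List.tabulate f)) ≤ 1
          go (suc m) f zero z o inj = ℕP.≤-trans (ℕP.+-mono-≤ o (ℕP.≤-reflexive (zeros m (f ∘ suc) (λ k → z (f (suc k)) (λ e → FP.0≢1+n (≡.sym (inj (suc k) e))))))) ℕP.≤-refl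
            where
            zeros : ∀ m (f : Fin m → Fin n) → (∀ k → deg F δ (g (f k)) ≡ 0) → degΠ F δ (map g (List.tabulate f)) ≡ 0
            zeros zero f e = ≡.refl
            zeros (suc m) f e = ≡.cong₂ ℕ._+_ (e zero) (zeros m (f ∘ suc) (e ∘ suc))
          go (suc m) f (suc k₁) z o inj = ℕP.≤-trans (ℕP.≤-reflexive (≡.cong (ℕ._+ degΠ F δ (map g (List.tabulate (f ∘ suc)))) (z (f zero) (λ e → FP.0≢1+n (inj zero e)))))
            (go m (f ∘ suc) k₁ z o (λ k e → FP.suc-injective (inj (suc k) e)))

        leaf-zero : ∀ l j → (∀ v → ¬ variable? i₀ ≡ just (l , v)) → deg F δ (leafForm (λ i → i) l j) ≡ 0
        leaf-zero l j ne = ≡.cong₂ ℕ._+_ (δ-not (variable-string l j) (ne _)) (degΠ-zero _ (λ k → ≡.trans (degLit (selectorVar l k) (lookup j k)) (δ-not (variable-selector l k) (ne _))) (allFin (len R 0 l)))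

        leaf-one : ∀ l v j → variable? i₀ ≡ just (l , v) → deg F δ (leafForm (λ i → i) l j) ≤ 1
        leaf-one l (inj₁ j₀) j e = ℕP.≤-trans (ℕP.+-mono-≤ (δ≤1 _) (ℕP.≤-reflexive (degΠ-zero _ (λ k → ≡.trans (degLit (selectorVar l k) (lookup j k)) (δ-not (variable-selector l k) (λ e' → conflict k (≡.trans (≡.sym e) e')))) (allFin (len R 0 l))))) ℕP.≤-refl
          where
          conflict : ∀ k → ¬ just (l , inj₁ j₀) ≡ just (l , inj₂ k)
          conflict k ()
        leaf-one l (inj₂ k₀) j e = ℕP.≤-trans (ℕP.+-mono-≤ (ℕP.≤-reflexive (δ-not (variable-string l j) (λ e' → conflict (≡.trans (≡.sym e) e'))))
            (degΠ-one _ k₀ (λ k ne → ≡.trans (degLit (selectorVar l k) (lookup j k)) (δ-not (variable-selector l k) (λ e' → ne (same (≡.trans (≡.sym e) e'))))) (ℕP.≤-trans (ℕP.≤-reflexive (degLit (selectorVar l k₀) (lookup j k₀))) (δ≤1 _)))) ℕP.≤-refl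
          where
          conflict : ¬ just (l , inj₂ k₀) ≡ just (l , inj₁ j)
          conflict ()
          same : ∀ {k} → just (l , inj₂ k₀) ≡ just (l , inj₂ k) → k ≡ k₀
          same ≡.refl = ≡.refl

        degΣ-bound : ∀ {b} {I : Set b} n (g : I → Form F (Fin size)) is → (∀ i → deg F δ (g i) ≤ n) → degΣ F δ (map (λ i → F.1# , g i) is) ≤ n
        degΣ-bound n g [] h = z≤n
        degΣ-bound n g (i ∷ is) h = ℕP.⊔-lub (h i) (degΣ-bound n g is h)

        LeafForms : ℕ → ℕ → Set _
        LeafForms r t = (l : Leaf r t) → Vec Bool (len r t l) → Form F (Fin size)

        net-zero : ∀ r t (lf : LeafForms r t) → (∀ l j → deg F δ (lf l j) ≡ 0) → ∀ m → deg F δ (netForm bools r t lf m) ≤ 0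
        net-zero zero t lf e m = ℕP.≤-reflexive (e tt m)
        net-zero (suc zero) t lf e m = ℕP.≤-reflexive (e tt m)
        net-zero (suc (suc r)) t lf e m = degΣ-bound 0 _ (cuts bools t) (λ M → ℕP.+-mono-≤ {_} {0} {_} {0} (net-zero r (suc (suc t)) (λ l → lf (inj₁ l)) (λ l → e (inj₁ l)) _)
          (ℕP.≤-reflexive (degΠ-zero _ (λ i → ℕP.n≤0⇒n≡0 (net-zero (suc r) (suc t) (λ l → lf (inj₂ (i , l))) (λ l → e (inj₂ (i , l))) (lookup M i))) (allFin (γ t)))))

        net-one : ∀ r t (lf : LeafForms r t) l₀ → (∀ l j → ¬ l ≡ l₀ → deg F δ (lf l j) ≡ 0) → (∀ j → deg F δ (lf l₀ j) ≤ 1) → ∀ m → deg F δ (netForm bools r t lf m) ≤ 1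
        net-one zero t lf tt z o m = o m
        net-one (suc zero) t lf tt z o m = o m
        net-one (suc (suc r)) t lf (inj₁ l₀) z o m = degΣ-bound 1 _ (cuts bools t) (λ M → ℕP.+-mono-≤ {_} {1} {_} {0} (net-one r (suc (suc t)) (λ l → lf (inj₁ l)) l₀ (λ l j ne → z (inj₁ l) j (λ { ≡.refl → ne ≡.refl })) o _)
          (ℕP.≤-reflexive (degΠ-zero _ (λ i → ℕP.n≤0⇒n≡0 (net-zero (suc r) (suc t) (λ l → lf (inj₂ (i , l))) (λ l j → z (inj₂ (i , l)) j (λ ())) (lookup M i))) (allFin (γ t)))))
        net-one (suc (suc r)) t lf (inj₂ (i₁ , l₀)) z o m = degΣ-bound 1 _ (cuts bools t) (λ M → ℕP.+-mono-≤ {_} {0} {_} {1} (net-zero r (suc (suc t)) (λ l → lf (inj₁ l)) (λ l j → z (inj₁ l) j (λ ())) _)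
          (degΠ-one _ i₁ (λ i ne → ℕP.n≤0⇒n≡0 (net-zero (suc r) (suc t) (λ l → lf (inj₂ (i , l))) (λ l j → z (inj₂ (i , l)) j (λ { ≡.refl → ne ≡.refl })) (lookup M i)))
            (net-one (suc r) (suc t) (λ l → lf (inj₂ (i₁ , l))) l₀ (λ l j ne → z (inj₂ (i₁ , l)) j (λ { ≡.refl → ne ≡.refl })) o (lookup M i₁))))

      degree-h : deg F δ h ≤ 1
      degree-h = cases (variable? i₀) ≡.refl
        where
        cases : ∀ v → variable? i₀ ≡ v → deg F δ h ≤ 1
        cases nothing e = ℕP.≤-trans (net-zero R 0 (leafForm (λ i → i)) (λ l j → leaf-zero l j (λ v e' → conflict (≡.trans (≡.sym e) e'))) []) z≤n
          where
          conflict : ∀ {v : Var R 0} → ¬ nothing ≡ just v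
          conflict ()
        cases (just (l₀ , v₀)) e = net-one R 0 (leafForm (λ i → i)) l₀ (λ l j ne → leaf-zero l j (λ v e' → ne (≡.cong proj₁ (just-injective (≡.trans (≡.sym e') e))))) (λ j → leaf-one l₀ v₀ j e) []

module RankArgument where
  open CommutativeAlgebra
  open FormulaSemantics
  open CircuitSemantics
  open TensorRank
  open DualNumberTower
  open CircuitBounds
  open RootExpansions
  open Refutations
  open LowRankExtraction
  open NetworkStructure
  open NetworkRank
  open NetworkFormulas
  open HardRefutation
  open import Defs using (Field; module Field; natF; CharZero; IPSVar; Circuit; module Circuit; depth) renaming (size to circuitSize)
  open import Data.List using (allFin; concatMap)
  open import Data.List.Relation.Unary.All as All using (All; []; _∷_)
  open import Data.List.Relation.Unary.Any using (here; there)
  open import Data.List.Relation.Unary.AllPairs using ([]; _∷_)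
  open import Data.List.Relation.Unary.Unique.Propositional using (Unique)
  import Data.List.Relation.Unary.Unique.Propositional.Properties as UP
  import Data.List.Membership.Propositional.Properties as MP
  open import Data.Sum.Properties using (inj₁-injective)

  module LeafList (γ : ℕ → ℕ) (Z : ℕ) where
    open Network γ Z using (Leaf; leaves)

    private
      copies : ∀ r t → List (Fin (γ t)) → List (Leaf (suc (suc r)) t)
      copies r t is = concatMap (λ i → map (λ l → inj₂ (i , l)) (leaves (suc r) (suc t))) is

      copies-index : ∀ r t is {i l} → inj₂ (i , l) ∈ copies r t is → i ∈ is
      copies-index r t (i ∷ is) h with MP.∈-++⁻ (map (λ l → inj₂ (i , l)) (leaves (suc r) (suc t))) h
      ... | inj₁ m with MP.∈-map⁻ _ m
      ... | _ , _ , ≡.refl = here ≡.refl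
      copies-index r t (i ∷ is) h | inj₂ m = there (copies-index r t is m)

      copies-right : ∀ r t is {l} → ¬ inj₁ l ∈ copies r t is
      copies-right r t (i ∷ is) h with MP.∈-++⁻ (map (λ l → inj₂ (i , l)) (leaves (suc r) (suc t))) h
      ... | inj₁ m with MP.∈-map⁻ _ m
      ... | _ , _ , ()
      copies-right r t (i ∷ is) h | inj₂ m = copies-right r t is m

      copies-complete : ∀ r t is {i l} → i ∈ is → l ∈ leaves (suc r) (suc t) → inj₂ (i , l) ∈ copies r t is
      copies-complete r t (i ∷ is) (here ≡.refl) h = MP.∈-++⁺ˡ (MP.∈-map⁺ _ h)
      copies-complete r t (i ∷ is) (there m) h = MP.∈-++⁺ʳ (map (λ l → inj₂ (i , l)) (leaves (suc r) (suc t))) (copies-complete r t is m h)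

      copies-unique : ∀ r t is → Unique is → Unique (leaves (suc r) (suc t)) → Unique (copies r t is)
      copies-unique r t [] [] h = []
      copies-unique r t (i ∷ is) (ni ∷ u) h = UP.++⁺ (UP.map⁺ (λ { ≡.refl → ≡.refl }) h) (copies-unique r t is u h) disjoint
        where
        disjoint : ∀ {v} → ¬ (v ∈ map (λ l → inj₂ (i , l)) (leaves (suc r) (suc t)) × v ∈ copies r t is)
        disjoint (p , q) with MP.∈-map⁻ _ p
        ... | _ , _ , ≡.refl = All.lookup ni (copies-index r t is q) ≡.refl

    leaves-complete : ∀ r t l → l ∈ leaves r t
    leaves-complete zero t tt = here ≡.refl
    leaves-complete (suc zero) t tt = here ≡.refl
    leaves-complete (suc (suc r)) t (inj₁ l) = MP.∈-++⁺ˡ (MP.∈-map⁺ inj₁ (leaves-complete r (suc (suc t)) l))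
    leaves-complete (suc (suc r)) t (inj₂ (i , l)) = MP.∈-++⁺ʳ (map inj₁ (leaves r (suc (suc t)))) (copies-complete r t (allFin (γ t)) (MP.∈-allFin i) (leaves-complete (suc r) (suc t) l))

    leaves-unique : ∀ r t → Unique (leaves r t)
    leaves-unique zero t = [] ∷ []
    leaves-unique (suc zero) t = [] ∷ []
    leaves-unique (suc (suc r)) t = UP.++⁺ (UP.map⁺ inj₁-injective (leaves-unique r (suc (suc t)))) (copies-unique r t (allFin (γ t)) (UP.allFin⁺ (γ t)) (leaves-unique (suc r) (suc t))) disjoint
      where
      disjoint : ∀ {v} → ¬ (v ∈ map inj₁ (leaves r (suc (suc t))) × v ∈ copies r t (allFin (γ t)))
      disjoint (p , q) with MP.∈-map⁻ _ p
      ... | _ , _ , ≡.refl = copies-right r t (allFin (γ t)) q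

  module TopRank {c ℓ : Level} (F : Field c ℓ) (char0 : CharZero F) (γ : ℕ → ℕ) (Z : ℕ) (r pad : ℕ) (Λ : ℕ) where
    private module F = Field F using (*-assoc; *-congˡ; *-identityʳ; -‿cong; Carrier; refl; ring; sym; trans; _*_; -_; _-_; 1#; commutativeRing; nontrivial; inverse)
    open RefutationForm F char0 γ Z r pad using (H; Leaf; LocalVar; QFactor; Refutes; RefutesIn; Var; W; W≡2H; assign; children; combination; combination-axioms; combination-cong; combination-zero; cuts; decode-encodeVar; decodeVar; degree-h; encodeVar; fValue; h; h-value; hFactor; i6; i6-n₆; isRow; leafForm; leafForm-value; leafForm²; leafForm¹; leafValue; leaf≟; leaves; len; level; lit; literal; literal-value; literal²; lit²; lit²-square; lit²-zero; neg-ι; netForm; pairs; refutation; refutation-value; refutationTerms; refutes; selectorVar; size; square-minus; stringVar; string²; varCount; variable-selector; variable-string; variable?; weightedTerms; module Construction; module Contraction; module NetSemantics; module Pairs; module RefutesIn; module Squares) public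
    open LeafList γ Z using (leaves-complete; leaves-unique)
    open Configurations γ Z using (Conf; Injection; bits; cols-determine; configurations; confs; decode; lens; rows-determine; totalLen≡; module Expansion; module Injection)

    R : ℕ
    R = suc (suc r)

    hv : Leaf R 0 → ℕ
    hv l = H (level R 0 l)

    open Extraction F char0 (Leaf R 0) (leaf≟ R 0) (len R 0) (isRow R 0) hv (λ l → W≡2H (level R 0 l)) Λ using (Agree; BigE; BigE-+; BigE-0; BigE-resp; BigE-scale; BigE-sumTo; BigE-∑; BigE-≤; Bounded; ColDep; DepE; DepE-*; DepE-+; DepE-0; DepE-const; DepE-inv; DepE-log; DepE-neg; DepE-resp; DepE-ι; DepE-∑; DepE-⊆; DependsOn; EAlg; Idx; K; Levels; LowRankTop; Lvl; Nil; NodeClass; Rank1; Rk; Rk-*; Rk-+; Rk-0; Rk-1; Rk-flip; Rk-resp; Rk-rows; Rk-scale; Rk-∑; Rk-≤; RowDep; Tens; Unit; axiomForm; base; base-*; base-+; base-0; base-1; base-cong; base-lin; base-⟦⟧; baseHom; circuit-bounded; colH; const; const-*; const-ι; depRel; entry; ev-nilpotent; exp; exp-cong; exp-log; fun≡base; hvs; inv; inv-correct; kill; lin; lin-big; lin-dep; lin-square; log; log-*; log-1; low-rank-top; nilpotent; nodes-bounded; p-degree; p-value; pForm; point; rowBits; rowH; set; set-agree; set-id; start; top; top-+; top-0; top-cong; top-const-*; trivialRank; value; value-dep; ∏-units; ∏-units≈exp; ∏E; ∑-logs; 𝒯; module E; module Expansions; module Gen; module Levels; module Lvl; module Rank; module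 T; module TimesGate) public
    private
      module K = Alg (stableAlg F) using (*-comm; *-cong; *-congʳ; *-congˡ; *-identityʳ; *-identityˡ; +-assoc; +-comm; +-commutativeMonoid; +-cong; +-congʳ; +-congˡ; +-identityʳ; +-identityˡ; -‿cong; -‿inverseʳ; -‿inverseˡ; distribʳ; distribˡ; refl; reflexive; ring; semiring; sym; trans; zeroʳ; zeroˡ; _+_; _*_; -_; _-_; _≈_; 0#; 1#; cring)
      module SK = Sums K.cring using (∏; ∏-*; ∏-cong; ∑; ∑-0; ∑-cong)
      module KD = Kronecker K.cring using (δᵥ; δᵥ-refl; δᵥ-≢)

    toDir : Maybe (Var R 0) → Maybe (Σ (Leaf R 0) λ l → Σ Tens λ β → DependsOn (_≡ l) β)
    toDir (just (l , inj₁ j)) = just (l , (λ a → KD.δᵥ (a l) j) , λ a a' e → K.reflexive (≡.cong (λ v → KD.δᵥ v j) (e l ≡.refl)))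
    toDir (just (l , inj₂ k)) = nothing
    toDir nothing = nothing

    dir : Fin size → Maybe (Σ (Leaf R 0) λ l → Σ Tens λ β → DependsOn (_≡ l) β)
    dir i = toDir (variable? i)

    private
      point-just : ∀ es x i {l β d} → dir i ≡ just (l , β , d) → point dir es x i ≡ lin es (x i) l β
      point-just es x i e with dir i
      point-just es x i ≡.refl | .(just _) = ≡.refl

      point-nothing : ∀ es x i → dir i ≡ nothing → point dir es x i ≡ E.ι es (x i)
      point-nothing es x i e with dir i
      point-nothing es x i ≡.refl | .nothing = ≡.refl

    litF : F.Carrier → Bool → F.Carrier
    litF = lit (stableAlg F)

    selected : (Fin size → F.Carrier) → (l : Leaf R 0) → Vec Bool (len R 0 l) → F.Carrier
    selected x l j = SK.∏ (allFin (len R 0 l)) (λ k → litF (x (selectorVar l k)) (lookup j k))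

    private
      ι-lit : ∀ es s b → E._≈_ es (lit (EAlg es) (E.ι es s) b) (E.ι es (litF s b))
      ι-lit es s true = E.refl es
      ι-lit es s false = E.sym es (E.trans es (E.ι-+ es _ _) (E.+-cong es (E.ι-1 es) (E.ι-neg es s)))

      ι-∏ : ∀ es {b} {I : Set b} (is : List I) (g : I → F.Carrier) (g' : I → E.Carrier es) → (∀ i → E._≈_ es (g' i) (E.ι es (g i))) → E._≈_ es (Sums.∏ (E.cring es) is g') (E.ι es (SK.∏ is g))
      ι-∏ es [] g g' e = E.sym es (E.ι-1 es)
      ι-∏ es (i ∷ is) g g' e = E.trans es (E.*-cong es (e i) (ι-∏ es is g g' e)) (E.sym es (E.ι-* es _ _))

      leafValue-point : ∀ es x l j → E._≈_ es (leafValue (EAlg es) (point dir es x) l j) (E._*_ es (lin es (x (stringVar l j)) l (λ a → KD.δᵥ (a l) j)) (E.ι es (selected x l j)))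
      leafValue-point es x l j = E.*-cong es (E.reflexive es (point-just es x (stringVar l j) (≡.cong toDir (variable-string l j))))
        (ι-∏ es (allFin (len R 0 l)) _ _ (λ k → E.trans es (E.reflexive es (≡.cong (λ s → lit (EAlg es) s (lookup j k)) (point-nothing es x (selectorVar l k) (≡.cong toDir (variable-selector l k))))) (ι-lit es (x (selectorVar l k)) (lookup j k))))

      lin-here : ∀ es a l β → lin (l ∷ es) a l β ≡ (E.ι es a , const es β)
      lin-here es a l β with leaf≟ R 0 l l
      ... | yes _ = ≡.refl
      ... | no ne = ⊥-elim (ne ≡.refl)

      lin-there : ∀ es a l l' β → ¬ l' ≡ l → lin (l' ∷ es) a l β ≡ (lin es a l β , E.0# es)
      lin-there es a l l' β ne with leaf≟ R 0 l' l
      ... | yes e = ⊥-elim (ne e)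
      ... | no _ = ≡.refl

    module _ (xs : Leaf R 0 → F.Carrier) (βs : Leaf R 0 → Tens) (Ss : Leaf R 0 → F.Carrier) where
      private
        y : ∀ es → Leaf R 0 → E.Carrier es
        y es l = E._*_ es (lin es (xs l) l (βs l)) (E.ι es (Ss l))

      -- Only the ε-parts contribute to the top component of a product of affine elements with distinct directions.
      top-∏ : ∀ es → Unique es → ∀ a → top es (Sums.∏ (E.cring es) es (y es)) a K.≈ SK.∏ es (λ l → Ss l F.* βs l a)
      top-∏ [] u a = K.refl
      top-∏ (l₀ ∷ es) (n ∷ u) a = K.trans (top-cong es second a) (K.trans (top-const-* es (λ a → Ss l₀ F.* βs l₀ a) (Sums.∏ (E.cring es) es (y es)) a) (K.*-congˡ (top-∏ es u a)))
        where
        open Alg (EAlg es) using (*-comm; *-cong; *-congʳ; *-congˡ; +-cong; +-congʳ; +-identityˡ; refl; reflexive; sym; trans; zeroʳ; zeroˡ; _*_; _≈_; 0#; cring; ι)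
        open RS cring using (rsolve; _:+_; _:*_; _⊜_)
        rest : ∀ ls → All (λ l → ¬ l₀ ≡ l) ls → Alg._≈_ (EAlg (l₀ ∷ es)) (Sums.∏ (E.cring (l₀ ∷ es)) ls (y (l₀ ∷ es))) (Sums.∏ cring ls (y es) , 0#)
        rest [] [] = refl , refl
        rest (l ∷ ls) (ne ∷ nes) = E.trans (l₀ ∷ es) (E.*-cong (l₀ ∷ es) (E.*-congʳ (l₀ ∷ es) (E.reflexive (l₀ ∷ es) (lin-there es (xs l) l l₀ (βs l) ne))) (rest ls nes))
          (refl , trans (+-cong (zeroʳ _) (trans (*-congʳ (trans (+-cong (zeroʳ _) (zeroˡ _)) (+-identityˡ _))) (zeroˡ _))) (+-identityˡ _))
        second : proj₂ (Sums.∏ (E.cring (l₀ ∷ es)) (l₀ ∷ es) (y (l₀ ∷ es))) ≈ const es (λ a → Ss l₀ F.* βs l₀ a) * Sums.∏ cring es (y es)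
        second = trans (proj₂ (E.*-cong (l₀ ∷ es) (E.*-congʳ (l₀ ∷ es) {x = E.ι (l₀ ∷ es) (Ss l₀)} (E.reflexive (l₀ ∷ es) (lin-here es (xs l₀) l₀ (βs l₀)))) (rest es n)))
          (trans (+-cong (zeroʳ _) (*-congʳ (trans (+-congʳ (zeroʳ _)) (trans (+-identityˡ _) (trans (*-comm _ _) (trans (*-congʳ (const-ι es (Ss l₀))) (sym (const-* es (T.ι (Ss l₀)) (βs l₀)))))))))
            (+-identityˡ _))

    es : List (Leaf R 0)
    es = leaves R 0

    indicator : (Fin size → F.Carrier) → Conf R 0 → Tens
    indicator x c a = SK.∏ es (λ l → selected x l (decode R 0 c [] l) F.* KD.δᵥ (a l) (decode R 0 c [] l))

    top-h : ∀ x a → top es (⟦_⟧ F (EAlg es) h (point dir es x)) a K.≈ SK.∑ (confs R 0) (λ c → indicator x c a)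
    top-h x a = K.trans (top-cong es (trans (h-value (EAlg es) (point dir es x)) (Expansion.net-expand cring R 0 (leafValue (EAlg es) (point dir es x)) [])) a)
      (K.trans (top-∑ (confs R 0) _) (SK.∑-cong (confs R 0) (λ c → K.trans (top-cong es (Sums.∏-cong cring es (λ l → leafValue-point es x l (decode R 0 c [] l))) a)
        (top-∏ (λ l → x (stringVar l (decode R 0 c [] l))) (λ l a → KD.δᵥ (a l) (decode R 0 c [] l)) (λ l → selected x l (decode R 0 c [] l)) es (leaves-unique R 0) a))))
      where
      open Alg (EAlg es) using (+-congˡ; Carrier; trans; _≈_; cring)
      top-∑ : ∀ {b} {I : Set b} (is : List I) (g : I → Carrier) → top es (Sums.∑ cring is g) a K.≈ SK.∑ is (λ i → top es (g i) a)
      top-∑ [] g = top-0 es a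
      top-∑ (i ∷ is) g = K.trans (top-+ es _ _ a) (K.+-congˡ (top-∑ is g))

    sel : Form F (Fin size)
    sel = prod (map (λ l → prod (map (λ k → prod (literal (selectorVar l k) true ∷ literal (selectorVar l k) false ∷ [])) (allFin (len R 0 l)))) es)

    sel-value : ∀ x → ⟦_⟧ F (stableAlg F) sel x K.≈ SK.∏ es (λ l → SK.∏ (allFin (len R 0 l)) (λ k → litF (x (selectorVar l k)) true F.* litF (x (selectorVar l k)) false))
    sel-value x = K.trans (⟦map⟧Π _ es) (SK.∏-cong es (λ l → K.trans (⟦map⟧Π _ (allFin (len R 0 l))) (SK.∏-cong (allFin (len R 0 l)) (λ k →
      K.*-congˡ (K.trans (K.*-identityʳ _) (literal-value (stableAlg F) x (selectorVar l k) false))))))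
      where open NetSemantics bools (stableAlg F) x using (⟦map⟧Π)

    private
      nonzero-* : ∀ {a b} → ¬ (a K.≈ K.0#) → ¬ (b K.≈ K.0#) → ¬ (a K.* b K.≈ K.0#)
      nonzero-* {a} {b} na nb e with F.inverse b (λ z → nb (λ k → k z))
      ... | y , h = na (K.trans (λ k → k (F.trans (F.sym (F.*-identityʳ a)) (F.trans (F.*-congˡ (F.sym h)) (F.sym (F.*-assoc _ _ _))))) (K.trans (K.*-congʳ e) (K.zeroˡ y)))

      nonzero-∏ : ∀ {b} {I : Set b} (is : List I) {g : I → F.Carrier} → (∀ i → ¬ (g i K.≈ K.0#)) → ¬ (SK.∏ is g K.≈ K.0#)
      nonzero-∏ [] h e = e F.nontrivial
      nonzero-∏ (i ∷ is) h = nonzero-* (h i) (nonzero-∏ is h)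

    sel-nonzero : ∀ n → ¬ (⟦_⟧ F (stableAlg F) sel (λ _ → natF F (2 ℕ.+ n)) K.≈ K.0#)
    sel-nonzero n e = nonzero-∏ es (λ l → nonzero-∏ (allFin (len R 0 l)) (λ k → nonzero-* (λ e → e (char0 (suc n))) one-minus)) (K.trans (K.sym (sel-value _)) e)
      where
      open RS F.commutativeRing using (rsolve; _:+_; :-_; _:-_; _⊜_)
      one-minus : ¬ (F.1# F.- natF F (2 ℕ.+ n) K.≈ K.0#)
      one-minus e = e (λ z → char0 n (F.trans (F.sym (rsolve 2 (λ o m → :- (o :- (o :+ m)) ⊜ m) F.refl F.1# (natF F (suc n)))) (F.trans (F.-‿cong z) -0#≈0#)))
        where open import Algebra.Properties.Ring F.ring using (-0#≈0#)

    selected-nonzero : ∀ x → ¬ (⟦_⟧ F (stableAlg F) sel x K.≈ K.0#) → ∀ (j : ∀ l → Vec Bool (len R 0 l)) → ¬ (SK.∏ es (λ l → selected x l (j l)) K.≈ K.0#)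
    selected-nonzero x nz j e = nz (K.trans (sel-value x) (K.trans (SK.∏-cong es (λ l → K.trans (SK.∏-cong (allFin (len R 0 l)) (λ k → split (x (selectorVar l k)) (lookup (j l) k))) (SK.∏-* (allFin (len R 0 l)) _ _)))
      (K.trans (SK.∏-* es _ _) (K.trans (K.*-congʳ e) (K.zeroˡ _)))))
      where
      split : ∀ s b → litF s true F.* litF s false K.≈ litF s b F.* litF s (not b)
      split s true = K.refl
      split s false = K.*-comm s (litF s false)

    module _ (x : Fin size → F.Carrier) (nz : ¬ (⟦_⟧ F (stableAlg F) sel x K.≈ K.0#)) where
      open RankLower F (Leaf R 0) (leaf≟ R 0) (len R 0) (isRow R 0) using (mix; diagonal-rank)

      private
        T₀ : Tens
        T₀ = top es (⟦_⟧ F (EAlg es) h (point dir es x))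

        strings-of : Conf R 0 → Idx
        strings-of c = decode R 0 c []

        indicator-off : ∀ c a → ¬ (∀ l → a l ≡ strings-of c l) → indicator x c a K.≈ K.0#
        indicator-off c a ne = cases (All.all? (λ l → VP.≡-dec Bool._≟_ (a l) (strings-of c l)) es)
          where
          zero-∏ : ∀ ls → ¬ All (λ l → a l ≡ strings-of c l) ls → SK.∏ ls (λ l → selected x l (strings-of c l) F.* KD.δᵥ (a l) (strings-of c l)) K.≈ K.0#
          zero-∏ [] n = ⊥-elim (n [])
          zero-∏ (l ∷ ls) n = cases′ (VP.≡-dec Bool._≟_ (a l) (strings-of c l))
            where
            cases′ : Dec (a l ≡ strings-of c l) → _
            cases′ (yes e) = K.trans (K.*-congˡ (zero-∏ ls (λ as → n (e ∷ as)))) (K.zeroʳ _)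
            cases′ (no ne) = K.trans (K.*-congʳ (K.trans (K.*-congˡ {selected x l (strings-of c l)} (KD.δᵥ-≢ (a l) (strings-of c l) ne)) (K.zeroʳ (selected x l (strings-of c l))))) (K.zeroˡ _)
          cases : Dec (All (λ l → a l ≡ strings-of c l) es) → indicator x c a K.≈ K.0#
          cases (yes as) = ⊥-elim (ne (λ l → All.lookup as (leaves-complete R 0 l)))
          cases (no n) = zero-∏ es n

        mix-rows : ∀ c c' c″ → (∀ l → mix (strings-of c) (strings-of c') l ≡ strings-of c″ l) → c ≡ c″ × c' ≡ c″
        mix-rows c c' c″ e = rows-determine R 0 c c″ [] (λ l s → ≡.trans (≡.sym (row l s)) (e l)) , cols-determine R 0 c' c″ [] (λ l s → ≡.trans (≡.sym (col l s)) (e l))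
          where
          row : ∀ l → isRow R 0 l ≡ true → mix (strings-of c) (strings-of c') l ≡ strings-of c l
          row l s with isRow R 0 l
          row l ≡.refl | .true = ≡.refl
          col : ∀ l → isRow R 0 l ≡ false → mix (strings-of c) (strings-of c') l ≡ strings-of c' l
          col l s with isRow R 0 l
          col l ≡.refl | .false = ≡.refl

        points : Injection (bits R 0) (Conf R 0)
        points = configurations R 0

        conf-at : Fin (2 ^ bits R 0) → Conf R 0
        conf-at = Injection.fun points

        off-diagonal : ∀ i k → ¬ i ≡ k → T₀ (mix (strings-of (conf-at i)) (strings-of (conf-at k))) K.≈ K.0#
        off-diagonal i k ne = K.trans (top-h x _) (SK.∑-0 (confs R 0) (λ c → indicator-off c _ (λ e →
          ne (Injection.injective points i k (≡.trans (proj₁ (mix-rows (conf-at i) (conf-at k) c e)) (≡.sym (proj₂ (mix-rows (conf-at i) (conf-at k) c e))))))))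

        diagonal : ∀ i → ¬ (T₀ (mix (strings-of (conf-at i)) (strings-of (conf-at i))) K.≈ K.0#)
        diagonal i e = selected-nonzero x nz (strings-of (conf-at i)) (K.trans (K.sym on) (K.trans (K.sym (Expansion.confs-enumerate K.cring R 0 (conf-at i) (λ c → indicator x c a)
            (λ c ne → indicator-off c a (λ e → ne (≡.sym (proj₁ (mix-rows (conf-at i) (conf-at i) c e))))))) (K.trans (K.sym (top-h x a)) e)))
          where
          a : Idx
          a = mix (strings-of (conf-at i)) (strings-of (conf-at i))
          mix-same : ∀ l → a l ≡ strings-of (conf-at i) l
          mix-same l with isRow R 0 l
          ... | true = ≡.refl
          ... | false = ≡.refl
          on : indicator x (conf-at i) a K.≈ SK.∏ es (λ l → selected x l (strings-of (conf-at i) l))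
          on = SK.∏-cong es (λ l → K.trans (K.*-congˡ {selected x l (strings-of (conf-at i) l)} (K.trans (K.reflexive (≡.cong (λ v → KD.δᵥ v (strings-of (conf-at i) l)) (mix-same l))) (KD.δᵥ-refl (strings-of (conf-at i) l)))) (K.*-identityʳ _))

      rank-lower : ∀ {n} → Rk n (top es (⟦_⟧ F (EAlg es) h (point dir es x))) → 2 ^ bits R 0 ≤ n
      rank-lower = diagonal-rank (strings-of ∘ conf-at) off-diagonal diagonal

    hvs≡bits : hvs es ≡ bits R 0
    hvs≡bits = ℕP.*-cancelˡ-≡ (hvs es) (bits R 0) 2 (≡.trans (double es) (≡.trans (totalLen≡ R 0) (ℕP.+-identityʳ _)))
      where
      double : ∀ ls → 2 ℕ.* hvs ls ≡ lens R 0 ls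
      double [] = ≡.refl
      double (l ∷ ls) = ≡.trans (ℕP.*-distribˡ-+ 2 (hv l) (hvs ls)) (≡.cong₂ ℕ._+_ (≡.sym (W≡2H (level R 0 l))) (double ls))

    module _ (Δ : ℕ) (lvs : Levels (suc (2 ℕ.* Δ))) (thr0 : 1 ≤ Levels.thr lvs 0) (many : Levels.thr lvs (suc (2 ℕ.* Δ)) < length es)
      (C : Circuit F (IPSVar (suc size) 1)) (ref : Refutes (PolySemantics.circuitForm F C)) (depth≤ : depth F C ≤ Δ) (t : ℕ) (size≤ : circuitSize F C ≤ t)
      (D : ℕ) (deg≤ : deg F (λ _ → 2) (PolySemantics.circuitForm F C) ≤ D) (len≤ : suc (length es) ≤ D) where

      size-lower : 2 ^ Λ ≤ totalCount (length es) D t Δ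
      size-lower with 2 ^ Λ ℕP.≤? totalCount (length es) D t Δ
      ... | yes p = p
      ... | no np = ⊥-elim (low-rank-top dir es Δ lvs thr0 many h sel sel-nonzero C depth≤ t size≤ D deg≤ len≤ ref contradiction)
        where
        contradiction : LowRankTop dir es Δ lvs thr0 many h sel sel-nonzero C depth≤ t size≤ D deg≤ len≤ ref → ⊥
        contradiction (x , nz , n , rk , b) = np (ℕP.*-cancelʳ-≤ (2 ^ Λ) (totalCount (length es) D t Δ) (2 ^ hvs es) {{ℕP.m^n≢0 2 (hvs es)}}
          (ℕP.≤-trans (ℕP.≤-reflexive (ℕP.*-comm (2 ^ Λ) (2 ^ hvs es))) (ℕP.≤-trans (ℕP.*-monoˡ-≤ (2 ^ Λ) (ℕP.≤-trans (ℕP.≤-reflexive (≡.cong (2 ^_) hvs≡bits)) (rank-lower x nz rk))) b)))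

module Compilation where
  open FormulaSemantics
  open CircuitSemantics
  open import Defs
  open import Data.Nat using () renaming (_⊔_ to _⊔ℕ_)

  module Compile {c ℓ : Level} (F : Field c ℓ) {V : Set} where
    private module F = Field F using (Carrier; 1#)
    open PolySemantics F using (nodeForms; gateForm; circuitForm)

    formDepth : Form F V → ℕ
    formDepthΣ : List (F.Carrier × Form F V) → ℕ
    formDepthΠ : List (Form F V) → ℕ
    formDepth (inp v) = 0
    formDepth (con a) = 0
    formDepth (sum ws) = suc (formDepthΣ ws)
    formDepth (prod fs) = suc (formDepthΠ fs)
    formDepthΣ [] = 0
    formDepthΣ ((a , f) ∷ ws) = formDepth f ⊔ℕ formDepthΣ ws
    formDepthΠ [] = 0
    formDepthΠ (f ∷ fs) = formDepth f ⊔ℕ formDepthΠ fs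

    wires : Form F V → ℕ
    wiresΣ : List (F.Carrier × Form F V) → ℕ
    wiresΠ : List (Form F V) → ℕ
    wires (inp v) = 0
    wires (con a) = 0
    wires (sum ws) = wiresΣ ws
    wires (prod fs) = wiresΠ fs
    wiresΣ [] = 0
    wiresΣ ((a , f) ∷ ws) = suc (wires f ℕ.+ wiresΣ ws)
    wiresΠ [] = 0
    wiresΠ (f ∷ fs) = suc (wires f ℕ.+ wiresΠ fs)

    -- The number of nodes after appending the nodes of a formula to a program of i nodes.
    after : Form F V → ℕ → ℕ
    afterΣ : List (F.Carrier × Form F V) → ℕ → ℕ
    afterΠ : List (Form F V) → ℕ → ℕ
    after (inp v) i = suc i
    after (con a) i = suc i
    after (sum ws) i = suc (afterΣ ws i)
    after (prod fs) i = suc (afterΠ fs i)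
    afterΣ [] i = i
    afterΣ ((a , f) ∷ ws) i = afterΣ ws (after f i)
    afterΠ [] i = i
    afterΠ (f ∷ fs) i = afterΠ fs (after f i)

    root : ∀ f i → Fin (after f i)
    root (inp v) i = zero
    root (con a) i = zero
    root (sum ws) i = zero
    root (prod fs) i = zero

    keep : ∀ f {i} → Fin i → Fin (after f i)
    keepΣ : ∀ ws {i} → Fin i → Fin (afterΣ ws i)
    keepΠ : ∀ fs {i} → Fin i → Fin (afterΠ fs i)
    keep (inp v) j = suc j
    keep (con a) j = suc j
    keep (sum ws) j = suc (keepΣ ws j)
    keep (prod fs) j = suc (keepΠ fs j)
    keepΣ [] j = j
    keepΣ ((a , f) ∷ ws) j = keepΣ ws (keep f j)
    keepΠ [] j = j
    keepΠ (f ∷ fs) j = keepΠ fs (keep f j)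

    rootsΣ : ∀ ws i → List (F.Carrier × Fin (afterΣ ws i))
    rootsΣ [] i = []
    rootsΣ ((a , f) ∷ ws) i = (a , keepΣ ws (root f i)) ∷ rootsΣ ws (after f i)

    rootsΠ : ∀ fs i → List (Fin (afterΠ fs i))
    rootsΠ [] i = []
    rootsΠ (f ∷ fs) i = keepΠ fs (root f i) ∷ rootsΠ fs (after f i)

    compile : ∀ f {i} → SLP F V i → SLP F V (after f i)
    compileΣ : ∀ ws {i} → SLP F V i → SLP F V (afterΣ ws i)
    compileΠ : ∀ fs {i} → SLP F V i → SLP F V (afterΠ fs i)
    compile (inp v) p = p ▷ input v
    compile (con a) p = p ▷ const a
    compile (sum ws) p = compileΣ ws p ▷ plus (rootsΣ ws _)
    compile (prod fs) p = compileΠ fs p ▷ times (rootsΠ fs _)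
    compileΣ [] p = p
    compileΣ ((a , f) ∷ ws) p = compileΣ ws (compile f p)
    compileΠ [] p = p
    compileΠ (f ∷ fs) p = compileΠ fs (compile f p)

    -- Any quantity computed along the program is preserved on the old nodes and is the intended one at the root.
    module _ {a} {A : Set a} (step : ∀ {i} → Vec A i → Gate F V i → A) (value : ∀ {i} → SLP F V i → Vec A i)
      (value-▷ : ∀ {i} (p : SLP F V i) g → value (p ▷ g) ≡ step (value p) g ∷ value p) where

      value-suc : ∀ {i} (p : SLP F V i) g j → lookup (value (p ▷ g)) (suc j) ≡ lookup (value p) j
      value-suc p g j = ≡.cong (λ v → lookup v (suc j)) (value-▷ p g)

      value-keep : ∀ f {i} (p : SLP F V i) j → lookup (value (compile f p)) (keep f j) ≡ lookup (value p) j
      value-keepΣ : ∀ ws {i} (p : SLP F V i) j → lookup (value (compileΣ ws p)) (keepΣ ws j) ≡ lookup (value p) j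
      value-keepΠ : ∀ fs {i} (p : SLP F V i) j → lookup (value (compileΠ fs p)) (keepΠ fs j) ≡ lookup (value p) j
      value-keep (inp v) p j = value-suc p (input v) j
      value-keep (con a) p j = value-suc p (const a) j
      value-keep (sum ws) p j = ≡.trans (value-suc (compileΣ ws p) _ _) (value-keepΣ ws p j)
      value-keep (prod fs) p j = ≡.trans (value-suc (compileΠ fs p) _ _) (value-keepΠ fs p j)
      value-keepΣ [] p j = ≡.refl
      value-keepΣ ((a , f) ∷ ws) p j = ≡.trans (value-keepΣ ws (compile f p) (keep f j)) (value-keep f p j)
      value-keepΠ [] p j = ≡.refl
      value-keepΠ (f ∷ fs) p j = ≡.trans (value-keepΠ fs (compile f p) (keep f j)) (value-keep f p j)

    nodeForms-root : ∀ f {i} (p : SLP F V i) → lookup (nodeForms (compile f p)) (root f i) ≡ f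
    nodeForms-Σ : ∀ ws {i} (p : SLP F V i) → map (λ w → proj₁ w , lookup (nodeForms (compileΣ ws p)) (proj₂ w)) (rootsΣ ws i) ≡ ws
    nodeForms-Π : ∀ fs {i} (p : SLP F V i) → map (lookup (nodeForms (compileΠ fs p))) (rootsΠ fs i) ≡ fs
    nodeForms-root (inp v) p = ≡.refl
    nodeForms-root (con a) p = ≡.refl
    nodeForms-root (sum ws) p = ≡.cong sum (nodeForms-Σ ws p)
    nodeForms-root (prod fs) p = ≡.cong prod (nodeForms-Π fs p)
    nodeForms-Σ [] p = ≡.refl
    nodeForms-Σ ((a , f) ∷ ws) p = ≡.cong₂ (λ g gs → (a , g) ∷ gs) (≡.trans (value-keepΣ gateForm nodeForms (λ _ _ → ≡.refl) ws (compile f p) (root f _)) (nodeForms-root f p)) (nodeForms-Σ ws (compile f p))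
    nodeForms-Π [] p = ≡.refl
    nodeForms-Π (f ∷ fs) p = ≡.cong₂ _∷_ (≡.trans (value-keepΠ gateForm nodeForms (λ _ _ → ≡.refl) fs (compile f p) (root f _)) (nodeForms-root f p)) (nodeForms-Π fs (compile f p))

    depth-root : ∀ f {i} (p : SLP F V i) → lookup (depthsSLP F (compile f p)) (root f i) ≡ formDepth f
    depth-Σ : ∀ ws {i} (p : SLP F V i) → maxList F (map (λ w → lookup (depthsSLP F (compileΣ ws p)) (proj₂ w)) (rootsΣ ws i)) ≡ formDepthΣ ws
    depth-Π : ∀ fs {i} (p : SLP F V i) → maxList F (map (lookup (depthsSLP F (compileΠ fs p))) (rootsΠ fs i)) ≡ formDepthΠ fs
    depth-root (inp v) p = ≡.refl
    depth-root (con a) p = ≡.refl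
    depth-root (sum ws) p = ≡.cong suc (depth-Σ ws p)
    depth-root (prod fs) p = ≡.cong suc (depth-Π fs p)
    depth-Σ [] p = ≡.refl
    depth-Σ ((a , f) ∷ ws) p = ≡.cong₂ _⊔ℕ_ (≡.trans (value-keepΣ (gateDepth F) (depthsSLP F) (λ _ _ → ≡.refl) ws (compile f p) (root f _)) (depth-root f p)) (depth-Σ ws (compile f p))
    depth-Π [] p = ≡.refl
    depth-Π (f ∷ fs) p = ≡.cong₂ _⊔ℕ_ (≡.trans (value-keepΠ (gateDepth F) (depthsSLP F) (λ _ _ → ≡.refl) fs (compile f p) (root f _)) (depth-root f p)) (depth-Π fs (compile f p))

    wires-compile : ∀ f {i} (p : SLP F V i) → wiresSLP F (compile f p) ≡ wiresSLP F p ℕ.+ wires f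
    wires-Σ : ∀ ws {i} (p : SLP F V i) → wiresSLP F (compileΣ ws p) ℕ.+ length (rootsΣ ws i) ≡ wiresSLP F p ℕ.+ wiresΣ ws
    wires-Π : ∀ fs {i} (p : SLP F V i) → wiresSLP F (compileΠ fs p) ℕ.+ length (rootsΠ fs i) ≡ wiresSLP F p ℕ.+ wiresΠ fs
    wires-compile (inp v) p = ≡.refl
    wires-compile (con a) p = ≡.refl
    wires-compile (sum ws) p = wires-Σ ws p
    wires-compile (prod fs) p = wires-Π fs p
    wires-Σ [] p = ≡.refl
    wires-Σ ((a , f) ∷ ws) p = ≡.trans (ℕP.+-suc _ _) (≡.trans (≡.cong suc (≡.trans (wires-Σ ws (compile f p)) (≡.trans (≡.cong (ℕ._+ wiresΣ ws) (wires-compile f p)) (ℕP.+-assoc (wiresSLP F p) (wires f) (wiresΣ ws))))) (≡.sym (ℕP.+-suc (wiresSLP F p) _)))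
    wires-Π [] p = ≡.refl
    wires-Π (f ∷ fs) p = ≡.trans (ℕP.+-suc _ _) (≡.trans (≡.cong suc (≡.trans (wires-Π fs (compile f p)) (≡.trans (≡.cong (ℕ._+ wiresΠ fs) (wires-compile f p)) (ℕP.+-assoc (wiresSLP F p) (wires f) (wiresΠ fs))))) (≡.sym (ℕP.+-suc (wiresSLP F p) _)))

    padded : ℕ → List (F.Carrier × Form F V) → List (F.Carrier × Form F V)
    padded zero ws = ws
    padded (suc n) ws = (F.1# , sum (padded n ws)) ∷ []

    padded-depth : ∀ n ws → formDepth (sum (padded n ws)) ≡ n ℕ.+ formDepth (sum ws)
    padded-depth zero ws = ≡.refl
    padded-depth (suc n) ws = ≡.cong suc (≡.trans (ℕP.⊔-identityʳ _) (padded-depth n ws))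

    padded-wires : ∀ n ws → wiresΣ (padded n ws) ≡ n ℕ.+ wiresΣ ws
    padded-wires zero ws = ≡.refl
    padded-wires (suc n) ws = ≡.cong suc (≡.trans (ℕP.+-identityʳ _) (padded-wires n ws))

    padded-value : ∀ (A : Alg F) x n ws → Alg._≈_ A (⟦_⟧Σ F A (padded n ws) x) (⟦_⟧Σ F A ws x)
    padded-value A x zero ws = Alg.refl A
    padded-value A x (suc n) ws = trans (+-identityʳ _) (trans (*-congʳ ι-1) (trans (*-identityˡ _) (padded-value A x n ws)))
      where open Alg A using (*-congʳ; *-identityˡ; +-identityʳ; trans; ι-1)

    sumCircuit : List (F.Carrier × Form F V) → Circuit F V
    sumCircuit ws = circuit (afterΣ ws 0) (compile (sum ws) [])

    sumCircuit-form : ∀ ws → circuitForm (sumCircuit ws) ≡ sum ws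
    sumCircuit-form ws = nodeForms-root (sum ws) []

    sumCircuit-depth : ∀ ws → depth F (sumCircuit ws) ≡ formDepth (sum ws)
    sumCircuit-depth ws = depth-root (sum ws) []

    sumCircuit-size : ∀ ws → size F (sumCircuit ws) ≡ wiresΣ ws
    sumCircuit-size ws = wires-Σ ws []

module SizeBounds where
  open FormulaSemantics
  open TensorRank
  open NetworkFormulas
  open HardRefutation
  open Compilation
  open import Defs using (Field; module Field; CharZero; IPSVar)
  open import Data.Nat using (_+_; _*_)
  open import Data.Nat.Properties using (module ≤-Reasoning)
  open import Data.Nat.Solver using (module +-*-Solver)
  open import Data.List using (allFin)

  n<2^n : ∀ n → n < 2 ^ n
  n<2^n zero = s≤s z≤n
  n<2^n (suc n) = ℕP.≤-trans (ℕP.+-mono-≤ (ℕP.m^n>0 2 n) (n<2^n n)) (ℕP.≤-reflexive (≡.cong (2 ^ n +_) (≡.sym (ℕP.+-identityʳ _))))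

  depthBound : ℕ → ℕ
  depthBound zero = 2
  depthBound (suc zero) = 2
  depthBound (suc (suc r)) = 2 + depthBound (suc r)

  depthBound≡ : ∀ r → depthBound (suc r) ≡ 2 * suc r
  depthBound≡ zero = ≡.refl
  depthBound≡ (suc r) = ≡.trans (≡.cong (2 +_) (depthBound≡ r)) (≡.sym (ℕP.*-suc 2 (suc r)))

  2≤depthBound : ∀ r → 2 ≤ depthBound r
  2≤depthBound zero = ℕP.≤-refl
  2≤depthBound (suc zero) = ℕP.≤-refl
  2≤depthBound (suc (suc r)) = ℕP.m≤m+n 2 _

  depthBound-suc : ∀ r → depthBound r ≤ depthBound (suc r)
  depthBound-suc zero = ℕP.≤-refl
  depthBound-suc (suc r) = ℕP.m≤n+m _ 2

  -- The number of wires of a block of height r is at most X ^ exponent r.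
  exponent : ℕ → ℕ
  exponent zero = 3
  exponent (suc zero) = 3
  exponent (suc (suc r)) = 4 + exponent (suc r)

  module Bounds {c ℓ : Level} (F : Field c ℓ) (char0 : CharZero F) (γ : ℕ → ℕ) (Z : ℕ) (r pad : ℕ) where
    private module F = Field F using (1#)
    open RefutationForm F char0 γ Z r pad using (Leaf; QFactor; W; children; cuts; h; hFactor; i6; leafForm²; leafForm¹; len; level; literal; literal²; netForm; pairs; refutation; refutationTerms; size; string²; weightedTerms)

    private
      R : ℕ
      R = suc (suc r)

    module _ {V : Set} where
      open Compile F {V} using (formDepth; formDepthΠ; formDepthΣ; wires; wiresΠ; wiresΣ)

      depthΠ-map : ∀ {b} {I : Set b} (g : I → Form F V) is n → (∀ i → formDepth (g i) ≤ n) → formDepthΠ (map g is) ≤ n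
      depthΠ-map g [] n h = z≤n
      depthΠ-map g (i ∷ is) n h = ℕP.⊔-lub (h i) (depthΠ-map g is n h)

      depthΣ-map : ∀ {b} {I : Set b} a (g : I → Form F V) is n → (∀ i → formDepth (g i) ≤ n) → formDepthΣ (map (λ i → a , g i) is) ≤ n
      depthΣ-map a g [] n h = z≤n
      depthΣ-map a g (i ∷ is) n h = ℕP.⊔-lub (h i) (depthΣ-map a g is n h)

      depthΣ-++ : ∀ us vs n → formDepthΣ us ≤ n → formDepthΣ vs ≤ n → formDepthΣ (us ++ vs) ≤ n
      depthΣ-++ [] vs n h k = k
      depthΣ-++ ((a , f) ∷ us) vs n h k = ℕP.⊔-lub (ℕP.≤-trans (ℕP.m≤m⊔n _ _) h) (depthΣ-++ us vs n (ℕP.≤-trans (ℕP.m≤n⊔m (formDepth f) _) h) k)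

      wiresΠ-map : ∀ {b} {I : Set b} (g : I → Form F V) is n → (∀ i → wires (g i) ≤ n) → wiresΠ (map g is) ≤ length is * suc n
      wiresΠ-map g [] n h = z≤n
      wiresΠ-map g (i ∷ is) n h = s≤s (ℕP.+-mono-≤ (h i) (wiresΠ-map g is n h))

      wiresΣ-map : ∀ {b} {I : Set b} a (g : I → Form F V) is n → (∀ i → wires (g i) ≤ n) → wiresΣ (map (λ i → a , g i) is) ≤ length is * suc n
      wiresΣ-map a g [] n h = z≤n
      wiresΣ-map a g (i ∷ is) n h = s≤s (ℕP.+-mono-≤ (h i) (wiresΣ-map a g is n h))

      wiresΣ-++ : ∀ us vs → wiresΣ (us ++ vs) ≡ wiresΣ us + wiresΣ vs
      wiresΣ-++ [] vs = ≡.refl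
      wiresΣ-++ ((a , f) ∷ us) vs = ≡.cong suc (≡.trans (≡.cong (wires f +_) (wiresΣ-++ us vs)) (≡.sym (ℕP.+-assoc (wires f) _ _)))

      module _ {X : Set} (xs : List X) where

        LeafForms : ℕ → ℕ → Set _
        LeafForms r t = (l : Leaf r t) → Vec X (len r t l) → Form F V

        netForm-depth : ∀ r t (lf : LeafForms r t) → (∀ l j → formDepth (lf l j) ≤ 2) → ∀ m → formDepth (netForm xs r t lf m) ≤ depthBound r
        netForm-depth zero t lf h m = h tt m
        netForm-depth (suc zero) t lf h m = h tt m
        netForm-depth (suc (suc r)) t lf h m = s≤s (depthΣ-map F.1# _ (cuts xs t) _ (λ M → s≤s (ℕP.⊔-lub
          (ℕP.≤-trans (netForm-depth r (suc (suc t)) (λ l → lf (inj₁ l)) (λ l → h (inj₁ l)) _) (depthBound-suc r))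
          (depthΠ-map _ (allFin (γ t)) _ (λ i → netForm-depth (suc r) (suc t) (λ l → lf (inj₂ (i , l))) (λ l → h (inj₂ (i , l))) (lookup M i))))))

        weightedTerms-depth : ∀ r t a e (lf : LeafForms (suc (suc r)) t) → formDepth e ≤ 2 → (∀ l j → formDepth (lf l j) ≤ 2) → ∀ m →
          formDepthΣ (weightedTerms xs r t a e lf m) ≤ suc (depthBound (suc r))
        weightedTerms-depth r t a e lf he h m = depthΣ-map a _ (cuts xs t) _ (λ M → s≤s (ℕP.⊔-lub (ℕP.≤-trans he (2≤depthBound (suc r))) (ℕP.⊔-lub
          (ℕP.≤-trans (netForm-depth r (suc (suc t)) (λ l → lf (inj₁ l)) (λ l → h (inj₁ l)) _) (depthBound-suc r))
          (depthΠ-map _ (allFin (γ t)) _ (λ i → netForm-depth (suc r) (suc t) (λ l → lf (inj₂ (i , l))) (λ l → h (inj₂ (i , l))) (lookup M i))))))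

    open Compile F {IPSVar (suc size) 1} using (formDepth; padded; padded-wires; wires; wiresΣ)

    private
      leaf¹-depth : ∀ l j → formDepth (leafForm¹ l j) ≤ 2
      leaf¹-depth l j = s≤s (depthΠ-map _ (allFin (len R 0 l)) 1 (λ k → literal-depth _ (lookup j k)))
        where
        literal-depth : ∀ v b → formDepth (literal v b) ≤ 1
        literal-depth v true = z≤n
        literal-depth v false = ℕP.≤-refl

      literal²-depth : ∀ s z p → formDepth (literal² s z p) ≤ 1
      literal²-depth s z (true , true) = ℕP.≤-refl
      literal²-depth s z (true , false) = ℕP.≤-refl
      literal²-depth s z (false , true) = ℕP.≤-refl
      literal²-depth s z (false , false) = ℕP.≤-refl

      string²-depth : ∀ l p d → formDepth (string² l p d) ≤ 1
      string²-depth l p (yes _) = ℕP.≤-refl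
      string²-depth l p (no _) = ℕP.≤-refl

      leaf²-depth : ∀ l p → formDepth (leafForm² l p) ≤ 2
      leaf²-depth l p = s≤s (ℕP.⊔-lub (string²-depth l p _) (depthΠ-map _ (allFin (len R 0 l)) 1 (λ k → literal²-depth _ _ (lookup p k))))

    refutation-depth : formDepth refutation ≤ 2 * R
    refutation-depth = ℕP.≤-trans (s≤s (depthΣ-++ (weightedTerms bools r 0 i6 hFactor leafForm¹ []) _ _
        (weightedTerms-depth bools r 0 i6 hFactor leafForm¹ ℕP.≤-refl leaf¹-depth [])
        (depthΣ-++ (weightedTerms pairs r 0 i6 QFactor leafForm² []) _ _ (weightedTerms-depth pairs r 0 i6 QFactor leafForm² (s≤s z≤n) leaf²-depth []) (s≤s z≤n))))
      (ℕP.≤-reflexive (≡.trans (≡.cong (2 +_) (depthBound≡ r)) (≡.sym (ℕP.*-suc 2 (suc r)))))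

    module _ (B : ℕ) (W≤B : ∀ s → s ≤ R → W s ≤ B) (γ≤X : ∀ t → t ≤ r → 10 + γ t ≤ 2 ^ B) where
      private
        X : ℕ
        X = 2 ^ B

        X≥10 : 10 ≤ X
        X≥10 = ℕP.≤-trans (ℕP.m≤m+n 10 _) (γ≤X 0 z≤n)

        B<X : B < X
        B<X = n<2^n B

        pow≥1 : ∀ n → 1 ≤ X ^ n
        pow≥1 n = ℕP.≤-trans (ℕP.≤-reflexive (≡.sym (ℕP.^-zeroˡ n))) (ℕP.^-monoˡ-≤ n (ℕP.m^n>0 2 B))

        cuts-length : ∀ {Y : Set} (ys : List Y) → length ys ≤ 4 → ∀ t → t ≤ r → length (cuts ys t) ≤ X * X
        cuts-length ys le t t≤r = begin
          length (vecs (vecs ys (W (suc t))) (γ t)) ≡⟨ ≡.trans (length-vecs (vecs ys (W (suc t))) (γ t)) (≡.cong (_^ γ t) (length-vecs ys (W (suc t)))) ⟩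
          (length ys ^ W (suc t)) ^ γ t ≡⟨ ℕP.^-*-assoc (length ys) (W (suc t)) (γ t) ⟩
          length ys ^ (W (suc t) * γ t) ≤⟨ ℕP.^-monoˡ-≤ (W (suc t) * γ t) le ⟩
          (2 * 2) ^ (W (suc t) * γ t) ≤⟨ ℕP.^-monoʳ-≤ 4 (ℕP.≤-trans (ℕP.≤-trans (ℕP.≤-reflexive (ℕP.*-comm (W (suc t)) (γ t))) (ℕP.m≤m+n _ (W t))) (W≤B (suc (suc t)) (s≤s (s≤s t≤r)))) ⟩
          (2 * 2) ^ B ≡⟨ square B ⟩
          2 ^ B * 2 ^ B ∎
          where
          open ≤-Reasoning
          square : ∀ n → (2 * 2) ^ n ≡ 2 ^ n * 2 ^ n
          square zero = ≡.refl
          square (suc n) = ≡.trans (≡.cong (4 *_) (square n)) (solve 1 (λ a → con 4 :* (a :* a) := (con 2 :* a) :* (con 2 :* a)) ≡.refl (2 ^ n))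
            where open +-*-Solver

      module _ {V Y : Set} (ys : List Y) (ys≤4 : length ys ≤ 4) where
        private module C = Compile F {V} using (wires; wiresΣ)

        private
          -- Each of the products of a block has at most X (1 + b) wires, counting the wire above it.
          product-wires : ∀ t → t ≤ r → ∀ we b (f g : ℕ) → we ≤ 7 → f ≤ b → g ≤ γ t * suc b → suc (suc (we + suc (f + g))) ≤ X * suc b
          product-wires t t≤r we b f g hwe hf hg = begin
            suc (suc (we + suc (f + g))) ≤⟨ s≤s (s≤s (ℕP.+-mono-≤ hwe (s≤s (ℕP.+-mono-≤ hf hg)))) ⟩
            9 + suc (b + γ t * suc b) ≤⟨ ℕP.+-monoˡ-≤ _ (ℕP.m≤m*n 9 (suc b)) ⟩
            9 * suc b + (suc b + γ t * suc b) ≡⟨ solve 2 (λ b g → con 9 :* b :+ (b :+ g :* b) := (con 10 :+ g) :* b) ≡.refl (suc b) (γ t) ⟩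
            (10 + γ t) * suc b ≤⟨ ℕP.*-monoˡ-≤ (suc b) (γ≤X t t≤r) ⟩
            X * suc b ∎
            where
            open ≤-Reasoning
            open +-*-Solver

          block : ∀ t → t ≤ r → ∀ n b → 1 ≤ b → n ≤ length (cuts ys t) * (X * suc b) → n ≤ (X * (X * (X * X))) * b
          block t t≤r n b pos le = begin
            n ≤⟨ le ⟩
            length (cuts ys t) * (X * suc b) ≤⟨ ℕP.*-mono-≤ (cuts-length ys ys≤4 t t≤r) (ℕP.*-monoʳ-≤ X (ℕP.≤-trans (ℕP.+-monoˡ-≤ b pos) (ℕP.≤-trans (ℕP.≤-reflexive (≡.cong (b +_) (≡.sym (ℕP.+-identityʳ b)))) (ℕP.*-monoˡ-≤ b (ℕP.≤-trans (s≤s (s≤s z≤n)) X≥10))))) ⟩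
            (X * X) * (X * (X * b)) ≡⟨ solve 2 (λ x b → (x :* x) :* (x :* (x :* b)) := (x :* (x :* (x :* x))) :* b) ≡.refl X b ⟩
            (X * (X * (X * X))) * b ∎
            where
            open ≤-Reasoning
            open +-*-Solver

          X⁴ : ∀ n → (X * (X * (X * X))) * X ^ n ≡ X ^ (4 + n)
          X⁴ n = solve 2 (λ x y → (x :* (x :* (x :* x))) :* y := x :* (x :* (x :* (x :* y)))) ≡.refl X (X ^ n)
            where open +-*-Solver

          exponent-suc : ∀ r → X ^ exponent r ≤ X ^ exponent (suc r)
          exponent-suc r = ℕP.^-monoʳ-≤ X {{ℕP.m^n≢0 2 B}} (go r)
            where
            go : ∀ r → exponent r ≤ exponent (suc r)
            go zero = ℕP.≤-refl
            go (suc r) = ℕP.m≤n+m _ 4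

        netForm-wires : ∀ r' t → r' + t ≤ R → (lf : LeafForms ys r' t) → (∀ l j → C.wires (lf l j) ≤ X ^ 3) → ∀ m → C.wires (netForm {V} ys r' t lf m) ≤ X ^ exponent r'
        netForm-wires zero t le lf h m = h tt m
        netForm-wires (suc zero) t le lf h m = h tt m
        netForm-wires (suc (suc r')) t le lf h m = ℕP.≤-trans (block t t≤r _ (X ^ exponent (suc r')) (pow≥1 (exponent (suc r')))
            (ℕP.≤-trans (wiresΣ-map F.1# (λ M → prod (children ys r' t lf m M)) (cuts ys t) _ (λ M → ℕP.+-mono-≤ {1} {1} ℕP.≤-refl (ℕP.+-mono-≤
                (ℕP.≤-trans (netForm-wires r' (suc (suc t)) le₁ (λ l → lf (inj₁ l)) (λ l → h (inj₁ l)) _) (exponent-suc r'))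
                (wiresΠ-map _ (allFin (γ t)) _ (λ i → netForm-wires (suc r') (suc t) le₂ (λ l → lf (inj₂ (i , l))) (λ l → h (inj₂ (i , l))) (lookup M i))))))
              (ℕP.*-monoʳ-≤ (length (cuts ys t)) (ℕP.≤-trans (s≤s (ℕP.n≤1+n _)) (product-wires t t≤r 0 (X ^ exponent (suc r')) _ _ z≤n ℕP.≤-refl
                (ℕP.≤-reflexive (≡.cong (_* suc (X ^ exponent (suc r'))) (LP.length-tabulate {n = γ t} (λ i → i)))))))))
            (ℕP.≤-reflexive (X⁴ (exponent (suc r'))))
          where
          t≤r : t ≤ r
          t≤r = ℕP.≤-trans (ℕP.m≤n+m t r') (ℕP.≤-pred (ℕP.≤-pred le))
          le₁ : r' + suc (suc t) ≤ R
          le₁ = ℕP.≤-trans (ℕP.≤-reflexive (≡.trans (ℕP.+-suc r' (suc t)) (≡.cong suc (ℕP.+-suc r' t)))) le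
          le₂ : suc r' + suc t ≤ R
          le₂ = ℕP.≤-trans (ℕP.≤-reflexive (≡.cong suc (ℕP.+-suc r' t))) le

        weightedTerms-wires : ∀ a e (lf : LeafForms ys R 0) → C.wires e ≤ 7 → (∀ l j → C.wires (lf l j) ≤ X ^ 3) → ∀ m → C.wiresΣ (weightedTerms {V} ys r 0 a e lf m) ≤ X ^ (4 + exponent (suc r))
        weightedTerms-wires a e lf he h m = ℕP.≤-trans (block 0 z≤n _ (X ^ exponent (suc r)) (pow≥1 (exponent (suc r)))
            (ℕP.≤-trans (wiresΣ-map a (λ M → prod (e ∷ children ys r 0 lf m M)) (cuts ys 0) _ (λ M → s≤s (ℕP.+-monoʳ-≤ (C.wires e) (s≤s (ℕP.+-mono-≤
                (ℕP.≤-trans (netForm-wires r 2 (ℕP.≤-reflexive (≡.trans (ℕP.+-suc r 1) (≡.cong suc (≡.trans (ℕP.+-suc r 0) (≡.cong suc (ℕP.+-identityʳ r)))))) (λ l → lf (inj₁ l)) (λ l → h (inj₁ l)) _) (exponent-suc r))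
                (wiresΠ-map _ (allFin (γ 0)) _ (λ i → netForm-wires (suc r) 1 (ℕP.≤-reflexive (≡.cong suc (≡.trans (ℕP.+-suc r 0) (≡.cong suc (ℕP.+-identityʳ r))))) (λ l → lf (inj₂ (i , l))) (λ l → h (inj₂ (i , l))) (lookup M i))))))))
              (ℕP.*-monoʳ-≤ (length (cuts ys 0)) (product-wires 0 z≤n (C.wires e) (X ^ exponent (suc r)) _ _ he ℕP.≤-refl
                (ℕP.≤-reflexive (≡.cong (_* suc (X ^ exponent (suc r))) (LP.length-tabulate {n = γ 0} (λ i → i))))))))
            (ℕP.≤-reflexive (X⁴ (exponent (suc r))))

      module _ (level≤ : ∀ l → level R 0 l ≤ R) where
        private
          len≤B : ∀ l → len R 0 l ≤ B
          len≤B l = W≤B _ (level≤ l)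

          leaf-bound : ∀ n → n ≤ B → 3 + n * 4 ≤ X ^ 3
          leaf-bound n le = begin
            3 + n * 4 ≤⟨ ℕP.+-mono-≤ (s≤s (s≤s (s≤s (z≤n {1})))) (ℕP.*-monoˡ-≤ 4 le) ⟩
            4 + B * 4 ≤⟨ ℕP.*-monoˡ-≤ 4 B<X ⟩
            X * 4 ≤⟨ ℕP.*-monoʳ-≤ X (ℕP.≤-trans (s≤s (s≤s (s≤s (s≤s z≤n)))) X≥10) ⟩
            X * X ≤⟨ ℕP.*-monoʳ-≤ X (ℕP.≤-trans (ℕP.≤-reflexive (≡.sym (ℕP.*-identityʳ X))) (ℕP.*-monoʳ-≤ X (ℕP.≤-trans (ℕP.≤-trans (s≤s z≤n) X≥10) (ℕP.≤-reflexive (≡.sym (ℕP.*-identityʳ X)))))) ⟩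
            X ^ 3 ∎
            where open ≤-Reasoning

          leaf¹-wires : ∀ l j → wires (leafForm¹ l j) ≤ X ^ 3
          leaf¹-wires l j = ℕP.≤-trans (s≤s (wiresΠ-map _ (allFin (len R 0 l)) 3 (λ k → literal-wires _ (lookup j k))))
            (ℕP.≤-trans (ℕP.+-mono-≤ {1} {3} (s≤s z≤n) (ℕP.*-monoˡ-≤ 4 (ℕP.≤-reflexive (LP.length-tabulate {n = len R 0 l} (λ k → k))))) (leaf-bound (len R 0 l) (len≤B l)))
            where
            literal-wires : ∀ v b → wires (literal v b) ≤ 3
            literal-wires v true = z≤n
            literal-wires v false = s≤s (s≤s z≤n)

          leaf²-wires : ∀ l p → wires (leafForm² l p) ≤ X ^ 3
          leaf²-wires l p = ℕP.≤-trans (s≤s (ℕP.+-mono-≤ (string²-wires (VP.≡-dec Bool._≟_ _ _)) (wiresΠ-map _ (allFin (len R 0 l)) 3 (λ k → literal²-wires _ _ (lookup p k)))))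
            (ℕP.≤-trans (ℕP.+-monoʳ-≤ 3 (ℕP.*-monoˡ-≤ 4 (ℕP.≤-reflexive (LP.length-tabulate {n = len R 0 l} (λ k → k))))) (leaf-bound (len R 0 l) (len≤B l)))
            where
            string²-wires : ∀ d → wires (string² l p d) ≤ 2
            string²-wires (yes _) = ℕP.≤-refl
            string²-wires (no _) = ℕP.≤-refl
            literal²-wires : ∀ s z p → wires (literal² s z p) ≤ 3
            literal²-wires s z (true , true) = s≤s (s≤s z≤n)
            literal²-wires s z (true , false) = s≤s z≤n
            literal²-wires s z (false , true) = s≤s z≤n
            literal²-wires s z (false , false) = s≤s (s≤s (s≤s z≤n))

        sizeExponent : ℕ
        sizeExponent = 6 + exponent (suc r)

        refutation-wires : ∀ n → n ≤ X → wiresΣ (padded n refutationTerms) ≤ X ^ sizeExponent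
        refutation-wires n n≤X = begin
          wiresΣ (padded n refutationTerms) ≡⟨ padded-wires n refutationTerms ⟩
          n + wiresΣ refutationTerms ≡⟨ ≡.cong (n +_) (≡.trans (wiresΣ-++ (weightedTerms bools r 0 i6 hFactor leafForm¹ []) _) (≡.cong (wiresΣ (weightedTerms bools r 0 i6 hFactor leafForm¹ []) +_) (wiresΣ-++ (weightedTerms pairs r 0 i6 QFactor leafForm² []) _))) ⟩
          n + (wiresΣ (weightedTerms bools r 0 i6 hFactor leafForm¹ []) + (wiresΣ (weightedTerms pairs r 0 i6 QFactor leafForm² []) + 10))
            ≤⟨ ℕP.+-mono-≤ n≤X (ℕP.+-mono-≤ (weightedTerms-wires bools (s≤s (s≤s z≤n)) i6 hFactor leafForm¹ ℕP.≤-refl leaf¹-wires [])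
                 (ℕP.+-mono-≤ (weightedTerms-wires pairs ℕP.≤-refl i6 QFactor leafForm² (s≤s (s≤s z≤n)) leaf²-wires []) X≥10)) ⟩
          X + (Y + (Y + X)) ≤⟨ ℕP.+-mono-≤ X≤XY (ℕP.+-mono-≤ Y≤XY (ℕP.+-mono-≤ Y≤XY X≤XY)) ⟩
          X * Y + (X * Y + (X * Y + X * Y)) ≡⟨ solve 1 (λ y → y :+ (y :+ (y :+ y)) := con 4 :* y) ≡.refl (X * Y) ⟩
          4 * (X * Y) ≤⟨ ℕP.*-monoˡ-≤ (X * Y) (ℕP.≤-trans (s≤s (s≤s (s≤s (s≤s z≤n)))) X≥10) ⟩
          X * (X * Y) ∎
          where
          open ≤-Reasoning
          open +-*-Solver
          Y : ℕ
          Y = X ^ (4 + exponent (suc r))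
          X≤XY : X ≤ X * Y
          X≤XY = ℕP.≤-trans (ℕP.≤-reflexive (≡.sym (ℕP.*-identityʳ X))) (ℕP.*-monoʳ-≤ X (pow≥1 (4 + exponent (suc r))))
          Y≤XY : Y ≤ X * Y
          Y≤XY = ℕP.≤-trans (ℕP.≤-reflexive (≡.sym (ℕP.*-identityˡ Y))) (ℕP.*-monoˡ-≤ Y (ℕP.≤-trans (s≤s z≤n) X≥10))

module Growths where
  open NetworkStructure
  open import Data.Nat using (_+_; _*_; _∸_; ∣_-_∣)
  open import Data.Nat.Properties using (module ≤-Reasoning)
  open import Data.Nat.Solver using (module +-*-Solver)
  open import Data.Bool using (if_then_else_)
  open import Data.List using (concatMap; allFin)

  -- The number g p of copies grows so fast that sets of more than threshold p leaves, however they are split into sets of at most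
  -- threshold (p - 1) leaves, lose a factor 2 ^ (L v₀); scale p bounds v₀ / v (p + 1).
  module Growth (L : ℕ) where
    threshold scale : ℕ → ℕ
    threshold zero = 1
    threshold (suc p) = threshold p * (L * scale p)
    scale zero = 2
    scale (suc p) = scale p * suc (threshold (suc p))

    g : ℕ → ℕ
    g zero = 1
    g (suc p) = threshold (suc p)

    leafCount : ℕ → ℕ
    leafCount zero = 1
    leafCount (suc zero) = 1
    leafCount (suc (suc j)) = leafCount j + g j * leafCount (suc j)

    leafCount≥1 : ∀ j → 1 ≤ leafCount j
    leafCount≥1 zero = ℕP.≤-refl
    leafCount≥1 (suc zero) = ℕP.≤-refl
    leafCount≥1 (suc (suc j)) = ℕP.≤-trans (leafCount≥1 j) (ℕP.m≤m+n _ _)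

    threshold<leafCount : ∀ p → threshold p < leafCount (suc (suc p))
    threshold<leafCount zero = ℕP.≤-refl
    threshold<leafCount (suc p) = ℕP.+-mono-≤ (leafCount≥1 (suc p)) (ℕP.≤-trans (ℕP.≤-reflexive (≡.sym (ℕP.*-identityʳ _))) (ℕP.*-monoʳ-≤ (threshold (suc p)) (leafCount≥1 (suc (suc p)))))

    module _ (L≥1 : 1 ≤ L) where
      scale≥1 : ∀ p → 1 ≤ scale p
      scale≥1 zero = s≤s z≤n
      scale≥1 (suc p) = ℕP.*-mono-≤ (scale≥1 p) (s≤s (z≤n {threshold (suc p)}))

      threshold≥1 : ∀ p → 1 ≤ threshold p
      threshold≥1 zero = ℕP.≤-refl
      threshold≥1 (suc p) = ℕP.*-mono-≤ (threshold≥1 p) (ℕP.*-mono-≤ L≥1 (scale≥1 p))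

      threshold-suc : ∀ p → threshold p ≤ threshold (suc p)
      threshold-suc p = ℕP.≤-trans (ℕP.≤-reflexive (≡.sym (ℕP.*-identityʳ _))) (ℕP.*-monoʳ-≤ (threshold p) (ℕP.*-mono-≤ L≥1 (scale≥1 p)))

      g≥1 : ∀ p → 1 ≤ g p
      g≥1 zero = ℕP.≤-refl
      g≥1 (suc p) = threshold≥1 (suc p)

      g-suc : ∀ p → g p ≤ g (suc p)
      g-suc zero = threshold≥1 1
      g-suc (suc p) = threshold-suc (suc p)

      g-mono : ∀ {p q} → p ≤ q → g p ≤ g q
      g-mono {p} {zero} z≤n = ℕP.≤-refl
      g-mono {p} {suc q} le with ℕP.m≤n⇒m<n∨m≡n le
      ... | inj₁ lt = ℕP.≤-trans (g-mono (ℕP.≤-pred lt)) (g-suc q)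
      ... | inj₂ ≡.refl = ℕP.≤-refl

      module Weights (r Z : ℕ) where
        R : ℕ
        R = suc (suc r)

        γ : ℕ → ℕ
        γ t = g (r ∸ t)

        open Network γ Z using (H; Leaf; isRow; leaves; level)

        -- Half the length of the free index of a block of height j.
        v : ℕ → ℕ
        v j = H (R ∸ j)

        H-suc : ∀ t → H t ≤ H (suc t)
        H-suc zero = z≤n
        H-suc (suc t) = ℕP.≤-trans (ℕP.≤-trans (ℕP.≤-reflexive (≡.sym (ℕP.*-identityˡ _))) (ℕP.*-monoˡ-≤ (H (suc t)) (g≥1 (r ∸ t)))) (ℕP.m≤m+n _ (H t))

        H-mono : ∀ {s t} → s ≤ t → H s ≤ H t
        H-mono {s} {zero} z≤n = ℕP.≤-refl
        H-mono {s} {suc t} le with ℕP.m≤n⇒m<n∨m≡n le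
        ... | inj₁ lt = ℕP.≤-trans (H-mono (ℕP.≤-pred lt)) (H-suc t)
        ... | inj₂ ≡.refl = ℕP.≤-refl

        v-anti : ∀ {i j} → i ≤ j → v j ≤ v i
        v-anti le = H-mono (ℕP.∸-monoʳ-≤ R le)

        v-rec : ∀ j → j ≤ r → v j ≡ g j * v (suc j) + v (suc (suc j))
        v-rec j le rewrite ℕP.+-∸-assoc 2 le | ℕP.+-∸-assoc 1 le | ℕP.m∸[m∸n]≡n le = ≡.refl

        -- Euclid's algorithm: the v j are the remainders, and a combination with few leaves cannot be smaller than the remainder.
        euclid : ∀ s j x y → j + s ≤ suc r → 1 ≤ x * leafCount j + y * leafCount (suc j) → x * leafCount j + y * leafCount (suc j) < leafCount (suc (j + s)) →
          v (j + s) ≤ ∣ x * v j - y * v (suc j) ∣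
        euclid zero j x (suc y) le pos lt = ⊥-elim (ℕP.<⇒≱ lt (ℕP.≤-trans (ℕP.≤-reflexive (≡.cong (λ i → leafCount (suc i)) (ℕP.+-identityʳ j))) (ℕP.≤-trans (ℕP.m≤m+n _ _) (ℕP.m≤n+m _ (x * leafCount j)))))
        euclid zero j zero zero le () lt
        euclid zero j (suc x) zero le pos lt = ℕP.≤-trans (ℕP.≤-reflexive (≡.cong v (ℕP.+-identityʳ j))) (ℕP.≤-trans (ℕP.m≤m+n (v j) (x * v j)) (ℕP.≤-reflexive (≡.sym (ℕP.∣-∣-identityʳ _))))
        euclid (suc s) j x y le pos lt with g j * x ℕP.≤? y
        ... | yes p with ℕP.m≤n⇒∃[o]m+o≡n p
        ... | x' , ≡.refl = ℕP.≤-trans (ℕP.≤-reflexive (≡.cong v (ℕP.+-suc j s))) (ℕP.≤-trans (euclid s (suc j) x' x (ℕP.≤-trans (ℕP.≤-reflexive (≡.sym (ℕP.+-suc j s))) le)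
              (ℕP.≤-trans pos (ℕP.≤-reflexive count)) (ℕP.≤-trans (s≤s (ℕP.≤-reflexive (≡.sym count))) (ℕP.≤-trans lt (ℕP.≤-reflexive (≡.cong (λ i → leafCount (suc i)) (ℕP.+-suc j s))))))
            (ℕP.≤-reflexive difference))
          where
          open +-*-Solver
          j≤r : j ≤ r
          j≤r = ℕP.≤-pred (ℕP.≤-trans (ℕP.≤-trans (s≤s (ℕP.m≤m+n j s)) (ℕP.≤-reflexive (≡.sym (ℕP.+-suc j s)))) le)
          count : x * leafCount j + (g j * x + x') * leafCount (suc j) ≡ x' * leafCount (suc j) + x * leafCount (suc (suc j))
          count = solve 5 (λ x n g x' n' → x :* n :+ (g :* x :+ x') :* n' := x' :* n' :+ x :* (n :+ g :* n')) ≡.refl x (leafCount j) (g j) x' (leafCount (suc j))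
          difference : ∣ x' * v (suc j) - x * v (suc (suc j)) ∣ ≡ ∣ x * v j - (g j * x + x') * v (suc j) ∣
          difference = ≡.trans (ℕP.∣-∣-comm (x' * v (suc j)) _) (≡.sym (≡.trans (≡.cong₂ ∣_-_∣
            (≡.trans (≡.cong (x *_) (v-rec j j≤r)) (solve 4 (λ x g a b → x :* (g :* a :+ b) := x :* (g :* a) :+ x :* b) ≡.refl x (g j) (v (suc j)) (v (suc (suc j)))))
            (solve 4 (λ x g a x' → (g :* x :+ x') :* a := x :* (g :* a) :+ x' :* a) ≡.refl x (g j) (v (suc j)) x')) (ℕP.∣m+n-m+o∣≡∣n-o∣ (x * (g j * v (suc j))) _ _)))
        euclid (suc s) j x y le pos lt | no np with ℕP.m≤n⇒∃[o]m+o≡n (ℕP.≰⇒> np)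
        ... | e , eq = ℕP.≤-trans (v-anti {suc j} {j + suc s} (ℕP.≤-trans (s≤s (ℕP.m≤m+n j s)) (ℕP.≤-reflexive (≡.sym (ℕP.+-suc j s))))) (ℕP.≤-trans (ℕP.m≤m+n (v (suc j)) (e * v (suc j) + x * v (suc (suc j))))
            (ℕP.≤-reflexive (≡.sym (≡.trans (≡.cong (λ a → ∣ a - y * v (suc j) ∣) expand) (≡.trans (≡.cong (λ b → ∣ y * v (suc j) + rest - b ∣) (≡.sym (ℕP.+-identityʳ _)))
              (≡.trans (ℕP.∣m+n-m+o∣≡∣n-o∣ (y * v (suc j)) rest 0) (ℕP.∣-∣-identityʳ rest)))))))
          where
          open +-*-Solver
          j≤r : j ≤ r
          j≤r = ℕP.≤-pred (ℕP.≤-trans (ℕP.≤-trans (s≤s (ℕP.m≤m+n j s)) (ℕP.≤-reflexive (≡.sym (ℕP.+-suc j s)))) le)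
          rest : ℕ
          rest = v (suc j) + (e * v (suc j) + x * v (suc (suc j)))
          expand : x * v j ≡ y * v (suc j) + rest
          expand = ≡.trans (≡.cong (x *_) (v-rec j j≤r)) (≡.trans (solve 4 (λ x g a b → x :* (g :* a :+ b) := (g :* x) :* a :+ x :* b) ≡.refl x (g j) (v (suc j)) (v (suc (suc j))))
            (≡.trans (≡.cong (λ z → z * v (suc j) + x * v (suc (suc j))) (≡.sym eq)) (solve 5 (λ y e a x b → (con 1 :+ y :+ e) :* a :+ x :* b := y :* a :+ (a :+ (e :* a :+ x :* b))) ≡.refl y e (v (suc j)) x (v (suc (suc j))))))

        imbalance : ∀ p → p ≤ r → ∀ x y → 1 ≤ x + y → x + y ≤ threshold p → v (suc p) ≤ ∣ x * v 0 - y * v 1 ∣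
        imbalance p le x y pos bound = euclid (suc p) 0 x y (s≤s le) (ℕP.≤-trans pos (ℕP.≤-reflexive same)) (ℕP.≤-trans (s≤s (ℕP.≤-trans (ℕP.≤-reflexive (≡.sym same)) bound)) (threshold<leafCount p))
          where
          same : x + y ≡ x * 1 + y * 1
          same = ≡.sym (≡.cong₂ _+_ (ℕP.*-identityʳ x) (ℕP.*-identityʳ y))

        v₀≤ : ∀ p → p ≤ r → v 0 ≤ scale p * v (suc p)
        v₀≤ zero le = ℕP.≤-trans (ℕP.≤-reflexive (v-rec 0 z≤n)) (ℕP.+-mono-≤ (ℕP.≤-reflexive (ℕP.+-identityʳ _)) (ℕP.≤-trans (v-anti {1} {2} (s≤s z≤n)) (ℕP.≤-reflexive (≡.sym (ℕP.+-identityʳ _)))))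
        v₀≤ (suc p) le = ℕP.≤-trans (v₀≤ p (ℕP.≤-trans (ℕP.n≤1+n p) le)) (ℕP.≤-trans (ℕP.*-monoʳ-≤ (scale p)
          (ℕP.≤-trans (ℕP.≤-reflexive (v-rec (suc p) le)) (ℕP.≤-trans (ℕP.+-monoʳ-≤ (g (suc p) * v (suc (suc p))) (v-anti {suc (suc p)} {suc (suc (suc p))} (ℕP.n≤1+n _)))
            (ℕP.≤-reflexive (ℕP.+-comm _ (v (suc (suc p)))))))) (ℕP.≤-reflexive (≡.sym (ℕP.*-assoc (scale p) (suc (g (suc p))) _))))

        many-parts : ∀ p → p ≤ r → ∀ n k → threshold (suc p) < n → n ≤ k * threshold p → L * v 0 ≤ k * v (suc p)
        many-parts p le n k lt h = begin
          L * v 0 ≤⟨ ℕP.*-monoʳ-≤ L (v₀≤ p le) ⟩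
          L * (scale p * v (suc p)) ≡⟨ ≡.sym (ℕP.*-assoc L (scale p) _) ⟩
          L * scale p * v (suc p) ≤⟨ ℕP.*-monoˡ-≤ (v (suc p)) (ℕP.<⇒≤ k-large) ⟩
          k * v (suc p) ∎
          where
          open ≤-Reasoning
          k-large : L * scale p < k
          k-large = ℕP.*-cancelʳ-< (threshold p) (L * scale p) k (ℕP.≤-trans (s≤s (ℕP.≤-reflexive (ℕP.*-comm (L * scale p) (threshold p)))) (ℕP.≤-trans lt h))

        length-leaves : ∀ j t → j + t ≡ R → length (leaves j t) ≡ leafCount j
        length-leaves zero t e = ≡.refl
        length-leaves (suc zero) t e = ≡.refl
        length-leaves (suc (suc j)) t e = ≡.trans (LP.length-++ (map inj₁ (leaves j (suc (suc t))))) (≡.cong₂ _+_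
            (≡.trans (LP.length-map inj₁ (leaves j (suc (suc t)))) (length-leaves j (suc (suc t)) (≡.trans (≡.trans (ℕP.+-suc j (suc t)) (≡.cong suc (ℕP.+-suc j t))) e)))
            (≡.trans (copies (allFin (γ t))) (≡.cong₂ _*_ (≡.trans (LP.length-tabulate {n = γ t} (λ i → i)) copies-count) (length-leaves (suc j) (suc t) (≡.trans (≡.cong suc (ℕP.+-suc j t)) e)))))
          where
          copies : ∀ is → length (concatMap {B = Leaf (suc (suc j)) t} (λ i → map (λ l → inj₂ (i , l)) (leaves (suc j) (suc t))) is) ≡ length is * length (leaves (suc j) (suc t))
          copies [] = ≡.refl
          copies (i ∷ is) = ≡.trans (LP.length-++ {A = Leaf (suc (suc j)) t} (map (λ l → inj₂ (i , l)) (leaves (suc j) (suc t)))) (≡.cong₂ _+_ (LP.length-map _ (leaves (suc j) (suc t))) (copies is))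
          copies-count : γ t ≡ g j
          copies-count = ≡.cong g (≡.trans (≡.cong (_∸ t) (≡.sym (ℕP.suc-injective (ℕP.suc-injective e)))) (ℕP.m+n∸n≡m j t))

        level-leaf : ∀ j t → j + t ≡ R → ∀ l → level j t l ≡ (if isRow j t l then R else suc r)
        level-leaf zero t e l = e
        level-leaf (suc zero) t e l = ℕP.suc-injective e
        level-leaf (suc (suc j)) t e (inj₁ l) = level-leaf j (suc (suc t)) (≡.trans (≡.trans (ℕP.+-suc j (suc t)) (≡.cong suc (ℕP.+-suc j t))) e) l
        level-leaf (suc (suc j)) t e (inj₂ (_ , l)) = level-leaf (suc j) (suc t) (≡.trans (≡.cong suc (ℕP.+-suc j t)) e) l

module PolynomialBridge where
  open FormulaSemantics
  open CircuitSemantics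
  open Refutations
  open import Defs
  open import Data.Nat using () renaming (_⊔_ to _⊔ℕ_)

  module Degree {c ℓ : Level} (F : Field c ℓ) {V : Set} (t : ℕ) where
    open PolySemantics F using (nodeForms; gateForm; circuitForm)
    private
      deg₂ : Form F V → ℕ
      deg₂ = deg F (λ _ → 2)

      bound : ℕ → ℕ
      bound δ = 2 ℕ.* suc t ^ δ

      bound-mono : ∀ {δ δ'} → δ ≤ δ' → bound δ ≤ bound δ'
      bound-mono le = ℕP.*-monoʳ-≤ 2 (ℕP.^-monoʳ-≤ (suc t) le)

      module _ {i : ℕ} (fs : Vec (Form F V) i) (ds : Vec ℕ i) (δ : ℕ) (h : ∀ j → lookup ds j ≤ δ → deg₂ (lookup fs j) ≤ bound δ) where
        plus-degree : ∀ ws → maxList F (map (λ w → lookup ds (proj₂ w)) ws) ≤ δ → deg₂ (gateForm fs (plus ws)) ≤ bound δ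
        plus-degree [] le = z≤n
        plus-degree ((a , j) ∷ ws) le = ℕP.⊔-lub (h j (ℕP.≤-trans (ℕP.m≤m⊔n _ _) le)) (plus-degree ws (ℕP.≤-trans (ℕP.m≤n⊔m (lookup ds j) _) le))

        times-degree : ∀ js → maxList F (map (lookup ds) js) ≤ δ → deg₂ (gateForm fs (times js)) ≤ length js ℕ.* bound δ
        times-degree [] le = z≤n
        times-degree (j ∷ js) le = ℕP.+-mono-≤ (h j (ℕP.≤-trans (ℕP.m≤m⊔n _ _) le)) (times-degree js (ℕP.≤-trans (ℕP.m≤n⊔m (lookup ds j) _) le))

    node-degree : ∀ {i} (p : SLP F V i) → wiresSLP F p ≤ t → ∀ j → deg₂ (lookup (nodeForms p) j) ≤ bound (lookup (depthsSLP F p) j)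
    node-degree (p ▷ g) w (suc j) = node-degree p (ℕP.≤-trans (ℕP.m≤m+n _ _) w) j
    node-degree (p ▷ input v) w zero = ℕP.≤-refl
    node-degree (p ▷ const a) w zero = z≤n
    node-degree (p ▷ plus ws) w zero = ℕP.≤-trans (plus-degree (nodeForms p) (depthsSLP F p) δ (λ j le → ℕP.≤-trans (node-degree p (ℕP.≤-trans (ℕP.m≤m+n _ _) w) j) (bound-mono le)) ws ℕP.≤-refl)
        (bound-mono (ℕP.n≤1+n δ))
      where
      δ : ℕ
      δ = maxList F (map (λ w → lookup (depthsSLP F p) (proj₂ w)) ws)
    node-degree (p ▷ times js) w zero = ℕP.≤-trans (times-degree (nodeForms p) (depthsSLP F p) δ (λ j le → ℕP.≤-trans (node-degree p (ℕP.≤-trans (ℕP.m≤m+n _ _) w) j) (bound-mono le)) js ℕP.≤-refl)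
        (ℕP.≤-trans (ℕP.*-monoˡ-≤ (bound δ) (ℕP.≤-trans (ℕP.m≤n+m (length js) (wiresSLP F p)) (ℕP.≤-trans w (ℕP.n≤1+n t))))
          (ℕP.≤-reflexive (≡.trans (≡.sym (ℕP.*-assoc (suc t) 2 (suc t ^ δ))) (≡.trans (≡.cong (ℕ._* suc t ^ δ) (ℕP.*-comm (suc t) 2)) (ℕP.*-assoc 2 (suc t) (suc t ^ δ))))))
      where
      δ : ℕ
      δ = maxList F (map (lookup (depthsSLP F p)) js)

    circuit-degree : ∀ Δ (C : Circuit F V) → size F C ≤ t → depth F C ≤ Δ → deg F (λ _ → 2) (circuitForm C) ≤ 2 ℕ.* suc t ^ Δ
    circuit-degree Δ (circuit m (p ▷ g)) w le = ℕP.≤-trans (node-degree (p ▷ g) w zero) (bound-mono le)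

  -- A function on all algebras that is compatible with polyRel is a polynomial; a circuit refutes it if it does so in all algebras.
  module Bridge {c ℓ : Level} (F : Field c ℓ) (N : ℕ) where
    private module F = Field F using (*-identityˡ; +-congʳ; -‿inverseʳ; Carrier; refl; sym; trans; zeroˡ; _*_; -_; _-_; _≈_; 0#; 1#; nontrivial)
    open PolySemantics F using (DegIn; IPAlg; circuitForm; curry-*; curry-+; curry-cong; curry-const; curry-evalC; curry-injective; curry-neg; curry-uncurry; curry-var; curryP; evalML-polyRel; multilinear-uncurry; polyRel; polyRel-var; polyRel-⟦⟧; uncurryP; var)
    open Assignments F {N} using (RefutesIn; assign; square-minus; module RefutesIn)

    module _ (f̂ : ∀ (A : Alg F) → (Fin N → Alg.Carrier A) → Alg.Carrier A)
      (f̂-rel : ∀ B (X : Fin N → Alg.Carrier B) → Σ ℕ λ k → GradedRel.Rel (polyRel B N X) k (f̂ (IPAlg N) var) (f̂ B X)) where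

      polynomial : Poly F N
      polynomial = uncurryP N (f̂ (IPAlg N) var)

      private
        module I = Alg (IPAlg N) using (*-cong; +-cong; -‿cong; sym; trans; _≈_; 0#; ι-0; ι-1)

        σ₀≈ : ∀ v → curryP N (σ₀ F v) I.≈ assign (IPAlg N) var I.0# (λ _ → I.0#) v
        σ₀≈ (inj₁ i) = curry-var N i
        σ₀≈ (inj₂ (inj₁ j)) = I.trans (curry-const N F.0#) I.ι-0
        σ₀≈ (inj₂ (inj₂ i)) = I.trans (curry-const N F.0#) I.ι-0

        σ₁≈ : ∀ v → curryP N (σ₁ F (λ _ → polynomial) v) I.≈ assign (IPAlg N) var (f̂ (IPAlg N) var) (square-minus (IPAlg N) var) v
        σ₁≈ (inj₁ i) = curry-var N i
        σ₁≈ (inj₂ (inj₁ j)) = curry-uncurry N _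
        σ₁≈ (inj₂ (inj₂ i)) = I.trans (curry-+ N (_*P_ F (varP F i) (varP F i)) (λ e → F.- varP F i e)) (I.+-cong
          (I.trans (curry-* N (varP F i) (varP F i)) (I.*-cong (curry-var N i) (curry-var N i))) (I.trans (curry-neg N (varP F i)) (I.-‿cong (curry-var N i))))

        evalC₀ : ∀ C → curryP N (evalC F (σ₀ F) C) I.≈ ⟦_⟧ F (IPAlg N) (circuitForm C) (assign (IPAlg N) var I.0# (λ _ → I.0#))
        evalC₀ C = I.trans (curry-evalC (σ₀ F) C) (⟦⟧-cong F (IPAlg N) (circuitForm C) σ₀≈)

        evalC₁ : ∀ C → curryP N (evalC F (σ₁ F (λ _ → polynomial)) C) I.≈ ⟦_⟧ F (IPAlg N) (circuitForm C) (assign (IPAlg N) var (f̂ (IPAlg N) var) (square-minus (IPAlg N) var))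
        evalC₁ C = I.trans (curry-evalC (σ₁ F (λ _ → polynomial)) C) (⟦⟧-cong F (IPAlg N) (circuitForm C) σ₁≈)

      refutation⇒values : ∀ C → IPSRef₁ F polynomial C → RefutesIn f̂ (circuitForm C)
      refutation⇒values C (h₀ , h₁) = record
        { zero-axioms = λ A X → Alg.trans A (polyRel-⟦⟧ A N X (λ _ → 1) _ _ (rel₀ A X) (circuitForm C) F.0#
            (I.trans (I.sym (evalC₀ C)) (I.trans (curry-cong N h₀) (curry-const N F.0#)))) (Alg.ι-0 A)
        ; axioms = λ A X → Alg.trans A (polyRel-⟦⟧ A N X (λ _ → proj₁ (f̂-rel A X) ⊔ℕ 2) _ _ (rel₁ A X) (circuitForm C) F.1#
            (I.trans (I.sym (evalC₁ C)) (I.trans (curry-cong N h₁) (curry-const N F.1#)))) (Alg.ι-1 A) }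
        where
        rel₀ : ∀ A X v → GradedRel.Rel (polyRel A N X) 1 (assign (IPAlg N) var I.0# (λ _ → I.0#) v) (assign A X (Alg.0# A) (λ _ → Alg.0# A) v)
        rel₀ A X (inj₁ i) = polyRel-var A N X i
        rel₀ A X (inj₂ (inj₁ _)) = rel-≤ z≤n (rel-resp I.ι-0 (Alg.ι-0 A) (rel-con F.0#))
          where open GradedRel (polyRel A N X) using (rel-con; rel-resp; rel-≤)
        rel₀ A X (inj₂ (inj₂ _)) = rel-≤ z≤n (rel-resp I.ι-0 (Alg.ι-0 A) (rel-con F.0#))
          where open GradedRel (polyRel A N X) using (rel-con; rel-resp; rel-≤)
        minus : ∀ (A : Alg F) b → Alg._≈_ A (Alg._*_ A (Alg.ι A (F.- F.1#)) b) (Alg.-_ A b)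
        minus A b = A.trans (A.*-congʳ (A.trans (A.ι-neg _) (A.-‿cong A.ι-1))) (-1*x≈-x b)
          where
          module A = Alg A using (*-congʳ; -‿cong; ring; trans; ι-1; ι-neg)
          open import Algebra.Properties.Ring A.ring using (-1*x≈-x)
        rel₁ : ∀ A X v → GradedRel.Rel (polyRel A N X) (proj₁ (f̂-rel A X) ⊔ℕ 2) (assign (IPAlg N) var (f̂ (IPAlg N) var) (square-minus (IPAlg N) var) v) (assign A X (f̂ A X) (square-minus A X) v)
        rel₁ A X (inj₁ i) = rel-≤ (ℕP.≤-trans (s≤s z≤n) (ℕP.m≤n⊔m (proj₁ (f̂-rel A X)) 2)) (polyRel-var A N X i)
          where open GradedRel (polyRel A N X) using (rel-≤)
        rel₁ A X (inj₂ (inj₁ _)) = rel-≤ (ℕP.m≤m⊔n _ 2) (proj₂ (f̂-rel A X))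
          where open GradedRel (polyRel A N X) using (rel-≤)
        rel₁ A X (inj₂ (inj₂ i)) = rel-≤ (ℕP.m≤n⊔m (proj₁ (f̂-rel A X)) 2) (rel-+ (rel-* (polyRel-var A N X i) (polyRel-var A N X i))
            (rel-resp (minus (IPAlg N) _) (minus A _) (rel-≤ (s≤s z≤n) (rel-* (rel-con (F.- F.1#)) (polyRel-var A N X i)))))
          where open GradedRel (polyRel A N X) using (rel-*; rel-+; rel-con; rel-resp; rel-≤)

      values⇒refutation : ∀ C → RefutesIn f̂ (circuitForm C) → IPSRef₁ F polynomial C
      values⇒refutation C ref = curry-injective N (I.trans (evalC₀ C) (I.trans (zero-axioms (IPAlg N) var) (I.sym (I.trans (curry-const N F.0#) I.ι-0)))) ,
        curry-injective N (I.trans (evalC₁ C) (I.trans (axioms (IPAlg N) var) (I.sym (I.trans (curry-const N F.1#) I.ι-1))))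
        where open RefutesIn ref using (axioms; zero-axioms)

      module _ (degrees : ∀ (i : Fin N) → DegIn i 1 (f̂ (IPAlg N) var)) where

        multilinear : Multilinear F polynomial
        multilinear = multilinear-uncurry (f̂ (IPAlg N) var) degrees

        -- At a Boolean zero of f both conditions on a refutation would speak about the same point.
        unsatisfiable : ∀ C → RefutesIn f̂ C → UnsatBool F polynomial
        unsatisfiable C ref a e = F.nontrivial (F.trans (F.sym (axioms (baseAlg F) X)) (F.trans (⟦⟧-cong F (baseAlg F) C same) (zero-axioms (baseAlg F) X)))
          where
          open RefutesIn ref using (axioms; zero-axioms)
          X : Fin N → F.Carrier
          X = lookup (boolPt F a)
          boolean : ∀ {n} (a : Vec Bool n) i → lookup (boolPt F a) i F.* lookup (boolPt F a) i F.≈ lookup (boolPt F a) i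
          boolean (true ∷ a) zero = F.*-identityˡ _
          boolean (false ∷ a) zero = F.zeroˡ _
          boolean (b ∷ a) (suc i) = boolean a i
          same : ∀ v → assign (baseAlg F) X (f̂ (baseAlg F) X) (square-minus (baseAlg F) X) v F.≈ assign (baseAlg F) X F.0# (λ _ → F.0#) v
          same (inj₁ i) = F.refl
          same (inj₂ (inj₁ _)) = F.trans (F.sym (evalML-polyRel (f̂ (IPAlg N) var) (boolPt F a) degrees (proj₂ (f̂-rel (baseAlg F) X)))) e
          same (inj₂ (inj₂ i)) = F.trans (F.+-congʳ (boolean a i)) (F.-‿inverseʳ _)

module CountEstimates where
  open GateBounds
  open CircuitBounds
  open LowRankExtraction
  open import Data.Nat using (_+_; _*_)
  open import Data.Nat.Properties using (module ≤-Reasoning)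
  open import Data.Nat.Solver using (module +-*-Solver)

  totalExponent : ℕ → ℕ → ℕ
  totalExponent a Δ = suc (suc (a * Δ) + (suc (a * Δ) + (2 + a) * Δ))

  degreeBound : ℕ → ℕ → ℕ → ℕ
  degreeBound d t Δ = 2 * suc t ^ Δ + suc d

  module CountBounds (d X : ℕ) (times≤ : timesCount d ≤ X) (log≤ : logCount d ≤ X) (root≤ : rootCount (suc d) d ≤ X) (d≤ : 4 + d ≤ X) where
    open ≤-Reasoning
    open +-*-Solver

    X^n≥1 : ∀ n → 1 ≤ X ^ n
    X^n≥1 n = ℕP.≤-trans (ℕP.≤-reflexive (≡.sym (ℕP.^-zeroˡ n))) (ℕP.^-monoˡ-≤ n (ℕP.≤-trans (s≤s z≤n) d≤))

    suc-≤ : ∀ n → suc (X ^ n) ≤ X ^ suc n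
    suc-≤ n = begin
      1 + X ^ n ≤⟨ ℕP.+-monoˡ-≤ (X ^ n) (X^n≥1 n) ⟩
      X ^ n + X ^ n ≡⟨ solve 1 (λ x → x :+ x := con 2 :* x) ≡.refl (X ^ n) ⟩
      2 * X ^ n ≤⟨ ℕP.*-monoˡ-≤ (X ^ n) (ℕP.≤-trans (s≤s (s≤s z≤n)) d≤) ⟩
      X * X ^ n ∎

    module _ (a t : ℕ) (t≤ : suc t ≤ X ^ a) where

      circuitCount-≤ : ∀ δ → circuitCount d t δ ≤ X ^ ((2 + a) * δ)
      circuitCount-≤ zero = ℕP.≤-reflexive (≡.cong (X ^_) (≡.sym (ℕP.*-zeroʳ (2 + a))))
      circuitCount-≤ (suc δ) = begin
        timesCount d * (suc t * (logCount d * circuitCount d t δ)) ≤⟨ ℕP.*-mono-≤ times≤ (ℕP.*-mono-≤ t≤ (ℕP.*-mono-≤ log≤ (circuitCount-≤ δ))) ⟩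
        X * (X ^ a * (X * X ^ n)) ≡⟨ solve 3 (λ x p q → x :* (p :* (x :* q)) := x :* (x :* (p :* q))) ≡.refl X (X ^ a) (X ^ n) ⟩
        X * (X * (X ^ a * X ^ n)) ≡⟨ ≡.cong (λ p → X * (X * p)) (≡.sym (ℕP.^-distribˡ-+-* X a n)) ⟩
        X ^ (2 + a + n) ≡⟨ ≡.cong (X ^_) (≡.sym (ℕP.*-suc (2 + a) δ)) ⟩
        X ^ ((2 + a) * suc δ) ∎
        where
        n : ℕ
        n = (2 + a) * δ

      degreeBound-≤ : ∀ Δ → suc (degreeBound d t Δ) ≤ X ^ suc (a * Δ)
      degreeBound-≤ Δ = begin
        suc (2 * suc t ^ Δ + suc d) ≤⟨ s≤s (ℕP.+-monoˡ-≤ (suc d) (ℕP.*-monoʳ-≤ 2 (ℕP.≤-trans (ℕP.^-monoˡ-≤ Δ t≤) (ℕP.≤-reflexive (ℕP.^-*-assoc X a Δ))))) ⟩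
        suc (2 * X ^ (a * Δ) + suc d) ≡⟨ ≡.sym (ℕP.+-suc (2 * X ^ (a * Δ)) (suc d)) ⟩
        2 * X ^ (a * Δ) + (2 + d) ≤⟨ ℕP.+-monoʳ-≤ (2 * X ^ (a * Δ)) (ℕP.≤-trans (ℕP.≤-reflexive (≡.sym (ℕP.*-identityʳ (2 + d)))) (ℕP.*-monoʳ-≤ (2 + d) (X^n≥1 (a * Δ)))) ⟩
        2 * X ^ (a * Δ) + (2 + d) * X ^ (a * Δ) ≡⟨ ≡.sym (ℕP.*-distribʳ-+ (X ^ (a * Δ)) 2 (2 + d)) ⟩
        (4 + d) * X ^ (a * Δ) ≤⟨ ℕP.*-monoˡ-≤ (X ^ (a * Δ)) d≤ ⟩
        X * X ^ (a * Δ) ∎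

      totalCount-≤ : ∀ Δ → totalCount d (degreeBound d t Δ) t Δ ≤ X ^ totalExponent a Δ
      totalCount-≤ Δ = begin
        totalCount d (degreeBound d t Δ) t Δ ≤⟨ ℕP.*-mono-≤ root≤ (ℕP.*-mono-≤ (degreeBound-≤ Δ) (ℕP.*-mono-≤ (degreeBound-≤ Δ) (circuitCount-≤ Δ))) ⟩
        X * (X ^ b * (X ^ b * X ^ n)) ≡⟨ ≡.cong (λ p → X * (X ^ b * p)) (≡.sym (ℕP.^-distribˡ-+-* X b n)) ⟩
        X * (X ^ b * X ^ (b + n)) ≡⟨ ≡.cong (X *_) (≡.sym (ℕP.^-distribˡ-+-* X b (b + n))) ⟩
        X ^ totalExponent a Δ ∎
        where
        b n : ℕ
        b = suc (a * Δ)
        n = (2 + a) * Δ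

  -- 2 ^ (2 h) stands for the size; a loss of 2 ^ (L h) exceeds its M-th power.
  power-gap : ∀ L h M → 1 ≤ h → 2 * M < L → (2 ^ (2 * h)) ^ M < 2 ^ (L * h)
  power-gap L (suc h) M _ lt = ℕP.≤-trans (s≤s (ℕP.≤-reflexive (ℕP.^-*-assoc 2 (2 * suc h) M))) (ℕP.^-monoʳ-< 2 (s≤s (s≤s z≤n))
      (ℕP.≤-trans (s≤s (ℕP.≤-reflexive (solve 2 (λ h M → con 2 :* h :* M := con 2 :* M :* h) ≡.refl (suc h) M))) (ℕP.*-monoˡ-< (suc h) lt)))
    where open +-*-Solver

module DepthSeparation where
  open FormulaSemantics
  open CircuitSemantics
  open GateBounds
  open Refutations
  open LowRankExtraction
  open NetworkFormulas
  open HardRefutation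
  open RankArgument
  open Compilation
  open SizeBounds
  open Growths
  open PolynomialBridge
  open CountEstimates
  open import Defs using (Field; module Field; natF; CharZero; IPSVar; Poly; Multilinear; UnsatBool; Circuit; circuit; _▷_; input; const; plus; times; depth; IPSRef₁) renaming (size to circuitSize)
  open import Data.Nat using (_+_; _*_; _∸_; _/_; ∣_-_∣)
  open import Data.Nat.Properties using (module ≤-Reasoning)
  open import Data.Nat.DivMod using (m/n*n≤m; m≡m%n+[m/n]*n; m%n<n; m≥n⇒m/n>0)
  open import Data.Bool using (if_then_else_)

  module Search (need : ℕ → ℕ) where

    best : ℕ → ℕ → ℕ
    best N zero = 0
    best N (suc M) with need (suc M) ℕP.≤? N
    ... | yes _ = suc M
    ... | no _ = best N M

    best-fits : ∀ N M → 1 ≤ best N M → need (best N M) ≤ N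
    best-fits N (suc M) pos with need (suc M) ℕP.≤? N
    ... | yes le = le
    ... | no _ = best-fits N M pos

    best-max : ∀ N M m → m ≤ M → need m ≤ N → m ≤ best N M
    best-max N zero m z≤n fits = z≤n
    best-max N (suc M) m le fits with need (suc M) ℕP.≤? N
    ... | yes _ = le
    ... | no unfit with ℕP.m≤n⇒m<n∨m≡n le
    ... | inj₁ lt = best-max N M m (ℕP.≤-pred lt) fits
    ... | inj₂ ≡.refl = ⊥-elim (unfit fits)

  module PaddedRefutation {c ℓ : Level} (F : Field c ℓ) {n : ℕ} where
    open Assignments F {n} using (RefutesIn; module RefutesIn)
    open Compile F using (padded; padded-value)

    padded-refutes : ∀ {f̂ ws} m → RefutesIn f̂ (sum ws) → RefutesIn f̂ (sum (padded m ws))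
    padded-refutes {ws = ws} m ref = record
      { zero-axioms = λ A X → Alg.trans A (padded-value A _ m ws) (RefutesIn.zero-axioms ref A X)
      ; axioms = λ A X → Alg.trans A (padded-value A _ m ws) (RefutesIn.axioms ref A X) }

  module ConstantTwo {c ℓ : Level} (F : Field c ℓ) (char0 : CharZero F) (N : ℕ) where
    private module F = Field F using (+-congʳ; +-group; -‿inverseʳ; Carrier; sym; trans; zeroˡ; _*_; _≈_; 0#; 1#; nontrivial; inverse)
    open PolySemantics F using (DegIn; IPAlg; circuitForm; degRel; polyRel; var)
    open Assignments F {N} using (RefutesIn; assign; square-minus; module RefutesIn) public

    two : ∀ (A : Alg F) → (Fin N → Alg.Carrier A) → Alg.Carrier A
    two A X = Alg.ι A (natF F 2)

    two-rel : ∀ B (X : Fin N → Alg.Carrier B) → Σ ℕ λ k → GradedRel.Rel (polyRel B N X) k (two (IPAlg N) var) (two B X)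
    two-rel B X = 0 , GradedRel.rel-con (polyRel B N X) (natF F 2)

    two-degrees : ∀ (i : Fin N) → DegIn i 1 (two (IPAlg N) var)
    two-degrees i = GradedRel.rel-≤ (degRel i) {b = two (IPAlg N) var} z≤n (GradedRel.rel-con (degRel i) (natF F 2))

    half : Σ F.Carrier λ a → natF F 2 F.* a F.≈ F.1#
    half = F.inverse (natF F 2) (char0 1)

    halfAxiom : List (F.Carrier × Form F (IPSVar N 1))
    halfAxiom = (proj₁ half , inp (inj₂ (inj₁ zero))) ∷ []

    two-refutes : RefutesIn two (sum halfAxiom)
    two-refutes = record
      { zero-axioms = λ A X → let open Alg A using (+-identityʳ; trans; zeroʳ) in trans (+-identityʳ _) (zeroʳ _)
      ; axioms = λ A X → let open Alg A using (*-comm; +-identityʳ; sym; trans; ι-cong; ι-*; ι-1) in trans (+-identityʳ _) (trans (*-comm _ _) (trans (sym (ι-* _ _)) (trans (ι-cong (proj₂ half)) ι-1))) }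

    depth≥1 : ∀ C → RefutesIn two (circuitForm C) → 1 ≤ depth F C
    depth≥1 (circuit m (p ▷ plus ws)) ref = s≤s z≤n
    depth≥1 (circuit m (p ▷ times js)) ref = s≤s z≤n
    depth≥1 (circuit m (p ▷ const a)) ref = ⊥-elim (F.nontrivial (F.trans (F.sym (RefutesIn.axioms ref (baseAlg F) (λ _ → F.0#))) (RefutesIn.zero-axioms ref (baseAlg F) (λ _ → F.0#))))
    depth≥1 (circuit m (p ▷ input (inj₁ i))) ref = ⊥-elim (F.nontrivial (RefutesIn.zero-axioms ref (baseAlg F) (λ _ → F.1#)))
    depth≥1 (circuit m (p ▷ input (inj₂ (inj₁ zero)))) ref = ⊥-elim (char0 0 (identityʳ-unique F.1# (natF F 1) (RefutesIn.axioms ref (baseAlg F) (λ _ → F.0#))))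
      where open import Algebra.Properties.Group F.+-group using (identityʳ-unique)
    depth≥1 (circuit m (p ▷ input (inj₂ (inj₂ i)))) ref = ⊥-elim (F.nontrivial (F.trans (F.sym (RefutesIn.axioms ref (baseAlg F) (λ _ → F.0#))) (F.trans (F.+-congʳ (F.zeroˡ F.0#)) (F.-‿inverseʳ F.0#))))

  module HardPolynomial {c ℓ : Level} (F : Field c ℓ) (char0 : CharZero F) (γ : ℕ → ℕ) (Z r pad : ℕ) where
    private module F = Field F using (+-congʳ; +-group; -‿inverseʳ; Carrier; sym; trans; zeroˡ; _*_; _≈_; 0#; 1#; nontrivial; inverse)
    open PolySemantics F using (DegIn; IPAlg; degIn-var-other; degIn-var-self; degRel; polyRel; polyRel-var; var)
    open RefutationForm F char0 γ Z r pad using (degree-h; fValue; h; size)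

    N : ℕ
    N = suc size

    private module I = Alg (IPAlg N) using (refl; 1#; ι-1)

    deg-zero : ∀ {V : Set} (f : Form F V) → deg F (λ _ → 0) f ≡ 0
    deg-zeroΣ : ∀ {V : Set} ws → degΣ F {V} (λ _ → 0) ws ≡ 0
    deg-zeroΠ : ∀ {V : Set} fs → degΠ F {V} (λ _ → 0) fs ≡ 0
    deg-zero (inp v) = ≡.refl
    deg-zero (con a) = ≡.refl
    deg-zero (sum ws) = deg-zeroΣ ws
    deg-zero (prod fs) = deg-zeroΠ fs
    deg-zeroΣ [] = ≡.refl
    deg-zeroΣ ((a , f) ∷ ws) = ≡.cong₂ ℕ._⊔_ (deg-zero f) (deg-zeroΣ ws)
    deg-zeroΠ [] = ≡.refl
    deg-zeroΠ (f ∷ fs) = ≡.cong₂ _+_ (deg-zero f) (deg-zeroΠ fs)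

    fValue-rel : ∀ B (X : Fin N → Alg.Carrier B) → Σ ℕ λ k → GradedRel.Rel (polyRel B N X) k (fValue (IPAlg N) var) (fValue B X)
    fValue-rel B X = k , rel-+ {k} {I.1#} {B.1#} (rel-≤ {0} {k} {I.1#} {B.1#} z≤n (rel-resp {0} I.ι-1 B.ι-1 (rel-con F.1#)))
        (rel-+ {k} {var {N} zero} {X zero} (rel-≤ {1} {k} {var {N} zero} {X zero} (ℕP.m≤m⊔n 1 (deg F (λ _ → 1) h)) (polyRel-var B N X zero))
          (rel-≤ (ℕP.m≤n⊔m 1 (deg F (λ _ → 1) h)) (rel-⟦⟧ (λ _ → 1) {var ∘ suc} {X ∘ suc} (λ v → polyRel-var B N X (suc v)) h)))
      where
      open GradedRel (polyRel B N X) using (rel-+; rel-con; rel-resp; rel-≤; rel-⟦⟧)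
      module B = Alg B using (1#; ι-1)
      k : ℕ
      k = 1 ℕ.⊔ deg F (λ _ → 1) h

    private
      degree : ∀ {i j : Fin size} → Dec (i ≡ j) → ℕ
      degree (yes _) = 1
      degree (no _) = 0

      degree≤1 : ∀ {i j : Fin size} (d : Dec (i ≡ j)) → degree d ≤ 1
      degree≤1 (yes _) = ℕP.≤-refl
      degree≤1 (no _) = z≤n

      degree-other : ∀ {i j : Fin size} (d : Dec (i ≡ j)) → ¬ i ≡ j → degree d ≡ 0
      degree-other (yes e) ne = ⊥-elim (ne e)
      degree-other (no _) ne = ≡.refl

      degIn-degree : ∀ {i j} (d : Dec (i ≡ j)) → DegIn {N} (suc j) (degree d) (var (suc i))
      degIn-degree {i} (yes ≡.refl) = degIn-var-self (suc i)
      degIn-degree {i} {j} (no ne) = degIn-var-other (suc j) (suc i) (λ e → ne (≡.sym (FP.suc-injective e)))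

      f-degree : ∀ (i : Fin N) → DegIn i 1 (var {N} zero) → DegIn i 1 (⟦_⟧ F (IPAlg N) h (var ∘ suc)) → DegIn i 1 (fValue (IPAlg N) var)
      f-degree i dw dh = rel-+ {b = I.1#} {b' = I.1#} (rel-≤ {b = I.1#} z≤n (rel-resp {b = I.1#} {b' = I.1#} I.ι-1 I.refl (rel-con F.1#))) (rel-+ {b = I.1#} {b' = I.1#} dw dh)
        where open GradedRel (degRel {N} i) using (rel-+; rel-con; rel-resp; rel-≤)

    fValue-degrees : ∀ (i : Fin N) → DegIn i 1 (fValue (IPAlg N) var)
    fValue-degrees zero = f-degree zero (degIn-var-self {N} zero) (rel-≤ {b = I.1#} (ℕP.≤-trans (ℕP.≤-reflexive (deg-zero h)) z≤n)
        (rel-⟦⟧ (λ _ → 0) {var ∘ suc} {var ∘ suc} (λ v → degIn-var-other zero (suc v) (λ ())) h))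
      where open GradedRel (degRel {N} zero) using (rel-≤; rel-⟦⟧)
    fValue-degrees (suc i) = f-degree (suc i) (rel-≤ {b = I.1#} z≤n (degIn-var-other (suc i) zero (λ ()))) (rel-≤ {b = I.1#} (degree-h (λ v → degree (v Fin.≟ i)) (λ v → degree≤1 (v Fin.≟ i)) i (λ v → degree-other (v Fin.≟ i)))
        (rel-⟦⟧ (λ v → degree (v Fin.≟ i)) {var ∘ suc} {var ∘ suc} (λ v → degIn-degree (v Fin.≟ i)) h))
      where open GradedRel (degRel {N} (suc i)) using (rel-≤; rel-⟦⟧)

  module _ {c ℓ : Level} (F : Field c ℓ) (char0 : CharZero F) (Γ : ℕ) where
    private module F = Field F using (+-congʳ; +-group; -‿inverseʳ; Carrier; sym; trans; zeroˡ; _*_; _≈_; 0#; 1#; nontrivial; inverse)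

    -- A member of the family for N variables; L is the parameter that forces large refutations.
    record Instance (gap : ℕ → ℕ) (c₀ N L : ℕ) : Set (c ⊔ ℓ) where
      field
        f           : Poly F N
        s           : ℕ
        L≤s         : L ≤ s
        multilinear : Multilinear F f
        unsat       : UnsatBool F f
        upper       : 1 ≤ L → Σ (Circuit F (IPSVar N 1)) λ C → IPSRef₁ F f C × depth F C ≡ Γ × circuitSize F C ≤ c₀ * s ^ 5
        lower       : ∀ k → gap k ≤ L → (C : Circuit F (IPSVar N 1)) → IPSRef₁ F f C → 10 * depth F C ≤ Γ → s ^ k ≤ circuitSize F C

    Separation : Set (c ⊔ ℓ)
    Separation = Σ ((N : ℕ) → Poly F N) λ f → Σ (ℕ → ℕ) λ s →
      (∀ N → Multilinear F (f N)) ×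
      (∀ N → UnsatBool F (f N)) ×
      (∀ m → ∃ λ N₀ → ∀ N → N₀ ≤ N → m ≤ s N) ×
      (∃ λ c₀ → ∃ λ N₀ → ∀ N → N₀ ≤ N → Σ (Circuit F (IPSVar N 1)) λ C → IPSRef₁ F (f N) C × depth F C ≡ Γ × circuitSize F C ≤ c₀ * s N ^ 5) ×
      (∀ k → ∃ λ N₀ → ∀ N → N₀ ≤ N → (C : Circuit F (IPSVar N 1)) → IPSRef₁ F (f N) C → 10 * depth F C ≤ Γ → s N ^ k ≤ circuitSize F C)

    separation : ∀ gap c₀ (L : ℕ → ℕ) → (∀ m → ∃ λ N₀ → ∀ N → N₀ ≤ N → m ≤ L N) → (∀ N → Instance gap c₀ N (L N)) → Separation
    separation gap c₀ L grows inst = (λ N → f (inst N)) , (λ N → s (inst N)) , (λ N → multilinear (inst N)) , (λ N → unsat (inst N)) ,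
        (λ m → proj₁ (grows m) , λ N le → ℕP.≤-trans (proj₂ (grows m) N le) (L≤s (inst N))) ,
        (c₀ , proj₁ (grows 1) , λ N le → upper (inst N) (proj₂ (grows 1) N le)) ,
        (λ k → proj₁ (grows (gap k)) , λ N le → lower (inst N) k (proj₂ (grows (gap k)) N le))
      where open Instance using (L≤s; f; lower; multilinear; s; unsat; upper)

    module Constant (N : ℕ) where
      open ConstantTwo F char0 N using (RefutesIn; depth≥1; halfAxiom; two; two-degrees; two-refutes; two-rel; module RefutesIn)
      open Bridge F N using (multilinear; polynomial; refutation⇒values; unsatisfiable; values⇒refutation)
      open PaddedRefutation F {N} using (padded-refutes)
      open Compile F {IPSVar N 1} using (padded; padded-depth; padded-wires; sumCircuit; sumCircuit-depth; sumCircuit-form; sumCircuit-size)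
      open PolySemantics F using (circuitForm)

      constantPolynomial : Poly F N
      constantPolynomial = polynomial two two-rel

      constant-upper : 1 ≤ Γ → Σ (Circuit F (IPSVar N 1)) λ C → IPSRef₁ F constantPolynomial C × depth F C ≡ Γ × circuitSize F C ≡ Γ
      constant-upper Γ≥1 = C ,
          values⇒refutation two two-rel C (≡.subst (RefutesIn two) (≡.sym (sumCircuit-form ws)) (padded-refutes (Γ ∸ 1) two-refutes)) ,
          ≡.trans (sumCircuit-depth ws) (≡.trans (padded-depth (Γ ∸ 1) halfAxiom) (ℕP.m∸n+n≡m Γ≥1)) ,
          ≡.trans (sumCircuit-size ws) (≡.trans (padded-wires (Γ ∸ 1) halfAxiom) (ℕP.m∸n+n≡m Γ≥1))
        where
        ws : List (F.Carrier × Form F (IPSVar N 1))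
        ws = padded (Γ ∸ 1) halfAxiom
        C : Circuit F (IPSVar N 1)
        C = sumCircuit ws

      constant-depth : ∀ C → IPSRef₁ F constantPolynomial C → 1 ≤ depth F C
      constant-depth C ref = depth≥1 C (refutation⇒values two two-rel C ref)

      constant-multilinear : Multilinear F constantPolynomial
      constant-multilinear = Bridge.multilinear F N two two-rel two-degrees

      constant-unsat : UnsatBool F constantPolynomial
      constant-unsat = unsatisfiable two two-rel two-degrees (sum halfAxiom) two-refutes

    small-depth : 1 ≤ Γ → Γ < 10 → Separation
    small-depth Γ≥1 Γ<10 = separation (λ _ → 0) Γ (λ N → N) (λ m → m , λ N le → le) inst
      where
      inst : ∀ N → Instance (λ _ → 0) Γ N N
      inst N = record
        { f = constantPolynomial ; s = N ; L≤s = ℕP.≤-refl ; multilinear = constant-multilinear ; unsat = constant-unsat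
        ; upper = λ N≥1 → let C , ref , d , w = constant-upper Γ≥1 in C , ref , d ,
            ℕP.≤-trans (ℕP.≤-reflexive w) (ℕP.≤-trans (ℕP.≤-reflexive (≡.sym (ℕP.*-identityʳ Γ))) (ℕP.*-monoʳ-≤ Γ (ℕP.^-monoˡ-≤ 5 N≥1)))
        ; lower = λ k _ C ref d → ⊥-elim (ℕP.<⇒≱ Γ<10 (ℕP.≤-trans (ℕP.*-monoʳ-≤ 10 (constant-depth C ref)) d)) }
        where open Constant N using (constant-depth; constant-multilinear; constant-unsat; constant-upper; constantPolynomial)

    module Large (Δ : ℕ) (Δ≥1 : 1 ≤ Δ) (10Δ≤Γ : 10 * Δ ≤ Γ) (Γ<10Δ+10 : Γ < 10 * suc Δ) where
      r R κ : ℕ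
      r = suc (2 * Δ)
      R = suc (suc r)
      κ = 6 + exponent (suc r)

      gap : ℕ → ℕ
      gap k = suc (2 * totalExponent (suc (κ * k)) Δ)

      d : ℕ → ℕ
      d L = Growth.leafCount L R

      module Member (L : ℕ) (L≥1 : 1 ≤ L) (Z : ℕ) (L≤Z : L ≤ Z) (times≤Z : timesCount (d L) ≤ Z) (log≤Z : logCount (d L) ≤ Z)
        (root≤Z : rootCount (suc (d L)) (d L) ≤ Z) (d≤Z : 4 + d L ≤ Z) (g≤Z : 10 + Growth.g L r ≤ Z) (Γ≤Z : Γ ≤ Z) (pad : ℕ) where
        open Growth L using (g; g-mono; leafCount; threshold; threshold-suc; threshold<leafCount; threshold≥1; module Weights)
        open Weights L≥1 r Z using (H-mono; imbalance; length-leaves; level-leaf; many-parts; v; γ)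
        open TopRank F char0 γ Z r pad (L * v 0) using (H; Leaf; Levels; RefutesIn; W; W≡2H; colH; es; fValue; isRow; level; refutation; refutationTerms; refutes; rowH; size-lower; module Levels; module RefutesIn)
        open Bounds F char0 γ Z r pad using (refutation-depth; refutation-wires)
        open HardPolynomial F char0 γ Z r pad using (N; fValue-degrees; fValue-rel)
        open Bridge F N using (multilinear; polynomial; refutation⇒values; unsatisfiable; values⇒refutation)
        open PaddedRefutation F {N} using (padded-refutes)
        open Compile F {IPSVar N 1} using (formDepth; padded; padded-depth; sumCircuit; sumCircuit-depth; sumCircuit-form; sumCircuit-size)
        open PolySemantics F using (circuitForm)

        X s : ℕ
        X = 2 ^ (2 * H R)
        s = X ^ κ

        Z≤H : Z ≤ H R
        Z≤H = H-mono {1} {R} (s≤s z≤n)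

        Z≤X : ∀ {n} → n ≤ Z → n ≤ X
        Z≤X le = ℕP.≤-trans le (ℕP.≤-trans Z≤H (ℕP.≤-trans (ℕP.m≤n*m (H R) 2) (ℕP.<⇒≤ (n<2^n (2 * H R)))))

        hardPolynomial : Poly F N
        hardPolynomial = polynomial fValue fValue-rel

        depth≤Γ : formDepth refutation ≤ Γ
        depth≤Γ = begin
          formDepth refutation ≤⟨ refutation-depth ⟩
          2 * (3 + 2 * Δ) ≡⟨ solve 1 (λ n → con 2 :* (con 3 :+ con 2 :* n) := con 6 :* con 1 :+ con 4 :* n) ≡.refl Δ ⟩
          6 * 1 + 4 * Δ ≤⟨ ℕP.+-monoˡ-≤ (4 * Δ) (ℕP.*-monoʳ-≤ 6 Δ≥1) ⟩
          6 * Δ + 4 * Δ ≡⟨ solve 1 (λ n → con 6 :* n :+ con 4 :* n := con 10 :* n) ≡.refl Δ ⟩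
          10 * Δ ≤⟨ 10Δ≤Γ ⟩
          Γ ∎
          where
          open ≤-Reasoning
          open import Data.Nat.Solver using (module +-*-Solver)
          open +-*-Solver

        s≥1 : 1 ≤ s
        s≥1 = ℕP.≤-trans (ℕP.≤-reflexive (≡.sym (ℕP.^-zeroˡ κ))) (ℕP.^-monoˡ-≤ κ (ℕP.m^n>0 2 (2 * H R)))

        hard-upper : Σ (Circuit F (IPSVar N 1)) λ C → IPSRef₁ F hardPolynomial C × depth F C ≡ Γ × circuitSize F C ≤ 1 * s ^ 5
        hard-upper = C ,
            values⇒refutation fValue fValue-rel C (≡.subst (RefutesIn fValue) (≡.sym (sumCircuit-form ws)) (padded-refutes n refutes)) ,
            ≡.trans (sumCircuit-depth ws) (≡.trans (padded-depth n refutationTerms) (ℕP.m∸n+n≡m depth≤Γ)) ,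
            ℕP.≤-trans (ℕP.≤-reflexive (sumCircuit-size ws)) (ℕP.≤-trans (refutation-wires (2 * H R) W≤ γ≤ level≤ n (Z≤X (ℕP.≤-trans (ℕP.m∸n≤m Γ (formDepth refutation)) Γ≤Z)))
              (ℕP.≤-trans (ℕP.≤-trans (ℕP.≤-reflexive (≡.sym (ℕP.*-identityʳ s))) (ℕP.*-monoʳ-≤ s (ℕP.^-monoˡ-≤ 4 s≥1))) (ℕP.≤-reflexive (≡.sym (ℕP.+-identityʳ (s ^ 5))))))
          where
          n : ℕ
          n = Γ ∸ formDepth refutation
          ws : List (F.Carrier × Form F (IPSVar N 1))
          ws = padded n refutationTerms
          C : Circuit F (IPSVar N 1)
          C = sumCircuit ws
          W≤ : ∀ i → i ≤ R → W i ≤ 2 * H R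
          W≤ i le = ℕP.≤-trans (ℕP.≤-reflexive (W≡2H i)) (ℕP.*-monoʳ-≤ 2 (H-mono le))
          γ≤ : ∀ t → t ≤ r → 10 + γ t ≤ X
          γ≤ t le = Z≤X (ℕP.≤-trans (ℕP.+-monoʳ-≤ 10 (g-mono L≥1 (ℕP.m∸n≤m r t))) g≤Z)
          level≤ : ∀ l → level R 0 l ≤ R
          level≤ l = ℕP.≤-trans (ℕP.≤-reflexive (level-leaf R 0 (ℕP.+-identityʳ R) l)) (either (isRow R 0 l))
            where
            either : ∀ b → (if b then R else suc r) ≤ R
            either true = ℕP.≤-refl
            either false = ℕP.n≤1+n _

        rowCount colCount : List (Leaf R 0) → ℕ
        rowCount [] = 0
        rowCount (l ∷ ls) = (if isRow R 0 l then 1 else 0) + rowCount ls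
        colCount [] = 0
        colCount (l ∷ ls) = (if isRow R 0 l then 0 else 1) + colCount ls

        rowH≡ : ∀ ls → rowH ls ≡ rowCount ls * v 0
        rowH≡ [] = ≡.refl
        rowH≡ (l ∷ ls) with isRow R 0 l | level-leaf R 0 (ℕP.+-identityʳ R) l
        ... | true | e = ≡.cong₂ _+_ (≡.cong H e) (rowH≡ ls)
        ... | false | e = rowH≡ ls

        colH≡ : ∀ ls → colH ls ≡ colCount ls * v 1
        colH≡ [] = ≡.refl
        colH≡ (l ∷ ls) with isRow R 0 l | level-leaf R 0 (ℕP.+-identityʳ R) l
        ... | true | e = colH≡ ls
        ... | false | e = ≡.cong₂ _+_ (≡.cong H e) (colH≡ ls)

        length≡ : ∀ ls → length ls ≡ rowCount ls + colCount ls
        length≡ [] = ≡.refl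
        length≡ (l ∷ ls) with isRow R 0 l
        ... | true = ≡.cong suc (length≡ ls)
        ... | false = ≡.trans (≡.cong suc (length≡ ls)) (≡.sym (ℕP.+-suc (rowCount ls) (colCount ls)))

        levels : Levels (suc (2 * Δ))
        levels = record
          { thr = threshold ; thr-suc = threshold-suc L≥1
          ; level = λ p lt → record
            { θ = threshold p ; w = v (suc p) ; θ' = threshold (suc p) ; θ≤θ' = threshold-suc L≥1 p
            ; small = λ A pos le → ℕP.≤-trans (imbalance p (ℕP.<⇒≤ lt) (rowCount A) (colCount A) (ℕP.≤-trans pos (ℕP.≤-reflexive (length≡ A))) (ℕP.≤-trans (ℕP.≤-reflexive (≡.sym (length≡ A))) le))
                (ℕP.≤-reflexive (≡.sym (≡.cong₂ ∣_-_∣ (rowH≡ A) (colH≡ A))))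
            ; step = λ n k → many-parts p (ℕP.<⇒≤ lt) n k }
          ; level-θ = λ _ _ → ≡.refl ; level-θ' = λ _ _ → ≡.refl }

        es≡ : length es ≡ leafCount R
        es≡ = length-leaves R 0 (ℕP.+-identityʳ R)

        on-leaves : ∀ (n : ℕ → ℕ) → n (leafCount R) ≤ Z → n (length es) ≤ X
        on-leaves n le = Z≤X (ℕP.≤-trans (ℕP.≤-reflexive (≡.cong n es≡)) le)

        open CountBounds (length es) X (on-leaves timesCount times≤Z) (on-leaves logCount log≤Z) (on-leaves (λ d → rootCount (suc d) d) root≤Z) (on-leaves (4 +_) d≤Z) using (suc-≤; totalCount-≤)

        hard-lower : ∀ k → gap k ≤ L → (C : Circuit F (IPSVar N 1)) → IPSRef₁ F hardPolynomial C → 10 * depth F C ≤ Γ → s ^ k ≤ circuitSize F C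
        hard-lower k large C ref dep = cases (s ^ k ℕP.≤? circuitSize F C)
          where
          t D : ℕ
          t = s ^ k
          D = degreeBound (length es) t Δ
          depth≤Δ : depth F C ≤ Δ
          depth≤Δ = ℕP.≤-pred (ℕP.*-cancelˡ-< 10 (depth F C) (suc Δ) (ℕP.≤-<-trans dep Γ<10Δ+10))
          t≡ : t ≡ X ^ (κ * k)
          t≡ = ℕP.^-*-assoc X κ k
          many : threshold r < length es
          many = ℕP.≤-trans (threshold<leafCount r) (ℕP.≤-reflexive (≡.sym es≡))
          absurd : circuitSize F C < t → ⊥
          absurd lt = ℕP.<⇒≱ (power-gap L (H R) (totalExponent (suc (κ * k)) Δ) (ℕP.≤-trans L≥1 (ℕP.≤-trans L≤Z Z≤H)) large)
            (ℕP.≤-trans (size-lower Δ levels (threshold≥1 L≥1 0) many C (refutation⇒values fValue fValue-rel C ref) depth≤Δ t (ℕP.<⇒≤ lt) D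
                (ℕP.≤-trans (Degree.circuit-degree F t Δ C (ℕP.<⇒≤ lt) depth≤Δ) (ℕP.m≤m+n _ (suc (length es)))) (ℕP.m≤n+m (suc (length es)) _))
              (totalCount-≤ (suc (κ * k)) t (ℕP.≤-trans (s≤s (ℕP.≤-reflexive t≡)) (suc-≤ (κ * k))) Δ))
          cases : Dec (t ≤ circuitSize F C) → t ≤ circuitSize F C
          cases (yes le) = le
          cases (no nle) = ⊥-elim (absurd (ℕP.≰⇒> nle))

        member : Instance gap 1 N L
        member = record
          { f = hardPolynomial ; s = s
          ; L≤s = ℕP.≤-trans (Z≤X L≤Z) (ℕP.≤-trans (ℕP.≤-reflexive (≡.sym (ℕP.*-identityʳ X))) (ℕP.*-monoʳ-≤ X (ℕP.≤-trans (ℕP.≤-reflexive (≡.sym (ℕP.^-zeroˡ (5 + exponent (suc r))))) (ℕP.^-monoˡ-≤ (5 + exponent (suc r)) (ℕP.m^n>0 2 (2 * H R))))))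
          ; multilinear = Bridge.multilinear F N fValue fValue-rel fValue-degrees
          ; unsat = unsatisfiable fValue fValue-rel fValue-degrees refutation refutes
          ; upper = λ _ → hard-upper ; lower = hard-lower }

      Z need : ℕ → ℕ
      Z L = L + (timesCount (d L) + (logCount (d L) + (rootCount (suc (d L)) (d L) + ((4 + d L) + ((10 + Growth.g L r) + Γ)))))
      need L = suc (Variables.varCount (λ t → Growth.g L (r ∸ t)) (Z L) R 0)

      private
        later : ∀ {a b} c → a ≤ b → a ≤ c + b
        later {b = b} c le = ℕP.≤-trans le (ℕP.m≤n+m b c)

      member : ∀ L → 1 ≤ L → ∀ pad → Instance gap 1 (need L + pad) L
      member L L≥1 = Member.member L L≥1 (Z L) (ℕP.m≤m+n L _)
        (later L (ℕP.m≤m+n (timesCount (d L)) _))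
        (later L (later (timesCount (d L)) (ℕP.m≤m+n (logCount (d L)) _)))
        (later L (later (timesCount (d L)) (later (logCount (d L)) (ℕP.m≤m+n (rootCount (suc (d L)) (d L)) _))))
        (later L (later (timesCount (d L)) (later (logCount (d L)) (later (rootCount (suc (d L)) (d L)) (ℕP.m≤m+n (4 + d L) _)))))
        (later L (later (timesCount (d L)) (later (logCount (d L)) (later (rootCount (suc (d L)) (d L)) (later (4 + d L) (ℕP.m≤m+n (10 + Growth.g L r) Γ))))))
        (later L (later (timesCount (d L)) (later (logCount (d L)) (later (rootCount (suc (d L)) (d L)) (later (4 + d L) (ℕP.m≤n+m Γ (10 + Growth.g L r)))))))

      trivial : ∀ N → Instance gap 1 N 0
      trivial N = record
        { f = constantPolynomial ; s = 0 ; L≤s = z≤n ; multilinear = constant-multilinear ; unsat = constant-unsat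
        ; upper = λ () ; lower = λ k () }
        where open Constant N using (constant-multilinear; constant-unsat; constantPolynomial)

      instance-for : ∀ N L → (1 ≤ L → need L ≤ N) → Instance gap 1 N L
      instance-for N zero le = trivial N
      instance-for N (suc L) le = ≡.subst (λ N → Instance gap 1 N (suc L)) (proj₂ padding) (member (suc L) (s≤s z≤n) (proj₁ padding))
        where
        padding : ∃ λ pad → need (suc L) + pad ≡ N
        padding = ℕP.m≤n⇒∃[o]m+o≡n (le (s≤s z≤n))

      open Search need using (best; best-fits; best-max)

      large-depth : Separation
      large-depth = separation gap 1 (λ N → best N N) (λ m → m + need m , λ N le → best-max N N m (ℕP.≤-trans (ℕP.m≤m+n m (need m)) le) (ℕP.≤-trans (ℕP.m≤n+m (need m) m) le))
        (λ N → instance-for N (best N N) (best-fits N N))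

    constant-depth-separation : 1 ≤ Γ → Separation
    constant-depth-separation Γ≥1 = cases (10 ℕP.≤? Γ)
      where
      cases : Dec (10 ≤ Γ) → Separation
      cases (no small) = small-depth Γ≥1 (ℕP.≰⇒> small)
      cases (yes large) = Large.large-depth (Γ / 10) (m≥n⇒m/n>0 large) (ℕP.≤-trans (ℕP.≤-reflexive (ℕP.*-comm 10 (Γ / 10))) (m/n*n≤m Γ 10))
        (ℕP.≤-trans (ℕP.≤-trans (s≤s (ℕP.≤-reflexive (m≡m%n+[m/n]*n Γ 10))) (ℕP.+-monoˡ-≤ (Γ / 10 * 10) (m%n<n Γ 10))) (ℕP.≤-reflexive (ℕP.*-comm (suc (Γ / 10)) 10)))

open import Defs
open import Level using (Level)
open import Data.Nat using (ℕ; _≤_; _*_; _^_)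
open import Data.Product using (Σ; ∃; _×_)
open import Relation.Binary.PropositionalEquality using (_≡_)

mainTheorem1 : ∀ {c ℓ : Level} (F : Field c ℓ) → CharZero F →
    (Γ : ℕ) → 1 ≤ Γ →
    Σ ((N : ℕ) → Poly F N) λ f → Σ (ℕ → ℕ) λ s →
    (∀ N → Multilinear F (f N)) ×
    (∀ N → UnsatBool F (f N)) ×
    (∀ m → ∃ λ N₀ → ∀ N → N₀ ≤ N → m ≤ s N) ×
    (∃ λ c₀ → ∃ λ N₀ → ∀ N → N₀ ≤ N →
    Σ (Circuit F (IPSVar N 1)) λ C →
    IPSRef₁ F (f N) C × depth F C ≡ Γ × size F C ≤ c₀ * s N ^ 5) ×
    (∀ k → ∃ λ N₀ → ∀ N → N₀ ≤ N →
    (C : Circuit F (IPSVar N 1)) → IPSRef₁ F (f N) C →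
    10 * depth F C ≤ Γ → s N ^ k ≤ size F C)
mainTheorem1 F char0 Γ Γ≥1 = DepthSeparation.constant-depth-separation F char0 Γ Γ≥1
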